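{- Let $G$ be a Halin graph on $n$ vertices that satisfies at least one of the following conditions: (i) $\mathrm{mvc}(G)\ge\frac{9n}{16}$; or (ii) the number of leaves $l$ in the underlying tree of $G$ is at least $\frac{2n}{3}$. Then $\mathrm{evc}(G)\le\frac{4}{3}\mathrm{mvc}(G)$. Further, the class $\{C_1,C_2\}$ defined in the context (which is the output of the paper's Algorithm 1 on input $G$) is an eternal vertex cover class of $G$ of size at most $\frac{4}{3}\mathrm{mvc}(G)$, and it is computed in linear time.
   Context: All graphs are finite, simple and undirected. A vertex cover of $G=(V,E)$ is a set $S\subseteq V$ meeting every edge; $\mathrm{mvc}(G)$ is the minimum size of a vertex cover. Eternal vertex cover: a configuration is a vertex cover $C\subseteq V$, viewed as the set of positions of guards (at most one guard per vertex). When an edge $uv$ is attacked, the defender reconfigures $C$ to a new configuration $C'$ by moving all guards simultaneously: every guard stays or moves to an adjacent vertex, and some guard on $u$ or $v$ must move along the edge $uv$ to its other endpoint. That is, there is a bijection $\varphi:C\to C'$ with $\varphi(w)=w$ or $\varphi(w)$ adjacent to $w$ for all $w\in C$, and such that $u\in C,\varphi(u)=v$ or $v\in C,\varphi(v)=u$. An eternal vertex cover class of $G$ is a nonempty set of configurations, all of the same cardinality (called the size of the class), such that for every configuration $C$ in the class and every edge $uv$, an attack on $uv$ can be answered by reconfiguring $C$ to some configuration in the class. The eternal vertex cover number $\mathrm{evc}(G)$ is the minimum size of an eternal vertex cover class. A Halin graph is obtained from a tree $T$ (its underlying tree) with no vertex of degree two (and at least three leaves), embedded in the plane, by connecting all leaves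 of $T$ to form a cycle $C$ in the cyclic order induced by the planar embedding. $int(T)$ denotes the set of internal (non-leaf) vertices of $T$, and $l=|V(C)|$ is the number of leaves of $T$. Algorithm 1: given a Halin graph $G$, compute its decomposition into $T$ and $C$, order the vertices of $C$ anticlockwise as $c_0,c_1,\dots,c_{l-1}$, and output $\{C_1,C_2\}$ where $C_1=int(T)\cup\{c_i\mid 0\le i\le l-1,\ i\text{ even}\}$ and $C_2=int(T)\cup\{c_{i+1\bmod l}\mid 0\le i\le l-1,\ i\text{ even}\}$. -}

module Defs where

open import Data.Bool using (Bool; true; false; if_then_else_; _∧_)
open import Data.Fin using (Fin; toℕ)
open import Data.Fin.Properties using (nonZeroIndex)
open import Data.Fin.Subset using (Subset; _∈_; ∣_∣; ⁅_⁆; _∪_; ⋃)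
open import Data.List using (List; []; _∷_; _++_; length; map; filter; concatMap; lookup; allFin)
open import Data.List.Membership.Propositional using () renaming (_∈_ to _∈ˡ_)
open import Data.List.Relation.Unary.Unique.Propositional using (Unique)
open import Data.Nat using (ℕ; zero; suc; _+_; _*_; _∸_; _≤_; _≥_; _≡ᵇ_; _≟_)
open import Data.Nat.Divisibility using (_∣_; _∣?_)
open import Data.Nat.DivMod using (_mod_)
open import Data.Product using (Σ; ∃; ∃₂; ∃-syntax; _×_; _,_; proj₁; proj₂)
open import Data.Sum using (_⊎_)
open import Data.Vec as Vec using (tabulate)
open import Function.Bundles using (_⇔_; _⤖_; Bijection)
open import Level using (0ℓ)
open import Relation.Binary.Core using (Rel)
open import Relation.Binary.Definitions using (Decidable; Symmetric)
open import Relation.Binary.PropositionalEquality using (_≡_; _≢_)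
open import Relation.Nullary using (¬_; Dec; does; ¬?)
open import Relation.Unary using (Pred)

record Graph (n : ℕ) : Set₁ where
  field
    _~_    : Rel (Fin n) 0ℓ
    _~?_   : Decidable _~_
    ~-sym  : Symmetric _~_
    ~-irr  : ∀ {v} → ¬ (v ~ v)

  degree : Fin n → ℕ
  degree v = length (filter (v ~?_) (allFin n))

  IsLeaf : Fin n → Set
  IsLeaf v = degree v ≡ 1

  isLeaf? : ∀ v → Dec (IsLeaf v)
  isLeaf? v = degree v ≟ 1

IsMinimum : ∀ {ℓ} → Pred ℕ ℓ → Pred ℕ ℓ
IsMinimum P m = P m × (∀ k → P k → m ≤ k)

module _ {n : ℕ} (G : Graph n) where
  open Graph G

  IsVertexCover : Pred (Subset n) 0ℓ
  IsVertexCover S = ∀ {u v} → u ~ v → u ∈ S ⊎ v ∈ S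

  IsMvc : ℕ → Set
  IsMvc = IsMinimum (λ k → ∃[ S ] (IsVertexCover S × ∣ S ∣ ≡ k))

  record Answers (C C′ : Subset n) (u v : Fin n) : Set where
    field
      φ : ∃ (_∈ C) ⤖ ∃ (_∈ C′)

    move : ∃ (_∈ C) → Fin n
    move w = proj₁ (Bijection.to φ w)

    field
      moves   : ∀ w → (move w ≡ proj₁ w) ⊎ (proj₁ w ~ move w)
      crosses : (Σ (u ∈ C) λ u∈C → move (u , u∈C) ≡ v)
              ⊎ (Σ (v ∈ C) λ v∈C → move (v , v∈C) ≡ u)

  record IsEVCClass (𝒞 : Pred (Subset n) 0ℓ) (s : ℕ) : Set where
    field
      nonempty : ∃[ C ] 𝒞 C
      covers   : ∀ {C} → 𝒞 C → IsVertexCover C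
      size     : ∀ {C} → 𝒞 C → ∣ C ∣ ≡ s
      defends  : ∀ {C u v} → 𝒞 C → u ~ v → ∃[ C′ ] (𝒞 C′ × Answers C C′ u v)

  IsEvc : ℕ → Set₁
  IsEvc = IsMinimum (λ s → ∃[ 𝒞 ] IsEVCClass 𝒞 s)

｛_,_｝ : ∀ {n} → Subset n → Subset n → Pred (Subset n) 0ℓ
｛ C₁ , C₂ ｝ C = C ≡ C₁ ⊎ C ≡ C₂

-- A tree embedded in the plane is given by rooting it at any vertex
-- (possibly a leaf) and listing the children of every vertex in
-- anticlockwise order, starting after the edge to the parent.
data PlaneTree (V : Set) : Set where
  node : V → List (PlaneTree V) → PlaneTree V

module _ {V : Set} where

  root : PlaneTree V → V
  root (node v _) = v

  preorder  : PlaneTree V → List V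
  preorders : List (PlaneTree V) → List V
  preorder (node v ts) = v ∷ preorders ts
  preorders []         = []
  preorders (t ∷ ts)   = preorder t ++ preorders ts

  -- Child t u w : w is a child of u in t
  data Child : PlaneTree V → V → V → Set where
    here  : ∀ {v ts t} → t ∈ˡ ts → Child (node v ts) v (root t)
    below : ∀ {v ts t u w} → t ∈ˡ ts → Child t u w → Child (node v ts) u w

record PlaneEmbedding {n : ℕ} (T : Graph n) : Set where
  open Graph T
  field
    tree     : PlaneTree (Fin n)
    distinct : Unique (preorder tree)
    spanning : ∀ v → v ∈ˡ preorder tree
    edges    : ∀ u v → (u ~ v) ⇔ (Child tree u v ⊎ Child tree v u)

  -- Depth-first traversal goes once around the tree, so it meets the
  -- leaves in the cyclic order of the embedding.  The choice of the root
  -- (and of its first child) is the choice of the starting leaf.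
  leaves : List (Fin n)
  leaves = filter isLeaf? (preorder tree)

-- i + 1 modulo l
next : ∀ {l} → Fin l → Fin l
next {l} i = _mod_ (suc (toℕ i)) l {{nonZeroIndex i}}

record Halin {n : ℕ} (G : Graph n) : Set₁ where
  field
    T         : Graph n
    embedding : PlaneEmbedding T

  open PlaneEmbedding embedding public using (leaves)

  l : ℕ
  l = length leaves

  c : Fin l → Fin n
  c = lookup leaves

  OnCycle : Rel (Fin n) 0ℓ
  OnCycle u v = ∃[ i ] (u ≡ c i × v ≡ c (next i))

  field
    noDegreeTwo : ∀ v → Graph.degree T v ≢ 2
    l≥3         : l ≥ 3
    edges       : ∀ u v → Graph._~_ G u v ⇔ (Graph._~_ T u v ⊎ (OnCycle u v ⊎ OnCycle v u))

  int : Subset n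
  int = tabulate (λ v → does (¬? (Graph.isLeaf? T v)))

  evens : List (Fin l)
  evens = filter (λ i → 2 ∣? toℕ i) (allFin l)

  C₁ C₂ : Subset n
  C₁ = int ∪ ⋃ (map (λ i → ⁅ c i ⁆) evens)
  C₂ = int ∪ ⋃ (map (λ i → ⁅ c (next i) ⁆) evens)

-- A Halin graph may have several decompositions into tree and cycle, and
-- the numbering of the cycle is not unique either: the algorithm may use any.
AlgorithmOutput : ∀ {n} → Graph n → Subset n → Subset n → Set₁
AlgorithmOutput G S₁ S₂ = Σ (Halin G) λ H → S₁ ≡ Halin.C₁ H × S₂ ≡ Halin.C₂ H

-- The memory consists of arrays; array a has the cells a [ 0 ], a [ 1 ], …
Store : Set
Store = ℕ → ℕ → ℕ

infixl 6 _⊕_ _⊖_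
infix  8 _[_]
infix  4 _[_]≔_
infixr 3 _⨾_

data Expr : Set where
  lit     : ℕ → Expr
  _[_]    : ℕ → Expr → Expr
  _⊕_ _⊖_ : Expr → Expr → Expr

data Program : Set where
  skip       : Program
  _[_]≔_     : ℕ → Expr → Expr → Program
  _⨾_        : Program → Program → Program
  if≢0_then_else_ : Expr → Program → Program → Program
  while≢0_repeat_     : Expr → Program → Program

⟦_⟧ : Expr → Store → ℕ
⟦ lit x ⟧   σ = x
⟦ a [ e ] ⟧ σ = σ a (⟦ e ⟧ σ)
⟦ e ⊕ f ⟧   σ = ⟦ e ⟧ σ + ⟦ f ⟧ σ
⟦ e ⊖ f ⟧   σ = ⟦ e ⟧ σ ∸ ⟦ f ⟧ σ

-- The number of machine operations needed to evaluate an expression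
cost : Expr → ℕ
cost (lit _)   = 1
cost (a [ e ]) = suc (cost e)
cost (e ⊕ f)   = suc (cost e + cost f)
cost (e ⊖ f)   = suc (cost e + cost f)

write : Store → ℕ → ℕ → ℕ → Store
write σ a i x b j = if (a ≡ᵇ b) ∧ (i ≡ᵇ j) then x else σ b j

-- ⟨ P , σ ⟩⇓[ t ] τ : started in σ, P halts in τ after t operations
data ⟨_,_⟩⇓[_]_ : Program → Store → ℕ → Store → Set where
  skip    : ∀ {σ} → ⟨ skip , σ ⟩⇓[ 1 ] σ
  assign  : ∀ {a e f σ} →
            ⟨ a [ e ]≔ f , σ ⟩⇓[ suc (cost e + cost f) ] write σ a (⟦ e ⟧ σ) (⟦ f ⟧ σ)
  seq     : ∀ {P Q σ τ υ s t} →
            ⟨ P , σ ⟩⇓[ s ] τ → ⟨ Q , τ ⟩⇓[ t ] υ → ⟨ P ⨾ Q , σ ⟩⇓[ s + t ] υ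
  if-then : ∀ {e P Q σ τ t} → ⟦ e ⟧ σ ≢ 0 →
            ⟨ P , σ ⟩⇓[ t ] τ → ⟨ if≢0 e then P else Q , σ ⟩⇓[ suc (cost e + t) ] τ
  if-else : ∀ {e P Q σ τ t} → ⟦ e ⟧ σ ≡ 0 →
            ⟨ Q , σ ⟩⇓[ t ] τ → ⟨ if≢0 e then P else Q , σ ⟩⇓[ suc (cost e + t) ] τ
  stop    : ∀ {e P σ} → ⟦ e ⟧ σ ≡ 0 →
            ⟨ while≢0 e repeat P , σ ⟩⇓[ suc (cost e) ] σ
  loop    : ∀ {e P σ τ υ s t} → ⟦ e ⟧ σ ≢ 0 →
            ⟨ P , σ ⟩⇓[ s ] τ → ⟨ while≢0 e repeat P , τ ⟩⇓[ t ] υ →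
            ⟨ while≢0 e repeat P , σ ⟩⇓[ suc (cost e + (s + t)) ] υ

record AdjacencyLists {n : ℕ} (G : Graph n) : Set where
  open Graph G
  field
    neighbours : Fin n → List (Fin n)
    unique     : ∀ v → Unique (neighbours v)
    complete   : ∀ u v → (u ~ v) ⇔ (v ∈ˡ neighbours u)

  -- n, then for each vertex its degree followed by its neighbours
  encode : List ℕ
  encode = n ∷ concatMap (λ v → length (neighbours v) ∷ map toℕ (neighbours v)) (allFin n)

-- The input word is in array 0; all other cells are initially 0.
load : List ℕ → Store
load []       _       _       = 0
load (x ∷ xs) (suc _) _       = 0
load (x ∷ xs) zero    zero    = x
load (x ∷ xs) zero    (suc i) = load xs zero i

-- Array a holds the characteristic vector of S.
Holds : ∀ {n} → Store → ℕ → Subset n → Set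
Holds σ a S = ∀ v → σ a (toℕ v) ≡ (if Vec.lookup S v then 1 else 0)

_computes⟨_,_⟩from_within_ : ∀ {n} → Program → Subset n → Subset n → List ℕ → ℕ → Set
P computes⟨ S₁ , S₂ ⟩from w within b =
  ∃₂ λ t τ → ⟨ P , load w ⟩⇓[ t ] τ × t ≤ b × Holds τ 1 S₁ × Holds τ 2 S₂

{-# OPTIONS --safe #-}

-- A decomposition of a Halin graph G is a plane tree cut at one of its edges, G being determined by the tree
-- edges and the cyclic order of the leaves.
--
-- An attack is answered by a matching of C₁ with C₂ (or by a swap of two guards). For an attack along the cycle,
-- all guards on leaves move one step in the same direction. For an attack on the edge between a leaf outside the
-- cover and its parent, the guards shift along the tree path between the leaf and a neighbouring leaf.
-- The size of the class is compared with 2m ≥ n + 1, which holds for every vertex cover of size m by induction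
-- on the tree, and with 2l ≥ n + 2; the number l of leaves is the same in all decompositions, because
-- the degree sum is 2n + 2l - 2.
--
-- The program finds a decomposition by contraction. Every Halin graph with at least four leaves has a triangle,
-- and a triangle consists of a tree vertex and two consecutive leaf children; if that vertex has degree three,
-- the triangle is contracted to a leaf, and otherwise the two leaves are merged. A triangle has a member of
-- degree three, and a contraction creates triangles only at the new vertex, so a single scan over the vertices finds
-- all of them. A decomposition of the contracted graph need not lift; the matrix records which edges may join a leaf
-- to its parent and array 11 which vertices must be leaves. The contractions are undone from the complete graph
-- on four vertices, and the cycle is then walked: the successor of a leaf is the sum of its neighbours minus its
-- parent and its predecessor.
module Submission where

open import Defs
open import Data.Bool using (Bool; true; false; if_then_else_)
open import Data.Empty using (⊥; ⊥-elim)
open import Data.Fin as Fin using (Fin; zero; suc; toℕ; fromℕ<; combine)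
open import Data.Fin.Properties using (combine-injective; toℕ-combine; toℕ-injective; toℕ<n; toℕ-fromℕ<; nonZeroIndex; suc-injective)
open import Data.Fin.Subset using (Subset; ∣_∣; ⁅_⁆; _∪_; ⋃) renaming (_∈_ to _∈ₛ_; _∉_ to _∉ₛ_)
open import Data.Fin.Subset.Properties using (x∈p∪q⁻; x∈p∪q⁺; x∈⁅x⁆; x∈⁅y⁆⇒x≡y; ∉⊥) renaming (_∈?_ to _∈ₛ?_)
open import Data.List using (List; []; _∷_; _++_; _∷ʳ_; length; map; filter; concatMap; lookup; allFin; reverse; tabulate; take)
import Data.List.Membership.DecPropositional as DecMem
open import Data.List.Membership.Propositional using (_∈_; _∉_; find; lose)
open import Data.List.Membership.Propositional.Properties using (∈-++⁺ˡ; ∈-++⁺ʳ; ∈-++⁻; ∈-map⁺; ∈-map⁻; ∈-filter⁺; ∈-filter⁻; ∈-allFin; ∈-∃++; ∈-lookup; ∈-upTo⁺)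
open import Data.List.Properties using (++-assoc; ++-identityʳ; length-++; length-map; length-filter; length-tabulate; length-upTo; filter-++; filter-accept; filter-reject; reverse-++; unfold-reverse; reverse-involutive; map-++; map-tabulate)
import Data.List.Relation.Binary.Permutation.Propositional as Permₚ
open import Data.List.Relation.Binary.Permutation.Propositional using (_↭_; ↭-refl; ↭-sym; ↭-trans; ↭-reflexive; prep)
open import Data.List.Relation.Binary.Permutation.Propositional.Properties as Perm using (↭-length; ∈-resp-↭; shift; ++-comm)
import Data.List.Relation.Binary.Permutation.Setoid.Properties as SetoidPerm
open import Data.List.Relation.Unary.All as All using (All; []; _∷_)
open import Data.List.Relation.Unary.AllPairs using ([]; _∷_)
open import Data.List.Relation.Unary.Any as Any using (Any; here; there)
import Data.List.Relation.Unary.Any.Properties as AnyP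
open import Data.List.Relation.Unary.Unique.Propositional using (Unique)
import Data.List.Relation.Unary.Unique.Propositional.Properties as Uniq
open import Data.Nat using (ℕ; zero; suc; _+_; _*_; _∸_; _≤_; _<_; z≤n; s≤s; _≟_; _≡ᵇ_)
open import Data.Nat.DivMod using (_%_; m<n⇒m%n≡m; n%n≡0)
open import Data.Nat.Divisibility using (_∣_; _∣?_; ∣m+n∣m⇒∣n; ∣m∣n⇒∣m+n; ∣-refl; ∣1⇒≡1; _∣0)
open import Data.Nat.ListAction using (sum)
open import Data.Nat.ListAction.Properties using (sum-↭; sum-++)
import Data.Nat.Properties as ℕ
open import Data.Nat.Tactic.RingSolver using (solve-∀)
open import Data.Product using (∃; ∃₂; ∃-syntax; _×_; _,_) renaming (proj₁ to fst; proj₂ to snd)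
open import Data.Sum using (_⊎_; [_,_]′) renaming (inj₁ to inl; inj₂ to inr; map to map-⊎)
open import Data.Unit using (⊤; tt)
import Data.Vec as Vec
open import Data.Vec.Properties using ([]=⇒lookup; lookup⇒[]=; lookup∘tabulate)
open import Data.Vec.Properties.WithK using ([]=-irrelevant)
open import Function using (_∘_; id; case_of_)
open import Function.Bundles using (_⇔_; mk⇔; mk⤖; Equivalence)
open import Relation.Binary.Definitions using (DecidableEquality; Symmetric)
import Relation.Binary.PropositionalEquality as Eq
open import Relation.Binary.PropositionalEquality using (_≡_; _≢_; refl; sym; trans; cong; cong₂; subst; subst₂; ≢-sym)
open import Relation.Nullary using (¬_; Dec; yes; no; does; ¬?; contradiction)
open import Relation.Nullary.Decidable using (dec-true; dec-false)
open Equivalence using (to; from)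

module _ {A : Set} where

 unique-resp-↭ : {xs ys : List A} → xs ↭ ys → Unique xs → Unique ys
 unique-resp-↭ p = SetoidPerm.Unique-resp-↭ (Eq.setoid A) (Permₚ.↭⇒↭ₛ p)

 unique-↭ : {xs ys : List A} → Unique xs → Unique ys →
  (∀ {w} → w ∈ xs → w ∈ ys) → (∀ {w} → w ∈ ys → w ∈ xs) → xs ↭ ys
 unique-↭ {[]}     {[]}     _ _ f g = ↭-refl
 unique-↭ {[]}     {y ∷ ys} _ _ f g = case g (here refl) of λ ()
 unique-↭ {x ∷ xs} {ys} (px ∷ pxs) u f g with ∈-∃++ (f (here refl))
 ... | as , bs , refl = ↭-trans (prep x (unique-↭ pxs (tl (unique-resp-↭ (shift x as bs) u)) f′ g′)) (↭-sym (shift x as bs))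
  where
   tl : ∀ {zs} → Unique (x ∷ zs) → Unique zs
   tl (_ ∷ p) = p
   f′ : ∀ {w} → w ∈ xs → w ∈ as ++ bs
   f′ w∈ with ∈-resp-↭ (shift x as bs) (f (there w∈))
   ... | here refl = ⊥-elim (All.lookup px w∈ refl)
   ... | there q   = q
   g′ : ∀ {w} → w ∈ as ++ bs → w ∈ xs
   g′ w∈ with g (∈-resp-↭ (↭-sym (shift x as bs)) (there w∈))
   ... | there q   = q
   ... | here refl with unique-resp-↭ (shift x as bs) u
   ...   | q ∷ _ = ⊥-elim (All.lookup q w∈ refl)

 unique-++⁻ : ∀ xs {ys : List A} → Unique (xs ++ ys) →
  Unique xs × Unique ys × (∀ {w} → w ∈ xs → w ∈ ys → ⊥)
 unique-++⁻ []       u        = [] , u , λ ()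
 unique-++⁻ (x ∷ xs) (p ∷ u) with unique-++⁻ xs u
 ... | u₁ , u₂ , d = All.tabulate (λ w∈ → All.lookup p (∈-++⁺ˡ w∈)) ∷ u₁ , u₂ ,
  λ { (here refl) w∈ → All.lookup p (∈-++⁺ʳ xs w∈) refl
   ; (there v∈)  w∈ → d v∈ w∈ }

 hd : List A → A → A
 hd []      z = z
 hd (x ∷ _) z = x

 lst : List A → A → A
 lst []       z = z
 lst (x ∷ xs) z = lst xs x

 hd-++ : ∀ xs {ys : List A} {z} → hd (xs ++ ys) z ≡ hd xs (hd ys z)
 hd-++ []       = refl
 hd-++ (x ∷ xs) = refl

 lst-++ : ∀ xs {ys : List A} {z} → lst (xs ++ ys) z ≡ lst ys (lst xs z)
 lst-++ []       = refl
 lst-++ (x ∷ xs) = lst-++ xs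

 lst-∈ : ∀ xs {z : A} → lst xs z ∈ z ∷ xs
 lst-∈ []       = here refl
 lst-∈ (x ∷ xs) = there (lst-∈ xs)

 -- In the list xs, w comes right after u; z comes after the last element.
 Succ : List A → A → A → A → Set
 Succ []       z u w = ⊥
 Succ (x ∷ xs) z u w = (u ≡ x × w ≡ hd xs z) ⊎ Succ xs z u w

 Inner : List A → A → A → Set
 Inner []       u w = ⊥
 Inner (x ∷ []) u w = ⊥
 Inner (x ∷ y ∷ ys) u w = (u ≡ x × w ≡ y) ⊎ Inner (y ∷ ys) u w

 Cyc : List A → A → A → Set
 Cyc xs u w = Succ xs (hd xs u) u w

 Succ-++⁻ : ∀ xs {ys z u w} → Succ (xs ++ ys) z u w → Succ xs (hd ys z) u w ⊎ Succ ys z u w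
 Succ-++⁻ []       s = inr s
 Succ-++⁻ (x ∷ xs) (inl (p , q)) = inl (inl (p , trans q (hd-++ xs)))
 Succ-++⁻ (x ∷ xs) (inr s) = map-⊎ inr id (Succ-++⁻ xs s)

 Succ-++⁺ˡ : ∀ xs {ys z u w} → Succ xs (hd ys z) u w → Succ (xs ++ ys) z u w
 Succ-++⁺ˡ (x ∷ xs) (inl (p , q)) = inl (p , trans q (sym (hd-++ xs)))
 Succ-++⁺ˡ (x ∷ xs) (inr s) = inr (Succ-++⁺ˡ xs s)

 Succ-++⁺ʳ : ∀ xs {ys z u w} → Succ ys z u w → Succ (xs ++ ys) z u w
 Succ-++⁺ʳ []       s = s
 Succ-++⁺ʳ (x ∷ xs) s = inr (Succ-++⁺ʳ xs s)

 Cyc-rotate : ∀ xs ys {u w} → Cyc (xs ++ ys) u w → Cyc (ys ++ xs) u w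
 Cyc-rotate []       ys       c rewrite ++-identityʳ ys = c
 Cyc-rotate (x ∷ xs) []       c rewrite ++-identityʳ xs = c
 Cyc-rotate (x ∷ xs) (y ∷ ys) c with Succ-++⁻ (x ∷ xs) c
 ... | inl s = Succ-++⁺ʳ (y ∷ ys) s
 ... | inr s = Succ-++⁺ˡ (y ∷ ys) s

 Inner-∈ : ∀ xs {u w} → Inner xs u w → u ∈ xs × w ∈ xs
 Inner-∈ (x ∷ y ∷ ys) (inl (refl , refl)) = here refl , there (here refl)
 Inner-∈ (x ∷ y ∷ ys) (inr i) with Inner-∈ (y ∷ ys) i
 ... | p , q = there p , there q

 Succ⇒Inner : ∀ x xs {z u w} → Succ (x ∷ xs) z u w → Inner (x ∷ xs) u w ⊎ (u ≡ lst xs x × w ≡ z)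
 Succ⇒Inner x []       (inl p) = inr p
 Succ⇒Inner x (y ∷ ys) (inl p) = inl (inl p)
 Succ⇒Inner x (y ∷ ys) (inr s) = map-⊎ inr id (Succ⇒Inner y ys s)

 Inner⇒Succ : ∀ xs {z u w} → Inner xs u w → Succ xs z u w
 Inner⇒Succ (x ∷ y ∷ ys) (inl p) = inl p
 Inner⇒Succ (x ∷ y ∷ ys) (inr i) = inr (Inner⇒Succ (y ∷ ys) i)

 lst⇒Succ : ∀ x xs {z} → Succ (x ∷ xs) z (lst xs x) z
 lst⇒Succ x []       = inl (refl , refl)
 lst⇒Succ x (y ∷ ys) = inr (lst⇒Succ y ys)

 Succ-∈ : ∀ xs {z u w} → Succ xs z u w → u ∈ xs × (w ∈ xs ⊎ w ≡ z)
 Succ-∈ (x ∷ xs) s with Succ⇒Inner x xs s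
 ... | inl i           = fst (Inner-∈ (x ∷ xs) i) , inl (snd (Inner-∈ (x ∷ xs) i))
 ... | inr (refl , q) = lst-∈ xs , inr q

 Cyc-∈ : ∀ xs {u w} → Cyc xs u w → u ∈ xs × w ∈ xs
 Cyc-∈ (x ∷ xs) c with Succ-∈ (x ∷ xs) c
 ... | p , inl q    = p , q
 ... | p , inr refl = p , here refl

 Inner-head : ∀ {x xs u w} → Unique (x ∷ xs) → Inner (x ∷ xs) u w → w ≢ x
 Inner-head {xs = y ∷ ys} (p ∷ _) (inl (_ , refl)) refl = All.lookup p (here refl) refl
 Inner-head {xs = y ∷ ys} (p ∷ _) (inr i) refl = All.lookup p (snd (Inner-∈ (y ∷ ys) i)) refl

 Inner-from-head : ∀ {x xs w} → Unique (x ∷ xs) → Inner (x ∷ xs) x w → w ≡ hd xs x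
 Inner-from-head {xs = y ∷ ys} _ (inl (_ , q)) = q
 Inner-from-head {xs = y ∷ ys} (p ∷ _) (inr i) = ⊥-elim (All.lookup p (fst (Inner-∈ (y ∷ ys) i)) refl)

-- Plane trees cut at an edge

-- An unrooted plane tree, cut at one of its edges.
infix 5 _⋈_
data CutTree (V : Set) : Set where
 _⋈_ : PlaneTree V → PlaneTree V → CutTree V

module _ {V : Set} where

 lvs  : PlaneTree V → List V
 lvss : List (PlaneTree V) → List V
 lvs (node v [])       = v ∷ []
 lvs (node v (t ∷ ts)) = lvs t ++ lvss ts
 lvss []       = []
 lvss (t ∷ ts) = lvs t ++ lvss ts

 ints  : PlaneTree V → List V
 intss : List (PlaneTree V) → List V
 ints (node v [])       = []
 ints (node v (t ∷ ts)) = v ∷ ints t ++ intss ts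
 intss []       = []
 intss (t ∷ ts) = ints t ++ intss ts

 Wf  : PlaneTree V → Set
 Wfs : List (PlaneTree V) → Set
 Wf (node v ts) = length ts ≢ 1 × Wfs ts
 Wfs []       = ⊤
 Wfs (t ∷ ts) = Wf t × Wfs ts

 verts Lvs Ints : CutTree V → List V
 verts (p ⋈ q) = preorder p ++ preorder q
 Lvs   (p ⋈ q) = lvs p ++ lvs q
 Ints  (p ⋈ q) = ints p ++ ints q

 WF : CutTree V → Set
 WF (p ⋈ q) = Wf p × Wf q

 Arc TE CE Adj : CutTree V → V → V → Set
 Arc (p ⋈ q) u w = Child p u w ⊎ Child q u w ⊎ (u ≡ root p × w ≡ root q)
 TE t u w = Arc t u w ⊎ Arc t w u
 CE t = Cyc (Lvs t)
 Adj t u w = TE t u w ⊎ (CE t u w ⊎ CE t w u)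

 preorders-++ : ∀ ts {us : List (PlaneTree V)} → preorders (ts ++ us) ≡ preorders ts ++ preorders us
 preorders-++ []       = refl
 preorders-++ (t ∷ ts) {us} rewrite preorders-++ ts {us} = sym (++-assoc (preorder t) _ _)

 lvss-++ : ∀ ts {us} → lvss (ts ++ us) ≡ lvss ts ++ lvss us
 lvss-++ []       = refl
 lvss-++ (t ∷ ts) {us} rewrite lvss-++ ts {us} = sym (++-assoc (lvs t) _ _)

 intss-++ : ∀ ts {us} → intss (ts ++ us) ≡ intss ts ++ intss us
 intss-++ []       = refl
 intss-++ (t ∷ ts) {us} rewrite intss-++ ts {us} = sym (++-assoc (ints t) _ _)

 Wfs-++ : ∀ ts {us} → Wfs ts → Wfs us → Wfs (ts ++ us)
 Wfs-++ []       _       w = w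
 Wfs-++ (t ∷ ts) (x , y) w = x , Wfs-++ ts y w

 Wfs-++⁻ : ∀ ts {us} → Wfs (ts ++ us) → Wfs ts × Wfs us
 Wfs-++⁻ []       w       = tt , w
 Wfs-++⁻ (t ∷ ts) (x , w) = let y , z = Wfs-++⁻ ts w in (x , y) , z

 Child-∷⁻ : ∀ {v : V} {t ts u w} → Child (node v (t ∷ ts)) u w →
  (u ≡ v × w ≡ root t) ⊎ Child t u w ⊎ Child (node v ts) u w
 Child-∷⁻ (here (here refl))    = inl (refl , refl)
 Child-∷⁻ (here (there m))      = inr (inr (here m))
 Child-∷⁻ (below (here refl) c) = inr (inl c)
 Child-∷⁻ (below (there m) c)   = inr (inr (below m c))

 Child-there : ∀ {v : V} {t ts u w} → Child (node v ts) u w → Child (node v (t ∷ ts)) u w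
 Child-there (here m)    = here (there m)
 Child-there (below m c) = below (there m) c

 Child-++⁻ : ∀ {v : V} ts {us u w} → Child (node v (ts ++ us)) u w → Child (node v ts) u w ⊎ Child (node v us) u w
 Child-++⁻ []       c = inr c
 Child-++⁻ (t ∷ ts) c with Child-∷⁻ c
 ... | inl (refl , refl) = inl (here (here refl))
 ... | inr (inl d)      = inl (below (here refl) d)
 ... | inr (inr d)      = map-⊎ Child-there id (Child-++⁻ ts d)

 Child-++⁺ˡ : ∀ {v : V} {ts us u w} → Child (node v ts) u w → Child (node v (ts ++ us)) u w
 Child-++⁺ˡ (here m)    = here (∈-++⁺ˡ m)
 Child-++⁺ˡ (below m c) = below (∈-++⁺ˡ m) c

 Child-++⁺ʳ : ∀ {v : V} ts {us u w} → Child (node v us) u w → Child (node v (ts ++ us)) u w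
 Child-++⁺ʳ ts (here m)    = here (∈-++⁺ʳ ts m)
 Child-++⁺ʳ ts (below m c) = below (∈-++⁺ʳ ts m) c

 Child-one : ∀ {v : V} {q u w} → Child (node v (q ∷ [])) u w → (u ≡ v × w ≡ root q) ⊎ Child q u w
 Child-one c with Child-∷⁻ c
 ... | inl p        = inl p
 ... | inr (inl d) = inr d
 ... | inr (inr (here ()))
 ... | inr (inr (below () _))

 root∈ : (t : PlaneTree V) → root t ∈ preorder t
 root∈ (node v ts) = here refl

 preorder⊆ : ∀ {t : PlaneTree V} {ts} → t ∈ ts → ∀ {x} → x ∈ preorder t → x ∈ preorders ts
 preorder⊆ (here refl) x∈ = ∈-++⁺ˡ x∈
 preorder⊆ {ts = t′ ∷ _} (there m) x∈ = ∈-++⁺ʳ (preorder t′) (preorder⊆ m x∈)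

 Child-∈ : ∀ {t : PlaneTree V} {u w} → Child t u w → u ∈ preorder t × w ∈ preorder t
 Child-∈ (here {t = t} m) = here refl , there (preorder⊆ m (root∈ t))
 Child-∈ (below m c) with Child-∈ c
 ... | p , q = there (preorder⊆ m p) , there (preorder⊆ m q)

 Child-∈ˢ : ∀ {v : V} {ts u w} → Child (node v ts) u w → w ∈ preorders ts
 Child-∈ˢ (here {t = t} m) = preorder⊆ m (root∈ t)
 Child-∈ˢ (below m c) = preorder⊆ m (snd (Child-∈ c))

 first final : PlaneTree V → V
 first t = hd (lvs t) (root t)
 final t = lst (lvs t) (root t)

 lvs-nonempty : ∀ t → ∃₂ λ x xs → lvs t ≡ x ∷ xs
 lvs-nonempty (node v [])       = v , [] , refl
 lvs-nonempty (node v (t ∷ ts)) with lvs t | lvs-nonempty t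
 ... | _ | x , xs , refl = x , _ , refl

 hd-lvs : ∀ t {ys z} → hd (lvs t ++ ys) z ≡ first t
 hd-lvs t with lvs t | lvs-nonempty t
 ... | _ | x , xs , refl = refl

 lst-lvs : ∀ t {z} → lst (lvs t) z ≡ final t
 lst-lvs t with lvs t | lvs-nonempty t
 ... | _ | x , xs , refl = refl

 lvs⊆ : ∀ t {x} → x ∈ lvs t → x ∈ preorder t
 lvss⊆ : ∀ ts {x} → x ∈ lvss ts → x ∈ preorders ts
 lvs⊆ (node v [])       (here refl) = here refl
 lvs⊆ (node v (t ∷ ts)) x∈ = there (lvss⊆ (t ∷ ts) x∈)
 lvss⊆ (t ∷ ts) x∈ with ∈-++⁻ (lvs t) x∈
 ... | inl p = ∈-++⁺ˡ (lvs⊆ t p)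
 ... | inr p = ∈-++⁺ʳ (preorder t) (lvss⊆ ts p)

 ints⊆ : ∀ t {x} → x ∈ ints t → x ∈ preorder t
 intss⊆ : ∀ ts {x} → x ∈ intss ts → x ∈ preorders ts
 ints⊆ (node v (t ∷ ts)) (here p) = here p
 ints⊆ (node v (t ∷ ts)) (there x∈) = there (intss⊆ (t ∷ ts) x∈)
 intss⊆ (t ∷ ts) x∈ with ∈-++⁻ (ints t) x∈
 ... | inl p = ∈-++⁺ˡ (ints⊆ t p)
 ... | inr p = ∈-++⁺ʳ (preorder t) (intss⊆ ts p)

 first∈ : ∀ t → first t ∈ lvs t
 first∈ t with lvs t | lvs-nonempty t
 ... | _ | x , xs , refl = here refl

 final∈ : ∀ t → final t ∈ lvs t
 final∈ t with lvs t | lvs-nonempty t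
 ... | _ | x , xs , refl = lst-∈ xs

 infix 4 _≃_
 record _≃_ (t t′ : CutTree V) : Set where
  field
   verts↭ : verts t ↭ verts t′
   lvs↭   : Lvs t ↭ Lvs t′
   ints↭  : Ints t ↭ Ints t′
   te     : ∀ {u w} → TE t u w ⇔ TE t′ u w
   ce     : ∀ {u w} → CE t u w ⇔ CE t′ u w
   wf     : WF t ⇔ WF t′

 open _≃_ public

 ≃-adj : ∀ {t t′} → t ≃ t′ → ∀ {u w} → Adj t u w ⇔ Adj t′ u w
 ≃-adj e = mk⇔ (map-⊎ (to (te e)) (map-⊎ (to (ce e)) (to (ce e))))
  (map-⊎ (from (te e)) (map-⊎ (from (ce e)) (from (ce e))))

 ≃-refl : ∀ {t : CutTree V} → t ≃ t
 ≃-refl = record { verts↭ = ↭-refl ; lvs↭ = ↭-refl ; ints↭ = ↭-refl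
  ; te = mk⇔ id id ; ce = mk⇔ id id ; wf = mk⇔ id id }

 ≃-trans : ∀ {t t′ t″} → t ≃ t′ → t′ ≃ t″ → t ≃ t″
 ≃-trans e f = record
  { verts↭ = ↭-trans (verts↭ e) (verts↭ f)
  ; lvs↭   = ↭-trans (lvs↭ e) (lvs↭ f)
  ; ints↭  = ↭-trans (ints↭ e) (ints↭ f)
  ; te     = mk⇔ (to (te f) ∘ to (te e)) (from (te e) ∘ from (te f))
  ; ce     = mk⇔ (to (ce f) ∘ to (ce e)) (from (ce e) ∘ from (ce f))
  ; wf     = mk⇔ (to (wf f) ∘ to (wf e)) (from (wf e) ∘ from (wf f))
  }

 ≃-sym : ∀ {t t′} → t ≃ t′ → t′ ≃ t
 ≃-sym e = record
  { verts↭ = ↭-sym (verts↭ e)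
  ; lvs↭   = ↭-sym (lvs↭ e)
  ; ints↭  = ↭-sym (ints↭ e)
  ; te     = mk⇔ (from (te e)) (to (te e))
  ; ce     = mk⇔ (from (ce e)) (to (ce e))
  ; wf     = mk⇔ (from (wf e)) (to (wf e))
  }

 TE-sym : ∀ (t : CutTree V) {u w} → TE t u w → TE t w u
 TE-sym _ (inl a) = inr a
 TE-sym _ (inr a) = inl a

 Adj-sym : ∀ (t : CutTree V) {u w} → Adj t u w → Adj t w u
 Adj-sym t (inl a)        = inl (TE-sym t a)
 Adj-sym t (inr (inl a)) = inr (inr a)
 Adj-sym t (inr (inr a)) = inr (inl a)

 swap : ∀ p q → p ⋈ q ≃ q ⋈ p
 swap p q = record
  { verts↭ = ++-comm (preorder p) _
  ; lvs↭   = ++-comm (lvs p) _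
  ; ints↭  = ++-comm (ints p) _
  ; te     = mk⇔ (swapTE p q) (swapTE q p)
  ; ce     = mk⇔ (Cyc-rotate (lvs p) (lvs q)) (Cyc-rotate (lvs q) (lvs p))
  ; wf     = mk⇔ (λ { (a , b) → b , a }) (λ { (a , b) → b , a })
  }
  where
   swapTE : ∀ p q {u w} → TE (p ⋈ q) u w → TE (q ⋈ p) u w
   swapTE p q (inl (inl c))        = inl (inr (inl c))
   swapTE p q (inl (inr (inl c))) = inl (inl c)
   swapTE p q (inl (inr (inr (a , b)))) = inr (inr (inr (b , a)))
   swapTE p q (inr (inl c))        = inr (inr (inl c))
   swapTE p q (inr (inr (inl c))) = inr (inl c)
   swapTE p q (inr (inr (inr (a , b)))) = inl (inr (inr (b , a)))

 length-∷ʳ : ∀ {A : Set} (xs : List A) {x} → length (xs ∷ʳ x) ≡ suc (length xs)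
 length-∷ʳ []       = refl
 length-∷ʳ (y ∷ xs) = cong suc (length-∷ʳ xs)

 slide : ∀ v t ts q → node v (t ∷ ts) ⋈ q ≃ t ⋈ node v (ts ∷ʳ q)
 slide v t ts q = record
  { verts↭ = ↭-trans (↭-reflexive (cong (v ∷_) (trans (++-assoc (preorder t) _ _)
   (cong (preorder t ++_) (trans (cong (preorders ts ++_) (sym (++-identityʳ _)))
    (sym (preorders-++ ts)))))))
   (↭-sym (shift v (preorder t) _))
  ; lvs↭   = ↭-reflexive lvs≡
  ; ints↭  = ↭-trans (↭-reflexive (cong (v ∷_) (trans (++-assoc (ints t) _ _)
   (cong (ints t ++_) (trans (cong (intss ts ++_) (sym (++-identityʳ _)))
    (sym (intss-++ ts)))))))
   (↭-trans (↭-sym (shift v (ints t) _))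
    (↭-reflexive (cong (ints t ++_) (sym (ints-node v (ts ∷ʳ q) (ne ts))))))
  ; te     = mk⇔ (λ { (inl a) → f a ; (inr a) → TE-sym (t ⋈ node v (ts ∷ʳ q)) (f a) }) (λ { (inl a) → g a ; (inr a) → TE-sym (node v (t ∷ ts) ⋈ q) (g a) })
  ; ce     = λ {u} {w} → subst (λ l → CE (node v (t ∷ ts) ⋈ q) u w ⇔ Cyc l u w) lvs≡ (mk⇔ id id)
  ; wf     = mk⇔ (λ { ((l , wt , wts) , wq) → wt , (λ eq → l (trans (sym (length-∷ʳ ts)) eq)) , Wfs-++ ts wts (wq , tt) })
   (λ { (wt , l , ws) → let wts , wq , _ = Wfs-++⁻ ts ws in
                        ((λ eq → l (trans (length-∷ʳ ts) eq)) , wt , wts) , wq })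
  }
  where
   ne : ∀ (ts : List (PlaneTree V)) → ts ∷ʳ q ≢ []
   ne [] ()
   ne (_ ∷ _) ()
   ints-node : ∀ v ts → ts ≢ [] → ints (node v ts) ≡ v ∷ intss ts
   ints-node v []      n = contradiction refl n
   ints-node v (_ ∷ _) n = refl
   lvs-node : ∀ v ts → ts ≢ [] → lvs (node v ts) ≡ lvss ts
   lvs-node v []      n = contradiction refl n
   lvs-node v (_ ∷ _) n = refl
   lvs≡ : Lvs (node v (t ∷ ts) ⋈ q) ≡ Lvs (t ⋈ node v (ts ∷ʳ q))
   lvs≡ rewrite lvs-node v (ts ∷ʳ q) (ne ts) | lvss-++ ts {q ∷ []} | ++-identityʳ (lvs q)
    = ++-assoc (lvs t) _ _
   f′ : ∀ {u w} → (u ≡ v × w ≡ root t) ⊎ Child t u w ⊎ Child (node v ts) u w → TE (t ⋈ node v (ts ∷ʳ q)) u w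
   f′ (inl (refl , refl)) = inr (inr (inr (refl , refl)))
   f′ (inr (inl d))      = inl (inl d)
   f′ (inr (inr d))      = inl (inr (inl (Child-++⁺ˡ d)))
   f : ∀ {u w} → Arc (node v (t ∷ ts) ⋈ q) u w → TE (t ⋈ node v (ts ∷ʳ q)) u w
   f (inl c) = f′ (Child-∷⁻ c)
   f (inr (inl c)) = inl (inr (inl (Child-++⁺ʳ ts (below (here refl) c))))
   f (inr (inr (refl , refl))) = inl (inr (inl (Child-++⁺ʳ ts (here (here refl)))))
   g : ∀ {u w} → Arc (t ⋈ node v (ts ∷ʳ q)) u w → TE (node v (t ∷ ts) ⋈ q) u w
   g (inl c) = inl (inl (below (here refl) c))
   g (inr (inl c)) with Child-++⁻ ts {q ∷ []} c
   ... | inl d = inl (inl (Child-there d))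
   ... | inr d with Child-one d
   ...   | inl (refl , refl) = inl (inr (inr (refl , refl)))
   ...   | inr e = inl (inr (inl e))
   g (inr (inr (refl , refl))) = inr (inl (here (here refl)))

 data Sub (r : PlaneTree V) : PlaneTree V → Set where
  whole : Sub r r
  inner : ∀ {v ts t} → t ∈ ts → Sub r t → Sub r (node v ts)

 cut-at-child : ∀ {v t} ts us q → t ∈ ts → ∃ λ ss → node v (ts ++ us) ⋈ q ≃ t ⋈ node v ss
 cut-at-child (t ∷ ts) us q (here refl) = _ , slide _ t (ts ++ us) q
 cut-at-child {v} (t′ ∷ ts) us q (there m) with cut-at-child {v} ts (us ∷ʳ q) t′ m
 ... | s , e = s , ≃-trans (slide v t′ (ts ++ us) q)
  (≃-trans (swap t′ _) (subst (λ xs → node v xs ⋈ t′ ≃ _) (sym (++-assoc ts us _)) e))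

 cut-at-sub : ∀ {r p} → Sub r p → ∀ q → ∃ λ s → p ⋈ q ≃ r ⋈ s
 cut-at-sub whole       q = q , ≃-refl
 cut-at-sub (inner {ts = ts} m i) q with cut-at-child ts [] q m | ++-identityʳ ts
 ... | ss , e | eq rewrite eq with cut-at-sub i (node _ ss)
 ...   | s′ , e′ = s′ , ≃-trans e e′

 sub-vertex  : ∀ p {v} → v ∈ preorder p → ∃ λ ts → Sub (node v ts) p
 sub-vertexˢ : ∀ ps {v} → v ∈ preorders ps → ∃₂ λ ts t → t ∈ ps × Sub (node v ts) t
 sub-vertex (node v ts) (here refl) = ts , whole
 sub-vertex (node v ts) (there m) with sub-vertexˢ ts m
 ... | us , t , t∈ , s = us , inner t∈ s
 sub-vertexˢ (p ∷ ps) m with ∈-++⁻ (preorder p) m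
 ... | inl m′ = let ts , s = sub-vertex p m′ in ts , p , here refl , s
 ... | inr m′ = let ts , t , t∈ , s = sub-vertexˢ ps m′ in ts , t , there t∈ , s

 cut-at-vertex : ∀ (t : CutTree V) {v} → v ∈ verts t → ∃₂ λ ts s → t ≃ node v ts ⋈ s
 cut-at-vertex (p ⋈ q) m with ∈-++⁻ (preorder p) m
 ... | inl m′ = let ts , i = sub-vertex p m′ ; s , e = cut-at-sub i q in ts , s , e
 ... | inr m′ = let ts , i = sub-vertex q m′ ; s , e = cut-at-sub i p in ts , s , ≃-trans (swap p q) e

module _ {V : Set} where

 preorder-split  : (t : PlaneTree V) → preorder t ↭ lvs t ++ ints t
 preorders-split : (ts : List (PlaneTree V)) → preorders ts ↭ lvss ts ++ intss ts
 preorder-split (node v [])       = ↭-refl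
 preorder-split (node v (t ∷ ts)) =
  ↭-trans (prep v (preorders-split (t ∷ ts))) (↭-sym (shift v (lvss (t ∷ ts)) _))
 preorders-split []       = ↭-refl
 preorders-split (t ∷ ts) = ↭-trans (Perm.++⁺ (preorder-split t) (preorders-split ts)) (++-interchange (lvs t) (ints t) (lvss ts) (intss ts))
  where
   ++-interchange : ∀ (as bs cs ds : List V) → (as ++ bs) ++ (cs ++ ds) ↭ (as ++ cs) ++ (bs ++ ds)
   ++-interchange as bs cs ds = ↭-trans (↭-reflexive (++-assoc as bs _))
    (↭-trans (Perm.++⁺ˡ as (Perm.shifts bs cs)) (↭-reflexive (sym (++-assoc as cs _))))

 verts-split : (t : CutTree V) → verts t ↭ Lvs t ++ Ints t
 verts-split (p ⋈ q) = subst (λ xs → verts (p ⋈ q) ↭ xs) eq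
  (↭-trans (Perm.++⁺ (preorder-split p) (preorder-split q))
  (↭-trans (↭-reflexive (++-assoc (lvs p) _ _))
  (Perm.++⁺ˡ (lvs p) (Perm.shifts (ints p) (lvs q)))))
  where
   eq : lvs p ++ lvs q ++ ints p ++ ints q ≡ (lvs p ++ lvs q) ++ ints p ++ ints q
   eq = sym (++-assoc (lvs p) _ _)

 record UniqueV (t : CutTree V) : Set where
  constructor mkU
  field unV : Unique (verts t)
 open UniqueV public

 module _ {t : CutTree V} (u : UniqueV t) where

  lvs-ints-disjoint : ∀ {x} → x ∈ Lvs t → x ∈ Ints t → ⊥
  lvs-ints-disjoint = snd (snd (unique-++⁻ (Lvs t) (unique-resp-↭ (verts-split t) (unV u))))

  Lvs-unique : Unique (Lvs t)
  Lvs-unique = fst (unique-++⁻ (Lvs t) (unique-resp-↭ (verts-split t) (unV u)))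

 leaf-or-int : ∀ (t : CutTree V) {x} → x ∈ verts t → x ∈ Lvs t ⊎ x ∈ Ints t
 leaf-or-int t x∈ = ∈-++⁻ (Lvs t) (∈-resp-↭ (verts-split t) x∈)

 Lvs⊆ : ∀ (t : CutTree V) {x} → x ∈ Lvs t → x ∈ verts t
 Lvs⊆ t x∈ = ∈-resp-↭ (↭-sym (verts-split t)) (∈-++⁺ˡ x∈)

 Ints⊆ : ∀ (t : CutTree V) {x} → x ∈ Ints t → x ∈ verts t
 Ints⊆ t x∈ = ∈-resp-↭ (↭-sym (verts-split t)) (∈-++⁺ʳ (Lvs t) x∈)

 unique-tail : ∀ {x : V} {xs} → Unique (x ∷ xs) → Unique xs
 unique-tail (_ ∷ u) = u

 TE-∈ : ∀ (t : CutTree V) {u w} → TE t u w → u ∈ verts t × w ∈ verts t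
 TE-∈ (p ⋈ q) = λ { (inl a) → f a ; (inr a) → let x , y = f a in y , x }
   where
     f : ∀ {u w} → Arc (p ⋈ q) u w → u ∈ verts (p ⋈ q) × w ∈ verts (p ⋈ q)
     f (inl c) = let a , b = Child-∈ c in ∈-++⁺ˡ a , ∈-++⁺ˡ b
     f (inr (inl c)) = let a , b = Child-∈ c in ∈-++⁺ʳ (preorder p) a , ∈-++⁺ʳ (preorder p) b
     f (inr (inr (refl , refl))) = ∈-++⁺ˡ (root∈ p) , ∈-++⁺ʳ (preorder p) (root∈ q)

 Adj-∈ : ∀ (t : CutTree V) {u w} → Adj t u w → u ∈ verts t × w ∈ verts t
 Adj-∈ t (inl e) = TE-∈ t e
 Adj-∈ t (inr (inl c)) = let a , b = Cyc-∈ (Lvs t) c in Lvs⊆ t a , Lvs⊆ t b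
 Adj-∈ t (inr (inr c)) = let a , b = Cyc-∈ (Lvs t) c in Lvs⊆ t b , Lvs⊆ t a

 TE-crossing : ∀ {p q : PlaneTree V} → UniqueV (p ⋈ q) → ∀ {u w} → TE (p ⋈ q) u w → u ∈ preorder p → w ∈ preorder q →
  u ≡ root p × w ≡ root q
 TE-crossing {p} {q} U {u} {w} e u∈ w∈ = g e
  where
   d : ∀ {x} → x ∈ preorder p → x ∈ preorder q → ⊥
   d = snd (snd (unique-++⁻ (preorder p) (unV U)))
   g : TE (p ⋈ q) u w → u ≡ root p × w ≡ root q
   g (inl (inl c))        = ⊥-elim (d (snd (Child-∈ c)) w∈)
   g (inl (inr (inl c))) = ⊥-elim (d u∈ (fst (Child-∈ c)))
   g (inl (inr (inr e))) = e
   g (inr (inl c))        = ⊥-elim (d (fst (Child-∈ c)) w∈)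
   g (inr (inr (inl c))) = ⊥-elim (d u∈ (snd (Child-∈ c)))
   g (inr (inr (inr (refl , refl)))) = ⊥-elim (d (root∈ p) w∈)

 root-∈ : ∀ {t : PlaneTree V} {ts} → t ∈ ts → root t ∈ map root ts
 root-∈ = ∈-map⁺ root

 module _ {y : V} {ts : List (PlaneTree V)} {s : PlaneTree V} (U : UniqueV (node y ts ⋈ s)) where

  private
   y∉ts : y ∉ preorders ts
   y∉ts m = Uniq.Unique[x∷xs]⇒x∉xs (unV U) (∈-++⁺ˡ m)
   y∉s : y ∉ preorder s
   y∉s m = Uniq.Unique[x∷xs]⇒x∉xs (unV U) (∈-++⁺ʳ (preorders ts) m)

  te-nbr⁻ : ∀ {w} → TE (node y ts ⋈ s) y w → w ∈ root s ∷ map root ts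
  te-nbr⁻ (inl (inl (here m)))        = there (root-∈ m)
  te-nbr⁻ (inl (inl (below m c)))     = ⊥-elim (y∉ts (preorder⊆ m (fst (Child-∈ c))))
  te-nbr⁻ (inl (inr (inl c)))        = ⊥-elim (y∉s (fst (Child-∈ c)))
  te-nbr⁻ (inl (inr (inr (_ , e))))  = here e
  te-nbr⁻ (inr (inl c))               = ⊥-elim (y∉ts (Child-∈ˢ c))
  te-nbr⁻ (inr (inr (inl c)))        = ⊥-elim (y∉s (snd (Child-∈ c)))
  te-nbr⁻ (inr (inr (inr (_ , refl)))) = ⊥-elim (y∉s (root∈ s))

  te-nbr⁺ : ∀ {w} → w ∈ root s ∷ map root ts → TE (node y ts ⋈ s) y w
  te-nbr⁺ (here refl) = inl (inr (inr (refl , refl)))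
  te-nbr⁺ (there m) with ∈-map⁻ root m
  ... | t , t∈ , refl = inl (inl (here t∈))

  te-nbrs-unique : Unique (root s ∷ map root ts)
  te-nbrs-unique = All.tabulate (λ { m refl → case ∈-map⁻ root m of λ { (t , t∈ , e) →
   snd (snd (unique-++⁻ (y ∷ preorders ts) (unV U))) (there (preorder⊆ t∈ (root∈ t))) (subst (_∈ preorder s) e (root∈ s)) } })
   ∷ roots ts (fst (snd (unique-++⁻ (y ∷ []) (fst (unique-++⁻ (y ∷ preorders ts) (unV U))))))
   where
    roots : ∀ ts → Unique (preorders ts) → Unique (map root ts)
    roots []       _ = []
    roots (t ∷ ts) u with unique-++⁻ (preorder t) u
    ... | _ , u₂ , d = All.tabulate (λ { m refl → case ∈-map⁻ root m of λ { (t′ , t∈ , e) →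
     d (root∈ t) (subst (_∈ preorders ts) (sym e) (preorder⊆ t∈ (root∈ t′))) } }) ∷ roots ts u₂

 adj-int⁻ : ∀ {y : V} {c cs s} → UniqueV (node y (c ∷ cs) ⋈ s) → ∀ {w} →
  Adj (node y (c ∷ cs) ⋈ s) y w → TE (node y (c ∷ cs) ⋈ s) y w
 adj-int⁻ U (inl e) = e
 adj-int⁻ {y} {c} {cs} {s} U (inr (inl e)) = ⊥-elim (lvs-ints-disjoint U (fst (Cyc-∈ (Lvs (node y (c ∷ cs) ⋈ s)) e)) (here refl))
 adj-int⁻ {y} {c} {cs} {s} U (inr (inr e)) = ⊥-elim (lvs-ints-disjoint U (snd (Cyc-∈ (Lvs (node y (c ∷ cs) ⋈ s)) e)) (here refl))

 leafT : V → PlaneTree V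
 leafT v = node v []

 module _ {a : V} {s : PlaneTree V} (U : UniqueV (leafT a ⋈ s)) where

  private
   a∉s : a ∉ preorder s
   a∉s = Uniq.Unique[x∷xs]⇒x∉xs (unV U)
   a∉l : a ∉ lvs s
   a∉l m = a∉s (lvs⊆ s m)

  ce-leaf-next : ∀ {w} → CE (leafT a ⋈ s) a w → w ≡ first s
  ce-leaf-next (inl (_ , e)) = trans e (trans (cong (λ l → hd l a) (sym (++-identityʳ (lvs s)))) (hd-lvs s))
  ce-leaf-next (inr p) = ⊥-elim (a∉l (fst (Succ-∈ (lvs s) p)))

  ce-leaf-prev : ∀ {w} → CE (leafT a ⋈ s) w a → w ≡ final s
  ce-leaf-prev c with lvs s | lvs-nonempty s | a∉l
  ce-leaf-prev (inl (_ , refl)) | _ | x , xs , refl | n = ⊥-elim (n (here refl))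
  ce-leaf-prev (inr p) | _ | x , xs , refl | n with Succ⇒Inner x xs p
  ... | inl i = ⊥-elim (n (snd (Inner-∈ (x ∷ xs) i)))
  ... | inr (e , _) = e

  ce-next-leaf : CE (leafT a ⋈ s) a (first s)
  ce-next-leaf with lvs s | lvs-nonempty s
  ... | _ | x , xs , refl = inl (refl , refl)

  ce-prev-leaf : CE (leafT a ⋈ s) (final s) a
  ce-prev-leaf with lvs s | lvs-nonempty s
  ... | _ | x , xs , refl = inr (lst⇒Succ x xs)

  adj-leaf⁻ : ∀ {w} → Adj (leafT a ⋈ s) a w → w ∈ root s ∷ first s ∷ final s ∷ []
  adj-leaf⁻ (inl e) with te-nbr⁻ U e
  ... | here p = here p
  adj-leaf⁻ (inr (inl c)) = there (here (ce-leaf-next c))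
  adj-leaf⁻ (inr (inr c)) = there (there (here (ce-leaf-prev c)))

  adj-leaf⁺ : ∀ {w} → w ∈ root s ∷ first s ∷ final s ∷ [] → Adj (leafT a ⋈ s) a w
  adj-leaf⁺ (here refl) = inl (te-nbr⁺ U (here refl))
  adj-leaf⁺ (there (here refl)) = inr (inl ce-next-leaf)
  adj-leaf⁺ (there (there (here refl))) = inr (inr ce-prev-leaf)

 record Good (t : CutTree V) : Set where
  constructor good
  field
   uniq : UniqueV t
   isWF : WF t
   size : 4 ≤ length (verts t)
 open Good public

 good-≃ : ∀ {t : CutTree V} {t′} → t ≃ t′ → Good t → Good t′
 good-≃ e (good u w s) = good (mkU (unique-resp-↭ (verts↭ e) (unV u))) (to (wf e) w) (subst (4 ≤_) (↭-length (verts↭ e)) s)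

 cut-at-leaf : ∀ {t : CutTree V} {a} → Good t → a ∈ Lvs t → ∃ λ s → t ≃ leafT a ⋈ s
 cut-at-leaf {t} g a∈ with cut-at-vertex t (Lvs⊆ t a∈)
 ... | []     , s , e = s , e
 ... | c ∷ cs , s , e = ⊥-elim (lvs-ints-disjoint (uniq (good-≃ e g)) (∈-resp-↭ (lvs↭ e) a∈) (here refl))

 cut-at-int : ∀ {t : CutTree V} {a} → Good t → a ∈ Ints t → ∃₂ λ c cs → ∃ λ s → t ≃ node a (c ∷ cs) ⋈ s
 cut-at-int {t} g a∈ with cut-at-vertex t (Ints⊆ t a∈)
 ... | c ∷ cs , s , e = c , cs , s , e
 ... | []     , s , e = ⊥-elim (lvs-ints-disjoint (uniq (good-≃ e g)) (here refl) (∈-resp-↭ (ints↭ e) a∈))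

 data Branching : PlaneTree V → Set where
  branching : ∀ {y c c′ cs} → Branching (node y (c ∷ c′ ∷ cs))

 wf-cases : (s : PlaneTree V) → Wf s → (∃ λ b → s ≡ leafT b) ⊎ Branching s
 wf-cases (node b [])           _ = inl (b , refl)
 wf-cases (node b (c ∷ []))     w = contradiction refl (fst w)
 wf-cases (node b (c ∷ c′ ∷ cs)) _ = inr branching

 good-leaf : ∀ {a s} → Good (leafT a ⋈ s) → Branching s
 good-leaf {a} {s} g with wf-cases s (snd (isWF g))
 ... | inr b = b
 ... | inl (b , refl) with size g
 ...   | s≤s (s≤s ())

 no-TE-between-leaves : ∀ {t : CutTree V} {u w} → Good t → u ∈ Lvs t → w ∈ Lvs t → TE t u w → ⊥
 no-TE-between-leaves {t} {u} {w} g u∈ w∈ e with cut-at-leaf g u∈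
 ... | s , eq with good-leaf (good-≃ eq g) | te-nbr⁻ (uniq (good-≃ eq g)) (to (te eq) e)
 ...   | branching | here refl = lvs-ints-disjoint (uniq (good-≃ eq g)) (∈-resp-↭ (lvs↭ eq) w∈) (here refl)

 root-fresh : ∀ {y : V} {ts s} → UniqueV (node y ts ⋈ s) → ∀ {w} → w ∈ preorders ts ++ preorder s → y ≢ w
 root-fresh U w∈ refl = Uniq.Unique[x∷xs]⇒x∉xs (unV U) w∈

 Adj-irrefl : ∀ {t : CutTree V} {u} → Good t → Adj t u u → ⊥
 Adj-irrefl {t} {u} g a with leaf-or-int t (fst (Adj-∈ t a))
 ... | inr i with cut-at-int g i
 ...   | c , cs , s , e with te-nbr⁻ (uniq (good-≃ e g)) (adj-int⁻ (uniq (good-≃ e g)) (to (≃-adj e) a))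
 ...     | here p = root-fresh (uniq (good-≃ e g)) (∈-++⁺ʳ (preorders (c ∷ cs)) (root∈ s)) p
 ...     | there m with ∈-map⁻ root m
 ...       | t′ , t∈ , p = root-fresh (uniq (good-≃ e g)) (∈-++⁺ˡ {xs = preorders (c ∷ cs)} (preorder⊆ {ts = c ∷ cs} t∈ (root∈ t′))) p
 Adj-irrefl {t} {u} g a | inl l with cut-at-leaf g l
 ... | s , e with adj-leaf⁻ (uniq (good-≃ e g)) (to (≃-adj e) a)
 ...   | here p = root-fresh (uniq (good-≃ e g)) (root∈ s) p
 ...   | there (here p) = root-fresh (uniq (good-≃ e g)) (lvs⊆ s (first∈ s)) p
 ...   | there (there (here p)) = root-fresh (uniq (good-≃ e g)) (lvs⊆ s (final∈ s)) p

module _ {V : Set} where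

 few-ints  : (p : PlaneTree V) → Wf p → length (ints p) < length (lvs p)
 few-intss : (ts : List (PlaneTree V)) → Wfs ts → length (intss ts) + length ts ≤ length (lvss ts)
 few-ints (node v [])            _ = s≤s z≤n
 few-ints (node v (c ∷ []))      w = contradiction refl (fst w)
 few-ints (node v (c ∷ c′ ∷ cs)) (_ , w) =
  ℕ.≤-trans (ℕ.≤-reflexive (sym (ℕ.+-comm (length (intss (c ∷ c′ ∷ cs))) 2)))
   (ℕ.≤-trans (ℕ.+-monoʳ-≤ (length (intss (c ∷ c′ ∷ cs))) (s≤s (s≤s z≤n))) (few-intss (c ∷ c′ ∷ cs) w))
 few-intss []       _ = z≤n
 few-intss (t ∷ ts) (w , ws)
  rewrite length-++ (ints t) {intss ts} | length-++ (lvs t) {lvss ts}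
   | ℕ.+-assoc (length (ints t)) (length (intss ts)) (suc (length ts))
   | ℕ.+-suc (length (intss ts)) (length ts)
   | ℕ.+-suc (length (ints t)) (length (intss ts) + length ts)
  = ℕ.+-mono-≤ (few-ints t w) (few-intss ts ws)

 few-Ints : (t : CutTree V) → WF t → 2 + length (Ints t) ≤ length (Lvs t)
 few-Ints (p ⋈ q) (wp , wq)
  rewrite length-++ (ints p) {ints q} | length-++ (lvs p) {lvs q}
   | sym (ℕ.+-suc (length (ints p)) (length (ints q)))
  = ℕ.+-mono-≤ (few-ints p wp) (few-ints q wq)

 length-verts : (t : CutTree V) → length (verts t) ≡ length (Lvs t) + length (Ints t)
 length-verts t = trans (↭-length (verts-split t)) (length-++ (Lvs t))

 many-leaves : (t : CutTree V) → WF t → 2 + length (verts t) ≤ 2 * length (Lvs t)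
 many-leaves t w rewrite length-verts t | ℕ.+-identityʳ (length (Lvs t)) =
  ℕ.≤-trans (ℕ.≤-reflexive lem) (ℕ.+-monoʳ-≤ (length (Lvs t)) (few-Ints t w))
  where
   lem : 2 + (length (Lvs t) + length (Ints t)) ≡ length (Lvs t) + (2 + length (Ints t))
   lem = trans (ℕ.+-comm 2 _) (trans (ℕ.+-assoc (length (Lvs t)) _ 2) (cong (length (Lvs t) +_) (ℕ.+-comm _ 2)))

 ≥4-leaves : (t : CutTree V) → WF t → 5 ≤ length (verts t) → 4 ≤ length (Lvs t)
 ≥4-leaves t w h with length (Lvs t) | many-leaves t w
 ... | 0 | ()
 ... | 1 | m = contradiction (ℕ.≤-trans (ℕ.+-monoʳ-≤ 2 h) m) λ { (s≤s (s≤s ())) }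
 ... | 2 | m = contradiction (ℕ.≤-trans (ℕ.+-monoʳ-≤ 2 h) m) λ { (s≤s (s≤s (s≤s (s≤s ())))) }
 ... | 3 | m = contradiction (ℕ.≤-trans (ℕ.+-monoʳ-≤ 2 h) m) λ { (s≤s (s≤s (s≤s (s≤s (s≤s (s≤s ())))))) }
 ... | suc (suc (suc (suc _))) | _ = s≤s (s≤s (s≤s (s≤s z≤n)))

 Fan : CutTree V → V → V → V → Set
 Fan t y u v = ∃₂ λ rest s → t ≃ node y (leafT u ∷ leafT v ∷ rest) ⋈ s

 snoc : ∀ (x : PlaneTree V) xs → ∃₂ λ ys z → x ∷ xs ≡ ys ∷ʳ z
 snoc x []       = [] , x , refl
 snoc x (y ∷ xs) with snoc y xs
 ... | ys , z , eq = x ∷ ys , z , cong (x ∷_) eq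

 same-child : ∀ {ts t t′} {x : V} → Unique (preorders ts) → t ∈ ts → t′ ∈ ts → x ∈ preorder t → x ∈ preorder t′ → t ≡ t′
 same-child u (here refl) (here refl) _ _ = refl
 same-child {ts = t ∷ ts} u (here refl) (there m) x∈ x∈′ = ⊥-elim (snd (snd (unique-++⁻ (preorder t) u)) x∈ (preorder⊆ m x∈′))
 same-child {ts = t ∷ ts} u (there m) (here refl) x∈ x∈′ = ⊥-elim (snd (snd (unique-++⁻ (preorder t) u)) x∈′ (preorder⊆ m x∈))
 same-child {ts = t ∷ ts} u (there m) (there m′) = same-child (fst (snd (unique-++⁻ (preorder t) u))) m m′

 preorder-unique : ∀ {ts} {t : PlaneTree V} → Unique (preorders ts) → t ∈ ts → Unique (preorder t)
 preorder-unique {t ∷ ts} u (here refl) = fst (unique-++⁻ (preorder t) u)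
 preorder-unique {t ∷ ts} u (there m) = preorder-unique (fst (snd (unique-++⁻ (preorder t) u))) m

 leaf-root : ∀ {c : PlaneTree V} → Unique (preorder c) → root c ∈ lvs c → c ≡ leafT (root c)
 leaf-root {node f []}       u m = refl
 leaf-root {node f (d ∷ ds)} u m = ⊥-elim (snd (snd (unique-++⁻ (lvs (node f (d ∷ ds))) (unique-resp-↭ (preorder-split (node f (d ∷ ds))) u))) m (here refl))

 leaf-child : ∀ {ts c} {x : V} → Unique (preorders ts) → c ∈ ts → x ∈ lvs c → x ∈ map root ts → c ≡ leafT x
 leaf-child {c = c} u m x∈ x∈r with ∈-map⁻ root x∈r
 ... | t′ , m′ , refl with same-child u m m′ (lvs⊆ c x∈) (root∈ t′)
 ...   | refl = leaf-root (preorder-unique u m) x∈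

 children-unique : ∀ {y : V} {ts s} → UniqueV (node y ts ⋈ s) → Unique (preorders ts)
 children-unique {y} {ts} U = fst (unique-++⁻ (preorders ts) (unique-tail (unV U)))

 final-∷ʳ : ∀ {y : V} ts {r} → final (node y (ts ∷ʳ r)) ≡ final r
 final-∷ʳ {y} ts {r} = trans (cong (λ l → lst l y) (lv (ts ∷ʳ r) (ne ts)))
  (trans (cong (λ l → lst l y) (lvss-++ ts)) (trans (lst-++ (lvss ts)) (trans (cong (λ l → lst l (lst (lvss ts) y)) (++-identityʳ (lvs r))) (lst-lvs r))))
  where
   ne : ∀ (ts : List (PlaneTree V)) → ts ∷ʳ r ≢ []
   ne [] ()
   ne (_ ∷ _) ()
   lv : ∀ ts → ts ≢ [] → lvs (node y ts) ≡ lvss ts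
   lv []      n = contradiction refl n
   lv (_ ∷ _) n = refl

 head-last-apart : ∀ {x : V} xs → Unique (x ∷ xs) → 3 ≤ length (x ∷ xs) → Inner (x ∷ xs) x (lst xs x) → ⊥
 head-last-apart (y ∷ [])     _           (s≤s (s≤s ())) _
 head-last-apart (y ∷ z ∷ zs) u@(_ ∷ q ∷ _) _ i = All.lookup q (lst-∈ zs) (sym (Inner-from-head u i))

 module _ {a : V} {s : PlaneTree V} (g : Good (leafT a ⋈ s)) where

  private
   open-children : ∀ {y c cs x} → s ≡ node y (c ∷ cs) → Adj (leafT a ⋈ s) y x → x ≢ a → x ∈ map root (c ∷ cs)
   open-children {y} {c} {cs} refl e n
    with te-nbr⁻ (uniq (good-≃ (swap (leafT a) s) g)) (adj-int⁻ (uniq (good-≃ (swap (leafT a) s) g)) (to (≃-adj (swap (leafT a) s)) e))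
   ... | here p  = ⊥-elim (n p)
   ... | there p = p

  fan-next : Adj (leafT a ⋈ s) (root s) (first s) → Fan (leafT a ⋈ s) (root s) a (first s)
  fan-next e with good-leaf g
  ... | branching {y} {c} {c′} {cs} with snoc c′ cs
  ...   | init , r , eq = subst₂ (λ f x → Fan (leafT a ⋈ node y (f ∷ c′ ∷ cs)) y a x) (sym c≡) (sym fc)
   (subst (λ l → Fan (leafT a ⋈ node y (leafT (first c) ∷ l)) y a (first c)) (sym eq)
    (init , r , ≃-sym (slide y (leafT a) (leafT (first c) ∷ init) r)))
   where
    fc : first (node y (c ∷ c′ ∷ cs)) ≡ first c
    fc = hd-lvs c
    c≡ : c ≡ leafT (first c)
    c≡ = leaf-child (children-unique (uniq (good-≃ (swap (leafT a) s) g))) (here refl) (first∈ c)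
     (subst (_∈ map root (c ∷ c′ ∷ cs)) fc (open-children refl e
      (≢-sym (root-fresh (uniq g) (lvs⊆ s (first∈ s))))))

  fan-prev : Adj (leafT a ⋈ s) (root s) (final s) → Fan (leafT a ⋈ s) (root s) (final s) a
  fan-prev e with good-leaf g
  ... | branching {y} {c} {c′} {cs} with snoc c′ cs
  ...   | i₁ , r , eq with snoc c i₁
  ...     | i₂ , r₂ , eq₂ = subst (λ l → Fan (leafT a ⋈ node y l) y (final (node y l)) a) (sym ds≡)
   (subst (λ x → Fan (leafT a ⋈ node y ((i₂ ∷ʳ r₂) ∷ʳ r)) y x a) (sym (final-∷ʳ (i₂ ∷ʳ r₂)))
    (subst (λ c → Fan (leafT a ⋈ node y ((i₂ ∷ʳ r₂) ∷ʳ c)) y (final r) a) (sym r≡)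
     (i₂ , r₂ , ≃-sym (≃-trans (slide y (leafT (final r)) (leafT a ∷ i₂) r₂)
      (≃-trans (swap (leafT (final r)) _) (slide y (leafT a) (i₂ ∷ʳ r₂) (leafT (final r))))))))
   where
    ds≡ : c ∷ c′ ∷ cs ≡ (i₂ ∷ʳ r₂) ∷ʳ r
    ds≡ = trans (cong (c ∷_) eq) (cong (_∷ʳ r) eq₂)
    r∈ : r ∈ c ∷ c′ ∷ cs
    r∈ = subst (r ∈_) (sym ds≡) (∈-++⁺ʳ (i₂ ∷ʳ r₂) (here refl))
    f≡ : final (node y (c ∷ c′ ∷ cs)) ≡ final r
    f≡ = trans (cong (λ l → final (node y l)) ds≡) (final-∷ʳ (i₂ ∷ʳ r₂))
    r≡ : r ≡ leafT (final r)
    r≡ = leaf-child (children-unique (uniq (good-≃ (swap (leafT a) s) g))) r∈ (final∈ r)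
     (subst (_∈ map root (c ∷ c′ ∷ cs)) f≡ (open-children refl e
      (≢-sym (root-fresh (uniq g) (lvs⊆ s (final∈ s))))))

  first-final-apart : 4 ≤ length (Lvs (leafT a ⋈ s)) → Adj (leafT a ⋈ s) (first s) (final s) → ⊥
  first-final-apart h (inl e) = no-TE-between-leaves g (there (first∈ s)) (there (final∈ s)) e
  first-final-apart h (inr c) with lvs s | lvs-nonempty s | Lvs-unique (uniq g)
  first-final-apart (s≤s h) (inr (inl (inl (refl , _)))) | _ | x , xs , refl | (p ∷ u) = All.lookup p (here refl) refl
  first-final-apart (s≤s h) (inr (inl (inr c))) | _ | x , xs , refl | (p ∷ u) with Succ⇒Inner x xs c
  ... | inr (_ , e) = All.lookup p (lst-∈ xs) (sym e)
  ... | inl i = head-last-apart xs u h i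
  first-final-apart (s≤s h) (inr (inr (inl (e , _)))) | _ | x , xs , refl | (p ∷ u) = All.lookup p (lst-∈ xs) (sym e)
  first-final-apart (s≤s h) (inr (inr (inr c))) | _ | x , xs , refl | (p ∷ u) with Succ⇒Inner x xs c
  ... | inr (_ , e) = All.lookup p (here refl) (sym e)
  ... | inl i = Inner-head u i refl

 TE-of-int : ∀ {t : CutTree V} {x y} → Good t → x ∈ Ints t → Adj t x y → TE t x y
 TE-of-int g m (inl e) = e
 TE-of-int {t} g m (inr (inl c)) = ⊥-elim (lvs-ints-disjoint (uniq g) (fst (Cyc-∈ (Lvs t) c)) m)
 TE-of-int {t} g m (inr (inr c)) = ⊥-elim (lvs-ints-disjoint (uniq g) (snd (Cyc-∈ (Lvs t) c)) m)

 cut-at-edge : ∀ {t : CutTree V} {a p} → Good t → TE t a p →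
  ∃₂ λ P Q → t ≃ P ⋈ Q × root P ≡ p × root Q ≡ a
 cut-at-edge {t} {a} g ap with cut-at-vertex t (fst (TE-∈ t ap))
 ... | ts , s , e with te-nbr⁻ (uniq (good-≃ e g)) (to (te e) ap)
 ...   | here eq = s , node a ts , ≃-trans e (swap _ s) , sym eq , refl
 ...   | there m with ∈-map⁻ root m
 ...     | t′ , m′ , eq with cut-at-child {v = a} ts [] s m′ | ++-identityʳ ts
 ...       | ss , e′ | eq′ rewrite eq′ = t′ , node a ss , ≃-trans e e′ , sym eq , refl

 TE-irrefl : ∀ {t : CutTree V} {u} → Good t → TE t u u → ⊥
 TE-irrefl g e = Adj-irrefl g (inl e)

 no-common-neighbour : ∀ {P Q : PlaneTree V} {q} → Good (P ⋈ Q) → TE (P ⋈ Q) (root Q) q → TE (P ⋈ Q) (root P) q → ⊥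
 no-common-neighbour {P} {Q} g aq pq with ∈-++⁻ (preorder P) (snd (TE-∈ (P ⋈ Q) aq))
 ... | inl m = TE-irrefl g (subst (TE (P ⋈ Q) (root P)) (fst (TE-crossing (uniq g) (TE-sym (P ⋈ Q) aq) m (root∈ Q))) pq)
 ... | inr m = TE-irrefl g (subst (TE (P ⋈ Q) (root Q)) (snd (TE-crossing (uniq g) pq (root∈ P) m)) aq)

 int-edge-no-triangle : ∀ {t : CutTree V} {a p q} → Good t → a ∈ Ints t → p ∈ Ints t →
  Adj t a p → Adj t a q → Adj t p q → ⊥
 int-edge-no-triangle g a∈ p∈ ap aq pq with cut-at-edge g (TE-of-int g a∈ ap)
 ... | P , Q , e , refl , refl = no-common-neighbour (good-≃ e g) (to (te e) (TE-of-int g a∈ aq)) (to (te e) (TE-of-int g p∈ pq))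

 record FanOn (t : CutTree V) (a p q : V) : Set where
  constructor fanOn
  field
   {hub l r} : V
   fan  : Fan t hub l r
   perm : hub ∷ l ∷ r ∷ [] ↭ a ∷ p ∷ q ∷ []

 Fan-≃ : ∀ {t t′ : CutTree V} {y u v} → t ≃ t′ → Fan t′ y u v → Fan t y u v
 Fan-≃ e (rest , s , f) = rest , s , ≃-trans e f

 module _ {a : V} {s : PlaneTree V} (g : Good (leafT a ⋈ s)) (h : 4 ≤ length (Lvs (leafT a ⋈ s))) where

  cut-leaf-triangle : ∀ {p q} → p ∈ root s ∷ first s ∷ final s ∷ [] → q ∈ root s ∷ first s ∷ final s ∷ [] →
   Adj (leafT a ⋈ s) p q → FanOn (leafT a ⋈ s) a p q
  cut-leaf-triangle (here refl) (here refl) x = ⊥-elim (Adj-irrefl g x)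
  cut-leaf-triangle (here refl) (there (here refl)) x = fanOn (fan-next g x) (Permₚ.swap _ _ ↭-refl)
  cut-leaf-triangle (here refl) (there (there (here refl))) x = fanOn (fan-prev g x)
   (↭-trans (prep _ (Permₚ.swap _ _ ↭-refl)) (↭-trans (Permₚ.swap _ _ ↭-refl) ↭-refl))
  cut-leaf-triangle (there (here refl)) (here refl) x = fanOn (fan-next g (Adj-sym (leafT a ⋈ s) x))
   (↭-trans (Permₚ.swap _ _ ↭-refl) (prep _ (Permₚ.swap _ _ ↭-refl)))
  cut-leaf-triangle (there (here refl)) (there (here refl)) x = ⊥-elim (Adj-irrefl g x)
  cut-leaf-triangle (there (here refl)) (there (there (here refl))) x = ⊥-elim (first-final-apart g h x)
  cut-leaf-triangle (there (there (here refl))) (here refl) x = fanOn (fan-prev g (Adj-sym (leafT a ⋈ s) x))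
   (↭-trans (prep _ (Permₚ.swap _ _ ↭-refl)) (↭-trans (Permₚ.swap _ _ ↭-refl) (prep _ (Permₚ.swap _ _ ↭-refl))))
  cut-leaf-triangle (there (there (here refl))) (there (here refl)) x = ⊥-elim (first-final-apart g h (Adj-sym (leafT a ⋈ s) x))
  cut-leaf-triangle (there (there (here refl))) (there (there (here refl))) x = ⊥-elim (Adj-irrefl g x)

 leaf-triangle : ∀ {t : CutTree V} {a p q} → Good t → 4 ≤ length (Lvs t) → a ∈ Lvs t →
  Adj t a p → Adj t a q → Adj t p q → FanOn t a p q
 leaf-triangle g h a∈ ap aq pq with cut-at-leaf g a∈
 ... | s , e with cut-leaf-triangle (good-≃ e g) (subst (4 ≤_) (↭-length (lvs↭ e)) h)
  (adj-leaf⁻ (uniq (good-≃ e g)) (to (≃-adj e) ap)) (adj-leaf⁻ (uniq (good-≃ e g)) (to (≃-adj e) aq)) (to (≃-adj e) pq)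
 ...   | fanOn f p = fanOn (Fan-≃ e f) p

 triangle-fan : ∀ {t : CutTree V} {a p q} → Good t → 4 ≤ length (Lvs t) →
  Adj t a p → Adj t a q → Adj t p q → FanOn t a p q
 triangle-fan {t} g h ap aq pq with leaf-or-int t (fst (Adj-∈ t ap)) | leaf-or-int t (snd (Adj-∈ t ap))
 ... | inl l | _      = leaf-triangle g h l ap aq pq
 ... | inr i | inr j = ⊥-elim (int-edge-no-triangle g i j ap aq pq)
 ... | inr i | inl l with leaf-triangle g h l (Adj-sym t ap) pq aq
 ...   | fanOn f p = fanOn f (↭-trans p (Permₚ.swap _ _ ↭-refl))

 fan-exists  : (p : PlaneTree V) → Wf p → Branching p → ∃ λ y → ∃₂ λ u v → ∃ λ rest → Sub (node y (leafT u ∷ leafT v ∷ rest)) p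
 fans-exist : (ts : List (PlaneTree V)) → Wfs ts →
  (∃₂ λ t y → ∃₂ λ u v → ∃ λ rest → t ∈ ts × Sub (node y (leafT u ∷ leafT v ∷ rest)) t) ⊎ All (λ t → t ≡ leafT (root t)) ts
 fan-exists (node y (c ∷ c′ ∷ cs)) (_ , ws) branching with fans-exist (c ∷ c′ ∷ cs) ws
 ... | inl (t , y′ , u , v , rest , m , i) = y′ , u , v , rest , inner m i
 ... | inr (p ∷ p′ ∷ _) = y , root c , root c′ , cs , subst₂ (λ d d′ → Sub (node y (d ∷ d′ ∷ cs)) (node y (c ∷ c′ ∷ cs))) p p′ whole
 fans-exist []       _ = inr []
 fans-exist (t ∷ ts) (w , ws) with wf-cases t w
 ... | inr b = let y , u , v , rest , i = fan-exists t w b in inl (t , y , u , v , rest , here refl , i)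
 ... | inl (b , refl) with fans-exist ts ws
 ...   | inl (t , y , u , v , rest , m , i) = inl (t , y , u , v , rest , there m , i)
 ...   | inr al = inr (refl ∷ al)

 good-fan : ∀ {t : CutTree V} → Good t → ∃ λ y → ∃₂ λ u v → Fan t y u v
 good-fan {p ⋈ q} g with wf-cases p (fst (isWF g))
 ... | inr b = let y , u , v , rest , i = fan-exists p (fst (isWF g)) b ; s , e = cut-at-sub i q in y , u , v , rest , s , e
 ... | inl (a , refl) = let y , u , v , rest , i = fan-exists q (snd (isWF g)) (good-leaf g) ; s , e = cut-at-sub i p
                         in y , u , v , rest , s , ≃-trans (swap p q) e

module _ {V : Set} where

 cyc₁⁻ : ∀ {a : V} L {p w} → Cyc (a ∷ L) p w → Inner L p w ⊎ (p ≡ a × w ≡ hd L a) ⊎ (p ≡ lst L a × w ≡ a)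
 cyc₁⁻ L (inl e) = inr (inl e)
 cyc₁⁻ (x ∷ xs) (inr s) = map-⊎ id inr (Succ⇒Inner x xs s)

 cyc₁⁺ : ∀ {a : V} L {p w} → Inner L p w ⊎ (p ≡ a × w ≡ hd L a) ⊎ (p ≡ lst L a × w ≡ a) → Cyc (a ∷ L) p w
 cyc₁⁺ L (inl i) = inr (Inner⇒Succ L i)
 cyc₁⁺ L (inr (inl e)) = inl e
 cyc₁⁺ []       (inr (inr e)) = inl e
 cyc₁⁺ (x ∷ xs) (inr (inr (refl , refl))) = inr (lst⇒Succ x xs)

 cyc₂⁻ : ∀ {u v : V} L {p w} → Cyc (u ∷ v ∷ L) p w →
  Inner L p w ⊎ (p ≡ u × w ≡ v) ⊎ (p ≡ v × w ≡ hd L u) ⊎ (p ≡ lst L v × w ≡ u)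
 cyc₂⁻ L (inl e) = inr (inl e)
 cyc₂⁻ L (inr (inl e)) = inr (inr (inl e))
 cyc₂⁻ (x ∷ xs) (inr (inr s)) = map-⊎ id (inr ∘ inr) (Succ⇒Inner x xs s)

 cyc₂⁺ : ∀ {u v : V} L {p w} →
  Inner L p w ⊎ (p ≡ u × w ≡ v) ⊎ (p ≡ v × w ≡ hd L u) ⊎ (p ≡ lst L v × w ≡ u) → Cyc (u ∷ v ∷ L) p w
 cyc₂⁺ L (inl i) = inr (inr (Inner⇒Succ L i))
 cyc₂⁺ L (inr (inl e)) = inl e
 cyc₂⁺ L (inr (inr (inl e))) = inr (inl e)
 cyc₂⁺ []       (inr (inr (inr e))) = inr (inl e)
 cyc₂⁺ (x ∷ xs) (inr (inr (inr (refl , refl)))) = inr (inr (lst⇒Succ x xs))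

 Core : (V → V → Set) → List V → V → V → Set
 Core A L p w = (A p w ⊎ A w p) ⊎ (Inner L p w ⊎ Inner L w p)

 Clique : List V → V → V → Set
 Clique ds p w = p ∈ ds × w ∈ ds × p ≢ w

 -- The graph K consists of C, a clique on ds, and the edges of Port, which leave ds.
 record Gadget (K C : V → V → Set) (ds : List V) (Port : V → V → Set) : Set where
  field
   split  : ∀ {p w} → K p w → C p w ⊎ Clique ds p w ⊎ Port p w ⊎ Port w p
   core   : ∀ {p w} → C p w → K p w
   clique : ∀ {p w} → Clique ds p w → K p w
   port   : ∀ {p w} → Port p w → K p w
   avoids : ∀ {p w} → C p w → p ∉ ds × w ∉ ds
   leaves-ds : ∀ {p w} → Port p w → p ∈ ds × w ∉ ds

 -- The quotient of K that identifies the vertices of ds with a.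
 Quot : (V → V → Set) → V → List V → V → V → Set
 Quot K a ds p w = (p ∉ ds × w ∉ ds × K p w)
  ⊎ (p ≡ a × w ∉ ds × Any (λ d → K d w) ds)
  ⊎ (w ≡ a × p ∉ ds × Any (λ d → K d p) ds)

 Quot-map : ∀ {K K′ : V → V → Set} {a ds} → (∀ {x y} → K x y → K′ x y) → ∀ {x y} → Quot K a ds x y → Quot K′ a ds x y
 Quot-map m (inl (p , w , k)) = inl (p , w , m k)
 Quot-map m (inr (inl (p , w , k))) = inr (inl (p , w , Any.map m k))
 Quot-map m (inr (inr (p , w , k))) = inr (inr (p , w , Any.map m k))

 Quot-↭ : ∀ {K a ds es} → ds ↭ es → ∀ {p w} → Quot K a ds p w → Quot K a es p w
 Quot-↭ {K} {a} {ds} {es} σ = λ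
  { (inl (p∉ , w∉ , k)) → inl (n p∉ , n w∉ , k)
  ; (inr (inl (e , w∉ , k))) → inr (inl (e , n w∉ , Perm.Any-resp-↭ σ k))
  ; (inr (inr (e , w∉ , k))) → inr (inr (e , n w∉ , Perm.Any-resp-↭ σ k)) }
  where
   n : ∀ {x} → x ∉ ds → x ∉ es
   n m x∈ = m (∈-resp-↭ (↭-sym σ) x∈)

 module _ {K K′ C Port Port′ : V → V → Set} {a : V} {ds : List V}
  (sK′ : Symmetric K′) (a∈ : a ∈ ds)
  (g : Gadget K C ds Port) (g′ : Gadget K′ C (a ∷ []) Port′)
  (merge : ∀ {d w} → Port d w → Port′ a w) (spread : ∀ {w} → Port′ a w → ∃ λ d → Port d w) where
  open Gadget

  quotient-gadget : ∀ {p w} → K′ p w ⇔ Quot K a ds p w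
  quotient-gadget = mk⇔ f b
   where
    half : ∀ {w d} → d ∈ ds → w ∉ ds → K d w → Port′ a w
    half d∈ w∉ k with split g k
    ... | inl c = ⊥-elim (fst (avoids g c) d∈)
    ... | inr (inl (_ , w∈ , _)) = ⊥-elim (w∉ w∈)
    ... | inr (inr (inl q)) = merge q
    ... | inr (inr (inr q)) = ⊥-elim (w∉ (fst (leaves-ds g q)))
    portQ : ∀ {w} → Port′ a w → w ∉ ds × Any (λ d → K d w) ds
    portQ q with spread q
    ... | d , q′ = snd (leaves-ds g q′) , Any.map (λ { refl → port g q′ }) (fst (leaves-ds g q′))
    f : ∀ {p w} → K′ p w → Quot K a ds p w
    f k with split g′ k
    ... | inl c = inl (fst (avoids g c) , snd (avoids g c) , core g c)
    ... | inr (inl (here refl , here refl , n)) = ⊥-elim (n refl)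
    ... | inr (inr (inl q)) with fst (leaves-ds g′ q)
    ...   | here refl = inr (inl (refl , portQ q))
    f k | inr (inr (inr q)) with fst (leaves-ds g′ q)
    ...   | here refl = inr (inr (refl , portQ q))
    anyHalf : ∀ {w} → w ∉ ds → Any (λ d → K d w) ds → Port′ a w
    anyHalf w∉ k with find k
    ... | d , d∈ , r = half d∈ w∉ r
    b : ∀ {p w} → Quot K a ds p w → K′ p w
    b (inl (p∉ , w∉ , k)) with split g k
    ... | inl c = core g′ c
    ... | inr (inl (p∈ , _)) = ⊥-elim (p∉ p∈)
    ... | inr (inr (inl q)) = ⊥-elim (p∉ (fst (leaves-ds g q)))
    ... | inr (inr (inr q)) = ⊥-elim (w∉ (fst (leaves-ds g q)))
    b (inr (inl (refl , w∉ , k))) = port g′ (anyHalf w∉ k)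
    b (inr (inr (refl , p∉ , k))) = sK′ (port g′ (anyHalf p∉ k))

 module _ (_≟_ : DecidableEquality V) {K T T′ C Port Port′ : V → V → Set} {a : V} {ds : List V}
  (sK : Symmetric K) (sT : Symmetric T) (a∈ : a ∈ ds)
  (g : Gadget T C ds Port) (g′ : Gadget T′ C (a ∷ []) Port′)
  (fits : ∀ {p w} → T′ p w ⇔ Quot K a ds p w)
  (inside : ∀ {d e} → d ∈ ds → e ∈ ds → K d e ⇔ (d ≢ e))
  (outside : ∀ {d w} → d ∈ ds → w ∉ ds → K d w ⇔ Port d w) where
  open Gadget
  open DecMem _≟_ using (_∈?_)

  lift-gadget : ∀ {p w} → T p w ⇔ K p w
  lift-gadget = mk⇔ f b
   where
    ≢a : ∀ {p} → p ∉ ds → p ≢ a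
    ≢a p∉ refl = p∉ a∈
    f : ∀ {p w} → T p w → K p w
    f k with split g k
    ... | inr (inl (p∈ , w∈ , n)) = from (inside p∈ w∈) n
    ... | inr (inr (inl q)) = let p∈ , w∉ = leaves-ds g q in from (outside p∈ w∉) q
    ... | inr (inr (inr q)) = let p∈ , w∉ = leaves-ds g q in sK (from (outside p∈ w∉) q)
    ... | inl c with to fits (core g′ c)
    ...   | inl (_ , _ , k′) = k′
    ...   | inr (inl (refl , _)) = ⊥-elim (fst (avoids g′ c) (here refl))
    ...   | inr (inr (refl , _)) = ⊥-elim (snd (avoids g′ c) (here refl))
    b : ∀ {p w} → K p w → T p w
    b {p} {w} k with p ∈? ds | w ∈? ds
    ... | yes p∈ | yes w∈ = clique g (p∈ , w∈ , to (inside p∈ w∈) k)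
    ... | yes p∈ | no w∉  = port g (to (outside p∈ w∉) k)
    ... | no p∉  | yes w∈ = sT (port g (to (outside w∈ p∉) (sK k)))
    ... | no p∉  | no w∉ with split g′ (from fits (inl (p∉ , w∉ , k)))
    ...   | inl c = core g c
    ...   | inr (inl (here e , _)) = ⊥-elim (≢a p∉ e)
    ...   | inr (inr (inl q)) with fst (leaves-ds g′ q)
    ...     | here e = ⊥-elim (≢a p∉ e)
    b {p} {w} k | no p∉ | no w∉ | inr (inr (inr q)) with fst (leaves-ds g′ q)
    ...     | here e = ⊥-elim (≢a w∉ e)

 Child-leaf : ∀ {u p w : V} → Child (leafT u) p w → ⊥
 Child-leaf (here ())
 Child-leaf (below () _)

 hd-lvs′ : ∀ (s : PlaneTree V) {z} → hd (lvs s) z ≡ first s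
 hd-lvs′ s {z} = trans (cong (λ l → hd l z) (sym (++-identityʳ (lvs s)))) (hd-lvs s)

 Port₁ : PlaneTree V → V → V → V → Set
 Port₁ s a p w = p ≡ a × w ∈ root s ∷ first s ∷ final s ∷ []

 leaf-gadget : ∀ {a} {s : PlaneTree V} → UniqueV (leafT a ⋈ s) →
  Gadget (Adj (leafT a ⋈ s)) (Core (Child s) (lvs s)) (a ∷ []) (Port₁ s a)
 leaf-gadget {a} {s} U = record
  { split = splt
  ; core  = λ { (inl (inl c)) → inl (inl (inr (inl c))) ; (inl (inr c)) → inl (inr (inr (inl c)))
   ; (inr (inl i)) → inr (inl (cyc₁⁺ (lvs s) (inl i))) ; (inr (inr i)) → inr (inr (cyc₁⁺ (lvs s) (inl i))) }
  ; clique = λ { (here refl , here refl , n) → ⊥-elim (n refl) }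
  ; port  = λ { (refl , m) → adj-leaf⁺ U m }
  ; avoids = λ { (inl (inl c)) → let x , y = Child-∈ c in n x , n y
               ; (inl (inr c)) → let x , y = Child-∈ c in n y , n x
               ; (inr (inl i)) → let x , y = Inner-∈ (lvs s) i in n (lvs⊆ s x) , n (lvs⊆ s y)
               ; (inr (inr i)) → let x , y = Inner-∈ (lvs s) i in n (lvs⊆ s y) , n (lvs⊆ s x) }
  ; leaves-ds = λ { (refl , m) → here refl , n (portsIn m) }
  }
  where
   n : ∀ {x} → x ∈ preorder s → x ∉ a ∷ []
   n m (here refl) = root-fresh U m refl
   portsIn : ∀ {w} → w ∈ root s ∷ first s ∷ final s ∷ [] → w ∈ preorder s
   portsIn (here refl) = root∈ s
   portsIn (there (here refl)) = lvs⊆ s (first∈ s)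
   portsIn (there (there (here refl))) = lvs⊆ s (final∈ s)
   cyc : ∀ {p w} → CE (leafT a ⋈ s) p w → (Inner (lvs s) p w) ⊎ (p ≡ a × w ≡ first s) ⊎ (p ≡ final s × w ≡ a)
   cyc c with cyc₁⁻ (lvs s) c
   ... | inl i = inl i
   ... | inr (inl (e , e′)) = inr (inl (e , trans e′ (hd-lvs′ s)))
   ... | inr (inr (e , e′)) = inr (inr (trans e (lst-lvs s) , e′))
   splt : ∀ {p w} → Adj (leafT a ⋈ s) p w → Core (Child s) (lvs s) p w ⊎ Clique (a ∷ []) p w ⊎ Port₁ s a p w ⊎ Port₁ s a w p
   splt (inl (inl (inl c))) = ⊥-elim (Child-leaf c)
   splt (inl (inl (inr (inl c)))) = inl (inl (inl c))
   splt (inl (inl (inr (inr (e , e′))))) = inr (inr (inl (e , here e′)))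
   splt (inl (inr (inl c))) = ⊥-elim (Child-leaf c)
   splt (inl (inr (inr (inl c)))) = inl (inl (inr c))
   splt (inl (inr (inr (inr (e , e′))))) = inr (inr (inr (e , here e′)))
   splt (inr (inl c)) with cyc c
   ... | inl i = inl (inr (inl i))
   ... | inr (inl (e , e′)) = inr (inr (inl (e , there (here e′))))
   ... | inr (inr (e , e′)) = inr (inr (inr (e′ , there (there (here e)))))
   splt (inr (inr c)) with cyc c
   ... | inl i = inl (inr (inr i))
   ... | inr (inl (e , e′)) = inr (inr (inr (e , there (here e′))))
   ... | inr (inr (e , e′)) = inr (inr (inl (e′ , there (there (here e)))))

 Port₃ : PlaneTree V → V → V → V → V → V → Set
 Port₃ s z u v p w = (p ≡ z × w ≡ root s) ⊎ (p ≡ u × w ≡ final s) ⊎ (p ≡ v × w ≡ first s)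

 cherry : V → V → V → PlaneTree V
 cherry z u v = node z (leafT u ∷ leafT v ∷ [])

 cherry-gadget : ∀ {z u v} {s : PlaneTree V} → UniqueV (cherry z u v ⋈ s) →
  Gadget (Adj (cherry z u v ⋈ s)) (Core (Child s) (lvs s)) (z ∷ u ∷ v ∷ []) (Port₃ s z u v)
 cherry-gadget {z} {u} {v} {s} (mkU U@((z≢u ∷ z≢v ∷ _) ∷ (u≢v ∷ _) ∷ _)) = record
  { split = splt
  ; core  = cor
  ; clique = clq
  ; port  = prt
  ; avoids = λ { (inl (inl c)) → let x , y = Child-∈ c in n x , n y
               ; (inl (inr c)) → let x , y = Child-∈ c in n y , n x
               ; (inr (inl i)) → let x , y = Inner-∈ (lvs s) i in n (lvs⊆ s x) , n (lvs⊆ s y)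
               ; (inr (inr i)) → let x , y = Inner-∈ (lvs s) i in n (lvs⊆ s y) , n (lvs⊆ s x) }
  ; leaves-ds = λ { (inl (refl , refl)) → here refl , n (root∈ s)
   ; (inr (inl (refl , refl))) → there (here refl) , n (lvs⊆ s (final∈ s))
   ; (inr (inr (refl , refl))) → there (there (here refl)) , n (lvs⊆ s (first∈ s)) }
  }
  where
   K : V → V → Set
   K = Adj (cherry z u v ⋈ s)
   n : ∀ {x} → x ∈ preorder s → x ∉ z ∷ u ∷ v ∷ []
   n m m′ = snd (snd (unique-++⁻ (z ∷ u ∷ v ∷ []) U)) m′ m
   zu : K z u
   zu = inl (inl (inl (here (here refl))))
   zv : K z v
   zv = inl (inl (inl (here (there (here refl)))))
   uv : K u v
   uv = inr (inl (inl (refl , refl)))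
   cor : ∀ {p w} → Core (Child s) (lvs s) p w → K p w
   cor (inl (inl c)) = inl (inl (inr (inl c)))
   cor (inl (inr c)) = inl (inr (inr (inl c)))
   cor (inr (inl i)) = inr (inl (cyc₂⁺ (lvs s) (inl i)))
   cor (inr (inr i)) = inr (inr (cyc₂⁺ (lvs s) (inl i)))
   prt : ∀ {p w} → Port₃ s z u v p w → K p w
   prt (inl (e , e′)) = inl (inl (inr (inr (e , e′))))
   prt (inr (inl (refl , refl))) = inr (inr (cyc₂⁺ (lvs s) (inr (inr (inr (sym (lst-lvs s) , refl))))))
   prt (inr (inr (refl , refl))) = inr (inl (cyc₂⁺ (lvs s) (inr (inr (inl (refl , sym (hd-lvs′ s)))))))
   clq : ∀ {p w} → Clique (z ∷ u ∷ v ∷ []) p w → K p w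
   clq (here refl , here refl , n) = ⊥-elim (n refl)
   clq (here refl , there (here refl) , _) = zu
   clq (here refl , there (there (here refl)) , _) = zv
   clq (there (here refl) , here refl , _) = Adj-sym (cherry z u v ⋈ s) zu
   clq (there (here refl) , there (here refl) , n) = ⊥-elim (n refl)
   clq (there (here refl) , there (there (here refl)) , _) = uv
   clq (there (there (here refl)) , here refl , _) = Adj-sym (cherry z u v ⋈ s) zv
   clq (there (there (here refl)) , there (here refl) , _) = Adj-sym (cherry z u v ⋈ s) uv
   clq (there (there (here refl)) , there (there (here refl)) , n) = ⊥-elim (n refl)
   Half : V → V → Set
   Half p w = (Child s p w ⊎ Inner (lvs s) p w) ⊎ Clique (z ∷ u ∷ v ∷ []) p w ⊎ Port₃ s z u v p w ⊎ Port₃ s z u v w p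
   arc : ∀ {p w} → Arc (cherry z u v ⋈ s) p w → Half p w
   arc (inl c) with Child-∷⁻ c
   ... | inl (refl , refl) = inr (inl (here refl , there (here refl) , z≢u))
   ... | inr (inl d) = ⊥-elim (Child-leaf d)
   ... | inr (inr d) with Child-one d
   ...   | inl (refl , refl) = inr (inl (here refl , there (there (here refl)) , z≢v))
   ...   | inr d′ = ⊥-elim (Child-leaf d′)
   arc (inr (inl c)) = inl (inl c)
   arc (inr (inr e)) = inr (inr (inl (inl e)))
   cyc : ∀ {p w} → CE (cherry z u v ⋈ s) p w → Half p w
   cyc c with cyc₂⁻ (lvs s) c
   ... | inl i = inl (inr i)
   ... | inr (inl (refl , refl)) = inr (inl (there (here refl) , there (there (here refl)) , u≢v))
   ... | inr (inr (inl (e , e′))) = inr (inr (inl (inr (inr (e , trans e′ (hd-lvs′ s))))))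
   ... | inr (inr (inr (e , e′))) = inr (inr (inr (inr (inl (e′ , trans e (lst-lvs s))))))
   Full : V → V → Set
   Full p w = Core (Child s) (lvs s) p w ⊎ Clique (z ∷ u ∷ v ∷ []) p w ⊎ Port₃ s z u v p w ⊎ Port₃ s z u v w p
   fwd : ∀ {p w} → Half p w → Full p w
   fwd (inl (inl c)) = inl (inl (inl c))
   fwd (inl (inr c)) = inl (inr (inl c))
   fwd (inr h) = inr h
   bwd : ∀ {p w} → Half w p → Full p w
   bwd (inl (inl c)) = inl (inl (inr c))
   bwd (inl (inr c)) = inl (inr (inr c))
   bwd (inr (inl (a , b , n))) = inr (inl (b , a , ≢-sym n))
   bwd (inr (inr (inl q))) = inr (inr (inr q))
   bwd (inr (inr (inr q))) = inr (inr (inl q))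
   splt : ∀ {p w} → K p w → Full p w
   splt (inl (inl e)) = fwd (arc e)
   splt (inl (inr e)) = bwd (arc e)
   splt (inr (inl c)) = fwd (cyc c)
   splt (inr (inr c)) = bwd (cyc c)

 module _ {x : V} {c : PlaneTree V} {cs : List (PlaneTree V)} {s : PlaneTree V} where

  private
   ts : List (PlaneTree V)
   ts = c ∷ cs
   L : List V
   L = lvss ts ++ lvs s
   R : CutTree V
   R = node x ts ⋈ s
   C : V → V → Set
   C = Core (Arc R) L
   hdL : ∀ {z} → hd L z ≡ first c
   hdL {z} = trans (hd-++ (lvss ts)) (hd-lvs c)
   lstL : ∀ {z} → lst L z ≡ final s
   lstL {z} = trans (lst-++ (lvss ts)) (lst-lvs s)
   L⊆ : ∀ {w} → w ∈ L → w ∈ verts R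
   L⊆ w∈ = Lvs⊆ R w∈
   C⊆ : ∀ {p w} → C p w → p ∈ verts R × w ∈ verts R
   C⊆ (inl e) = TE-∈ R e
   C⊆ (inr (inl i)) = let a , b = Inner-∈ L i in L⊆ a , L⊆ b
   C⊆ (inr (inr i)) = let a , b = Inner-∈ L i in L⊆ b , L⊆ a
   first∈L : first c ∈ L
   first∈L = ∈-++⁺ˡ (∈-++⁺ˡ (first∈ c))
   final∈L : final s ∈ L
   final∈L = ∈-++⁺ʳ (lvss ts) (final∈ s)

  Port₁′ : V → V → V → Set
  Port₁′ a p w = p ≡ a × w ∈ x ∷ first c ∷ final s ∷ []

  Port₂ : V → V → V → V → Set
  Port₂ u v p w = (p ∈ u ∷ v ∷ [] × w ≡ x) ⊎ (p ≡ u × w ≡ final s) ⊎ (p ≡ v × w ≡ first c)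

  arc-leaf⁻ : ∀ {u us p w} → Arc (node x (leafT u ∷ us) ⋈ s) p w → (p ≡ x × w ≡ u) ⊎ Arc (node x us ⋈ s) p w
  arc-leaf⁻ (inr e) = inr (inr e)
  arc-leaf⁻ (inl d) with Child-∷⁻ d
  ... | inl e = inl e
  ... | inr (inl d′) = ⊥-elim (Child-leaf d′)
  ... | inr (inr d′) = inr (inl d′)

  arc-leaf⁺ : ∀ {u us p w} → Arc (node x us ⋈ s) p w → Arc (node x (leafT u ∷ us) ⋈ s) p w
  arc-leaf⁺ (inl d) = inl (Child-there d)
  arc-leaf⁺ (inr e) = inr e

  te-leaf⁺ : ∀ {u us p w} → TE (node x us ⋈ s) p w → TE (node x (leafT u ∷ us) ⋈ s) p w
  te-leaf⁺ (inl a) = inl (arc-leaf⁺ a)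
  te-leaf⁺ (inr a) = inr (arc-leaf⁺ a)

  te-leaf⁻ : ∀ {u us p w} → TE (node x (leafT u ∷ us) ⋈ s) p w →
   ((p ≡ x × w ≡ u) ⊎ (p ≡ u × w ≡ x)) ⊎ TE (node x us ⋈ s) p w
  te-leaf⁻ (inl a) = map-⊎ inl inl (arc-leaf⁻ a)
  te-leaf⁻ (inr a) = map-⊎ (λ { (e , e′) → inr (e′ , e) }) inr (arc-leaf⁻ a)

  merged-gadget : ∀ {a} → UniqueV (node x (leafT a ∷ ts) ⋈ s) →
   Gadget (Adj (node x (leafT a ∷ ts) ⋈ s)) C (a ∷ []) (Port₁′ a)
  merged-gadget {a} (mkU ((x≢a ∷ x∉) ∷ (a∉ ∷ _))) = record
   { split = splt
   ; core  = λ { (inl e) → inl (te-leaf⁺ e) ; (inr (inl i)) → inr (inl (cyc₁⁺ L (inl i))) ; (inr (inr i)) → inr (inr (cyc₁⁺ L (inl i))) }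
   ; clique = λ { (here refl , here refl , n) → ⊥-elim (n refl) }
   ; port  = prt
   ; avoids = λ q → let a , b = C⊆ q in n a , n b
   ; leaves-ds = λ { (refl , m) → here refl , n (ports m) }
   }
   where
    n : ∀ {w} → w ∈ verts R → w ∉ a ∷ []
    n (here refl) (here refl) = x≢a refl
    n (there m)   (here refl) = All.lookup a∉ m refl
    ports : ∀ {w} → w ∈ x ∷ first c ∷ final s ∷ [] → w ∈ verts R
    ports (here refl) = here refl
    ports (there (here refl)) = L⊆ first∈L
    ports (there (there (here refl))) = L⊆ final∈L
    prt : ∀ {p w} → Port₁′ a p w → Adj (node x (leafT a ∷ ts) ⋈ s) p w
    prt (refl , here refl) = inl (inr (inl (here (here refl))))
    prt (refl , there (here refl)) = inr (inl (cyc₁⁺ L (inr (inl (refl , sym hdL)))))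
    prt (refl , there (there (here refl))) = inr (inr (cyc₁⁺ L (inr (inr (sym lstL , refl)))))
    cyc : ∀ {p w} → Cyc (a ∷ L) p w → Inner L p w ⊎ Port₁′ a p w ⊎ Port₁′ a w p
    cyc q with cyc₁⁻ L q
    ... | inl i = inl i
    ... | inr (inl (e , e′)) = inr (inl (e , there (here (trans e′ hdL))))
    ... | inr (inr (e , e′)) = inr (inr (e′ , there (there (here (trans e lstL)))))
    splt : ∀ {p w} → Adj (node x (leafT a ∷ ts) ⋈ s) p w → C p w ⊎ Clique (a ∷ []) p w ⊎ Port₁′ a p w ⊎ Port₁′ a w p
    splt (inl e) with te-leaf⁻ e
    ... | inl (inl (e , e′)) = inr (inr (inr (e′ , here e)))
    ... | inl (inr (e , e′)) = inr (inr (inl (e , here e′)))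
    ... | inr e = inl (inl e)
    splt (inr (inl q)) with cyc q
    ... | inl i = inl (inr (inl i))
    ... | inr p = inr (inr p)
    splt (inr (inr q)) with cyc q
    ... | inl i = inl (inr (inr i))
    ... | inr (inl p) = inr (inr (inr p))
    ... | inr (inr p) = inr (inr (inl p))

  twins-gadget : ∀ {u v} → UniqueV (node x (leafT u ∷ leafT v ∷ ts) ⋈ s) →
   Gadget (Adj (node x (leafT u ∷ leafT v ∷ ts) ⋈ s)) C (u ∷ v ∷ []) (Port₂ u v)
  twins-gadget {u} {v} (mkU ((x≢u ∷ x≢v ∷ _) ∷ (u≢v ∷ u∉) ∷ (v∉ ∷ _))) = record
   { split = splt
   ; core  = λ { (inl e) → inl (te-leaf⁺ (te-leaf⁺ e)) ; (inr (inl i)) → inr (inl (cyc₂⁺ L (inl i))) ; (inr (inr i)) → inr (inr (cyc₂⁺ L (inl i))) }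
   ; clique = clq
   ; port  = prt
   ; avoids = λ q → let a , b = C⊆ q in n a , n b
   ; leaves-ds = λ { (inl (m , refl)) → m , n (here refl)
    ; (inr (inl (refl , refl))) → here refl , n (L⊆ final∈L)
    ; (inr (inr (refl , refl))) → there (here refl) , n (L⊆ first∈L) }
   }
   where
    T : CutTree V
    T = node x (leafT u ∷ leafT v ∷ ts) ⋈ s
    n : ∀ {w} → w ∈ verts R → w ∉ u ∷ v ∷ []
    n (here refl) (here refl) = x≢u refl
    n (here refl) (there (here refl)) = x≢v refl
    n (there m)   (here refl) = All.lookup u∉ m refl
    n (there m)   (there (here refl)) = All.lookup v∉ m refl
    uv : Adj T u v
    uv = inr (inl (inl (refl , refl)))
    clq : ∀ {p w} → Clique (u ∷ v ∷ []) p w → Adj T p w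
    clq (here refl , here refl , n) = ⊥-elim (n refl)
    clq (here refl , there (here refl) , _) = uv
    clq (there (here refl) , here refl , _) = Adj-sym T uv
    clq (there (here refl) , there (here refl) , n) = ⊥-elim (n refl)
    prt : ∀ {p w} → Port₂ u v p w → Adj T p w
    prt (inl (here refl , refl)) = inl (inr (inl (here (here refl))))
    prt (inl (there (here refl) , refl)) = inl (inr (inl (here (there (here refl)))))
    prt (inr (inl (refl , refl))) = inr (inr (cyc₂⁺ L (inr (inr (inr (sym lstL , refl))))))
    prt (inr (inr (refl , refl))) = inr (inl (cyc₂⁺ L (inr (inr (inl (refl , sym hdL))))))
    Out : V → V → Set
    Out p w = Clique (u ∷ v ∷ []) p w ⊎ Port₂ u v p w ⊎ Port₂ u v w p
    flip : ∀ {p w} → Out p w → Out w p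
    flip (inl (a , b , n)) = inl (b , a , ≢-sym n)
    flip (inr (inl p)) = inr (inr p)
    flip (inr (inr p)) = inr (inl p)
    cyc : ∀ {p w} → Cyc (u ∷ v ∷ L) p w → Inner L p w ⊎ Out p w
    cyc q with cyc₂⁻ L q
    ... | inl i = inl i
    ... | inr (inl (refl , refl)) = inr (inl (here refl , there (here refl) , u≢v))
    ... | inr (inr (inl (e , e′))) = inr (inr (inl (inr (inr (e , trans e′ hdL)))))
    ... | inr (inr (inr (e , e′))) = inr (inr (inr (inr (inl (e′ , trans e lstL)))))
    splt : ∀ {p w} → Adj T p w → C p w ⊎ Out p w
    splt (inl e) with te-leaf⁻ e
    ... | inl (inl (e , e′)) = inr (inr (inr (inl (here e′ , e))))
    ... | inl (inr (e , e′)) = inr (inr (inl (inl (here e , e′))))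
    ... | inr e with te-leaf⁻ e
    ...   | inl (inl (e , e′)) = inr (inr (inr (inl (there (here e′) , e))))
    ...   | inl (inr (e , e′)) = inr (inr (inl (inl (there (here e) , e′))))
    ...   | inr e = inl (inl e)
    splt (inr (inl q)) with cyc q
    ... | inl i = inl (inr (inl i))
    ... | inr o = inr o
    splt (inr (inr q)) with cyc q
    ... | inl i = inl (inr (inr i))
    ... | inr o = inr (flip o)

module _ {V : Set} where

 Fits : CutTree V → (V → V → Set) → Set
 Fits t K = ∀ {u w} → Adj t u w ⇔ K u w

 Par : CutTree V → V → V → Set
 Par t p y = p ∈ Lvs t × TE t p y

 record Compat (Ok : V → V → Set) (IOk : V → Set) (t : CutTree V) : Set where
  constructor compat
  field
   parOk : ∀ {p y} → Par t p y → Ok p y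
   intOk : ∀ {y} → y ∈ Ints t → IOk y
 open Compat public

 Par-≃ : ∀ {t t′ : CutTree V} → t ≃ t′ → ∀ {p y} → Par t p y → Par t′ p y
 Par-≃ e (m , q) = ∈-resp-↭ (lvs↭ e) m , to (te e) q

 Compat-≃ : ∀ {Ok IOk} {t t′ : CutTree V} → t ≃ t′ → Compat Ok IOk t → Compat Ok IOk t′
 Compat-≃ e (compat p i) = compat (p ∘ Par-≃ (≃-sym e)) (i ∘ ∈-resp-↭ (↭-sym (ints↭ e)))

 Fits-≃ : ∀ {K} {t t′ : CutTree V} → t ≃ t′ → Fits t K → Fits t′ K
 Fits-≃ e f = mk⇔ (to f ∘ from (≃-adj e)) (to (≃-adj e) ∘ from f)

 Branching-size : ∀ {s : PlaneTree V} → Branching s → 3 ≤ length (preorder s)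
 Branching-size (branching {c = node _ ds} {node _ ds′} {cs}) =
  s≤s (s≤s (subst (1 ≤_) (sym (length-++ (preorders ds))) (ℕ.≤-trans (s≤s z≤n) (ℕ.m≤n+m _ (length (preorders ds))))))

 nonempty-preorder : (s : PlaneTree V) → 1 ≤ length (preorder s)
 nonempty-preorder (node v ts) = s≤s z≤n

 ports-distinct : ∀ {a} {s : PlaneTree V} → Good (leafT a ⋈ s) → Unique (root s ∷ final s ∷ first s ∷ [])
 ports-distinct {a} {s} g with good-leaf g
 ... | branching {y} {c} {c′} {cs} = (r≢f ∷ r≢h ∷ []) ∷ (l≢h ∷ []) ∷ [] ∷ []
  where
   u : Unique (preorder s)
   u = unique-tail (unV (uniq g))
   in-children : ∀ {w} → w ∈ lvs s → w ∈ preorders (c ∷ c′ ∷ cs)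
   in-children m = lvss⊆ (c ∷ c′ ∷ cs) m
   r≢ : ∀ {w} → w ∈ lvs s → y ≢ w
   r≢ m refl = Uniq.Unique[x∷xs]⇒x∉xs u (in-children m)
   r≢f : y ≢ final s
   r≢f = r≢ (final∈ s)
   r≢h : y ≢ first s
   r≢h = r≢ (first∈ s)
   h≡ : first s ≡ first c
   h≡ = hd-lvs c
   l≡ : final s ≡ lst (lvss (c′ ∷ cs)) (lst (lvs c) y)
   l≡ = lst-++ (lvs c)
   l∈ : ∀ z → lst (lvss (c′ ∷ cs)) z ∈ lvss (c′ ∷ cs)
   l∈ z with lvs c′ | lvs-nonempty c′
   ... | _ | x , xs , refl = lst-∈ (xs ++ lvss cs)
   l≢h : final s ≢ first s
   l≢h e = snd (snd (unique-++⁻ (preorder c) (unique-tail u)))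
    (lvs⊆ c (first∈ c)) (subst (_∈ preorders (c′ ∷ cs)) (trans (sym l≡) (trans e h≡)) (lvss⊆ (c′ ∷ cs) (l∈ (lst (lvs c) y))))

 branching-root : ∀ {s : PlaneTree V} → Branching s → root s ∈ ints s
 branching-root branching = here refl

 par-rest : ∀ {P s : PlaneTree V} → UniqueV (P ⋈ s) → Branching s → ∀ {p y} → p ∈ lvs s → TE (P ⋈ s) p y → Child s p y ⊎ Child s y p
 par-rest {P} {s} U br {p} {y} m e = go e
  where
   n : ∀ {w} → w ∈ preorder P → w ∈ preorder s → ⊥
   n = snd (snd (unique-++⁻ (preorder P) (unV U)))
   root-int : root s ∈ ints s
   root-int = branching-root br
   go : TE (P ⋈ s) p y → Child s p y ⊎ Child s y p
   go (inl (inl c)) = ⊥-elim (n (fst (Child-∈ c)) (lvs⊆ s m))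
   go (inl (inr (inl c))) = inl c
   go (inl (inr (inr (refl , _)))) = ⊥-elim (n (root∈ P) (lvs⊆ s m))
   go (inr (inl c)) = ⊥-elim (n (snd (Child-∈ c)) (lvs⊆ s m))
   go (inr (inr (inl c))) = inr c
   go (inr (inr (inr (_ , refl)))) = ⊥-elim (lvs-ints-disjoint U (∈-++⁺ʳ (lvs P) m) (∈-++⁺ʳ (ints P) root-int))

 te-rest : ∀ {P s : PlaneTree V} {p y} → Child s p y ⊎ Child s y p → TE (P ⋈ s) p y
 te-rest (inl c) = inl (inr (inl c))
 te-rest (inr c) = inr (inr (inl c))

 par-leaf⁻ : ∀ {a} {s : PlaneTree V} → Good (leafT a ⋈ s) → ∀ {p y} → Par (leafT a ⋈ s) p y →
  (p ≡ a × y ≡ root s) ⊎ (p ∈ lvs s × (Child s p y ⊎ Child s y p))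
 par-leaf⁻ g (here refl , e) with te-nbr⁻ (uniq g) e
 ... | here q = inl (refl , q)
 par-leaf⁻ g (there m , e) = inr (m , par-rest (uniq g) (good-leaf g) m e)

 par-cherry⁻ : ∀ {z u v} {s : PlaneTree V} → Good (cherry z u v ⋈ s) → Branching s → ∀ {p y} → Par (cherry z u v ⋈ s) p y →
  (p ∈ u ∷ v ∷ [] × y ≡ z) ⊎ (p ∈ lvs s × (Child s p y ⊎ Child s y p))
 par-cherry⁻ {z} {u} {v} {s} g br {p} {y} (m , e) with ∈-++⁻ (u ∷ v ∷ []) m
 ... | inr m′ = inr (m′ , par-rest (uniq g) br m′ e)
 ... | inl m′ = inl (m′ , go m′ e)
  where
   U : Unique (z ∷ u ∷ v ∷ preorder s)
   U = unV (uniq g)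
   n : ∀ {w} → w ∈ z ∷ u ∷ v ∷ [] → w ∈ preorder s → ⊥
   n = snd (snd (unique-++⁻ (z ∷ u ∷ v ∷ []) U))
   fromz : ∀ {w} → w ∈ u ∷ v ∷ [] → w ≢ z
   fromz w∈ refl = Uniq.Unique[x∷xs]⇒x∉xs U (∈-++⁺ˡ w∈)
   nochild : ∀ {w w′} → w ∈ u ∷ v ∷ [] → Child (cherry z u v) w w′ → ⊥
   nochild w∈ (here _) = fromz w∈ refl
   nochild w∈ (below (here refl) c) = Child-leaf c
   nochild w∈ (below (there (here refl)) c) = Child-leaf c
   parent : ∀ {w w′} → Child (cherry z u v) w w′ → w ≡ z
   parent (here _) = refl
   parent (below (here refl) c) = ⊥-elim (Child-leaf c)
   parent (below (there (here refl)) c) = ⊥-elim (Child-leaf c)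
   go : ∀ {p} → p ∈ u ∷ v ∷ [] → TE (cherry z u v ⋈ s) p y → y ≡ z
   go w∈ (inl (inl c)) = ⊥-elim (nochild w∈ c)
   go w∈ (inl (inr (inl c))) = ⊥-elim (n (there w∈) (fst (Child-∈ c)))
   go w∈ (inl (inr (inr (eq , _)))) = ⊥-elim (fromz w∈ eq)
   go w∈ (inr (inl c)) = parent c
   go w∈ (inr (inr (inl c))) = ⊥-elim (n (there w∈) (snd (Child-∈ c)))
   go w∈ (inr (inr (inr (eq , refl)))) = ⊥-elim (n (there w∈) (root∈ s))

 has-neighbour : ∀ {t : CutTree V} → Good t → ∀ {w} → w ∈ verts t → ∃ λ y → Adj t w y
 has-neighbour {t} g m with cut-at-vertex t m
 ... | ts , s , e = root s , from (≃-adj e) (inl (te-nbr⁺ (uniq (good-≃ e g)) (here refl)))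

 gone : ∀ {t : CutTree V} {K a ds} → Good t → Fits t (Quot K a ds) → ∀ {w} → w ∈ ds → w ∈ verts t → w ≡ a
 gone g f w∈ m with has-neighbour g m
 ... | y , e with to f e
 ...   | inl (w∉ , _)            = ⊥-elim (w∉ w∈)
 ...   | inr (inl (q , _))      = q
 ...   | inr (inr (_ , w∉ , _)) = ⊥-elim (w∉ w∈)

 record Contracted (K : V → V → Set) (Ok : V → V → Set) (IOk : V → Set) (a : V) (n : ℕ) : Set where
  constructor contracted
  field
   tree   : CutTree V
   isGood : Good tree
   fits   : Fits tree K
   comp   : Compat Ok IOk tree
   isLeaf : a ∈ Lvs tree
   count  : n ≡ length (verts tree)

 -- The tree obtained by giving the two leaves u, v to the hub z instead of the leaf of t.
 record Lifted (K : V → V → Set) (Ok : V → V → Set) (IOk : V → Set) (t : CutTree V) (u v z : V) : Set where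
  constructor lifted
  field
   tree   : CutTree V
   isGood : Good tree
   fits   : Fits tree K
   comp   : Compat Ok IOk tree
   par    : ∀ {p y} → Par tree p y → (p ∈ u ∷ v ∷ [] × y ≡ z) ⊎ (p ∉ u ∷ v ∷ [] × Par t p y)
   int    : ∀ {y} → y ∈ Ints tree → y ≡ z ⊎ y ∈ Ints t
   int⁻   : ∀ {y} → y ≡ z ⊎ y ∈ Ints t → y ∈ Ints tree
   leaves : u ∈ Lvs tree × v ∈ Lvs tree × Adj tree u v

 Lifted-swap : ∀ {K Ok IOk t u v z} → Lifted K Ok IOk t u v z → Lifted K Ok IOk t v u z
 Lifted-swap (lifted t g f c p i i⁻ (a , b , e)) = lifted t g f c
  (λ q → map-⊎ (λ { (m , e) → sw m , e }) (λ { (n , q) → (λ m → n (sw m)) , q }) (p q)) i i⁻ (b , a , Adj-sym t e)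
  where
   sw : ∀ {x y p : V} → p ∈ x ∷ y ∷ [] → p ∈ y ∷ x ∷ []
   sw (here e) = there (here e)
   sw (there (here e)) = here e

 module _ {K : V → V → Set} (K-sym : Symmetric K) {Ok Ok′ : V → V → Set} {IOk IOk′ : V → Set} {a z u v : V} {s : PlaneTree V} where

  private
   ds : List V
   ds = z ∷ u ∷ v ∷ []

  contract-cherry : Good (cherry z u v ⋈ s) → 5 ≤ length (verts (cherry z u v ⋈ s)) →
   Fits (cherry z u v ⋈ s) K → Compat Ok IOk (cherry z u v ⋈ s) → a ∈ ds →
   (∀ {w} → w ∉ ds → K z w → IOk z → Ok u z → Ok v z → Ok′ a w) →
   (∀ {p y} → p ∉ ds → y ∉ ds → K p y → Ok p y → Ok′ p y) →
   (∀ {y} → y ∉ ds → IOk y → IOk′ y) →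
   ∃ λ n → length (verts (cherry z u v ⋈ s)) ≡ 2 + n × Contracted (Quot K a ds) Ok′ IOk′ a n
  contract-cherry g h f co a∈ hub old oldI =
   _ , refl , contracted (leafT a ⋈ s) g′ f′ (compat pr it) (here refl) refl
   where
    U : Unique (z ∷ u ∷ v ∷ preorder s)
    U = unV (uniq g)
    out : ∀ {w} → w ∈ preorder s → w ∉ ds
    out m m′ = snd (snd (unique-++⁻ ds U)) m′ m
    br : Branching s
    br with wf-cases s (snd (isWF g))
    ... | inr b = b
    ... | inl (b , refl) = contradiction h λ { (s≤s (s≤s (s≤s (s≤s ())))) }
    g′ : Good (leafT a ⋈ s)
    g′ = good (mkU (All.tabulate (λ m e → out m (subst (_∈ ds) e a∈)) ∷ fst (snd (unique-++⁻ ds U))))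
     (((λ ()) , tt) , snd (isWF g)) (s≤s (Branching-size br))
    q : ∀ {p w} → Adj (leafT a ⋈ s) p w ⇔ Quot (Adj (cherry z u v ⋈ s)) a ds p w
    q = quotient-gadget (Adj-sym (leafT a ⋈ s)) a∈ (cherry-gadget (uniq g)) (leaf-gadget (uniq g′))
     (λ { (inl (_ , e)) → refl , here e ; (inr (inl (_ , e))) → refl , there (there (here e)) ; (inr (inr (_ , e))) → refl , there (here e) })
     (λ { (_ , here e) → z , inl (refl , e) ; (_ , there (here e)) → v , inr (inr (refl , e)) ; (_ , there (there (here e))) → u , inr (inl (refl , e)) })
    f′ : Fits (leafT a ⋈ s) (Quot K a ds)
    f′ = mk⇔ (λ e → Quot-map (to f) (to q e)) (λ k → from q (Quot-map (from f) k))
    TEsub : ∀ {p y} → Child s p y ⊎ Child s y p → p ∉ ds × y ∉ ds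
    TEsub (inl c) = out (fst (Child-∈ c)) , out (snd (Child-∈ c))
    TEsub (inr c) = out (snd (Child-∈ c)) , out (fst (Child-∈ c))
    pr : ∀ {p y} → Par (leafT a ⋈ s) p y → Ok′ p y
    pr pa with par-leaf⁻ g′ pa
    ... | inl (refl , refl) = hub (out (root∈ s)) (to f (inl (inl (inr (inr (refl , refl))))))
     (intOk co (here refl)) (parOk co (here refl , inr (inl (here (here refl)))))
     (parOk co (there (here refl) , inr (inl (here (there (here refl))))))
    ... | inr (m , c) = old (fst (TEsub c)) (snd (TEsub c)) (to f (inl (te-rest {cherry z u v} c)))
     (parOk co (there (there m) , te-rest {cherry z u v} c))
    it : ∀ {y} → y ∈ Ints (leafT a ⋈ s) → IOk′ y
    it m = oldI (out (ints⊆ s m)) (intOk co (there m))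

  lift-cherry : DecidableEquality V → Good (leafT a ⋈ s) → Fits (leafT a ⋈ s) (Quot K a ds) → Compat Ok′ IOk′ (leafT a ⋈ s) →
   a ∈ ds → Unique ds →
   (∀ {d e} → d ∈ ds → e ∈ ds → K d e ⇔ (d ≢ e)) →
   (∀ {d w} → d ∈ ds → w ∉ ds → K d w ⇔ Port₃ s z u v d w) →
   IOk z → Ok u z → Ok v z →
   (∀ {p y} → p ∉ ds → y ∉ ds → K p y → Ok′ p y → Ok p y) →
   (∀ {y} → y ∉ ds → IOk′ y → IOk y) →
   Lifted K Ok IOk (leafT a ⋈ s) u v z
  lift-cherry _≟_ g f co a∈ ud ins outs iz ou ov old oldI =
   lifted (cherry z u v ⋈ s) g′ f′ (compat pr it)
    (λ pa → case par-cherry⁻ g′ br pa of λ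
     { (inl q) → inl q
     ; (inr (m , c)) → inr ((λ m′ → fst (TEsub c) (there m′)) , there m , te-rest {leafT a} c) })
    (λ { (here e) → inl e ; (there m) → inr m }) (λ { (inl refl) → here refl ; (inr m) → there m })
    (here refl , there (here refl) , inr (inl (inl (refl , refl))))
   where
    br : Branching s
    br = good-leaf g
    out : ∀ {w} → w ∈ preorder s → w ∉ ds
    out m m′ with gone {K = K} {ds = ds} g f m′ (there m)
    ... | e = root-fresh (uniq g) m (sym e)
    g′ : Good (cherry z u v ⋈ s)
    g′ = good (mkU (Uniq.++⁺ ud (unique-tail (unV (uniq g))) (λ { (m , m′) → out m′ m })))
     (((λ ()) , ((λ ()) , tt) , ((λ ()) , tt) , tt) , snd (isWF g)) (s≤s (s≤s (s≤s (nonempty-preorder s))))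
    f′ : Fits (cherry z u v ⋈ s) K
    f′ = lift-gadget _≟_ K-sym (Adj-sym (cherry z u v ⋈ s)) a∈ (cherry-gadget (uniq g′)) (leaf-gadget (uniq g)) f ins outs
    TEsub : ∀ {p y} → Child s p y ⊎ Child s y p → p ∉ ds × y ∉ ds
    TEsub (inl c) = out (fst (Child-∈ c)) , out (snd (Child-∈ c))
    TEsub (inr c) = out (snd (Child-∈ c)) , out (fst (Child-∈ c))
    pr : ∀ {p y} → Par (cherry z u v ⋈ s) p y → Ok p y
    pr pa with par-cherry⁻ g′ br pa
    ... | inl (here refl , refl) = ou
    ... | inl (there (here refl) , refl) = ov
    ... | inr (m , c) = old (fst (TEsub c)) (snd (TEsub c)) (to f′ (inl (te-rest {cherry z u v} c))) (parOk co (there m , te-rest {leafT a} c))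
    it : ∀ {y} → y ∈ Ints (cherry z u v ⋈ s) → IOk y
    it (here refl) = iz
    it (there m) = oldI (out (ints⊆ s m)) (intOk co m)

two-more : ∀ {V} (c : PlaneTree V) cs s → 2 ≤ length (preorders (c ∷ cs) ++ preorder s)
two-more (node _ ds) cs s rewrite length-++ (preorders ds ++ preorders cs) {preorder s} =
 s≤s (ℕ.≤-trans (nonempty-preorder s) (ℕ.m≤n+m _ (length (preorders ds ++ preorders cs))))

module _ {V : Set} {x : V} {c : PlaneTree V} {cs : List (PlaneTree V)} {s : PlaneTree V} where

 private
  L : List V
  L = lvss (c ∷ cs) ++ lvs s
  R : CutTree V
  R = node x (c ∷ cs) ⋈ s
  P₁ : V → V → V → Set
  P₁ = Port₁′ {x = x} {c} {cs} {s}
  P₂ : V → V → V → V → Set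
  P₂ = Port₂ {x = x} {c} {cs} {s}

 par-merged⁻ : ∀ {a} → UniqueV (node x (leafT a ∷ c ∷ cs) ⋈ s) → ∀ {p y} → Par (node x (leafT a ∷ c ∷ cs) ⋈ s) p y →
  (p ≡ a × y ≡ x) ⊎ (p ∈ L × TE R p y)
 par-merged⁻ {a} U@(mkU ((x≢a ∷ x∉) ∷ (a∉ ∷ _))) {p} {y} (m , e) = go m (te-leaf⁻ {c = c} {cs} e)
  where
   a∉R : a ∉ verts R
   a∉R (here refl) = x≢a refl
   a∉R (there m)   = All.lookup a∉ m refl
   x∉L : x ∉ L
   x∉L m = lvs-ints-disjoint U (there m) (here refl)
   go : p ∈ a ∷ L → ((p ≡ x × y ≡ a) ⊎ (p ≡ a × y ≡ x)) ⊎ TE R p y → (p ≡ a × y ≡ x) ⊎ (p ∈ L × TE R p y)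
   go _ (inl (inr q)) = inl q
   go (here refl) (inl (inl (refl , _))) = ⊥-elim (x≢a refl)
   go (here refl) (inr e) = ⊥-elim (a∉R (fst (TE-∈ R e)))
   go (there m) (inl (inl (refl , _))) = ⊥-elim (x∉L m)
   go (there m) (inr e) = inr (m , e)

 par-twins⁻ : ∀ {u v} → UniqueV (node x (leafT u ∷ leafT v ∷ c ∷ cs) ⋈ s) → ∀ {p y} → Par (node x (leafT u ∷ leafT v ∷ c ∷ cs) ⋈ s) p y →
  (p ∈ u ∷ v ∷ [] × y ≡ x) ⊎ (p ∈ L × TE R p y)
 par-twins⁻ {u} {v} U@(mkU ((x≢u ∷ x≢v ∷ x∉) ∷ (u≢v ∷ u∉) ∷ (v∉ ∷ _))) {p} {y} (m , e) with te-leaf⁻ {c = c} {cs} e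
 ... | inl (inl (refl , _)) = ⊥-elim (lvs-ints-disjoint U m (here refl))
 ... | inl (inr (refl , refl)) = inl (here refl , refl)
 ... | inr e′ with te-leaf⁻ {c = c} {cs} e′
 ...   | inl (inl (refl , _)) = ⊥-elim (lvs-ints-disjoint U m (here refl))
 ...   | inl (inr (refl , refl)) = inl (there (here refl) , refl)
 ...   | inr e″ with m
 ...     | there (there m′) = inr (m′ , e″)
 ...     | here refl = ⊥-elim (n (fst (TE-∈ R e″)))
  where
   n : u ∉ verts R
   n (here refl) = x≢u refl
   n (there m)   = All.lookup u∉ m refl
 ...     | there (here refl) = ⊥-elim (n (fst (TE-∈ R e″)))
  where
   n : v ∉ verts R
   n (here refl) = x≢v refl
   n (there m)   = All.lookup v∉ m refl

 module _ {K : V → V → Set} (K-sym : Symmetric K) {Ok Ok′ : V → V → Set} {IOk IOk′ : V → Set} {a u v : V} where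

  private
   ds : List V
   ds = u ∷ v ∷ []
   t₁ t₂ : CutTree V
   t₁ = node x (leafT a ∷ c ∷ cs) ⋈ s
   t₂ = node x (leafT u ∷ leafT v ∷ c ∷ cs) ⋈ s

  contract-twins : Good t₂ → Fits t₂ K → Compat Ok IOk t₂ → a ∈ ds →
   (Ok u x → Ok v x → Ok′ a x) →
   (∀ {p y} → p ∉ ds → y ∉ ds → K p y → Ok p y → Ok′ p y) →
   (∀ {y} → y ∉ ds → IOk y → IOk′ y) →
   ∃ λ n → length (verts t₂) ≡ 1 + n × Contracted (Quot K a ds) Ok′ IOk′ a n
  contract-twins g f co a∈ hub old oldI =
   _ , refl , contracted t₁ g′ f′ (compat pr it) (here refl) refl
   where
    U : Unique (x ∷ u ∷ v ∷ preorders (c ∷ cs) ++ preorder s)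
    U = unV (uniq g)
    out : ∀ {w} → w ∈ verts R → w ∉ ds
    out (here refl) m′ = Uniq.Unique[x∷xs]⇒x∉xs U (∈-++⁺ˡ m′)
    out (there m) m′ = snd (snd (unique-++⁻ ds (unique-tail U))) m′ m
    g′ : Good t₁
    g′ = good (mkU ((All.tabulate (λ { (here refl) e → out (here refl) (subst (_∈ ds) (sym e) a∈)
     ; (there m) e → Uniq.Unique[x∷xs]⇒x∉xs U (subst (_∈ u ∷ v ∷ preorders (c ∷ cs) ++ preorder s) (sym e) (there (there m))) }))
     ∷ All.tabulate (λ m e → out (there m) (subst (_∈ ds) e a∈))
     ∷ fst (snd (unique-++⁻ ds (unique-tail U)))))
     (((λ ()) , snd (snd (fst (isWF g)))) , snd (isWF g)) (s≤s (s≤s (two-more c cs s)))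
    q : ∀ {p w} → Adj t₁ p w ⇔ Quot (Adj t₂) a ds p w
    q = quotient-gadget (Adj-sym t₁) a∈ (twins-gadget (uniq g)) (merged-gadget (uniq g′))
     (λ { (inl (_ , e)) → refl , here e ; (inr (inl (_ , e))) → refl , there (there (here e)) ; (inr (inr (_ , e))) → refl , there (here e) })
     (λ { (_ , here e) → u , inl (here refl , e) ; (_ , there (here e)) → v , inr (inr (refl , e)) ; (_ , there (there (here e))) → u , inr (inl (refl , e)) })
    f′ : Fits t₁ (Quot K a ds)
    f′ = mk⇔ (λ e → Quot-map (to f) (to q e)) (λ k → from q (Quot-map (from f) k))
    up : ∀ {p y} → TE R p y → TE t₂ p y
    up e = te-leaf⁺ {c = c} {cs} (te-leaf⁺ {c = c} {cs} e)
    pr : ∀ {p y} → Par t₁ p y → Ok′ p y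
    pr pa with par-merged⁻ (uniq g′) pa
    ... | inl (refl , refl) = hub (parOk co (here refl , inr (inl (here (here refl)))))
     (parOk co (there (here refl) , inr (inl (here (there (here refl))))))
    ... | inr (m , e) = old (out (fst (TE-∈ R e))) (out (snd (TE-∈ R e))) (to f (inl (up e))) (parOk co (there (there m) , up e))
    it : ∀ {y} → y ∈ Ints t₁ → IOk′ y
    it m = oldI (out (Ints⊆ R m)) (intOk co m)

  lift-twins : DecidableEquality V → Good t₁ → Fits t₁ (Quot K a ds) → Compat Ok′ IOk′ t₁ →
   a ∈ ds → Unique ds →
   (∀ {d e} → d ∈ ds → e ∈ ds → K d e ⇔ (d ≢ e)) →
   (∀ {d w} → d ∈ ds → w ∉ ds → K d w ⇔ P₂ u v d w) →
   Ok u x → Ok v x →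
   (∀ {p y} → p ∉ ds → y ∉ ds → K p y → Ok′ p y → Ok p y) →
   (∀ {y} → y ∉ ds → IOk′ y → IOk y) →
   Lifted K Ok IOk t₁ u v x
  lift-twins _≟_ g f co a∈ ud ins outs ou ov old oldI =
   lifted t₂ g′ f′ (compat pr it)
    (λ pa → case par-twins⁻ (uniq g′) pa of λ
     { (inl q) → inl q
     ; (inr (m , e)) → inr (out (fst (TE-∈ R e)) , there m , te-leaf⁺ {c = c} {cs} e) })
    inr (λ { (inl refl) → here refl ; (inr m) → m })
    (here refl , there (here refl) , inr (inl (inl (refl , refl))))
   where
    U : Unique (x ∷ a ∷ preorders (c ∷ cs) ++ preorder s)
    U = unV (uniq g)
    a∉R : ∀ {w} → w ∈ verts R → w ≢ a
    a∉R (here refl) refl = Uniq.Unique[x∷xs]⇒x∉xs U (here refl)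
    a∉R (there m)   refl = Uniq.Unique[x∷xs]⇒x∉xs (unique-tail U) m
    R⊆ : ∀ {w} → w ∈ verts R → w ∈ verts t₁
    R⊆ (here e)  = here e
    R⊆ (there m) = there (there m)
    out : ∀ {w} → w ∈ verts R → w ∉ ds
    out m m′ = a∉R m (gone {K = K} {ds = ds} g f m′ (R⊆ m))
    UR : Unique (verts R)
    UR with U
    ... | (_ ∷ p) ∷ _ ∷ q = p ∷ q
    g′ : Good t₂
    g′ = good (mkU (unique-resp-↭ (↭-trans (prep u (Permₚ.swap v x ↭-refl)) (Permₚ.swap u x ↭-refl))
     (Uniq.++⁺ ud UR (λ { (m , m′) → out m′ m }))))
     (((λ ()) , ((λ ()) , tt) , snd (fst (isWF g))) , snd (isWF g)) (ℕ.≤-trans (size g) (ℕ.n≤1+n _))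
    f′ : Fits t₂ K
    f′ = lift-gadget _≟_ K-sym (Adj-sym t₂) a∈ (twins-gadget (uniq g′)) (merged-gadget (uniq g)) f ins outs
    pr : ∀ {p y} → Par t₂ p y → Ok p y
    pr pa with par-twins⁻ (uniq g′) pa
    ... | inl (here refl , refl) = ou
    ... | inl (there (here refl) , refl) = ov
    ... | inr (m , e) = old (out (fst (TE-∈ R e))) (out (snd (TE-∈ R e)))
     (to f′ (inl (te-leaf⁺ {c = c} {cs} (te-leaf⁺ {c = c} {cs} e)))) (parOk co (there m , te-leaf⁺ {c = c} {cs} e))
    it : ∀ {y} → y ∈ Ints t₂ → IOk y
    it m = oldI (out (Ints⊆ R m)) (intOk co m)

module _ {V : Set} where

 unique-⊆-↭ : {xs ys : List V} → Unique xs → (∀ {w} → w ∈ xs → w ∈ ys) → length xs ≡ length ys → xs ↭ ys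
 unique-⊆-↭ {[]}     {[]} _ _ _ = ↭-refl
 unique-⊆-↭ {x ∷ xs} {ys} (p ∷ u) f l with ∈-∃++ (f (here refl))
 ... | as , bs , refl = ↭-trans (prep x (unique-⊆-↭ u f′ (ℕ.suc-injective (trans l (↭-length (shift x as bs)))))) (↭-sym (shift x as bs))
  where
   f′ : ∀ {w} → w ∈ xs → w ∈ as ++ bs
   f′ w∈ with ∈-resp-↭ (shift x as bs) (f (there w∈))
   ... | here refl = ⊥-elim (All.lookup p w∈ refl)
   ... | there q   = q

 record Nbrs (K : V → V → Set) (v : V) (xs : List V) : Set where
  constructor nbrs
  field
   distinct : Unique xs
   members  : ∀ {w} → K v w ⇔ w ∈ xs
 open Nbrs public

 Nbrs-length : ∀ {K v xs ys} → Nbrs K v xs → Nbrs K v ys → length xs ≡ length ys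
 Nbrs-length n m = ↭-length (unique-↭ (distinct n) (distinct m) (λ i → to (members m) (from (members n) i)) (λ i → to (members n) (from (members m) i)))

 leaf-nbrs : ∀ {a} {s : PlaneTree V} {K} → Good (leafT a ⋈ s) → Fits (leafT a ⋈ s) K →
  Nbrs K a (root s ∷ final s ∷ first s ∷ [])
 leaf-nbrs g f = nbrs (ports-distinct g) (mkDir (sw ∘ adj-leaf⁻ (uniq g) ∘ from f) (to f ∘ adj-leaf⁺ (uniq g) ∘ sw))
  where
   sw : ∀ {w x y z : V} → w ∈ x ∷ y ∷ z ∷ [] → w ∈ x ∷ z ∷ y ∷ []
   sw (here e) = here e
   sw (there (here e)) = there (there (here e))
   sw (there (there (here e))) = there (here e)
   mkDir : ∀ {A B : Set} → (A → B) → (B → A) → A ⇔ B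
   mkDir = mk⇔

 int-nbrs : ∀ {y c cs} {s : PlaneTree V} {K} → Good (node y (c ∷ cs) ⋈ s) → Fits (node y (c ∷ cs) ⋈ s) K →
  Nbrs K y (root s ∷ map root (c ∷ cs))
 int-nbrs g f = nbrs (te-nbrs-unique (uniq g)) (mk⇔ (te-nbr⁻ (uniq g) ∘ adj-int⁻ (uniq g) ∘ from f) (to f ∘ inl ∘ te-nbr⁺ (uniq g)))

 leaf-degree : ∀ {t : CutTree V} {a K xs} → Good t → Fits t K → a ∈ Lvs t → Nbrs K a xs → length xs ≡ 3
 leaf-degree g f m n with cut-at-leaf g m
 ... | s , e = Nbrs-length n (leaf-nbrs (good-≃ e g) (Fits-≃ e f))

 Lifted-≃ : ∀ {K Ok IOk} {t t′ : CutTree V} {u v z} → t ≃ t′ → Lifted K Ok IOk t′ u v z → Lifted K Ok IOk t u v z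
 Lifted-≃ e (lifted t g f c p i i⁻ l) = lifted t g f c
  (λ q → map-⊎ id (λ { (n , r) → n , Par-≃ (≃-sym e) r }) (p q))
  (λ m → map-⊎ id (∈-resp-↭ (↭-sym (ints↭ e))) (i m)) (λ m → i⁻ (map-⊎ id (∈-resp-↭ (ints↭ e)) m)) l

 pair-↭ : ∀ {u v p q : V} → u ∷ v ∷ [] ↭ p ∷ q ∷ [] → u ≢ v → (u ≡ p × v ≡ q) ⊎ (u ≡ q × v ≡ p)
 pair-↭ σ n with ∈-resp-↭ σ (here refl) | ∈-resp-↭ σ (there (here refl))
 ... | here refl         | here refl         = ⊥-elim (n refl)
 ... | here refl         | there (here refl) = inl (refl , refl)
 ... | there (here refl) | here refl         = inr (refl , refl)
 ... | there (here refl) | there (here refl) = ⊥-elim (n refl)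

 Lifted-↭ : ∀ {K Ok IOk} {t : CutTree V} {u v p q z} → u ∷ v ∷ [] ↭ p ∷ q ∷ [] → Lifted K Ok IOk t u v z → Lifted K Ok IOk t p q z
 Lifted-↭ {K} {Ok} {IOk} {t} {u} {v} {p} {q} {z} σ L@(lifted t′ g _ _ _ _ _ (_ , _ , e)) with pair-↭ σ (λ { refl → Adj-irrefl g e })
 ... | inl (refl , refl) = L
 ... | inr (refl , refl) = Lifted-swap L

 pick : ∀ {P : List (V × V)} {w} → w ∈ map snd P → ∃₂ λ d P′ → P ↭ (d , w) ∷ P′
 pick {P} m with ∈-map⁻ snd m
 ... | (d , w) , m′ , refl with ∈-∃++ m′
 ...   | as , bs , refl = d , as ++ bs , shift (d , w) as bs

 arrange : ∀ {P : List (V × V)} {r l h} → length P ≡ 3 → Unique (r ∷ l ∷ h ∷ []) →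
  r ∈ map snd P → l ∈ map snd P → h ∈ map snd P →
  ∃₂ λ z u → ∃ λ v → P ↭ (z , r) ∷ (u , l) ∷ (v , h) ∷ []
 arrange {P} len ((r≢l ∷ r≢h ∷ _) ∷ (l≢h ∷ _) ∷ _) r∈ l∈ h∈ with pick {P} r∈
 ... | z , P₁ , σ₁ with ∈-resp-↭ (Perm.map⁺ snd σ₁) l∈ | ∈-resp-↭ (Perm.map⁺ snd σ₁) h∈
 ...   | here refl | _ = ⊥-elim (r≢l refl)
 ...   | there _   | here refl = ⊥-elim (r≢h refl)
 ...   | there l∈₁ | there h∈₁ with pick {P₁} l∈₁
 ...     | u , P₂ , σ₂ with ∈-resp-↭ (Perm.map⁺ snd σ₂) h∈₁
 ...       | here refl = ⊥-elim (l≢h refl)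
 ...       | there h∈₂ with pick {P₂} h∈₂
 ...         | v , P₃ , σ₃ with P₃ | ↭-trans σ₁ (prep _ (↭-trans σ₂ (prep _ σ₃)))
 ...           | []    | σ = z , u , v , σ
 ...           | _ ∷ _ | σ = case trans (sym len) (↭-length σ) of λ ()

 module _ {K : V → V → Set} (K-sym : Symmetric K) (K-irr : ∀ {v} → ¬ K v v) {a b x α β : V}
  (na : Nbrs K a (b ∷ x ∷ α ∷ [])) (nb : Nbrs K b (a ∷ x ∷ β ∷ []))
  {Ok Ok′ : V → V → Set} {IOk IOk′ : V → Set} where

  private
   ab : K a b
   ab = from (members na) (here refl)
   ax : K a x
   ax = from (members na) (there (here refl))
   bx : K b x
   bx = from (members nb) (there (here refl))
   aα : K a α
   aα = from (members na) (there (there (here refl)))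
   bβ : K b β
   bβ = from (members nb) (there (there (here refl)))
   K≢ : ∀ {u w} → K u w → u ≢ w
   K≢ k refl = K-irr k
   distinct-abx : Unique (a ∷ b ∷ x ∷ [])
   distinct-abx = (K≢ ab ∷ K≢ ax ∷ []) ∷ (K≢ bx ∷ []) ∷ [] ∷ []
   α≢b : α ≢ b
   α≢b with distinct na
   ... | (_ ∷ p ∷ []) ∷ _ = ≢-sym p
   α≢x : α ≢ x
   α≢x with distinct na
   ... | _ ∷ (p ∷ []) ∷ _ = ≢-sym p
   β≢a : β ≢ a
   β≢a with distinct nb
   ... | (_ ∷ p ∷ []) ∷ _ = ≢-sym p
   β≢x : β ≢ x
   β≢x with distinct nb
   ... | _ ∷ (p ∷ []) ∷ _ = ≢-sym p
   third : ∀ {d e f o w} → Nbrs K d (e ∷ f ∷ o ∷ []) → K d w → w ≢ e → w ≢ f → w ≡ o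
   third n k p q with to (members n) k
   ... | here refl = ⊥-elim (p refl)
   ... | there (here refl) = ⊥-elim (q refl)
   ... | there (there (here refl)) = refl

  module Merge₃ {ξ : V} (nx : Nbrs K x (a ∷ b ∷ ξ ∷ []))
   (old : ∀ {p y} → p ∉ a ∷ b ∷ x ∷ [] → y ∉ a ∷ b ∷ x ∷ [] → K p y → Ok p y ⇔ Ok′ p y)
   (oldI : ∀ {y} → y ∉ a ∷ b ∷ x ∷ [] → IOk y ⇔ IOk′ y)
   (okα : (IOk a × Ok b a × Ok x a) ⇔ Ok′ a α)
   (okβ : (IOk b × Ok a b × Ok x b) ⇔ Ok′ a β)
   (okξ : (IOk x × Ok a x × Ok b x) ⇔ Ok′ a ξ) where

   ds : List V
   ds = a ∷ b ∷ x ∷ []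

   private
    P : List (V × V)
    P = (a , α) ∷ (b , β) ∷ (x , ξ) ∷ []
    xξ : K x ξ
    xξ = from (members nx) (there (there (here refl)))
    ξ≢a : ξ ≢ a
    ξ≢a with distinct nx
    ... | (_ ∷ p ∷ []) ∷ _ = ≢-sym p
    ξ≢b : ξ ≢ b
    ξ≢b with distinct nx
    ... | _ ∷ (p ∷ []) ∷ _ = ≢-sym p

   outside-ds : ∀ {w} → w ∈ α ∷ β ∷ ξ ∷ [] → w ∉ ds
   outside-ds (here refl) (here p) = K≢ aα (sym p)
   outside-ds (here refl) (there (here p)) = α≢b p
   outside-ds (here refl) (there (there (here p))) = α≢x p
   outside-ds (there (here refl)) (here p) = β≢a p
   outside-ds (there (here refl)) (there (here p)) = K≢ bβ (sym p)
   outside-ds (there (here refl)) (there (there (here p))) = β≢x p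
   outside-ds (there (there (here refl))) (here p) = ξ≢a p
   outside-ds (there (there (here refl))) (there (here p)) = ξ≢b p
   outside-ds (there (there (here refl))) (there (there (here p))) = K≢ xξ (sym p)

   private
    toP : ∀ {d w} → d ∈ ds → w ∉ ds → K d w → (d , w) ∈ P
    toP (here refl) w∉ k = here (cong (a ,_) (third na k (λ { refl → w∉ (there (here refl)) }) (λ { refl → w∉ (there (there (here refl))) })))
    toP (there (here refl)) w∉ k = there (here (cong (b ,_) (third nb k (λ { refl → w∉ (here refl) }) (λ { refl → w∉ (there (there (here refl))) }))))
    toP (there (there (here refl))) w∉ k = there (there (here (cong (x ,_) (third nx k (λ { refl → w∉ (here refl) }) (λ { refl → w∉ (there (here refl)) })))))
    fromP : ∀ {d w} → (d , w) ∈ P → K d w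
    fromP (here refl) = aα
    fromP (there (here refl)) = bβ
    fromP (there (there (here refl))) = xξ

   outs-of-a : ∀ {w} → Quot K a ds a w ⇔ w ∈ α ∷ β ∷ ξ ∷ []
   outs-of-a = mk⇔ f b′
    where
     f : ∀ {w} → Quot K a ds a w → w ∈ α ∷ β ∷ ξ ∷ []
     f (inl (n , _)) = ⊥-elim (n (here refl))
     f (inr (inr (_ , n , _))) = ⊥-elim (n (here refl))
     f (inr (inl (_ , w∉ , k))) with find k
     ... | d , d∈ , k′ = ∈-map⁺ snd (toP d∈ w∉ k′)
     b′ : ∀ {w} → w ∈ α ∷ β ∷ ξ ∷ [] → Quot K a ds a w
     b′ m = inr (inl (refl , outside-ds m , g m))
      where
       g : ∀ {w} → w ∈ α ∷ β ∷ ξ ∷ [] → Any (λ d → K d w) ds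
       g (here refl) = here aα
       g (there (here refl)) = there (here bβ)
       g (there (there (here refl))) = there (there (here xξ))

   outs-distinct : ∀ {t} → Good t → Fits t (Quot K a ds) → a ∈ Lvs t → Unique (α ∷ β ∷ ξ ∷ [])
   outs-distinct g f l with cut-at-leaf g l
   ... | s , e with leaf-nbrs {K = Quot K a ds} (good-≃ e g) (Fits-≃ e f)
   ...   | n = unique-resp-↭ (unique-⊆-↭ (distinct n) (λ m → to outs-of-a (from (members n) m)) refl) (distinct n)

   contract₃ : ∀ {t} → Good t → 5 ≤ length (verts t) → Fits t K → Compat Ok IOk t →
    ∃ λ n → length (verts t) ≡ 2 + n × Contracted (Quot K a ds) Ok′ IOk′ a n × Unique (α ∷ β ∷ ξ ∷ [])
   contract₃ {t} g h f co with triangle-fan g (≥4-leaves t (isWF g) h) (from f ab) (from f ax) (from f bx)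
   ... | fanOn {z} {u} {v} (c ∷ cs , s , e) σ = ⊥-elim (deg (∈-resp-↭ σ (here refl)))
    where
     nz : Nbrs K z (root s ∷ u ∷ v ∷ root c ∷ map root cs)
     nz = int-nbrs (good-≃ e g) (Fits-≃ e f)
     deg : z ∈ ds → ⊥
     deg (here refl) = case Nbrs-length na nz of λ ()
     deg (there (here refl)) = case Nbrs-length nb nz of λ ()
     deg (there (there (here refl))) = case Nbrs-length nx nz of λ ()
   ... | fanOn {z} {u} {v} ([] , s , e) σ
    with contract-cherry K-sym {Ok} {Ok′} {IOk} {IOk′} {a} (good-≃ e g) (subst (5 ≤_) (↭-length (verts↭ e)) h) (Fits-≃ e f) (Compat-≃ e co)
     (∈-resp-↭ (↭-sym σ) (here refl)) hub (λ p∉ y∉ k → to (old (out p∉) (out y∉) k)) (λ y∉ → to (oldI (out y∉)))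
    where
     out : ∀ {w} → w ∉ z ∷ u ∷ v ∷ [] → w ∉ ds
     out n m = n (∈-resp-↭ (↭-sym σ) m)
     hub : ∀ {w} → w ∉ z ∷ u ∷ v ∷ [] → K z w → IOk z → Ok u z → Ok v z → Ok′ a w
     hub w∉ k iz ou ov = go (toP (∈-resp-↭ σ (here refl)) (out w∉) k)
      where
       oth : ∀ {d} → d ∈ ds → d ≢ z → Ok d z
       oth m n with ∈-resp-↭ (↭-sym σ) m
       ... | here refl = ⊥-elim (n refl)
       ... | there (here refl) = ou
       ... | there (there (here refl)) = ov
       go : ∀ {w} → (z , w) ∈ P → Ok′ a w
       go (here refl) = to okα (iz , oth (there (here refl)) (≢-sym (K≢ ab)) , oth (there (there (here refl))) (≢-sym (K≢ ax)))
       go (there (here refl)) = to okβ (iz , oth (here refl) (K≢ ab) , oth (there (there (here refl))) (≢-sym (K≢ bx)))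
       go (there (there (here refl))) = to okξ (iz , oth (here refl) (K≢ ax) , oth (there (here refl)) (K≢ bx))
   ... | n , eq , contracted t′ g′ f′ c′ l′ k′ =
    n , trans (↭-length (verts↭ e)) eq , contracted t′ g′ f″ c′ l′ k′ , outs-distinct g′ f″ l′
    where
     f″ : Fits t′ (Quot K a ds)
     f″ = mk⇔ (Quot-↭ σ ∘ to f′) (from f′ ∘ Quot-↭ (↭-sym σ))

   lift₃ : DecidableEquality V → ∀ {t} → Good t → Fits t (Quot K a ds) → Compat Ok′ IOk′ t → ¬ IOk′ a →
    ∃ λ y → Par t a y × (y ≡ α → Lifted K Ok IOk t b x a)
     × (y ≢ α → y ≡ β → Lifted K Ok IOk t a x b)
     × (y ≢ α → y ≢ β → Lifted K Ok IOk t a b x)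
   lift₃ _≟_ {t} g f co ¬I with leaf-or-int t (fst (Adj-∈ t (from f (from outs-of-a (here refl)))))
   ... | inr i = ⊥-elim (¬I (intOk co i))
   ... | inl l with cut-at-leaf g l
   ...   | s , e with good-≃ e g | Compat-≃ e co
   ...     | g′ | co′ with leaf-nbrs {K = Quot K a ds} g′ (Fits-≃ e f)
   ...       | n′ with arrange {P} refl (distinct n′) (to outs-of-a (from (members n′) (here refl)))
    (to outs-of-a (from (members n′) (there (here refl)))) (to outs-of-a (from (members n′) (there (there (here refl)))))
   ...         | z , u , v , σ = root s , Par-≃ (≃-sym e) (here refl , to (te ≃-refl) (te-nbr⁺ (uniq g′) (here refl)))
    , (λ q → Lifted-≃ e (caseα q)) , (λ _ q → Lifted-≃ e (caseβ q)) , (λ p q → Lifted-≃ e (caseξ p q))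
    where
     f′ : Fits (leafT a ⋈ s) (Quot K a ds)
     f′ = Fits-≃ e f
     σ₁ : ds ↭ z ∷ u ∷ v ∷ []
     σ₁ = Perm.map⁺ fst σ
     uds : Unique (z ∷ u ∷ v ∷ [])
     uds = unique-resp-↭ σ₁ distinct-abx
     out : ∀ {w} → w ∉ z ∷ u ∷ v ∷ [] → w ∉ ds
     out n m = n (∈-resp-↭ σ₁ m)
     dist : Unique (α ∷ β ∷ ξ ∷ [])
     dist = outs-distinct g f l
     zP : (z , root s) ∈ P
     zP = ∈-resp-↭ (↭-sym σ) (here refl)
     outs : ∀ {d w} → d ∈ z ∷ u ∷ v ∷ [] → w ∉ z ∷ u ∷ v ∷ [] → K d w ⇔ Port₃ s z u v d w
     outs d∈ w∉ = mk⇔ (λ k → toPort (∈-resp-↭ σ (toP (∈-resp-↭ (↭-sym σ₁) d∈) (out w∉) k))) (λ p → fromP (∈-resp-↭ (↭-sym σ) (fromPort p)))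
      where
       toPort : ∀ {d w} → (d , w) ∈ (z , root s) ∷ (u , final s) ∷ (v , first s) ∷ [] → Port₃ s z u v d w
       toPort (here refl) = inl (refl , refl)
       toPort (there (here refl)) = inr (inl (refl , refl))
       toPort (there (there (here refl))) = inr (inr (refl , refl))
       fromPort : ∀ {d w} → Port₃ s z u v d w → (d , w) ∈ (z , root s) ∷ (u , final s) ∷ (v , first s) ∷ []
       fromPort (inl (refl , refl)) = here refl
       fromPort (inr (inl (refl , refl))) = there (here refl)
       fromPort (inr (inr (refl , refl))) = there (there (here refl))
     inside : ∀ {d e} → d ∈ z ∷ u ∷ v ∷ [] → e ∈ z ∷ u ∷ v ∷ [] → K d e ⇔ (d ≢ e)
     inside d∈ e∈ = mk⇔ K≢ (go (∈-resp-↭ (↭-sym σ₁) d∈) (∈-resp-↭ (↭-sym σ₁) e∈))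
      where
       go : ∀ {d e} → d ∈ ds → e ∈ ds → d ≢ e → K d e
       go (here refl) (here refl) n = ⊥-elim (n refl)
       go (here refl) (there (here refl)) _ = ab
       go (here refl) (there (there (here refl))) _ = ax
       go (there (here refl)) (here refl) _ = K-sym ab
       go (there (here refl)) (there (here refl)) n = ⊥-elim (n refl)
       go (there (here refl)) (there (there (here refl))) _ = bx
       go (there (there (here refl))) (here refl) _ = K-sym ax
       go (there (there (here refl))) (there (here refl)) _ = K-sym bx
       go (there (there (here refl))) (there (there (here refl))) n = ⊥-elim (n refl)
     ok : ∀ {z w} → (z , w) ∈ P → Ok′ a w → IOk z × (∀ {d} → d ∈ ds → d ≢ z → Ok d z)
     ok (here refl) o with from okα o
     ... | i , o₁ , o₂ = i , λ { (here refl) n → ⊥-elim (n refl) ; (there (here refl)) _ → o₁ ; (there (there (here refl))) _ → o₂ }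
     ok (there (here refl)) o with from okβ o
     ... | i , o₁ , o₂ = i , λ { (here refl) _ → o₁ ; (there (here refl)) n → ⊥-elim (n refl) ; (there (there (here refl))) _ → o₂ }
     ok (there (there (here refl))) o with from okξ o
     ... | i , o₁ , o₂ = i , λ { (here refl) _ → o₁ ; (there (here refl)) _ → o₂ ; (there (there (here refl))) n → ⊥-elim (n refl) }
     okz : IOk z × (∀ {d} → d ∈ ds → d ≢ z → Ok d z)
     okz = ok zP (parOk co′ (here refl , te-nbr⁺ (uniq g′) (here refl)))
     z≢u : z ≢ u
     z≢u = All.lookup (fst (uncons uds)) (here refl)
      where uncons : ∀ {x : V} {xs} → Unique (x ∷ xs) → All (x ≢_) xs × Unique xs
            uncons (p ∷ q) = p , q
     z≢v : z ≢ v
     z≢v refl = Uniq.Unique[x∷xs]⇒x∉xs uds (there (here refl))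
     L : Lifted K Ok IOk (leafT a ⋈ s) u v z
     L = lift-cherry K-sym _≟_ g′ (mk⇔ (Quot-↭ σ₁ ∘ to f′) (from f′ ∘ Quot-↭ (↭-sym σ₁))) co′ (∈-resp-↭ σ₁ (here refl)) uds
      inside outs (fst okz) (snd okz (∈-resp-↭ (↭-sym σ₁) (there (here refl))) (≢-sym z≢u))
      (snd okz (∈-resp-↭ (↭-sym σ₁) (there (there (here refl)))) (≢-sym z≢v))
      (λ p∉ y∉ k → from (old (out p∉) (out y∉) k)) (λ y∉ → from (oldI (out y∉)))
     caseα : root s ≡ α → Lifted K Ok IOk (leafT a ⋈ s) b x a
     caseα q with zP | dist
     ... | here refl | _ = Lifted-↭ (Perm.drop-∷ (↭-sym σ₁)) L
     ... | there (here refl) | (p ∷ _) ∷ _ = ⊥-elim (p (sym q))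
     ... | there (there (here refl)) | (_ ∷ p ∷ _) ∷ _ = ⊥-elim (p (sym q))
     caseβ : root s ≡ β → Lifted K Ok IOk (leafT a ⋈ s) a x b
     caseβ q with zP | dist
     ... | here refl | (p ∷ _) ∷ _ = ⊥-elim (p q)
     ... | there (here refl) | _ = Lifted-↭ (Perm.drop-∷ (↭-trans (↭-sym σ₁) (Permₚ.swap _ _ ↭-refl))) L
     ... | there (there (here refl)) | _ ∷ (p ∷ _) ∷ _ = ⊥-elim (p (sym q))
     caseξ : root s ≢ α → root s ≢ β → Lifted K Ok IOk (leafT a ⋈ s) a b x
     caseξ p q with zP
     ... | here refl = ⊥-elim (p refl)
     ... | there (here refl) = ⊥-elim (q refl)
     ... | there (there (here refl)) = Lifted-↭ (Perm.drop-∷ (↭-trans (↭-sym σ₁) (↭-trans (prep _ (Permₚ.swap _ _ ↭-refl)) (Permₚ.swap _ _ ↭-refl)))) L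

  module Merge₂ (old : ∀ {p y} → p ∉ a ∷ b ∷ [] → y ∉ a ∷ b ∷ [] → K p y → Ok p y ⇔ Ok′ p y)
   (oldI : ∀ {y} → y ∉ a ∷ b ∷ [] → IOk y ⇔ IOk′ y)
   (okα : ¬ Ok′ a α) (okβ : ¬ Ok′ a β)
   (okx : (Ok a x × Ok b x) ⇔ Ok′ a x) where

   ds : List V
   ds = a ∷ b ∷ []

   outside-ds : ∀ {w} → w ∈ α ∷ β ∷ x ∷ [] → w ∉ ds
   outside-ds (here refl) (here p) = K≢ aα (sym p)
   outside-ds (here refl) (there (here p)) = α≢b p
   outside-ds (there (here refl)) (here p) = β≢a p
   outside-ds (there (here refl)) (there (here p)) = K≢ bβ (sym p)
   outside-ds (there (there (here refl))) (here p) = K≢ ax (sym p)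
   outside-ds (there (there (here refl))) (there (here p)) = K≢ bx (sym p)

   outs-of-a : ∀ {w} → Quot K a ds a w ⇔ w ∈ α ∷ β ∷ x ∷ []
   outs-of-a = mk⇔ f b′
    where
     f : ∀ {w} → Quot K a ds a w → w ∈ α ∷ β ∷ x ∷ []
     f (inl (n , _)) = ⊥-elim (n (here refl))
     f (inr (inr (_ , n , _))) = ⊥-elim (n (here refl))
     f (inr (inl (_ , w∉ , here k))) with to (members na) k
     ... | here refl = ⊥-elim (w∉ (there (here refl)))
     ... | there (here refl) = there (there (here refl))
     ... | there (there (here refl)) = here refl
     f (inr (inl (_ , w∉ , there (here k)))) with to (members nb) k
     ... | here refl = ⊥-elim (w∉ (here refl))
     ... | there (here refl) = there (there (here refl))
     ... | there (there (here refl)) = there (here refl)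
     b′ : ∀ {w} → w ∈ α ∷ β ∷ x ∷ [] → Quot K a ds a w
     b′ m = inr (inl (refl , outside-ds m , g m))
      where
       g : ∀ {w} → w ∈ α ∷ β ∷ x ∷ [] → Any (λ d → K d w) ds
       g (here refl) = here aα
       g (there (here refl)) = there (here bβ)
       g (there (there (here refl))) = here ax

   outs-distinct : ∀ {t} → Good t → Fits t (Quot K a ds) → a ∈ Lvs t → Unique (α ∷ β ∷ x ∷ [])
   outs-distinct g f l with cut-at-leaf g l
   ... | s , e with leaf-nbrs {K = Quot K a ds} (good-≃ e g) (Fits-≃ e f)
   ...   | n = unique-resp-↭ (unique-⊆-↭ (distinct n) (λ m → to outs-of-a (from (members n) m)) refl) (distinct n)

   contract₂ : ∀ {t} → Good t → 5 ≤ length (verts t) → Fits t K → Compat Ok IOk t →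
    ∀ {xs} → Nbrs K x xs → 4 ≤ length xs →
    ∃ λ n → length (verts t) ≡ 1 + n × Contracted (Quot K a ds) Ok′ IOk′ a n × Unique (α ∷ β ∷ x ∷ [])
   contract₂ {t} g h f co {xs} nx deg with triangle-fan g (≥4-leaves t (isWF g) h) (from f ab) (from f ax) (from f bx)
   ... | fanOn {z} {u} {v} (rest , s , e) σ = go rest e
    where
     x-not-leaf : x ∈ Lvs t → ⊥
     x-not-leaf m = contradiction (subst (4 ≤_) (leaf-degree g f m nx) deg) λ { (s≤s (s≤s (s≤s ()))) }
     uv : ∀ {rest} → t ≃ node z (leafT u ∷ leafT v ∷ rest) ⋈ s → x ≡ z
     uv e′ with ∈-resp-↭ (↭-sym σ) (there (there (here refl)))
     ... | here q = q
     ... | there (here refl) = ⊥-elim (x-not-leaf (∈-resp-↭ (↭-sym (lvs↭ e′)) (here refl)))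
     ... | there (there (here refl)) = ⊥-elim (x-not-leaf (∈-resp-↭ (↭-sym (lvs↭ e′)) (there (here refl))))
     go : ∀ rest → t ≃ node z (leafT u ∷ leafT v ∷ rest) ⋈ s →
      ∃ λ n → length (verts t) ≡ 1 + n × Contracted (Quot K a ds) Ok′ IOk′ a n × Unique (α ∷ β ∷ x ∷ [])
     go rest e with uv e
     go [] e | refl with int-nbrs (good-≃ e g) (Fits-≃ {K = K} e f)
     ... | nz = contradiction (subst (4 ≤_) (Nbrs-length nx nz) deg) λ { (s≤s (s≤s (s≤s ()))) }
     go (c ∷ cs) e | refl
      with contract-twins K-sym {Ok} {Ok′} {IOk} {IOk′} {a} (good-≃ e g) (Fits-≃ e f) (Compat-≃ e co)
       (∈-resp-↭ (↭-sym σ′) (here refl))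
       (λ ou ov → to okx (oth ou ov (∈-resp-↭ (↭-sym σ′) (here refl)) , oth ou ov (∈-resp-↭ (↭-sym σ′) (there (here refl)))))
       (λ p∉ y∉ k → to (old (out p∉) (out y∉) k)) (λ y∉ → to (oldI (out y∉)))
      where
       σ′ : u ∷ v ∷ [] ↭ a ∷ b ∷ []
       σ′ = Perm.drop-∷ (↭-trans σ (↭-trans (prep a (Permₚ.swap b x ↭-refl)) (Permₚ.swap a x ↭-refl)))
       out : ∀ {w} → w ∉ u ∷ v ∷ [] → w ∉ ds
       out n m = n (∈-resp-↭ (↭-sym σ′) m)
       oth : Ok u x → Ok v x → ∀ {w} → w ∈ u ∷ v ∷ [] → Ok w x
       oth ou ov (here refl) = ou
       oth ou ov (there (here refl)) = ov
     ... | n , eq , contracted t′ g′ f′ c′ l′ k′ =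
      n , trans (↭-length (verts↭ e)) eq , contracted t′ g′ f″ c′ l′ k′ , outs-distinct g′ f″ l′
      where
       σ′ : u ∷ v ∷ [] ↭ a ∷ b ∷ []
       σ′ = Perm.drop-∷ (↭-trans σ (↭-trans (prep a (Permₚ.swap b x ↭-refl)) (Permₚ.swap a x ↭-refl)))
       f″ : Fits t′ (Quot K a ds)
       f″ = mk⇔ (Quot-↭ σ′ ∘ to f′) (from f′ ∘ Quot-↭ (↭-sym σ′))

   lift₂ : DecidableEquality V → ∀ {t} → Good t → Fits t (Quot K a ds) → Compat Ok′ IOk′ t → ¬ IOk′ a →
    Par t a x × Lifted K Ok IOk t a b x
   lift₂ _≟_ {t} g f co ¬I with leaf-or-int t (fst (Adj-∈ t (from f (from outs-of-a (here refl)))))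
   ... | inr i = ⊥-elim (¬I (intOk co i))
   ... | inl l with cut-at-leaf g l
   ...   | s , e with root-is-x
    where
     g′ : Good (leafT a ⋈ s)
     g′ = good-≃ e g
     pr : Par (leafT a ⋈ s) a (root s)
     pr = here refl , te-nbr⁺ (uniq g′) (here refl)
     root-is-x : root s ≡ x
     root-is-x with to outs-of-a (from (members (leaf-nbrs {K = Quot K a ds} g′ (Fits-≃ e f))) (here refl)) | parOk (Compat-≃ e co) pr
     ... | here q | o = ⊥-elim (okα (subst (Ok′ a) q o))
     ... | there (here q) | o = ⊥-elim (okβ (subst (Ok′ a) q o))
     ... | there (there (here q)) | _ = q
   ...     | refl with good-leaf (good-≃ e g)
   ...       | branching {_} {c₀} {c₁} {cs₁} with snoc c₁ cs₁
   ...         | i₁ , r , eq = Par-≃ (≃-sym e) pr , Lifted-≃ e′ L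
    where
     pr : Par (leafT a ⋈ s) a x
     pr = here refl , te-nbr⁺ (uniq (good-≃ e g)) (here refl)
     e′ : t ≃ node x (leafT a ∷ c₀ ∷ i₁) ⋈ r
     e′ = ≃-trans e (subst (λ l → leafT a ⋈ node x (c₀ ∷ l) ≃ node x (leafT a ∷ c₀ ∷ i₁) ⋈ r) (sym eq)
      (≃-sym (slide x (leafT a) (c₀ ∷ i₁) r)))
     g′ : Good (node x (leafT a ∷ c₀ ∷ i₁) ⋈ r)
     g′ = good-≃ e′ g
     f′ : Fits (node x (leafT a ∷ c₀ ∷ i₁) ⋈ r) (Quot K a ds)
     f′ = Fits-≃ e′ f
     n′ : Nbrs (Quot K a ds) a (x ∷ final s ∷ first s ∷ [])
     n′ = leaf-nbrs (good-≃ e g) (Fits-≃ e f)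
     final≡ : final s ≡ final r
     final≡ = trans (cong (λ l → final (node x (c₀ ∷ l))) eq) (final-∷ʳ (c₀ ∷ i₁))
     first≡ : first s ≡ first c₀
     first≡ = hd-lvs c₀
     lh : Unique (final s ∷ first s ∷ [])
     lh = unique-tail (distinct n′)
     x∉ : x ∉ final s ∷ first s ∷ []
     x∉ = Uniq.Unique[x∷xs]⇒x∉xs (distinct n′)
     σ : final s ∷ first s ∷ [] ↭ α ∷ β ∷ []
     σ = Perm.drop-∷ (↭-trans (unique-⊆-↭ (distinct n′) (λ m → to outs-of-a (from (members n′) m)) refl)
      (↭-trans (prep α (Permₚ.swap β x ↭-refl)) (Permₚ.swap α x ↭-refl)))
     Lift : V → V → Set
     Lift u v = Lifted K Ok IOk (node x (leafT a ∷ c₀ ∷ i₁) ⋈ r) u v x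
     ok : Ok a x × Ok b x
     ok = from okx (parOk (Compat-≃ e co) pr)
     ins : ∀ {d e} → d ∈ ds → e ∈ ds → K d e ⇔ (d ≢ e)
     ins d∈ e∈ = mk⇔ K≢ (h d∈ e∈)
      where
       h : ∀ {d e} → d ∈ ds → e ∈ ds → d ≢ e → K d e
       h (here refl) (here refl) n = ⊥-elim (n refl)
       h (here refl) (there (here refl)) _ = ab
       h (there (here refl)) (here refl) _ = K-sym ab
       h (there (here refl)) (there (here refl)) n = ⊥-elim (n refl)
     portsA : ∀ {w} → w ∉ ds → K a w ⇔ (w ≡ x ⊎ w ≡ α)
     portsA w∉ = mk⇔ (λ k → case to (members na) k of λ
      { (here refl) → ⊥-elim (w∉ (there (here refl))) ; (there (here q)) → inl q ; (there (there (here q))) → inr q })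
      λ { (inl refl) → ax ; (inr refl) → aα }
     portsB : ∀ {w} → w ∉ ds → K b w ⇔ (w ≡ x ⊎ w ≡ β)
     portsB w∉ = mk⇔ (λ k → case to (members nb) k of λ
      { (here refl) → ⊥-elim (w∉ (here refl)) ; (there (here q)) → inl q ; (there (there (here q))) → inr q })
      λ { (inl refl) → bx ; (inr refl) → bβ }
     L : Lift a b
     L with pair-↭ σ (λ q → Uniq.Unique[x∷xs]⇒x∉xs lh (here q))
     ... | inl (fα , hβ) = lift-twins K-sym _≟_ g′ f′ (Compat-≃ e′ co) (here refl) ((K≢ ab ∷ []) ∷ [] ∷ []) ins outs
      (fst ok) (snd ok) (λ p∉ y∉ k → from (old p∉ y∉ k)) (λ y∉ → from (oldI y∉))
      where
       outs : ∀ {d w} → d ∈ ds → w ∉ ds → K d w ⇔ Port₂ {x = x} {c₀} {i₁} {r} a b d w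
       outs (here refl) w∉ = mk⇔ (λ k → case to (portsA w∉) k of λ { (inl q) → inl (here refl , q) ; (inr q) → inr (inl (refl , trans q (trans (sym fα) final≡))) })
        λ { (inl (_ , q)) → from (portsA w∉) (inl q) ; (inr (inl (_ , q))) → from (portsA w∉) (inr (trans q (trans (sym final≡) fα)))
         ; (inr (inr (q , _))) → ⊥-elim (K≢ ab q) }
       outs (there (here refl)) w∉ = mk⇔ (λ k → case to (portsB w∉) k of λ { (inl q) → inl (there (here refl) , q) ; (inr q) → inr (inr (refl , trans q (trans (sym hβ) first≡))) })
        λ { (inl (_ , q)) → from (portsB w∉) (inl q) ; (inr (inr (_ , q))) → from (portsB w∉) (inr (trans q (trans (sym first≡) hβ)))
         ; (inr (inl (q , _))) → ⊥-elim (K≢ ab (sym q)) }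
     ... | inr (fβ , hα) = Lifted-swap (lift-twins K-sym _≟_ g′ (mk⇔ (Quot-↭ sw ∘ to f′) (from f′ ∘ Quot-↭ sw)) (Compat-≃ e′ co) (there (here refl)) ((≢-sym (K≢ ab) ∷ []) ∷ [] ∷ [])
      (λ d∈ e∈ → ins (∈-resp-↭ sw d∈) (∈-resp-↭ sw e∈)) outs
      (snd ok) (fst ok) (λ p∉ y∉ k → from (old (out p∉) (out y∉) k)) (λ y∉ → from (oldI (out y∉))))
      where
       sw : ∀ {p q : V} → p ∷ q ∷ [] ↭ q ∷ p ∷ []
       sw = Permₚ.swap _ _ ↭-refl
       out : ∀ {w} → w ∉ b ∷ a ∷ [] → w ∉ ds
       out n m = n (∈-resp-↭ sw m)
       outs : ∀ {d w} → d ∈ b ∷ a ∷ [] → w ∉ b ∷ a ∷ [] → K d w ⇔ Port₂ {x = x} {c₀} {i₁} {r} b a d w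
       outs (there (here refl)) w∉ = mk⇔ (λ k → case to (portsA (out w∉)) k of λ { (inl q) → inl (there (here refl) , q) ; (inr q) → inr (inr (refl , trans q (trans (sym hα) first≡))) })
        λ { (inl (_ , q)) → from (portsA (out w∉)) (inl q) ; (inr (inr (_ , q))) → from (portsA (out w∉)) (inr (trans q (trans (sym first≡) hα)))
         ; (inr (inl (q , _))) → ⊥-elim (K≢ ab q) }
       outs (here refl) w∉ = mk⇔ (λ k → case to (portsB (out w∉)) k of λ { (inl q) → inl (here refl , q) ; (inr q) → inr (inl (refl , trans q (trans (sym fβ) final≡))) })
        λ { (inl (_ , q)) → from (portsB (out w∉)) (inl q) ; (inr (inl (_ , q))) → from (portsB (out w∉)) (inr (trans q (trans (sym final≡) fβ)))
         ; (inr (inr (q , _))) → ⊥-elim (K≢ ab (sym q)) }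

-- The machine and the program

LoopFree : Program → Set
LoopFree skip                    = ⊤
LoopFree (_ [ _ ]≔ _)            = ⊤
LoopFree (P ⨾ Q)                 = LoopFree P × LoopFree Q
LoopFree (if≢0 _ then P else Q)  = LoopFree P × LoopFree Q
LoopFree (while≢0 _ repeat _)    = ⊥

choose : ∀ {A : Set} → ℕ → A → A → A
choose zero    p q = q
choose (suc _) p q = p

exec : Program → Store → Store
exec skip                   σ = σ
exec (a [ e ]≔ f)           σ = write σ a (⟦ e ⟧ σ) (⟦ f ⟧ σ)
exec (P ⨾ Q)                σ = exec Q (exec P σ)
exec (if≢0 e then P else Q) σ = choose (⟦ e ⟧ σ) (exec P σ) (exec Q σ)
exec (while≢0 e repeat P)   σ = σ

maxTime : Program → ℕ
maxTime skip                   = 1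
maxTime (a [ e ]≔ f)           = suc (cost e + cost f)
maxTime (P ⨾ Q)                = maxTime P + maxTime Q
maxTime (if≢0 e then P else Q) = suc (cost e + (maxTime P + maxTime Q))
maxTime (while≢0 e repeat P)   = 0

Runs : Program → Store → ℕ → Store → Set
Runs P σ b τ = ∃ λ t → ⟨ P , σ ⟩⇓[ t ] τ × t ≤ b

run-loop-free : ∀ P → LoopFree P → ∀ σ → Runs P σ (maxTime P) (exec P σ)
run-loop-free skip         _ σ = 1 , skip , ℕ.≤-refl
run-loop-free (a [ e ]≔ f) _ σ = _ , assign , ℕ.≤-refl
run-loop-free (P ⨾ Q) (p , q) σ with run-loop-free P p σ | run-loop-free Q q (exec P σ)
... | s , r , s≤ | t , r′ , t≤ = s + t , seq r r′ , ℕ.+-mono-≤ s≤ t≤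
run-loop-free (if≢0 e then P else Q) (p , q) σ with ⟦ e ⟧ σ in eq
... | zero  = let t , r , t≤ = run-loop-free Q q σ in
  _ , if-else eq r , s≤s (ℕ.+-monoʳ-≤ (cost e) (ℕ.≤-trans t≤ (ℕ.m≤n+m _ (maxTime P))))
... | suc _ = let t , r , t≤ = run-loop-free P p σ in
  _ , if-then (λ z → case trans (sym eq) z of λ ()) r , s≤s (ℕ.+-monoʳ-≤ (cost e) (ℕ.≤-trans t≤ (ℕ.m≤m+n _ (maxTime Q))))

run-seq : ∀ {P Q σ τ υ b c} → Runs P σ b τ → Runs Q τ c υ → Runs (P ⨾ Q) σ (b + c) υ
run-seq (s , r , s≤) (t , r′ , t≤) = s + t , seq r r′ , ℕ.+-mono-≤ s≤ t≤

-- Every iteration is paid for by a decrease of the potential C * m.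
run-while : ∀ {ℓ} {e P} C (I : ℕ → Store → Set ℓ) →
 (∀ m σ → I m σ → ⟦ e ⟧ σ ≢ 0 → ∃₂ λ m′ σ′ → I m′ σ′ × ∃ λ b → Runs P σ b σ′ × suc (cost e + b) + C * m′ ≤ C * m) →
 ∀ m σ → I m σ → ∃₂ λ m′ τ → I m′ τ × ⟦ e ⟧ τ ≡ 0 × Runs (while≢0 e repeat P) σ (suc (cost e) + C * m) τ
run-while {e = e} {P} C I step m σ inv = go (C * m) m σ inv ℕ.≤-refl
 where
  go : ∀ fuel m σ → I m σ → C * m ≤ fuel → ∃₂ λ m′ τ → I m′ τ × ⟦ e ⟧ τ ≡ 0 × Runs (while≢0 e repeat P) σ (suc (cost e) + C * m) τ
  go fuel m σ inv ≤f with ⟦ e ⟧ σ in eq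
  ... | zero = m , σ , inv , eq , _ , stop eq , ℕ.m≤m+n _ _
  ... | suc k with step m σ inv (λ z → case trans (sym eq) z of λ ())
  ...   | m′ , σ′ , inv′ , b , (t , r , t≤) , dec with fuel
  ...     | zero = contradiction (ℕ.≤-trans dec ≤f) λ ()
  ...     | suc fuel′ with go fuel′ m′ σ′ inv′ (ℕ.≤-pred (ℕ.≤-trans (ℕ.≤-trans (ℕ.+-monoˡ-≤ (C * m′) (s≤s z≤n)) dec) ≤f))
  ...       | m″ , τ , inv″ , e≡0 , t′ , r′ , t′≤ =
   m″ , τ , inv″ , e≡0 , _ , loop (λ z → case trans (sym eq) z of λ ()) r r′ , bound
   where
    bound : suc (cost e + (t + t′)) ≤ suc (cost e) + C * m
    bound = begin
     suc (cost e + (t + t′))                          ≤⟨ s≤s (ℕ.+-monoʳ-≤ (cost e) (ℕ.+-mono-≤ t≤ t′≤)) ⟩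
     suc (cost e + (b + (suc (cost e) + C * m′)))     ≡⟨ lem (cost e) b (C * m′) ⟩
     suc (cost e) + (suc (cost e + b) + C * m′)       ≤⟨ ℕ.+-monoʳ-≤ (suc (cost e)) dec ⟩
     suc (cost e) + C * m                             ∎
     where
      open ℕ.≤-Reasoning
      lem : ∀ c b x → suc (c + (b + (suc c + x))) ≡ suc c + (suc (c + b) + x)
      lem = solve-∀

-- Arrays: 0 input, 1 internal vertices and first output, 2 second output, 3 scalars,
-- 4 degree, 5 sum of the neighbours, 6 the same for the input graph, 7 and 8 two of the neighbours
-- (of vertices of degree three), 9 matrix, 10 start of the rows of the matrix, 11 merged vertices,
-- 12 active vertices, 13 parents, 14 to 18 history, 19 renaming.
-- A matrix entry (u, v) is 0 if u and v are not adjacent, and 1 if u may be a leaf with parent v.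
var : ℕ → Expr
var x = 3 [ lit x ]

infix 4 _≔_
_≔_ : ℕ → Expr → Program
x ≔ e = 3 [ lit x ]≔ e

mat : Expr → Expr → Expr
mat u v = 9 [ 10 [ u ] ⊕ v ]

infix 4 mat⟨_,_⟩≔_
mat⟨_,_⟩≔_ : Expr → Expr → Expr → Program
mat⟨ u , v ⟩≔ e = 9 [ 10 [ u ] ⊕ v ]≔ e

size-of-input : Expr
size-of-input = 0 [ lit 0 ]

pattern #v = 0
pattern #pos = 1
pattern #row = 2
pattern #cnt = 3
pattern #deg = 4
pattern #i = 5
pattern #alive = 6
pattern #k = 7
pattern #p = 8
pattern #q = 9
pattern #r = 10
pattern #t = 11
pattern #b = 12
pattern #x = 13
pattern #m₁ = 14
pattern #m₂ = 15
pattern #m₃ = 16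
pattern #c₀ = 17
pattern #c₁ = 18
pattern #bit = 19
pattern #u = 20

read-neighbour : Program
read-neighbour =
 #u ≔ 0 [ var #pos ]
 ⨾ #pos ≔ var #pos ⊕ lit 1
 ⨾ 5 [ var #v ]≔ 5 [ var #v ] ⊕ var #u
 ⨾ 8 [ var #v ]≔ 7 [ var #v ]
 ⨾ 7 [ var #v ]≔ var #u
 ⨾ mat⟨ var #v , var #u ⟩≔ lit 1
 ⨾ #deg ≔ var #deg ⊖ lit 1

start-vertex : Program
start-vertex =
 10 [ var #v ]≔ var #row
 ⨾ #row ≔ var #row ⊕ size-of-input
 ⨾ #deg ≔ 0 [ var #pos ]
 ⨾ #pos ≔ var #pos ⊕ lit 1
 ⨾ 4 [ var #v ]≔ var #deg
 ⨾ 12 [ var #v ]≔ lit 1 ⊖ ((var #deg ⊖ lit 3) ⊕ (lit 3 ⊖ var #deg))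
 ⨾ 19 [ var #v ]≔ var #v

end-vertex : Program
end-vertex =
 6 [ var #v ]≔ 5 [ var #v ]
 ⨾ #v ≔ var #v ⊕ lit 1
 ⨾ #cnt ≔ var #cnt ⊖ lit 1

read-input : Program
read-input =
 (#pos ≔ lit 1 ⨾ #cnt ≔ size-of-input ⨾ #alive ≔ size-of-input)
 ⨾ while≢0 var #cnt repeat
  (start-vertex ⨾ while≢0 var #deg repeat read-neighbour ⨾ end-vertex)

rotate-triple : Program
rotate-triple = #t ≔ var #p ⨾ #p ≔ var #q ⨾ #q ≔ var #r ⨾ #r ≔ var #t

load-triple : Program
load-triple = #p ≔ 7 [ var #i ] ⨾ #q ≔ 8 [ var #i ] ⨾ #r ≔ 5 [ var #i ] ⊖ var #p ⊖ var #q

opaque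

 find-edge : Program
 find-edge =
  (if≢0 mat (var #p) (var #q) then skip else rotate-triple)
  ⨾ (if≢0 mat (var #p) (var #q) then skip else rotate-triple)

 find-edge-loop-free : LoopFree find-edge
 find-edge-loop-free = _

rename : ℕ → ℕ → Program
rename z d =
 5 [ var z ]≔ 5 [ var z ] ⊕ var #i ⊖ var d
 ⨾ 7 [ var z ]≔ 19 [ 7 [ var z ] ]
 ⨾ 8 [ var z ]≔ 19 [ 8 [ var z ] ]
 ⨾ mat⟨ var z , var #i ⟩≔ lit 1

prepare : Program
prepare =
 (if≢0 4 [ var #p ] ⊖ lit 3 then (#t ≔ var #p ⨾ #p ≔ var #q ⨾ #q ≔ var #t) else skip)
 ⨾ #b ≔ 5 [ var #p ] ⊖ var #i ⊖ var #q

opaque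

 merge-two : Program
 merge-two =
  14 [ var #k ]≔ var #i ⨾ 15 [ var #k ]≔ var #p ⨾ 16 [ var #k ]≔ var #q
  ⨾ 17 [ var #k ]≔ var #i ⨾ 18 [ var #k ]≔ var #i
  ⨾ 19 [ var #p ]≔ var #i
  ⨾ 12 [ var #p ]≔ lit 0
  ⨾ mat⟨ var #i , var #q ⟩≔ mat (var #i) (var #q) ⊕ mat (var #p) (var #q) ⊖ lit 1
  ⨾ mat⟨ var #i , var #r ⟩≔ lit 2
  ⨾ mat⟨ var #i , var #b ⟩≔ lit 2
  ⨾ rename #b #p
  ⨾ 5 [ var #i ]≔ var #r ⊕ var #b ⊕ var #q
  ⨾ 5 [ var #q ]≔ 5 [ var #q ] ⊖ var #p
  ⨾ 4 [ var #q ]≔ 4 [ var #q ] ⊖ lit 1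
  ⨾ 7 [ var #i ]≔ var #r ⨾ 8 [ var #i ]≔ var #b
  ⨾ 11 [ var #i ]≔ lit 1
  ⨾ #k ≔ var #k ⊕ lit 1
  ⨾ #alive ≔ var #alive ⊖ lit 1

 merge-two-loop-free : LoopFree merge-two
 merge-two-loop-free = _

opaque

 merge-three : Program
 merge-three =
  #x ≔ 5 [ var #q ] ⊖ var #i ⊖ var #p
  ⨾ #m₁ ≔ 11 [ var #i ] ⊕ mat (var #p) (var #i) ⊕ mat (var #q) (var #i) ⊖ lit 1
  ⨾ #m₂ ≔ 11 [ var #p ] ⊕ mat (var #i) (var #p) ⊕ mat (var #q) (var #p) ⊖ lit 1
  ⨾ #m₃ ≔ 11 [ var #q ] ⊕ mat (var #i) (var #q) ⊕ mat (var #p) (var #q) ⊖ lit 1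
  ⨾ 14 [ var #k ]≔ var #i ⨾ 15 [ var #k ]≔ var #p ⨾ 16 [ var #k ]≔ var #q
  ⨾ 17 [ var #k ]≔ var #r ⨾ 18 [ var #k ]≔ var #b
  ⨾ 19 [ var #p ]≔ var #i ⨾ 19 [ var #q ]≔ var #i
  ⨾ 12 [ var #p ]≔ lit 0 ⨾ 12 [ var #q ]≔ lit 0
  ⨾ mat⟨ var #i , var #r ⟩≔ var #m₁
  ⨾ mat⟨ var #i , var #b ⟩≔ var #m₂
  ⨾ mat⟨ var #i , var #x ⟩≔ var #m₃
  ⨾ rename #b #p
  ⨾ rename #x #q
  ⨾ 5 [ var #i ]≔ var #r ⊕ var #b ⊕ var #x
  ⨾ 7 [ var #i ]≔ var #r ⨾ 8 [ var #i ]≔ var #b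
  ⨾ 11 [ var #i ]≔ lit 1
  ⨾ #k ≔ var #k ⊕ lit 1
  ⨾ #alive ≔ var #alive ⊖ lit 2

 merge-three-loop-free : LoopFree merge-three
 merge-three-loop-free = _

next-vertex : Program
next-vertex = #i ≔ var #i ⊕ lit 1

opaque

 merge-phase : Program
 merge-phase = if≢0 4 [ var #q ] ⊖ lit 3 then merge-two else merge-three

 merge-phase-loop-free : LoopFree merge-phase
 merge-phase-loop-free = merge-two-loop-free , merge-three-loop-free

edge-phase : Program
edge-phase = if≢0 mat (var #p) (var #q) then (prepare ⨾ merge-phase) else next-vertex

contract-step : Program
contract-step = if≢0 12 [ var #i ] then (load-triple ⨾ find-edge ⨾ edge-phase) else next-vertex

contract-step-loop-free : LoopFree contract-step
contract-step-loop-free = (_ , find-edge-loop-free , (_ , merge-phase-loop-free) , _) , _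

contract-all : Program
contract-all = while≢0 var #alive ⊖ lit 4 repeat contract-step

find-active : Program
find-active = while≢0 lit 1 ⊖ 12 [ var #i ] repeat next-vertex

bad-centre : Expr
bad-centre = 11 [ var #i ] ⊕ mat (var #p) (var #i) ⊕ mat (var #q) (var #i) ⊕ mat (var #r) (var #i) ⊖ lit 3

opaque

 change-centre : Program
 change-centre = if≢0 bad-centre
  then (#t ≔ var #i ⨾ #i ≔ var #p ⨾ #p ≔ var #q ⨾ #q ≔ var #r ⨾ #r ≔ var #t)
  else skip

 change-centre-loop-free : LoopFree change-centre
 change-centre-loop-free = _

opaque

 finish-star : Program
 finish-star =
  1 [ var #i ]≔ lit 1
  ⨾ 13 [ var #p ]≔ var #i ⨾ 13 [ var #q ]≔ var #i ⨾ 13 [ var #r ]≔ var #i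
  ⨾ #c₀ ≔ var #p ⨾ #c₁ ≔ var #q

 finish-star-loop-free : LoopFree finish-star
 finish-star-loop-free = _

make-star : Program
make-star = load-triple ⨾ change-centre ⨾ change-centre ⨾ change-centre ⨾ finish-star

make-star-loop-free : LoopFree make-star
make-star-loop-free = _ , change-centre-loop-free , change-centre-loop-free , change-centre-loop-free , finish-star-loop-free

infix 7 _≠_
_≠_ : Expr → Expr → Expr
e ≠ f = (e ⊖ f) ⊕ (f ⊖ e)

undo-step : Program
undo-step =
 (#k ≔ var #k ⊖ lit 1 ⨾ #i ≔ 14 [ var #k ] ⨾ #p ≔ 15 [ var #k ] ⨾ #q ≔ 16 [ var #k ])
 ⨾ (if≢0 13 [ var #i ] ≠ 17 [ var #k ]
  then (if≢0 13 [ var #i ] ≠ 18 [ var #k ] then skip else (#t ≔ var #p ⨾ #p ≔ var #q ⨾ #q ≔ var #t))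
  else (#t ≔ var #i ⨾ #i ≔ var #p ⨾ #p ≔ var #q ⨾ #q ≔ var #t))
 ⨾ 1 [ var #q ]≔ lit 1
 ⨾ 13 [ var #i ]≔ var #q ⨾ 13 [ var #p ]≔ var #q
 ⨾ #c₀ ≔ var #i ⨾ #c₁ ≔ var #p

undo-all : Program
undo-all = while≢0 var #k repeat undo-step

copy-vertex : Program
copy-vertex =
 2 [ var #v ]≔ 1 [ var #v ]
 ⨾ #deg ≔ var #deg ⊕ (lit 1 ⊖ 1 [ var #v ])
 ⨾ #v ≔ var #v ⊕ lit 1
 ⨾ #cnt ≔ var #cnt ⊖ lit 1

copy-internal : Program
copy-internal = (#v ≔ lit 0 ⨾ #cnt ≔ size-of-input ⨾ #deg ≔ lit 0) ⨾ while≢0 var #cnt repeat copy-vertex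

walk-step : Program
walk-step =
 1 [ var #c₀ ]≔ var #bit
 ⨾ 2 [ var #c₁ ]≔ var #bit
 ⨾ #t ≔ 6 [ var #c₁ ] ⊖ 13 [ var #c₁ ] ⊖ var #c₀
 ⨾ #c₀ ≔ var #c₁
 ⨾ #c₁ ≔ var #t
 ⨾ #bit ≔ lit 1 ⊖ var #bit
 ⨾ #deg ≔ var #deg ⊖ lit 1

walk-cycle : Program
walk-cycle = #bit ≔ lit 1 ⨾ while≢0 var #deg repeat walk-step

algorithm : Program
algorithm =
 read-input ⨾ contract-all ⨾ find-active ⨾ make-star ⨾ undo-all ⨾ copy-internal ⨾ walk-cycle

upd-hit : ∀ {i j x y : ℕ} → i ≡ j → (if i ≡ᵇ j then x else y) ≡ x
upd-hit {i} refl with i ≡ᵇ i | ℕ.≡⇒≡ᵇ i i refl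
... | true | _ = refl

upd-miss : ∀ {i j x y : ℕ} → i ≢ j → (if i ≡ᵇ j then x else y) ≡ y
upd-miss {i} {j} n with i ≡ᵇ j | ℕ.≡ᵇ⇒≡ i j
... | true  | f = contradiction (f tt) n
... | false | _ = refl

Alive : {V : Set} → (V → V → Set) → V → Set
Alive K v = ∃ λ w → K v w

module _ {V : Set} (_≟_ : DecidableEquality V) where

 redirect : V → V → V → V
 redirect d a w with w ≟ d
 ... | yes _ = a
 ... | no _  = w

 redirect-hit : ∀ d a → redirect d a d ≡ a
 redirect-hit d a with d ≟ d
 ... | yes _ = refl
 ... | no n  = contradiction refl n

 redirect-miss : ∀ {d a w} → w ≢ d → redirect d a w ≡ w
 redirect-miss {d} {a} {w} n with w ≟ d
 ... | yes p = contradiction p n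
 ... | no _  = refl

 map-redirect-∉ : ∀ {d a} xs → d ∉ xs → map (redirect d a) xs ≡ xs
 map-redirect-∉ []       _ = refl
 map-redirect-∉ (x ∷ xs) n = cong₂ _∷_ (redirect-miss (λ e → n (here (sym e)))) (map-redirect-∉ xs (n ∘ there))

 sum-redirect : ∀ (f : V → ℕ) {d a} xs → Unique xs → d ∈ xs → sum (map f (map (redirect d a) xs)) ≡ sum (map f xs) + f a ∸ f d
 sum-redirect f {d} {a} xs u d∈ = trans (sym (ℕ.m+n∸n≡m _ (f d))) (cong (_∸ f d) (sym (balance xs u d∈)))
  where
   shuffle′ : ∀ a b c → a + b + c ≡ c + b + a
   shuffle′ = solve-∀
   balance : ∀ xs → Unique xs → d ∈ xs → sum (map f xs) + f a ≡ sum (map f (map (redirect d a) xs)) + f d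
   balance (x ∷ xs) (p ∷ _) (here refl) rewrite redirect-hit d a | map-redirect-∉ {d} {a} xs (λ m → All.lookup p m refl) = shuffle′ (f d) (sum (map f xs)) (f a)
   balance (x ∷ xs) (p ∷ u) (there m) rewrite redirect-miss {d} {a} {x} (All.lookup p m) | ℕ.+-assoc (f x) (sum (map f xs)) (f a) | balance xs u m = sym (ℕ.+-assoc (f x) _ _)

 module _ {K : V → V → Set} (K-sym : Symmetric K) {a : V} {ds : List V} (a∈ : a ∈ ds) where

  nbrs-keep : ∀ {v xs} → v ∉ ds → (∀ {d} → d ∈ ds → K v d → d ≡ a) → Nbrs K v xs → Nbrs (Quot K a ds) v xs
  nbrs-keep {v} {xs} v∉ only n = nbrs (distinct n) (mk⇔ f b)
   where
    f : ∀ {w} → Quot K a ds v w → w ∈ xs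
    f (inl (_ , _ , k)) = to (members n) k
    f (inr (inl (refl , _))) = ⊥-elim (v∉ a∈)
    f (inr (inr (refl , _ , k))) with find k
    ... | d , d∈ , k′ with only d∈ (K-sym k′)
    ...   | refl = to (members n) (K-sym k′)
    b : ∀ {w} → w ∈ xs → Quot K a ds v w
    b {w} m with DecMem._∈?_ _≟_ w ds
    ... | no w∉ = inl (v∉ , w∉ , from (members n) m)
    ... | yes w∈ = inr (inr (only w∈ (from (members n) m) , v∉ , lose w∈ (K-sym (from (members n) m))))

  nbrs-redirect : ∀ {v xs d} → v ∉ ds → d ∈ ds → d ≢ a → K v d → (∀ {e} → e ∈ ds → K v e → e ≡ d) → Nbrs K v xs →
   Nbrs (Quot K a ds) v (map (redirect d a) xs)
  nbrs-redirect {v} {xs} {d} v∉ d∈ d≢a kd only n = nbrs (uniq-map xs (distinct n) (λ m → d≢a (sym (only a∈ (from (members n) m))))) (mk⇔ f b)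
   where
    uniq-map : ∀ xs → Unique xs → a ∉ xs → Unique (map (redirect d a) xs)
    uniq-map []       _ _ = []
    uniq-map (x ∷ xs) (p ∷ u) a∉ = All.tabulate g ∷ uniq-map xs u (a∉ ∘ there)
     where
      g : ∀ {w} → w ∈ map (redirect d a) xs → redirect d a x ≢ w
      g m e with ∈-map⁻ _ m
      ... | y , y∈ , refl with x ≟ d | y ≟ d
      ...   | yes refl | yes refl = All.lookup p y∈ refl
      ...   | yes refl | no _     = a∉ (there (subst (_∈ xs) (sym e) y∈))
      ...   | no _     | yes refl = a∉ (here (sym e))
      ...   | no _     | no _     = All.lookup p y∈ e
    f : ∀ {w} → Quot K a ds v w → w ∈ map (redirect d a) xs
    f {w} (inl (_ , w∉ , k)) = subst (_∈ map (redirect d a) xs) (redirect-miss (λ { refl → w∉ d∈ })) (∈-map⁺ _ (to (members n) k))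
    f (inr (inl (refl , _))) = ⊥-elim (v∉ a∈)
    f (inr (inr (refl , _ , _))) = subst (_∈ map (redirect d a) xs) (redirect-hit d a) (∈-map⁺ _ (to (members n) kd))
    b : ∀ {w} → w ∈ map (redirect d a) xs → Quot K a ds v w
    b m with ∈-map⁻ _ m
    ... | y , y∈ , refl with y ≟ d
    ...   | yes refl = inr (inr (refl , v∉ , lose d∈ (K-sym kd)))
    ...   | no y≢d   = inl (v∉ , (λ y∈ds → y≢d (only y∈ds (from (members n) y∈))) , from (members n) y∈)

  nbrs-drop : ∀ {v d xs ys} → v ∉ ds → d ∈ ds → d ≢ a → K v a → (∀ {e} → e ∈ ds → K v e → e ≢ a → e ≡ d) → Nbrs K v xs → xs ↭ d ∷ ys →
   Nbrs (Quot K a ds) v ys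
  nbrs-drop {v} {d} {xs} {ys} v∉ d∈ d≢a ka only n σ = nbrs (unique-tail u) (mk⇔ f b)
   where
    u : Unique (d ∷ ys)
    u = unique-resp-↭ σ (distinct n)
    in-ys : ∀ {w} → w ≢ d → K v w → w ∈ ys
    in-ys w≢ k with ∈-resp-↭ σ (to (members n) k)
    ... | here e  = ⊥-elim (w≢ e)
    ... | there m = m
    f : ∀ {w} → Quot K a ds v w → w ∈ ys
    f (inl (_ , w∉ , k)) = in-ys (λ { refl → w∉ d∈ }) k
    f (inr (inl (refl , _))) = ⊥-elim (v∉ a∈)
    f (inr (inr (refl , _))) = in-ys (≢-sym d≢a) ka
    b : ∀ {w} → w ∈ ys → Quot K a ds v w
    b {w} m with DecMem._∈?_ _≟_ w ds | from (members n) (∈-resp-↭ (↭-sym σ) (there m)) | w ≟ a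
    ... | no w∉  | k | _        = inl (v∉ , w∉ , k)
    ... | yes w∈ | k | yes refl = inr (inr (refl , v∉ , lose a∈ (K-sym ka)))
    ... | yes w∈ | k | no w≢a with only w∈ k w≢a
    ...   | refl = ⊥-elim (Uniq.Unique[x∷xs]⇒x∉xs u m)

module _ {V : Set} where

 Quot-alive : ∀ {K : V → V → Set} {a ds v} → Symmetric K → Alive (Quot K a ds) v → v ≡ a ⊎ (v ∉ ds × Alive K v)
 Quot-alive s (w , inl (v∉ , _ , k)) = inr (v∉ , w , k)
 Quot-alive s (w , inr (inl (e , _))) = inl e
 Quot-alive s (w , inr (inr (_ , v∉ , k))) = let d , _ , k′ = find k in inr (v∉ , d , s k′)

 Quot-sym : ∀ {K : V → V → Set} {a ds} → Symmetric K → Symmetric (Quot K a ds)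
 Quot-sym s (inl (p , w , k)) = inl (w , p , s k)
 Quot-sym s (inr (inl q)) = inr (inr q)
 Quot-sym s (inr (inr q)) = inr (inl q)

cell : ∀ {n} → Fin n → Fin n → ℕ
cell {n} u v = toℕ u * n + toℕ v

cell-injective : ∀ {n} {u v u′ v′ : Fin n} → cell u v ≡ cell u′ v′ → u ≡ u′ × v ≡ v′
cell-injective {n} {u} {v} {u′} {v′} e = combine-injective u v u′ v′ (toℕ-injective (trans (lem u v) (trans e (sym (lem u′ v′)))))
 where
  lem : ∀ u v → toℕ (combine u v) ≡ cell u v
  lem u v = trans (toℕ-combine u v) (cong (_+ toℕ v) (ℕ.*-comm n (toℕ u)))

module _ {n : ℕ} where

 hit : ∀ {u : Fin n} {x y} → (if toℕ u ≡ᵇ toℕ u then x else y) ≡ x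
 hit {u} = upd-hit {toℕ u} refl

 miss : ∀ {u v : Fin n} {x y} → v ≢ u → (if toℕ u ≡ᵇ toℕ v then x else y) ≡ y
 miss ne = upd-miss (λ e → ne (sym (toℕ-injective e)))

 missᵐ : ∀ {u v u′ v′ : Fin n} {x y} → (u ≡ u′ → v ≡ v′ → ⊥) → (if cell u′ v′ ≡ᵇ cell u v then x else y) ≡ y
 missᵐ ne = upd-miss (λ e → let p , q = cell-injective e in ne (sym p) (sym q))

 record Local (σ : Store) (K : Fin n → Fin n → Set) (v : Fin n) : Set where
  constructor local
  field
   nb     : List (Fin n)
   isNbrs : Nbrs K v nb
   degree : σ 4 (toℕ v) ≡ length nb
   total  : σ 5 (toℕ v) ≡ sum (map toℕ nb)
   triple : σ 12 (toℕ v) ≢ 0 → ∃₂ λ n₁ n₂ → ∃ λ n₃ → nb ≡ n₁ ∷ n₂ ∷ n₃ ∷ [] × σ 7 (toℕ v) ≡ toℕ n₁ × σ 8 (toℕ v) ≡ toℕ n₂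

 record Rep (σ : Store) (K : Fin n → Fin n → Set) : Set where
  field
   rows   : ∀ (u : Fin n) → σ 10 (toℕ u) ≡ toℕ u * n
   locals : ∀ {v : Fin n} → Alive K v → Local σ K v
   active : ∀ {v : Fin n} → σ 12 (toℕ v) ≢ 0 → Alive K v
   matrix : ∀ {u v : Fin n} → Alive K u → Alive K v → K u v ⇔ (σ 9 (cell u v) ≢ 0)
   names  : ∀ {v : Fin n} → Alive K v → σ 19 (toℕ v) ≡ toℕ v

module _ {n : ℕ} where

 local-same : ∀ {σ τ : Store} {K K′ : Fin n → Fin n → Set} {v} (l : Local σ K v) → Nbrs K′ v (Local.nb l) →
  τ 4 (toℕ v) ≡ σ 4 (toℕ v) → τ 5 (toℕ v) ≡ σ 5 (toℕ v) → τ 7 (toℕ v) ≡ σ 7 (toℕ v) →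
  τ 8 (toℕ v) ≡ σ 8 (toℕ v) → τ 12 (toℕ v) ≡ σ 12 (toℕ v) → Local τ K′ v
 local-same (local nb _ d s t) n′ e₄ e₅ e₇ e₈ e₁₂ = local nb n′ (trans e₄ d) (trans e₅ s)
  (λ ne → let n₁ , n₂ , n₃ , e , p , q = t (λ z → ne (trans e₁₂ z)) in n₁ , n₂ , n₃ , e , trans e₇ p , trans e₈ q)

 local-redirect : ∀ {σ τ : Store} {K K′ : Fin n → Fin n → Set} {v d a} (l : Local σ K v) → d ∈ Local.nb l →
  Nbrs K′ v (map (redirect Fin._≟_ d a) (Local.nb l)) →
  (∀ {w} → w ∈ Local.nb l → ∀ {m} → m ≡ toℕ w → τ 19 m ≡ toℕ (redirect Fin._≟_ d a w)) →
  τ 4 (toℕ v) ≡ σ 4 (toℕ v) → τ 5 (toℕ v) ≡ σ 5 (toℕ v) + toℕ a ∸ toℕ d → τ 7 (toℕ v) ≡ τ 19 (σ 7 (toℕ v)) →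
  τ 8 (toℕ v) ≡ τ 19 (σ 8 (toℕ v)) → τ 12 (toℕ v) ≡ σ 12 (toℕ v) → Local τ K′ v
 local-redirect {d = d} {a} (local nb nn dg s t) d∈ n′ ren e₄ e₅ e₇ e₈ e₁₂ =
  local _ n′ (trans e₄ (trans dg (sym (length-map _ nb))))
   (trans e₅ (trans (cong (λ z → z + toℕ a ∸ toℕ d) s) (sym (sum-redirect Fin._≟_ toℕ nb (distinct nn) d∈))))
   λ ne → let n₁ , n₂ , n₃ , e , p , q = t (λ z → ne (trans e₁₂ z)) in
          _ , _ , _ , cong (map (redirect Fin._≟_ d a)) e
            , trans e₇ (ren (subst (n₁ ∈_) (sym e) (here refl)) p)
            , trans e₈ (ren (subst (n₂ ∈_) (sym e) (there (here refl))) q)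

record Loaded₃ (σ : Store) (A P Q R B X rA rP rQ rB rX : ℕ) : Set where
 constructor loaded
 field
  eA : σ 3 5 ≡ A
  eP : σ 3 8 ≡ P
  eQ : σ 3 9 ≡ Q
  eR : σ 3 10 ≡ R
  eB : σ 3 12 ≡ B
  eX : σ 5 Q ∸ A ∸ P ≡ X
  ρA : σ 10 A ≡ rA
  ρP : σ 10 P ≡ rP
  ρQ : σ 10 Q ≡ rQ
  ρB : σ 10 B ≡ rB
  ρX : σ 10 X ≡ rX

rename₃ : Store → ℕ → ℕ → ℕ → ℕ → ℕ
rename₃ σ A P Q m = if Q ≡ᵇ m then A else (if P ≡ᵇ m then A else σ 19 m)

record Merged₃ (σ τ : Store) (A P Q R B X rA rP rQ rB rX : ℕ) : Set where
 field
  at-5 : ∀ {j} → τ 5 j ≡ (if A ≡ᵇ j then R + B + X else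
   (if X ≡ᵇ j then (if B ≡ᵇ X then σ 5 B + A ∸ P else σ 5 X) + A ∸ Q else
   (if B ≡ᵇ j then σ 5 B + A ∸ P else σ 5 j)))
  at-7 : ∀ {j} → τ 7 j ≡ (if A ≡ᵇ j then R else
   (if X ≡ᵇ j then rename₃ σ A P Q (if B ≡ᵇ X then rename₃ σ A P Q (σ 7 B) else σ 7 X) else
   (if B ≡ᵇ j then rename₃ σ A P Q (σ 7 B) else σ 7 j)))
  at-8 : ∀ {j} → τ 8 j ≡ (if A ≡ᵇ j then B else
   (if X ≡ᵇ j then rename₃ σ A P Q (if B ≡ᵇ X then rename₃ σ A P Q (σ 8 B) else σ 8 X) else
   (if B ≡ᵇ j then rename₃ σ A P Q (σ 8 B) else σ 8 j)))
  at-9 : ∀ {j} → τ 9 j ≡ (if rX + A ≡ᵇ j then 1 else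
   (if rB + A ≡ᵇ j then 1 else
   (if rA + X ≡ᵇ j then σ 11 Q + σ 9 (rA + Q) + σ 9 (rP + Q) ∸ 1 else
   (if rA + B ≡ᵇ j then σ 11 P + σ 9 (rA + P) + σ 9 (rQ + P) ∸ 1 else
   (if rA + R ≡ᵇ j then σ 11 A + σ 9 (rP + A) + σ 9 (rQ + A) ∸ 1 else σ 9 j)))))
  at-11 : ∀ {j} → τ 11 j ≡ (if A ≡ᵇ j then 1 else σ 11 j)
  at-12 : ∀ {j} → τ 12 j ≡ (if Q ≡ᵇ j then 0 else (if P ≡ᵇ j then 0 else σ 12 j))
  at-19 : ∀ {j} → τ 19 j ≡ rename₃ σ A P Q j
  at-4 : ∀ {j} → τ 4 j ≡ σ 4 j
  at-10 : ∀ {j} → τ 10 j ≡ σ 10 j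
  at-14 : ∀ {j} → τ 14 j ≡ (if σ 3 7 ≡ᵇ j then A else σ 14 j)
  at-15 : ∀ {j} → τ 15 j ≡ (if σ 3 7 ≡ᵇ j then P else σ 15 j)
  at-16 : ∀ {j} → τ 16 j ≡ (if σ 3 7 ≡ᵇ j then Q else σ 16 j)
  at-17 : ∀ {j} → τ 17 j ≡ (if σ 3 7 ≡ᵇ j then R else σ 17 j)
  at-18 : ∀ {j} → τ 18 j ≡ (if σ 3 7 ≡ᵇ j then B else σ 18 j)
  at-i : τ 3 5 ≡ σ 3 5
  at-k : τ 3 7 ≡ σ 3 7 + 1
  at-alive : τ 3 6 ≡ σ 3 6 ∸ 2
  at-0 : ∀ {j} → τ 0 j ≡ σ 0 j
  at-1 : ∀ {j} → τ 1 j ≡ σ 1 j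
  at-6 : ∀ {j} → τ 6 j ≡ σ 6 j
  at-13 : ∀ {j} → τ 13 j ≡ σ 13 j

opaque
 unfolding merge-three

 merged₃ : ∀ {σ A P Q R B X rA rP rQ rB rX} → Loaded₃ σ A P Q R B X rA rP rQ rB rX → Merged₃ σ (exec merge-three σ) A P Q R B X rA rP rQ rB rX
 merged₃ (loaded refl refl refl refl refl refl refl refl refl refl refl) = record
  { at-5 = refl ; at-7 = refl ; at-8 = refl ; at-9 = refl ; at-11 = refl ; at-12 = refl ; at-19 = refl ; at-4 = refl ; at-10 = refl ; at-14 = refl ; at-15 = refl ; at-16 = refl ; at-17 = refl ; at-18 = refl ; at-i = refl ; at-k = refl ; at-alive = refl ; at-0 = refl ; at-1 = refl ; at-6 = refl ; at-13 = refl }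

record Loaded₂ (σ : Store) (A P Q R B rA rP rB : ℕ) : Set where
 constructor loaded
 field
  eA : σ 3 5 ≡ A
  eP : σ 3 8 ≡ P
  eQ : σ 3 9 ≡ Q
  eR : σ 3 10 ≡ R
  eB : σ 3 12 ≡ B
  ρA : σ 10 A ≡ rA
  ρP : σ 10 P ≡ rP
  ρB : σ 10 B ≡ rB

rename₂ : Store → ℕ → ℕ → ℕ → ℕ
rename₂ σ A P m = if P ≡ᵇ m then A else σ 19 m

record Merged₂ (σ τ : Store) (A P Q R B rA rP rB : ℕ) : Set where
 field
  at-4 : ∀ {j} → τ 4 j ≡ (if Q ≡ᵇ j then σ 4 Q ∸ 1 else σ 4 j)
  at-5 : ∀ {j} → τ 5 j ≡ (if Q ≡ᵇ j then (if A ≡ᵇ Q then R + B + Q else (if B ≡ᵇ Q then σ 5 B + A ∸ P else σ 5 Q)) ∸ P else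
   (if A ≡ᵇ j then R + B + Q else
   (if B ≡ᵇ j then σ 5 B + A ∸ P else σ 5 j)))
  at-7 : ∀ {j} → τ 7 j ≡ (if A ≡ᵇ j then R else (if B ≡ᵇ j then rename₂ σ A P (σ 7 B) else σ 7 j))
  at-8 : ∀ {j} → τ 8 j ≡ (if A ≡ᵇ j then B else (if B ≡ᵇ j then rename₂ σ A P (σ 8 B) else σ 8 j))
  at-9 : ∀ {j} → τ 9 j ≡ (if rB + A ≡ᵇ j then 1 else
   (if rA + B ≡ᵇ j then 2 else
   (if rA + R ≡ᵇ j then 2 else
   (if rA + Q ≡ᵇ j then σ 9 (rA + Q) + σ 9 (rP + Q) ∸ 1 else σ 9 j))))
  at-11 : ∀ {j} → τ 11 j ≡ (if A ≡ᵇ j then 1 else σ 11 j)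
  at-12 : ∀ {j} → τ 12 j ≡ (if P ≡ᵇ j then 0 else σ 12 j)
  at-19 : ∀ {j} → τ 19 j ≡ rename₂ σ A P j
  at-10 : ∀ {j} → τ 10 j ≡ σ 10 j
  at-14 : ∀ {j} → τ 14 j ≡ (if σ 3 7 ≡ᵇ j then A else σ 14 j)
  at-15 : ∀ {j} → τ 15 j ≡ (if σ 3 7 ≡ᵇ j then P else σ 15 j)
  at-16 : ∀ {j} → τ 16 j ≡ (if σ 3 7 ≡ᵇ j then Q else σ 16 j)
  at-17 : ∀ {j} → τ 17 j ≡ (if σ 3 7 ≡ᵇ j then A else σ 17 j)
  at-18 : ∀ {j} → τ 18 j ≡ (if σ 3 7 ≡ᵇ j then A else σ 18 j)
  at-i : τ 3 5 ≡ σ 3 5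
  at-k : τ 3 7 ≡ σ 3 7 + 1
  at-alive : τ 3 6 ≡ σ 3 6 ∸ 1
  at-0 : ∀ {j} → τ 0 j ≡ σ 0 j
  at-1 : ∀ {j} → τ 1 j ≡ σ 1 j
  at-6 : ∀ {j} → τ 6 j ≡ σ 6 j
  at-13 : ∀ {j} → τ 13 j ≡ σ 13 j

opaque
 unfolding merge-two

 merged₂ : ∀ {σ A P Q R B rA rP rB} → Loaded₂ σ A P Q R B rA rP rB → Merged₂ σ (exec merge-two σ) A P Q R B rA rP rB
 merged₂ (loaded refl refl refl refl refl refl refl refl) = record
  { at-4 = refl ; at-5 = refl ; at-7 = refl ; at-8 = refl ; at-9 = refl ; at-11 = refl ; at-12 = refl ; at-19 = refl ; at-10 = refl ; at-14 = refl ; at-15 = refl ; at-16 = refl ; at-17 = refl ; at-18 = refl ; at-i = refl ; at-k = refl ; at-alive = refl ; at-0 = refl ; at-1 = refl ; at-6 = refl ; at-13 = refl }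

distinct₃ : ∀ {A : Set} {x y z : A} → Unique (x ∷ y ∷ z ∷ []) → x ≢ y × x ≢ z × y ≢ z
distinct₃ ((p ∷ q ∷ []) ∷ (r ∷ []) ∷ _) = p , q , r

module _ {n : ℕ} (σ : Store) {K : Fin n → Fin n → Set} (K-sym : Symmetric K) (K-irr : ∀ {v} → ¬ K v v) (rep : Rep σ K)
 {a b x α β : Fin n} (na : Nbrs K a (b ∷ x ∷ α ∷ [])) (nb : Nbrs K b (a ∷ x ∷ β ∷ [])) where

 open Rep rep

 private
  ab : K a b
  ab = from (members na) (here refl)
  ax : K a x
  ax = from (members na) (there (here refl))
  bx : K b x
  bx = from (members nb) (there (here refl))
  aα : K a α
  aα = from (members na) (there (there (here refl)))
  bβ : K b β
  bβ = from (members nb) (there (there (here refl)))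
  K≢ : ∀ {u w} → K u w → u ≢ w
  K≢ k refl = K-irr k

 module Merge₃-memory {ξ : Fin n} (nx : Nbrs K x (a ∷ b ∷ ξ ∷ [])) (outs : Unique (α ∷ β ∷ ξ ∷ []))
  (out-ds : ∀ {w} → w ∈ α ∷ β ∷ ξ ∷ [] → w ∉ a ∷ b ∷ x ∷ [])
  (outs-of-a : ∀ {w} → Quot K a (a ∷ b ∷ x ∷ []) a w ⇔ w ∈ α ∷ β ∷ ξ ∷ [])
  {τ : Store} (mg : Merged₃ σ τ (toℕ a) (toℕ b) (toℕ x) (toℕ α) (toℕ β) (toℕ ξ)
   (toℕ a * n) (toℕ b * n) (toℕ x * n) (toℕ β * n) (toℕ ξ * n))
  (a-deg : σ 4 (toℕ a) ≡ 3) (a-active : σ 12 (toℕ a) ≢ 0) where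

  open Merged₃ mg

  private
   ds : List (Fin n)
   ds = a ∷ b ∷ x ∷ []
   xξ : K x ξ
   xξ = from (members nx) (there (there (here refl)))
   β≢ξ : β ≢ ξ
   β≢ξ = snd (snd (distinct₃ outs))
   α≢β : α ≢ β
   α≢β = fst (distinct₃ outs)
   α≢ξ : α ≢ ξ
   α≢ξ = fst (snd (distinct₃ outs))
   β∉ : β ∉ ds
   β∉ = out-ds (there (here refl))
   ξ∉ : ξ ∉ ds
   ξ∉ = out-ds (there (there (here refl)))
   α∉ : α ∉ ds
   α∉ = out-ds (here refl)
   ≢a : ∀ {v} → v ∉ ds → v ≢ a
   ≢a n refl = n (here refl)
   ≢b : ∀ {v} → v ∉ ds → v ≢ b
   ≢b n refl = n (there (here refl))
   ≢x : ∀ {v} → v ∉ ds → v ≢ x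
   ≢x n refl = n (there (there (here refl)))
   into-b : ∀ {v} → v ∉ ds → K v b → v ≡ β
   into-b v∉ k with to (members nb) (K-sym k)
   ... | here e = ⊥-elim (≢a v∉ e)
   ... | there (here e) = ⊥-elim (≢x v∉ e)
   ... | there (there (here e)) = e
   into-x : ∀ {v} → v ∉ ds → K v x → v ≡ ξ
   into-x v∉ k with to (members nx) (K-sym k)
   ... | here e = ⊥-elim (≢a v∉ e)
   ... | there (here e) = ⊥-elim (≢b v∉ e)
   ... | there (there (here e)) = e
   into-a : ∀ {v} → v ∉ ds → K v a → v ≡ α
   into-a v∉ k with to (members na) (K-sym k)
   ... | here e = ⊥-elim (≢b v∉ e)
   ... | there (here e) = ⊥-elim (≢x v∉ e)
   ... | there (there (here e)) = e
   ren-other : ∀ {w m} → m ≡ toℕ w → Alive K w → w ≢ b → w ≢ x → τ 19 m ≡ toℕ w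
   ren-other refl al w≢b w≢x = trans at-19 (trans (miss w≢x) (trans (miss w≢b) (names al)))
   ren-b : ∀ {m} → m ≡ toℕ b → τ 19 m ≡ toℕ a
   ren-b refl = trans at-19 (trans (miss (K≢ bx)) (hit {u = b}))
   ren-x : ∀ {m} → m ≡ toℕ x → τ 19 m ≡ toℕ a
   ren-x refl = trans at-19 (hit {u = x})

  K′ : Fin n → Fin n → Set
  K′ = Quot K a ds

  active′ : ∀ {v} → v ∉ b ∷ x ∷ [] → τ 12 (toℕ v) ≡ σ 12 (toℕ v)
  active′ {v} v∉ = trans at-12 (trans (miss {u = x} {v} (λ { refl → v∉ (there (here refl)) })) (miss {u = b} {v} (λ { refl → v∉ (here refl) })))

  inactive′ : ∀ {v} → v ∈ b ∷ x ∷ [] → τ 12 (toℕ v) ≡ 0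
  inactive′ (here refl) = trans at-12 (trans (miss (K≢ bx)) (hit {u = b}))
  inactive′ (there (here refl)) = trans at-12 (hit {u = x})

  J-a : τ 11 (toℕ a) ≡ 1
  J-a = trans at-11 (hit {u = a})

  J-other : ∀ {v} → v ≢ a → τ 11 (toℕ v) ≡ σ 11 (toℕ v)
  J-other v≢a = trans at-11 (miss v≢a)

  private
   E≡ : ∀ {v} → v ∉ ds → τ 12 (toℕ v) ≡ σ 12 (toℕ v)
   E≡ v∉ = active′ (v∉ ∘ there)
   m-gen : ∀ {u v y} → (u ≡ ξ → v ≡ a → ⊥) → (u ≡ β → v ≡ a → ⊥) →
    (if cell a ξ ≡ᵇ cell u v then σ 11 (toℕ x) + σ 9 (cell a x) + σ 9 (cell b x) ∸ 1 else
     (if cell a β ≡ᵇ cell u v then σ 11 (toℕ b) + σ 9 (cell a b) + σ 9 (cell x b) ∸ 1 else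
     (if cell a α ≡ᵇ cell u v then σ 11 (toℕ a) + σ 9 (cell b a) + σ 9 (cell x a) ∸ 1 else σ 9 (cell u v)))) ≡ y →
    τ 9 (cell u v) ≡ y
   m-gen {u} {v} p q e = trans at-9 (trans (missᵐ {u = u} {v} {ξ} {a} p) (trans (missᵐ {u = u} {v} {β} {a} q) e))

  mat-aξ : τ 9 (cell a ξ) ≡ σ 11 (toℕ x) + σ 9 (cell a x) + σ 9 (cell b x) ∸ 1
  mat-aξ = m-gen {a} {ξ} (λ _ e → ≢a ξ∉ e) (λ _ e → ≢a ξ∉ e) (upd-hit {cell a ξ} refl)

  mat-aβ : τ 9 (cell a β) ≡ σ 11 (toℕ b) + σ 9 (cell a b) + σ 9 (cell x b) ∸ 1
  mat-aβ = m-gen {a} {β} (λ _ e → ≢a β∉ e) (λ _ e → ≢a β∉ e)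
   (trans (missᵐ {u = a} {β} {a} {ξ} (λ _ → β≢ξ)) (upd-hit {cell a β} refl))

  mat-aα : τ 9 (cell a α) ≡ σ 11 (toℕ a) + σ 9 (cell b a) + σ 9 (cell x a) ∸ 1
  mat-aα = m-gen {a} {α} (λ _ e → ≢a α∉ e) (λ _ e → ≢a α∉ e)
   (trans (missᵐ {u = a} {α} {a} {ξ} (λ _ → α≢ξ)) (trans (missᵐ {u = a} {α} {a} {β} (λ _ → α≢β)) (upd-hit {cell a α} refl)))

  mat-βa : τ 9 (cell β a) ≡ 1
  mat-βa = trans at-9 (trans (missᵐ {u = β} {a} {ξ} {a} (λ e _ → β≢ξ e)) (upd-hit {cell β a} refl))

  mat-ξa : τ 9 (cell ξ a) ≡ 1
  mat-ξa = trans at-9 (upd-hit {cell ξ a} refl)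

  mat-other : ∀ {u v} → (u ≡ a → v ∉ α ∷ β ∷ ξ ∷ []) → (v ≡ a → u ∉ β ∷ ξ ∷ []) → τ 9 (cell u v) ≡ σ 9 (cell u v)
  mat-other {u} {v} p q = m-gen {u} {v} (λ e e′ → q e′ (there (here e))) (λ e e′ → q e′ (here e))
   (trans (missᵐ {u = u} {v} {a} {ξ} (λ e e′ → p e (there (there (here e′)))))
   (trans (missᵐ {u = u} {v} {a} {β} (λ e e′ → p e (there (here e′))))
    (missᵐ {u = u} {v} {a} {α} (λ e e′ → p e (here e′)))))

  private
   ≢0 : ∀ {u w} → Alive K u → Alive K w → K u w → 1 ≤ σ 9 (cell u w)
   ≢0 au aw k = ℕ.n≢0⇒n>0 (to (matrix au aw) k)
   al : ∀ {u w} → K u w → Alive K u × Alive K w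
   al {u} {w} k = (w , k) , (u , K-sym k)
   pos : ∀ j {u v w y} → K u v → K w y → 1 ≤ j + σ 9 (cell u v) + σ 9 (cell w y) ∸ 1
   pos j {u} {v} {w} {y} k k′ = ℕ.∸-monoˡ-≤ 1 (ℕ.+-mono-≤ {1} (ℕ.≤-trans (≢0 (fst (al k)) (snd (al k)) k) (ℕ.m≤n+m _ j)) (≢0 (fst (al k′)) (snd (al k′)) k′))

   local-a : Local τ K′ a
   local-a = local (α ∷ β ∷ ξ ∷ []) (nbrs outs outs-of-a) (trans at-4 a-deg)
    (trans at-5 (trans (hit {u = a}) (solve₃ (toℕ α) (toℕ β) (toℕ ξ))))
    λ _ → α , β , ξ , refl , trans at-7 (hit {u = a}) , trans at-8 (hit {u = a})
    where
     solve₃ : ∀ p q r → p + q + r ≡ p + (q + (r + 0))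
     solve₃ = solve-∀

   local-β : Local τ K′ β
   local-β = local-redirect {τ = τ} (locals (b , K-sym bβ)) (to (members (Local.isNbrs (locals (b , K-sym bβ)))) (K-sym bβ))
    (nbrs-redirect Fin._≟_ K-sym (here refl) β∉ (there (here refl)) (≢-sym (K≢ ab)) (K-sym bβ) only (Local.isNbrs (locals (b , K-sym bβ))))
    rn at-4
    (trans at-5 (trans (miss (≢a β∉)) (trans (miss β≢ξ) (hit {u = β}))))
    (trans at-7 (trans (miss (≢a β∉)) (trans (miss β≢ξ) (trans (hit {u = β}) (sym at-19)))))
    (trans at-8 (trans (miss (≢a β∉)) (trans (miss β≢ξ) (trans (hit {u = β}) (sym at-19)))))
    (E≡ β∉)
    where
     only : ∀ {e} → e ∈ ds → K β e → e ≡ b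
     only (here refl) k = ⊥-elim (α≢β (sym (into-a β∉ k)))
     only (there (here refl)) k = refl
     only (there (there (here refl))) k = ⊥-elim (β≢ξ (into-x β∉ k))
     rn : ∀ {w} → w ∈ Local.nb (locals (b , K-sym bβ)) → ∀ {m} → m ≡ toℕ w → τ 19 m ≡ toℕ (redirect Fin._≟_ b a w)
     rn {w} w∈ e with w Fin.≟ b
     ... | yes refl = ren-b e
     ... | no w≢b = ren-other e (β , K-sym k) w≢b (λ { refl → β≢ξ (into-x β∉ k) })
      where k = from (members (Local.isNbrs (locals (b , K-sym bβ)))) w∈

   local-ξ : Local τ K′ ξ
   local-ξ = local-redirect {τ = τ} (locals (x , K-sym xξ)) (to (members (Local.isNbrs (locals (x , K-sym xξ)))) (K-sym xξ))
    (nbrs-redirect Fin._≟_ K-sym (here refl) ξ∉ (there (there (here refl))) (≢-sym (K≢ ax)) (K-sym xξ) only (Local.isNbrs (locals (x , K-sym xξ))))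
    rn at-4
    (trans at-5 (trans (miss (≢a ξ∉)) (trans (hit {u = ξ}) (cong (λ z → z + toℕ a ∸ toℕ x) (miss (≢-sym β≢ξ))))))
    (trans at-7 (trans (miss (≢a ξ∉)) (trans (hit {u = ξ}) (trans (cong (rename₃ σ (toℕ a) (toℕ b) (toℕ x)) (miss (≢-sym β≢ξ))) (sym at-19)))))
    (trans at-8 (trans (miss (≢a ξ∉)) (trans (hit {u = ξ}) (trans (cong (rename₃ σ (toℕ a) (toℕ b) (toℕ x)) (miss (≢-sym β≢ξ))) (sym at-19)))))
    (E≡ ξ∉)
    where
     only : ∀ {e} → e ∈ ds → K ξ e → e ≡ x
     only (here refl) k = ⊥-elim (α≢ξ (sym (into-a ξ∉ k)))
     only (there (here refl)) k = ⊥-elim (β≢ξ (sym (into-b ξ∉ k)))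
     only (there (there (here refl))) k = refl
     rn : ∀ {w} → w ∈ Local.nb (locals (x , K-sym xξ)) → ∀ {m} → m ≡ toℕ w → τ 19 m ≡ toℕ (redirect Fin._≟_ x a w)
     rn {w} w∈ e with w Fin.≟ x
     ... | yes refl = ren-x e
     ... | no w≢x = ren-other e (ξ , K-sym k) (λ { refl → β≢ξ (sym (into-b ξ∉ k)) }) w≢x
      where k = from (members (Local.isNbrs (locals (x , K-sym xξ)))) w∈

   local-other : ∀ {v} → v ∉ ds → v ≢ β → v ≢ ξ → Alive K v → Local τ K′ v
   local-other v∉ v≢β v≢ξ al = local-same {τ = τ} (locals al)
    (nbrs-keep Fin._≟_ K-sym (here refl) v∉ (λ { (here e) _ → e ; (there (here refl)) k → ⊥-elim (v≢β (into-b v∉ k)) ; (there (there (here refl))) k → ⊥-elim (v≢ξ (into-x v∉ k)) })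
     (Local.isNbrs (locals al)))
    at-4
    (trans at-5 (trans (miss (≢a v∉)) (trans (miss v≢ξ) (miss v≢β))))
    (trans at-7 (trans (miss (≢a v∉)) (trans (miss v≢ξ) (miss v≢β))))
    (trans at-8 (trans (miss (≢a v∉)) (trans (miss v≢ξ) (miss v≢β))))
    (E≡ v∉)

  rep₃ : Rep τ K′
  rep₃ = record
   { rows   = λ u → trans at-10 (rows u)
   ; locals = λ {v} al′ → loc (Quot-alive K-sym al′)
   ; active = act
   ; matrix = λ al al′ → mat′ (Quot-alive K-sym al) (Quot-alive K-sym al′)
   ; names  = λ al → nam (Quot-alive K-sym al)
   }
   where
    loc : ∀ {v} → v ≡ a ⊎ (v ∉ ds × Alive K v) → Local τ K′ v
    loc (inl refl) = local-a
    loc {v} (inr (v∉ , al)) with v Fin.≟ β | v Fin.≟ ξ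
    ... | yes refl | _ = local-β
    ... | no _ | yes refl = local-ξ
    ... | no p | no q = local-other v∉ p q al
    act : ∀ {v} → τ 12 (toℕ v) ≢ 0 → Alive K′ v
    act {v} ne with v Fin.≟ a | v ∈? (b ∷ x ∷ [])
     where _∈?_ = DecMem._∈?_ (Fin._≟_ {n})
    ... | yes refl | _ = α , from outs-of-a (here refl)
    ... | no _ | yes m = ⊥-elim (ne (inactive′ m))
    ... | no v≢a | no v∉ with active (λ z → ne (trans (active′ v∉) z))
    ...   | w , k with w ∈? ds
     where _∈?_ = DecMem._∈?_ (Fin._≟_ {n})
    ...     | no w∉ = w , inl ((λ { (here e) → v≢a e ; (there m) → v∉ m }) , w∉ , k)
    ...     | yes w∈ = a , inr (inr (refl , (λ { (here e) → v≢a e ; (there m) → v∉ m }) , lose w∈ (K-sym k)))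
    nam : ∀ {v} → v ≡ a ⊎ (v ∉ ds × Alive K v) → τ 19 (toℕ v) ≡ toℕ v
    nam (inl refl) = ren-other refl (b , ab) (K≢ ab) (K≢ ax)
    nam (inr (v∉ , al)) = ren-other refl al (≢b v∉) (≢x v∉)
    mat′ : ∀ {u v} → u ≡ a ⊎ (u ∉ ds × Alive K u) → v ≡ a ⊎ (v ∉ ds × Alive K v) → K′ u v ⇔ (τ 9 (cell u v) ≢ 0)
    mat′ {u} {v} (inl refl) (inl refl) = mk⇔
     (λ k → ⊥-elim (out-ds (to outs-of-a k) (here refl)))
     (λ ne → ⊥-elim (K-irr (from (matrix (b , ab) (b , ab)) (λ z → ne (trans (mat-other {a} {a} (λ _ m → out-ds m (here refl)) (λ _ m → out-ds (there m) (here refl))) z)))))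
    mat′ {u} {v} (inl refl) (inr (v∉ , alv)) = mk⇔ (λ k → f (to outs-of-a k)) (λ ne → b′ ne)
     where
      f : v ∈ α ∷ β ∷ ξ ∷ [] → τ 9 (cell a v) ≢ 0
      f (here refl) z = contradiction (subst (1 ≤_) (trans (sym mat-aα) z) (pos (σ 11 (toℕ a)) (K-sym ab) (K-sym ax))) λ ()
      f (there (here refl)) z = contradiction (subst (1 ≤_) (trans (sym mat-aβ) z) (pos (σ 11 (toℕ b)) ab (K-sym bx))) λ ()
      f (there (there (here refl))) z = contradiction (subst (1 ≤_) (trans (sym mat-aξ) z) (pos (σ 11 (toℕ x)) ax bx)) λ ()
      b′ : τ 9 (cell a v) ≢ 0 → K′ a v
      b′ ne with DecMem._∈?_ Fin._≟_ v (α ∷ β ∷ ξ ∷ [])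
      ... | yes m = from outs-of-a m
      ... | no m = inr (inl (refl , v∉ , here (from (matrix (b , ab) alv) (λ z → ne (trans (mat-other {a} {v} (λ _ → m) (λ e → ⊥-elim (≢a v∉ e))) z)))))
    mat′ {u} {v} (inr (u∉ , alu)) (inl refl) = mk⇔ (λ k → f (to outs-of-a (Quot-sym K-sym k))) (λ ne → b′ ne)
     where
      f : u ∈ α ∷ β ∷ ξ ∷ [] → τ 9 (cell u a) ≢ 0
      f (here refl) z = to (matrix alu (b , ab)) (K-sym aα) (trans (sym (mat-other {u} {a} (λ e → ⊥-elim (≢a u∉ e)) (λ { _ (here e) → α≢β e ; _ (there (here e)) → α≢ξ e }))) z)
      f (there (here refl)) z = case trans (sym mat-βa) z of λ ()
      f (there (there (here refl))) z = case trans (sym mat-ξa) z of λ ()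
      b′ : τ 9 (cell u a) ≢ 0 → K′ u a
      b′ ne with DecMem._∈?_ Fin._≟_ u (α ∷ β ∷ ξ ∷ [])
      ... | yes m = Quot-sym K-sym (from outs-of-a m)
      ... | no m = inr (inr (refl , u∉ , here (K-sym (from (matrix alu (b , ab)) (λ z → ne (trans (mat-other {u} {a} (λ e → ⊥-elim (≢a u∉ e)) (λ _ m′ → m (there m′))) z))))))
    mat′ {u} {v} (inr (u∉ , alu)) (inr (v∉ , alv)) = mk⇔ f (λ ne → inl (u∉ , v∉ , from (matrix alu alv) (λ z → ne (trans same z))))
     where
      same : τ 9 (cell u v) ≡ σ 9 (cell u v)
      same = mat-other {u} {v} (λ e → ⊥-elim (≢a u∉ e)) (λ e → ⊥-elim (≢a v∉ e))
      f : K′ u v → τ 9 (cell u v) ≢ 0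
      f (inl (_ , _ , k)) z = to (matrix alu alv) k (trans (sym same) z)
      f (inr (inl (e , _))) = ⊥-elim (≢a u∉ e)
      f (inr (inr (e , _))) = ⊥-elim (≢a v∉ e)

module _ {n : ℕ} (σ : Store) {K : Fin n → Fin n → Set} (K-sym : Symmetric K) (K-irr : ∀ {v} → ¬ K v v) (rep : Rep σ K)
 {a b x α β : Fin n} (na : Nbrs K a (b ∷ x ∷ α ∷ [])) (nb : Nbrs K b (a ∷ x ∷ β ∷ [])) where

 open Rep rep

 private
  ab : K a b
  ab = from (members na) (here refl)
  ax : K a x
  ax = from (members na) (there (here refl))
  bx : K b x
  bx = from (members nb) (there (here refl))
  aα : K a α
  aα = from (members na) (there (there (here refl)))
  bβ : K b β
  bβ = from (members nb) (there (there (here refl)))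
  K≢ : ∀ {u w} → K u w → u ≢ w
  K≢ k refl = K-irr k

 module Merge₂-memory (lx : Local σ K x) (x-deg : 4 ≤ length (Local.nb lx)) (outs : Unique (α ∷ β ∷ x ∷ []))
  (out-ds : ∀ {w} → w ∈ α ∷ β ∷ x ∷ [] → w ∉ a ∷ b ∷ [])
  (outs-of-a : ∀ {w} → Quot K a (a ∷ b ∷ []) a w ⇔ w ∈ α ∷ β ∷ x ∷ [])
  {τ : Store} (mg : Merged₂ σ τ (toℕ a) (toℕ b) (toℕ x) (toℕ α) (toℕ β) (toℕ a * n) (toℕ b * n) (toℕ β * n))
  (a-deg : σ 4 (toℕ a) ≡ 3) (a-active : σ 12 (toℕ a) ≢ 0) where

  open Merged₂ mg

  private
   ds : List (Fin n)
   ds = a ∷ b ∷ []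
   β≢x : β ≢ x
   β≢x = snd (snd (distinct₃ outs))
   α≢β : α ≢ β
   α≢β = fst (distinct₃ outs)
   α≢x : α ≢ x
   α≢x = fst (snd (distinct₃ outs))
   α∉ : α ∉ ds
   α∉ = out-ds (here refl)
   β∉ : β ∉ ds
   β∉ = out-ds (there (here refl))
   x∉ : x ∉ ds
   x∉ = out-ds (there (there (here refl)))
   ≢a : ∀ {v} → v ∉ ds → v ≢ a
   ≢a n refl = n (here refl)
   ≢b : ∀ {v} → v ∉ ds → v ≢ b
   ≢b n refl = n (there (here refl))
   into-b : ∀ {v} → v ∉ ds → K v b → v ≢ x → v ≡ β
   into-b v∉ k v≢x with to (members nb) (K-sym k)
   ... | here e = ⊥-elim (≢a v∉ e)
   ... | there (here e) = ⊥-elim (v≢x e)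
   ... | there (there (here e)) = e
   into-a : ∀ {v} → v ∉ ds → K v a → v ≢ x → v ≡ α
   into-a v∉ k v≢x with to (members na) (K-sym k)
   ... | here e = ⊥-elim (≢b v∉ e)
   ... | there (here e) = ⊥-elim (v≢x e)
   ... | there (there (here e)) = e
   ren-other : ∀ {w m} → m ≡ toℕ w → Alive K w → w ≢ b → τ 19 m ≡ toℕ w
   ren-other refl al w≢b = trans at-19 (trans (miss w≢b) (names al))
   ren-b : ∀ {m} → m ≡ toℕ b → τ 19 m ≡ toℕ a
   ren-b refl = trans at-19 (hit {u = b})

  K′ : Fin n → Fin n → Set
  K′ = Quot K a ds

  active′ : ∀ {v} → v ≢ b → τ 12 (toℕ v) ≡ σ 12 (toℕ v)
  active′ {v} v≢b = trans at-12 (miss {u = b} {v} v≢b)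

  inactive′ : τ 12 (toℕ b) ≡ 0
  inactive′ = trans at-12 (hit {u = b})

  J-a : τ 11 (toℕ a) ≡ 1
  J-a = trans at-11 (hit {u = a})

  J-other : ∀ {v} → v ≢ a → τ 11 (toℕ v) ≡ σ 11 (toℕ v)
  J-other v≢a = trans at-11 (miss v≢a)

  mat-βa : τ 9 (cell β a) ≡ 1
  mat-βa = trans at-9 (upd-hit {cell β a} refl)

  mat-aβ : τ 9 (cell a β) ≡ 2
  mat-aβ = trans at-9 (trans (missᵐ {u = a} {β} {β} {a} (λ _ → ≢a β∉)) (upd-hit {cell a β} refl))

  mat-aα : τ 9 (cell a α) ≡ 2
  mat-aα = trans at-9 (trans (missᵐ {u = a} {α} {β} {a} (λ _ → ≢a α∉)) (trans (missᵐ {u = a} {α} {a} {β} (λ _ → α≢β)) (upd-hit {cell a α} refl)))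

  mat-ax : τ 9 (cell a x) ≡ σ 9 (cell a x) + σ 9 (cell b x) ∸ 1
  mat-ax = trans at-9 (trans (missᵐ {u = a} {x} {β} {a} (λ _ → ≢a x∉)) (trans (missᵐ {u = a} {x} {a} {β} (λ _ → ≢-sym β≢x))
   (trans (missᵐ {u = a} {x} {a} {α} (λ _ → ≢-sym α≢x)) (upd-hit {cell a x} refl))))

  mat-other : ∀ {u v} → (u ≡ a → v ∉ α ∷ β ∷ x ∷ []) → (v ≡ a → u ≢ β) → τ 9 (cell u v) ≡ σ 9 (cell u v)
  mat-other {u} {v} p q = trans at-9 (trans (missᵐ {u = u} {v} {β} {a} (λ e e′ → q e′ e))
   (trans (missᵐ {u = u} {v} {a} {β} (λ e e′ → p e (there (here e′))))
   (trans (missᵐ {u = u} {v} {a} {α} (λ e e′ → p e (here e′)))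
    (missᵐ {u = u} {v} {a} {x} (λ e e′ → p e (there (there (here e′))))))))

  private
   local-a : Local τ K′ a
   local-a = local (α ∷ β ∷ x ∷ []) (nbrs outs outs-of-a) (trans at-4 (trans (miss (≢-sym (≢a x∉))) a-deg))
    (trans at-5 (trans (miss (≢-sym (≢a x∉))) (trans (hit {u = a}) (solve₃ (toℕ α) (toℕ β) (toℕ x)))))
    λ _ → α , β , x , refl , trans at-7 (hit {u = a}) , trans at-8 (hit {u = a})
    where
     solve₃ : ∀ p q r → p + q + r ≡ p + (q + (r + 0))
     solve₃ = solve-∀

   local-β : Local τ K′ β
   local-β = local-redirect {τ = τ} (locals (b , K-sym bβ)) (to (members (Local.isNbrs (locals (b , K-sym bβ)))) (K-sym bβ))
    (nbrs-redirect Fin._≟_ K-sym (here refl) β∉ (there (here refl)) (≢-sym (K≢ ab)) (K-sym bβ) only (Local.isNbrs (locals (b , K-sym bβ))))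
    rn (trans at-4 (miss β≢x))
    (trans at-5 (trans (miss β≢x) (trans (miss (≢a β∉)) (hit {u = β}))))
    (trans at-7 (trans (miss (≢a β∉)) (trans (hit {u = β}) (sym at-19))))
    (trans at-8 (trans (miss (≢a β∉)) (trans (hit {u = β}) (sym at-19))))
    (active′ (≢b β∉))
    where
     only : ∀ {e} → e ∈ ds → K β e → e ≡ b
     only (here refl) k = ⊥-elim (α≢β (sym (into-a β∉ k β≢x)))
     only (there (here refl)) k = refl
     rn : ∀ {w} → w ∈ Local.nb (locals (b , K-sym bβ)) → ∀ {m} → m ≡ toℕ w → τ 19 m ≡ toℕ (redirect Fin._≟_ b a w)
     rn {w} w∈ e with w Fin.≟ b
     ... | yes refl = ren-b e
     ... | no w≢b = ren-other e (β , K-sym k) w≢b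
      where k = from (members (Local.isNbrs (locals (b , K-sym bβ)))) w∈

   local-x : (l : Local σ K x) → 4 ≤ length (Local.nb l) → Local τ K′ x
   local-x (local xs nn dg tot tr) deg with ∈-∃++ (to (members nn) (K-sym bx))
   ... | as , bs , refl = local (as ++ bs)
    (nbrs-drop Fin._≟_ K-sym (here refl) x∉ (there (here refl)) (≢-sym (K≢ ab)) (K-sym ax)
     (λ { (here e) _ n → ⊥-elim (n e) ; (there (here e)) _ _ → e }) nn σ′)
    (trans at-4 (trans (hit {u = x}) (trans (cong (_∸ 1) dg) (cong (_∸ 1) (↭-length σ′)))))
    (trans at-5 (trans (hit {u = x}) (trans (cong (_∸ toℕ b) (trans (miss (≢a x∉)) (trans (miss (≢-sym β≢x)) tot)))
     (trans (cong (_∸ toℕ b) (sum-↭ (Perm.map⁺ toℕ σ′))) (ℕ.m+n∸m≡n (toℕ b) _)))))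
    (λ ne → let n₁ , n₂ , n₃ , e , _ = tr (λ z → ne (trans (active′ (≢b x∉)) z)) in
            contradiction (subst (4 ≤_) (cong length e) deg) λ { (s≤s (s≤s (s≤s ()))) })
    where
     σ′ : as ++ b ∷ bs ↭ b ∷ as ++ bs
     σ′ = shift b as bs

   local-other : ∀ {v} → v ∉ ds → v ≢ β → v ≢ x → Alive K v → Local τ K′ v
   local-other v∉ v≢β v≢x al = local-same {τ = τ} (locals al)
    (nbrs-keep Fin._≟_ K-sym (here refl) v∉ (λ { (here e) _ → e ; (there (here refl)) k → ⊥-elim (v≢β (into-b v∉ k v≢x)) }) (Local.isNbrs (locals al)))
    (trans at-4 (miss v≢x))
    (trans at-5 (trans (miss v≢x) (trans (miss (≢a v∉)) (miss v≢β))))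
    (trans at-7 (trans (miss (≢a v∉)) (miss v≢β)))
    (trans at-8 (trans (miss (≢a v∉)) (miss v≢β)))
    (active′ (≢b v∉))

   al : ∀ {u w} → K u w → Alive K u × Alive K w
   al {u} {w} k = (w , k) , (u , K-sym k)
   ≥1 : ∀ {u w} → K u w → 1 ≤ σ 9 (cell u w)
   ≥1 k = ℕ.n≢0⇒n>0 (to (matrix (fst (al k)) (snd (al k))) k)

  rep₂ : Rep τ K′
  rep₂ = record
   { rows   = λ u → trans at-10 (rows u)
   ; locals = λ al′ → loc (Quot-alive K-sym al′)
   ; active = act
   ; matrix = λ al al′ → mat′ (Quot-alive K-sym al) (Quot-alive K-sym al′)
   ; names  = λ al → nam (Quot-alive K-sym al)
   }
   where
    loc : ∀ {v} → v ≡ a ⊎ (v ∉ ds × Alive K v) → Local τ K′ v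
    loc (inl refl) = local-a
    loc {v} (inr (v∉ , al)) with v Fin.≟ β | v Fin.≟ x
    ... | yes refl | _ = local-β
    ... | no _ | yes refl = local-x lx x-deg
    ... | no p | no q = local-other v∉ p q al
    act : ∀ {v} → τ 12 (toℕ v) ≢ 0 → Alive K′ v
    act {v} ne with v Fin.≟ a | v Fin.≟ b
    ... | yes refl | _ = α , from outs-of-a (here refl)
    ... | no _ | yes refl = ⊥-elim (ne inactive′)
    ... | no v≢a | no v≢b with active (λ z → ne (trans (active′ v≢b) z))
    ...   | w , k with DecMem._∈?_ Fin._≟_ w ds
    ...     | no w∉ = w , inl ((λ { (here e) → v≢a e ; (there (here e)) → v≢b e }) , w∉ , k)
    ...     | yes w∈ = a , inr (inr (refl , (λ { (here e) → v≢a e ; (there (here e)) → v≢b e }) , lose w∈ (K-sym k)))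
    nam : ∀ {v} → v ≡ a ⊎ (v ∉ ds × Alive K v) → τ 19 (toℕ v) ≡ toℕ v
    nam (inl refl) = ren-other refl (b , ab) (K≢ ab)
    nam (inr (v∉ , al)) = ren-other refl al (≢b v∉)
    mat′ : ∀ {u v} → u ≡ a ⊎ (u ∉ ds × Alive K u) → v ≡ a ⊎ (v ∉ ds × Alive K v) → K′ u v ⇔ (τ 9 (cell u v) ≢ 0)
    mat′ {u} {v} (inl refl) (inl refl) = mk⇔
     (λ k → ⊥-elim (out-ds (to outs-of-a k) (here refl)))
     (λ ne → ⊥-elim (K-irr (from (matrix (b , ab) (b , ab)) (λ z → ne (trans (mat-other {a} {a} (λ _ m → out-ds m (here refl)) (λ _ e → β∉ (here (sym e)))) z)))))
    mat′ {u} {v} (inl refl) (inr (v∉ , alv)) = mk⇔ (λ k → f (to outs-of-a k)) (λ ne → b′ ne)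
     where
      f : v ∈ α ∷ β ∷ x ∷ [] → τ 9 (cell a v) ≢ 0
      f (here refl) z = case trans (sym mat-aα) z of λ ()
      f (there (here refl)) z = case trans (sym mat-aβ) z of λ ()
      f (there (there (here refl))) z = contradiction (subst (1 ≤_) (trans (sym mat-ax) z) (ℕ.∸-monoˡ-≤ 1 (ℕ.+-mono-≤ (≥1 ax) (≥1 bx)))) λ ()
      b′ : τ 9 (cell a v) ≢ 0 → K′ a v
      b′ ne with DecMem._∈?_ Fin._≟_ v (α ∷ β ∷ x ∷ [])
      ... | yes m = from outs-of-a m
      ... | no m = inr (inl (refl , v∉ , here (from (matrix (b , ab) alv) (λ z → ne (trans (mat-other {a} {v} (λ _ → m) (λ e → ⊥-elim (≢a v∉ e))) z)))))
    mat′ {u} {v} (inr (u∉ , alu)) (inl refl) = mk⇔ (λ k → f (to outs-of-a (Quot-sym K-sym k))) (λ ne → b′ ne)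
     where
      old : K u a → u ≢ β → τ 9 (cell u a) ≢ 0
      old k n z = to (matrix alu (b , ab)) k (trans (sym (mat-other {u} {a} (λ e → ⊥-elim (≢a u∉ e)) (λ _ → n))) z)
      f : u ∈ α ∷ β ∷ x ∷ [] → τ 9 (cell u a) ≢ 0
      f (here refl) = old (K-sym aα) α≢β
      f (there (here refl)) z = case trans (sym mat-βa) z of λ ()
      f (there (there (here refl))) = old (K-sym ax) (≢-sym β≢x)
      b′ : τ 9 (cell u a) ≢ 0 → K′ u a
      b′ ne with DecMem._∈?_ Fin._≟_ u (α ∷ β ∷ x ∷ [])
      ... | yes m = Quot-sym K-sym (from outs-of-a m)
      ... | no m = inr (inr (refl , u∉ , here (K-sym (from (matrix alu (b , ab)) (λ z → ne (trans (mat-other {u} {a} (λ e → ⊥-elim (≢a u∉ e)) (λ _ e → m (there (here e)))) z))))))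
    mat′ {u} {v} (inr (u∉ , alu)) (inr (v∉ , alv)) = mk⇔ f (λ ne → inl (u∉ , v∉ , from (matrix alu alv) (λ z → ne (trans same z))))
     where
      same : τ 9 (cell u v) ≡ σ 9 (cell u v)
      same = mat-other {u} {v} (λ e → ⊥-elim (≢a u∉ e)) (λ e → ⊥-elim (≢a v∉ e))
      f : K′ u v → τ 9 (cell u v) ≢ 0
      f (inl (_ , _ , k)) z = to (matrix alu alv) k (trans (sym same) z)
      f (inr (inl (e , _))) = ⊥-elim (≢a u∉ e)
      f (inr (inr (e , _))) = ⊥-elim (≢a v∉ e)

choose-zero : ∀ {A : Set} {c} {p q : A} → c ≡ 0 → choose c p q ≡ q
choose-zero refl = refl

choose-suc : ∀ {A : Set} {c} {p q : A} → c ≢ 0 → choose c p q ≡ p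
choose-suc {c = zero}  n = contradiction refl n
choose-suc {c = suc _} _ = refl

record SameArrays (σ τ : Store) : Set where
 field
  s-0  : ∀ j → τ 0 j ≡ σ 0 j
  s-1  : ∀ j → τ 1 j ≡ σ 1 j
  s-4  : ∀ j → τ 4 j ≡ σ 4 j
  s-5  : ∀ j → τ 5 j ≡ σ 5 j
  s-6  : ∀ j → τ 6 j ≡ σ 6 j
  s-7  : ∀ j → τ 7 j ≡ σ 7 j
  s-8  : ∀ j → τ 8 j ≡ σ 8 j
  s-9  : ∀ j → τ 9 j ≡ σ 9 j
  s-10 : ∀ j → τ 10 j ≡ σ 10 j
  s-11 : ∀ j → τ 11 j ≡ σ 11 j
  s-12 : ∀ j → τ 12 j ≡ σ 12 j
  s-13 : ∀ j → τ 13 j ≡ σ 13 j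
  s-14 : ∀ j → τ 14 j ≡ σ 14 j
  s-15 : ∀ j → τ 15 j ≡ σ 15 j
  s-16 : ∀ j → τ 16 j ≡ σ 16 j
  s-17 : ∀ j → τ 17 j ≡ σ 17 j
  s-18 : ∀ j → τ 18 j ≡ σ 18 j
  s-19 : ∀ j → τ 19 j ≡ σ 19 j

module _ {n : ℕ} where

 Adjacency : Set₁
 Adjacency = Fin n → Fin n → Set

 OkIn : Store → Fin n → Fin n → Set
 OkIn σ u v = σ 9 (cell u v) ≡ 1

 IntOkIn : Store → Fin n → Set
 IntOkIn σ v = σ 11 (toℕ v) ≡ 0

 LiftStep : (K Ok : Adjacency) (IOk : Fin n → Set) (K′ Ok′ : Adjacency) (IOk′ : Fin n → Set) (a b x α β : Fin n) → Set
 LiftStep K Ok IOk K′ Ok′ IOk′ a b x α β =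
  ∀ {t} → Good t → Fits t K′ → Compat Ok′ IOk′ t →
  ∃ λ y → Par t a y × (y ≡ α → Lifted K Ok IOk t b x a)
   × (y ≢ α → y ≡ β → Lifted K Ok IOk t a x b)
   × (y ≢ α → y ≢ β → Lifted K Ok IOk t a b x)

 -- The contractions recorded in arrays 14 to 18, from the graph G to the graph K.
 data Chain (σ : Store) (G : Adjacency) : ℕ → Adjacency → Adjacency → (Fin n → Set) → Set₁ where
  start : ∀ {Ok IOk} → Chain σ G 0 G Ok IOk
  step  : ∀ {k K Ok IOk K′ Ok′ IOk′ a b x α β} → Chain σ G k K Ok IOk →
   σ 14 k ≡ toℕ a → σ 15 k ≡ toℕ b → σ 16 k ≡ toℕ x → σ 17 k ≡ toℕ α → σ 18 k ≡ toℕ β →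
   LiftStep K Ok IOk K′ Ok′ IOk′ a b x α β → Chain σ G (suc k) K′ Ok′ IOk′

 Chain-cong : ∀ {σ τ G k K Ok IOk} → (∀ {j} → j < k → τ 14 j ≡ σ 14 j × τ 15 j ≡ σ 15 j × τ 16 j ≡ σ 16 j × τ 17 j ≡ σ 17 j × τ 18 j ≡ σ 18 j) →
  Chain σ G k K Ok IOk → Chain τ G k K Ok IOk
 Chain-cong e start = start
 Chain-cong e (step c p q r s t l) =
  let e₁ , e₂ , e₃ , e₄ , e₅ = e (ℕ.n<1+n _) in
  step (Chain-cong (λ j< → e (ℕ.m<n⇒m<1+n j<)) c) (trans e₁ p) (trans e₂ q) (trans e₃ r) (trans e₄ s) (trans e₅ t) l

 Chain-ok : ∀ {σ G k K} {Ok Ok′ : Adjacency} {IOk IOk′ : Fin n → Set} → (∀ {u v} → Ok′ u v → Ok u v) → (∀ {v} → IOk′ v → IOk v) →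
  Chain σ G k K Ok IOk → Chain σ G k K Ok′ IOk′
 Chain-ok f g start = start
 Chain-ok f g (step c p q r s t l) = step c p q r s t (λ gd ft (compat co ci) → l gd ft (compat (f ∘ co) (g ∘ ci)))

 record Inv (G : Adjacency) (S₀ : Fin n → ℕ) (σ : Store) : Set₁ where
  constructor mkInv
  field
   K      : Adjacency
   K-sym  : Symmetric K
   K-irr  : ∀ {v} → ¬ K v v
   t      : CutTree (Fin n)
   good-t : Good t
   fits-t : Fits t K
   comp-t : Compat (OkIn σ) (IntOkIn σ) t
   rep    : Rep σ K
   alive  : σ 3 6 ≡ length (verts t)
   scan   : ∀ {u v w} → K u v → K u w → K v w → ∃ λ e → e ∈ u ∷ v ∷ w ∷ [] × σ 12 (toℕ e) ≢ 0 × σ 3 5 ≤ toℕ e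
   chain  : Chain σ G (σ 3 7) K (OkIn σ) (IntOkIn σ)
   steps  : σ 3 7 + σ 3 6 ≤ n
   input  : σ 0 0 ≡ n
   sums   : ∀ v → σ 6 (toℕ v) ≡ S₀ v
   blank  : ∀ j → σ 1 j ≡ 0

 Rep-same : ∀ {σ τ} {K : Adjacency} → SameArrays σ τ → Rep σ K → Rep τ K
 Rep-same s r = record
  { rows   = λ u → trans (s-10 _) (rows u)
  ; locals = λ al → let local nb nn d t tr = locals al in
      local nb nn (trans (s-4 _) d) (trans (s-5 _) t)
        (λ ne → let a , b , c , e , p , q = tr (λ z → ne (trans (s-12 _) z)) in a , b , c , e , trans (s-7 _) p , trans (s-8 _) q)
  ; active = λ ne → active (λ z → ne (trans (s-12 _) z))
  ; matrix = λ al al′ → mk⇔ (λ k z → to (matrix al al′) k (trans (sym (s-9 _)) z)) (λ ne → from (matrix al al′) (λ z → ne (trans (s-9 _) z)))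
  ; names  = λ al → trans (s-19 _) (names al)
  }
  where open SameArrays s
        open Rep r

 Inv-same : ∀ {G S₀ σ τ} → SameArrays σ τ → τ 3 5 ≡ σ 3 5 → τ 3 6 ≡ σ 3 6 → τ 3 7 ≡ σ 3 7 → Inv G S₀ σ → Inv G S₀ τ
 Inv-same {G} {σ = σ} {τ} s e₅ e₆ e₇ i = record
  { K = K ; K-sym = K-sym ; K-irr = K-irr ; t = t ; good-t = good-t ; fits-t = fits-t
  ; comp-t = compat (λ p → trans (s-9 _) (parOk comp-t p)) (λ m → trans (s-11 _) (intOk comp-t m))
  ; rep = Rep-same s rep ; alive = trans e₆ alive
  ; scan = λ p q r → let e , m , ne , le = scan p q r in e , m , (λ z → ne (trans (sym (s-12 _)) z)) , subst (_≤ toℕ e) (sym e₅) le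
  ; chain = subst (λ k → Chain τ G k K (OkIn τ) (IntOkIn τ)) (sym e₇)
   (Chain-ok (λ p → trans (sym (s-9 _)) p) (λ p → trans (sym (s-11 _)) p)
    (Chain-cong (λ {j} _ → s-14 j , s-15 j , s-16 j , s-17 j , s-18 j) chain))
  ; steps = subst₂ (λ a b → a + b ≤ n) (sym e₇) (sym e₆) steps
  ; input = trans (s-0 _) input ; sums = λ v → trans (s-6 _) (sums v) ; blank = λ j → trans (s-1 j) (blank j)
  }
  where open SameArrays s
        open Inv i

 Nbrs-↭ : ∀ {K : Adjacency} {v xs ys} → xs ↭ ys → Nbrs K v xs → Nbrs K v ys
 Nbrs-↭ σ n = nbrs (unique-resp-↭ σ (distinct n)) (mk⇔ (∈-resp-↭ σ ∘ to (members n)) (from (members n) ∘ ∈-resp-↭ (↭-sym σ)))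

 complete-triple : ∀ {K : Adjacency} {v xs p q} → Nbrs K v xs → length xs ≡ 3 → K v p → K v q → p ≢ q →
  ∃ λ r → xs ↭ p ∷ q ∷ r ∷ []
 complete-triple {xs = xs} {p} {q} nb len kp kq p≢q with ∈-∃++ (to (members nb) kp)
 ... | as , bs , refl with ∈-resp-↭ (shift p as bs) (to (members nb) kq)
 ...   | here e = ⊥-elim (p≢q (sym e))
 ...   | there m with ∈-∃++ m
 ...     | cs , ds , eq = last-one (cs ++ ds) (↭-trans (shift p as bs) (prep p (↭-trans (↭-reflexive eq) (shift q cs ds))))
  where
   last-one : ∀ zs → as ++ p ∷ bs ↭ p ∷ q ∷ zs → ∃ λ r → as ++ p ∷ bs ↭ p ∷ q ∷ r ∷ []
   last-one (r ∷ [])     σ = r , σ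
   last-one []           σ = case trans (sym len) (↭-length σ) of λ ()
   last-one (_ ∷ _ ∷ _)  σ = case trans (sym len) (↭-length σ) of λ ()

 third-neighbour : ∀ {p q r : Fin n} {xs s} → xs ↭ p ∷ q ∷ r ∷ [] → s ≡ sum (map toℕ xs) → s ∸ toℕ p ∸ toℕ q ≡ toℕ r
 third-neighbour {p} {q} {r} σ refl = trans (cong (λ s → s ∸ toℕ p ∸ toℕ q) (sum-↭ (Perm.map⁺ toℕ σ)))
  (trans (cong (_∸ toℕ q) (ℕ.m+n∸m≡n (toℕ p) _)) (trans (ℕ.m+n∸m≡n (toℕ q) _) (ℕ.+-identityʳ _)))

 min-degree : ∀ {t : CutTree (Fin n)} {K v xs} → Good t → Fits t K → Nbrs K v xs → Alive K v → 3 ≤ length xs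
 min-degree {t} {K} {v} g f nb (w , k) with leaf-or-int t (fst (Adj-∈ t (from f k)))
 ... | inl l = ℕ.≤-reflexive (sym (leaf-degree g f l nb))
 ... | inr i with cut-at-int g i
 ...   | c , cs , s , e with cs | good-≃ e g | Nbrs-length nb (int-nbrs {K = K} (good-≃ e g) (Fits-≃ e f))
 ...     | []    | good _ ((w , _) , _) _ | _ = contradiction refl w
 ...     | _ ∷ _ | _ | len = subst (3 ≤_) (sym len) (s≤s (s≤s (s≤s z≤n)))

 -- Only the hub of a fan can have more than three neighbours.
 some-degree-three : ∀ {t : CutTree (Fin n)} {K : Adjacency} {a p q xs ys} → Good t → 5 ≤ length (verts t) → Fits t K →
  K a p → K a q → K p q → Nbrs K p xs → Nbrs K q ys → length xs ≢ 3 → length ys ≡ 3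
 some-degree-three {t} {K} {a} {p} {q} g h f ap aq pq np nq len with triangle-fan g (≥4-leaves t (isWF g) h) (from f ap) (from f aq) (from f pq)
 ... | fanOn {z} {l} {r} (rest , s , e) σ = go (∈-resp-↭ (↭-sym σ) (there (here refl))) (∈-resp-↭ (↭-sym σ) (there (there (here refl))))
  where
   leafL : ∀ {w} → w ∈ l ∷ r ∷ [] → w ∈ Lvs t
   leafL (here refl) = ∈-resp-↭ (↭-sym (lvs↭ e)) (here refl)
   leafL (there (here refl)) = ∈-resp-↭ (↭-sym (lvs↭ e)) (there (here refl))
   go : p ∈ z ∷ l ∷ r ∷ [] → q ∈ z ∷ l ∷ r ∷ [] → _
   go _ (there m) = leaf-degree g f (leafL m) nq
   go (there m) _ = ⊥-elim (len (leaf-degree g f (leafL m) np))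
   go (here refl) (here refl) = ⊥-elim (Adj-irrefl g (from f pq))

pay : ∀ C {m m′} → m′ < m → C + C * m′ ≤ C * m
pay C {m} {m′} lt = ℕ.≤-trans (ℕ.≤-reflexive (sym (ℕ.*-suc C m′))) (ℕ.*-monoʳ-≤ C lt)

≡-⇔ : ∀ {A : Set} {x y z : A} → x ≡ y → y ≡ z ⇔ x ≡ z
≡-⇔ e = mk⇔ (trans e) (trans (sym e))

sum-is-one⁻ : ∀ j p q → 1 ≤ p → 1 ≤ q → j + p + q ∸ 1 ≡ 1 → j ≡ 0 × p ≡ 1 × q ≡ 1
sum-is-one⁻ zero (suc zero) (suc zero) _ _ _ = refl , refl , refl
sum-is-one⁻ zero (suc zero) (suc (suc q)) _ _ ()
sum-is-one⁻ zero (suc (suc p)) (suc q) _ _ e rewrite ℕ.+-suc p q = case e of λ ()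
sum-is-one⁻ (suc j) (suc p) (suc q) _ _ e rewrite ℕ.+-suc j p | ℕ.+-suc (j + p) q = case e of λ ()

sum-is-one⁺ : ∀ {j p q} → j ≡ 0 × p ≡ 1 × q ≡ 1 → j + p + q ∸ 1 ≡ 1
sum-is-one⁺ (refl , refl , refl) = refl

Quot-irrefl : ∀ {V : Set} {K : V → V → Set} {a ds} → (∀ {v} → ¬ K v v) → a ∈ ds → ∀ {v} → ¬ Quot K a ds v v
Quot-irrefl irr a∈ (inl (_ , _ , k)) = irr k
Quot-irrefl irr a∈ (inr (inl (refl , n , _))) = n a∈
Quot-irrefl irr a∈ (inr (inr (refl , n , _))) = n a∈

module _ {n : ℕ} {G : Fin n → Fin n → Set} {S₀ : Fin n → ℕ} where

 Quot-scan : ∀ {K : Fin n → Fin n → Set} {a ds i} {A A′ : Fin n → Set} → a ∈ ds → i ≤ toℕ a → A′ a → (∀ {v} → v ∉ ds → A v → A′ v) →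
  (∀ {u v w} → K u v → K u w → K v w → ∃ λ e → e ∈ u ∷ v ∷ w ∷ [] × A e × i ≤ toℕ e) →
  ∀ {u v w} → Quot K a ds u v → Quot K a ds u w → Quot K a ds v w → ∃ λ e → e ∈ u ∷ v ∷ w ∷ [] × A′ e × i ≤ toℕ e
 Quot-scan {a = a} a∈ le act keep scan {u} {v} {w} (inl (u∉ , v∉ , k)) (inl (_ , w∉ , k′)) (inl (_ , _ , k″)) with scan k k′ k″
 ... | e , m , ae , le′ = e , m , keep (λ e∈ → out m e∈) ae , le′
  where
   out : ∀ {x} → x ∈ u ∷ v ∷ w ∷ [] → x ∉ _
   out (here refl) = u∉
   out (there (here refl)) = v∉
   out (there (there (here refl))) = w∉
 Quot-scan a∈ le act keep scan (inr (inl (refl , _))) _ _ = _ , here refl , act , le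
 Quot-scan a∈ le act keep scan (inr (inr (refl , _))) _ _ = _ , there (here refl) , act , le
 Quot-scan a∈ le act keep scan (inl _) (inr (inl (refl , _))) _ = _ , here refl , act , le
 Quot-scan a∈ le act keep scan (inl _) (inr (inr (refl , _))) _ = _ , there (there (here refl)) , act , le
 Quot-scan a∈ le act keep scan (inl _) (inl _) (inr (inl (refl , _))) = _ , there (here refl) , act , le
 Quot-scan a∈ le act keep scan (inl _) (inl _) (inr (inr (refl , _))) = _ , there (there (here refl)) , act , le

 record Triangle (σ : Store) (inv : Inv G S₀ σ) (a b x α : Fin n) : Set where
  open Inv inv
  field
   enough : 5 ≤ length (verts t)
   na     : Nbrs K a (b ∷ x ∷ α ∷ [])
   bx     : K b x
   b-deg  : σ 4 (toℕ b) ≡ 3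
   a-act  : σ 12 (toℕ a) ≢ 0
   at-a   : σ 3 5 ≡ toℕ a
   at-b   : σ 3 8 ≡ toℕ b
   at-x   : σ 3 9 ≡ toℕ x
   at-α   : σ 3 10 ≡ toℕ α
   at-β   : σ 3 12 ≡ σ 5 (toℕ b) ∸ toℕ a ∸ toℕ x

 Progress : Store → Store → Set₁
 Progress σ τ = Inv G S₀ τ × τ 3 5 ≡ σ 3 5 × τ 3 6 < σ 3 6

 module _ {σ : Store} {inv : Inv G S₀ σ} {a b x α : Fin n} (tri : Triangle σ inv a b x α) where
  open Inv inv
  open Triangle tri
  open Rep rep

  private
   ab : K a b
   ab = from (members na) (here refl)
   ax : K a x
   ax = from (members na) (there (here refl))
   lb : Local σ K b
   lb = locals (a , K-sym ab)
   lx : Local σ K x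
   lx = locals (a , K-sym ax)
   third-b : ∃ λ β → Local.nb lb ↭ a ∷ x ∷ β ∷ []
   third-b = complete-triple (Local.isNbrs lb) (trans (sym (Local.degree lb)) b-deg) (K-sym ab) bx (λ { refl → K-irr ax })
   β : Fin n
   β = fst third-b
   nb : Nbrs K b (a ∷ x ∷ β ∷ [])
   nb = Nbrs-↭ (snd third-b) (Local.isNbrs lb)
   at-β′ : σ 3 12 ≡ toℕ β
   at-β′ = trans at-β (third-neighbour (snd third-b) (Local.total lb))
   a-deg : σ 4 (toℕ a) ≡ 3
   a-deg = let l = locals (b , ab) in trans (Local.degree l) (Nbrs-length (Local.isNbrs l) na)
   ≥1 : ∀ {u w} → K u w → 1 ≤ σ 9 (cell u w)
   ≥1 {u} {w} k = ℕ.n≢0⇒n>0 (to (matrix (w , k) (u , K-sym k)) k)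
   k<n : ∀ {d m} → 1 ≤ d → d ≤ σ 3 6 → m ≡ σ 3 6 ∸ d → σ 3 7 + 1 + m ≤ n
   k<n {d} {m} 1≤d d≤ refl = ℕ.≤-trans (ℕ.≤-reflexive (ℕ.+-assoc (σ 3 7) 1 _)) (ℕ.≤-trans (ℕ.+-monoʳ-≤ (σ 3 7)
    (ℕ.≤-trans (ℕ.+-monoˡ-≤ (σ 3 6 ∸ d) 1≤d) (ℕ.≤-reflexive (ℕ.m+[n∸m]≡n d≤)))) steps)
   5≤ : 5 ≤ σ 3 6
   5≤ = subst (5 ≤_) (sym alive) enough

  progress₃ : ∀ {τ} → (∀ {A P Q R B X rA rP rQ rB rX} → Loaded₃ σ A P Q R B X rA rP rQ rB rX → Merged₃ σ τ A P Q R B X rA rP rQ rB rX) →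
   length (Local.nb lx) ≡ 3 → Progress σ τ
  progress₃ {τ} merged len with complete-triple (Local.isNbrs lx) len (K-sym ax) (K-sym bx) (λ { refl → K-irr ab })
  ... | ξ , πx = inv′ , at-i , subst (_< σ 3 6) (sym at-alive) (ℕ.∸-monoʳ-< {σ 3 6} {2} {0} (s≤s z≤n) (ℕ.≤-trans (s≤s (s≤s z≤n)) 5≤))
   where
    ds : List (Fin n)
    ds = a ∷ b ∷ x ∷ []
    nx : Nbrs K x (a ∷ b ∷ ξ ∷ [])
    nx = Nbrs-↭ πx (Local.isNbrs lx)
    mg : Merged₃ σ τ (toℕ a) (toℕ b) (toℕ x) (toℕ α) (toℕ β) (toℕ ξ) (toℕ a * n) (toℕ b * n) (toℕ x * n) (toℕ β * n) (toℕ ξ * n)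
    mg = merged (loaded at-a at-b at-x at-α at-β′ (third-neighbour πx (Local.total lx)) (rows a) (rows b) (rows x) (rows β) (rows ξ))
    open Merged₃ mg
    module Free = Merge₃ K-sym K-irr na nb {λ _ _ → ⊤} {λ _ _ → ⊤} {λ _ → ⊤} {λ _ → ⊤} nx
     (λ _ _ _ → mk⇔ id id) (λ _ → mk⇔ id id) (mk⇔ (λ _ → tt) (λ _ → tt , tt , tt)) (mk⇔ (λ _ → tt) (λ _ → tt , tt , tt)) (mk⇔ (λ _ → tt) (λ _ → tt , tt , tt))
    outs : Unique (α ∷ β ∷ ξ ∷ [])
    outs = snd (snd (snd (Free.contract₃ good-t enough fits-t (compat (λ _ → tt) (λ _ → tt)))))
    module Mem = Merge₃-memory σ K-sym K-irr rep na nb nx outs Free.outside-ds Free.outs-of-a mg a-deg a-act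
    ≢a : ∀ {v} → v ∉ ds → v ≢ a
    ≢a n refl = n (here refl)
    okay : ∀ {j p q u v w y m} → K u v → K w y → m ≡ j + σ 9 (cell u v) + σ 9 (cell w y) ∸ 1 → p ≡ σ 9 (cell u v) → q ≡ σ 9 (cell w y) →
     (j ≡ 0 × p ≡ 1 × q ≡ 1) ⇔ (m ≡ 1)
    okay {j} k k′ refl refl refl = mk⇔ sum-is-one⁺ (sum-is-one⁻ j _ _ (≥1 k) (≥1 k′))
    module Tree = Merge₃ K-sym K-irr na nb {OkIn σ} {OkIn τ} {IntOkIn σ} {IntOkIn τ} nx
     (λ {p} {y} p∉ y∉ k → ≡-⇔ (Mem.mat-other {p} {y} (λ q → ⊥-elim (≢a p∉ q)) (λ q → ⊥-elim (≢a y∉ q))))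
     (λ y∉ → ≡-⇔ (Mem.J-other (≢a y∉)))
     (okay (K-sym ab) (K-sym ax) Mem.mat-aα refl refl)
     (okay ab (K-sym bx) Mem.mat-aβ refl refl)
     (okay ax bx Mem.mat-aξ refl refl)
    K′ : Fin n → Fin n → Set
    K′ = Quot K a ds
    contraction : ∃ λ m → length (verts t) ≡ 2 + m × Contracted K′ (OkIn τ) (IntOkIn τ) a m × Unique (α ∷ β ∷ ξ ∷ [])
    contraction = Tree.contract₃ good-t enough fits-t comp-t
    open Contracted (fst (snd (snd contraction)))
    lift : LiftStep K (OkIn σ) (IntOkIn σ) K′ (OkIn τ) (IntOkIn τ) a b x α β
    lift g f c = Tree.lift₃ Fin._≟_ g f c (λ z → case trans (sym Mem.J-a) z of λ ())
    inv′ : Inv G S₀ τ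
    inv′ = record
     { K = K′ ; K-sym = Quot-sym K-sym ; K-irr = Quot-irrefl {K = K} K-irr (here refl)
     ; t = tree ; good-t = isGood ; fits-t = fits ; comp-t = comp
     ; rep = Mem.rep₃
     ; alive = trans at-alive (trans (cong (_∸ 2) (trans alive (fst (snd contraction)))) count)
     ; scan = λ {u} {v} {w} p q r → subst (λ i → ∃ λ e → e ∈ u ∷ v ∷ w ∷ [] × τ 12 (toℕ e) ≢ 0 × i ≤ toℕ e) (sym at-i)
      (Quot-scan {A = λ e → σ 12 (toℕ e) ≢ 0} {λ e → τ 12 (toℕ e) ≢ 0} (here refl) (ℕ.≤-reflexive at-a)
       (λ z → a-act (trans (sym (Mem.active′ (λ { (here e) → K-irr (subst (K a) (sym e) ab) ; (there (here e)) → K-irr (subst (K a) (sym e) ax) }))) z))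
       (λ v∉ ne z → ne (trans (sym (Mem.active′ (v∉ ∘ there))) z)) scan p q r)
     ; chain = subst (λ k → Chain τ G k K′ (OkIn τ) (IntOkIn τ)) (sym (trans at-k (ℕ.+-comm (σ 3 7) 1)))
      (step (Chain-cong (λ j< → let ne = λ e → ℕ.<⇒≢ j< (sym e) in
               trans at-14 (upd-miss ne) , trans at-15 (upd-miss ne) , trans at-16 (upd-miss ne) , trans at-17 (upd-miss ne) , trans at-18 (upd-miss ne)) chain)
        (trans at-14 (upd-hit {σ 3 7} refl)) (trans at-15 (upd-hit {σ 3 7} refl)) (trans at-16 (upd-hit {σ 3 7} refl))
        (trans at-17 (upd-hit {σ 3 7} refl)) (trans at-18 (upd-hit {σ 3 7} refl)) lift)
     ; steps = subst (λ k → k + τ 3 6 ≤ n) (sym at-k) (k<n {2} (s≤s z≤n) (ℕ.≤-trans (s≤s (s≤s z≤n)) 5≤) at-alive)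
     ; input = trans at-0 input ; sums = λ v → trans at-6 (sums v) ; blank = λ j → trans at-1 (blank j)
     }

  progress₂ : ∀ {τ} → (∀ {A P Q R B rA rP rB} → Loaded₂ σ A P Q R B rA rP rB → Merged₂ σ τ A P Q R B rA rP rB) →
   4 ≤ length (Local.nb lx) → Progress σ τ
  progress₂ {τ} merged len = inv′ , at-i , subst (_< σ 3 6) (sym at-alive) (ℕ.∸-monoʳ-< {σ 3 6} {1} {0} (s≤s z≤n) (ℕ.≤-trans (s≤s z≤n) 5≤))
   where
    ds : List (Fin n)
    ds = a ∷ b ∷ []
    mg : Merged₂ σ τ (toℕ a) (toℕ b) (toℕ x) (toℕ α) (toℕ β) (toℕ a * n) (toℕ b * n) (toℕ β * n)
    mg = merged (loaded at-a at-b at-x at-α at-β′ (rows a) (rows b) (rows β))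
    open Merged₂ mg
    ab≢ : a ≢ b
    ab≢ e = K-irr (subst (K a) (sym e) ab)
    α≢x : α ≢ x
    α≢x e = snd (snd (distinct₃ (distinct na))) (sym e)
    β≢x : β ≢ x
    β≢x e = snd (snd (distinct₃ (distinct nb))) (sym e)
    TrivOk : Fin n → Fin n → Set
    TrivOk p y = p ≡ a → y ≡ x
    module Plain = Merge₂ K-sym K-irr na nb {λ _ _ → ⊤} {TrivOk} {λ _ → ⊤} {λ _ → ⊤}
     (λ p∉ _ _ → mk⇔ (λ _ e → ⊥-elim (p∉ (here e))) (λ _ → tt)) (λ _ → mk⇔ id id)
     (λ o → α≢x (o refl)) (λ o → β≢x (o refl)) (mk⇔ (λ _ _ → refl) (λ _ → tt , tt))
    outs : Unique (α ∷ β ∷ x ∷ [])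
    outs = snd (snd (snd (Plain.contract₂ good-t enough fits-t (compat (λ _ → tt) (λ _ → tt)) (Local.isNbrs lx) len)))
    module Mem = Merge₂-memory σ K-sym K-irr rep na nb lx len outs Plain.outside-ds Plain.outs-of-a mg a-deg a-act
    ≢a : ∀ {v} → v ∉ ds → v ≢ a
    ≢a n refl = n (here refl)
    okay : ∀ {p q m} → m ≡ σ 9 (cell a x) + σ 9 (cell b x) ∸ 1 → p ≡ σ 9 (cell a x) → q ≡ σ 9 (cell b x) → (p ≡ 1 × q ≡ 1) ⇔ (m ≡ 1)
    okay refl refl refl = mk⇔ (λ { (p , q) → sum-is-one⁺ {0} (refl , p , q) }) (snd ∘ sum-is-one⁻ 0 _ _ (≥1 ax) (≥1 bx))
    module Tree = Merge₂ K-sym K-irr na nb {OkIn σ} {OkIn τ} {IntOkIn σ} {IntOkIn τ}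
     (λ {p} {y} p∉ y∉ k → ≡-⇔ (Mem.mat-other {p} {y} (λ q → ⊥-elim (≢a p∉ q)) (λ q → ⊥-elim (≢a y∉ q))))
     (λ y∉ → ≡-⇔ (Mem.J-other (≢a y∉)))
     (λ o → case trans (sym Mem.mat-aα) o of λ ()) (λ o → case trans (sym Mem.mat-aβ) o of λ ())
     (okay Mem.mat-ax refl refl)
    K′ : Fin n → Fin n → Set
    K′ = Quot K a ds
    contraction : ∃ λ m → length (verts t) ≡ 1 + m × Contracted K′ (OkIn τ) (IntOkIn τ) a m × Unique (α ∷ β ∷ x ∷ [])
    contraction = Tree.contract₂ good-t enough fits-t comp-t (Local.isNbrs lx) len
    open Contracted (fst (snd (snd contraction)))
    lift : LiftStep K (OkIn σ) (IntOkIn σ) K′ (OkIn τ) (IntOkIn τ) a b x a a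
    lift g f c with Tree.lift₂ Fin._≟_ g f c (λ z → case trans (sym Mem.J-a) z of λ ())
    ... | p , l = x , p , (λ e → ⊥-elim (K-irr (subst (K a) e ax))) , (λ n e → ⊥-elim (n e)) , (λ _ _ → l)
    inv′ : Inv G S₀ τ
    inv′ = record
     { K = K′ ; K-sym = Quot-sym K-sym ; K-irr = Quot-irrefl {K = K} K-irr (here refl)
     ; t = tree ; good-t = isGood ; fits-t = fits ; comp-t = comp
     ; rep = Mem.rep₂
     ; alive = trans at-alive (trans (cong (_∸ 1) (trans alive (fst (snd contraction)))) count)
     ; scan = λ {u} {v} {w} p q r → subst (λ i → ∃ λ e → e ∈ u ∷ v ∷ w ∷ [] × τ 12 (toℕ e) ≢ 0 × i ≤ toℕ e) (sym at-i)
      (Quot-scan {A = λ e → σ 12 (toℕ e) ≢ 0} {λ e → τ 12 (toℕ e) ≢ 0} (here refl) (ℕ.≤-reflexive at-a)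
       (λ z → a-act (trans (sym (Mem.active′ ab≢)) z))
       (λ v∉ ne z → ne (trans (sym (Mem.active′ (λ e → v∉ (there (here e))))) z)) scan p q r)
     ; chain = subst (λ k → Chain τ G k K′ (OkIn τ) (IntOkIn τ)) (sym (trans at-k (ℕ.+-comm (σ 3 7) 1)))
      (step (Chain-cong (λ j< → let ne = λ e → ℕ.<⇒≢ j< (sym e) in
               trans at-14 (upd-miss ne) , trans at-15 (upd-miss ne) , trans at-16 (upd-miss ne) , trans at-17 (upd-miss ne) , trans at-18 (upd-miss ne)) chain)
        (trans at-14 (upd-hit {σ 3 7} refl)) (trans at-15 (upd-hit {σ 3 7} refl)) (trans at-16 (upd-hit {σ 3 7} refl))
        (trans at-17 (upd-hit {σ 3 7} refl)) (trans at-18 (upd-hit {σ 3 7} refl)) lift)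
     ; steps = subst (λ k → k + τ 3 6 ≤ n) (sym at-k) (k<n {1} (s≤s z≤n) (ℕ.≤-trans (s≤s z≤n) 5≤) at-alive)
     ; input = trans at-0 input ; sums = λ v → trans at-6 (sums v) ; blank = λ j → trans at-1 (blank j)
     }

scalar-write : ∀ {σ i x} → SameArrays σ (write σ 3 i x)
scalar-write = record
 { s-0 = λ _ → refl ; s-1 = λ _ → refl ; s-4 = λ _ → refl ; s-5 = λ _ → refl ; s-6 = λ _ → refl ; s-7 = λ _ → refl
 ; s-8 = λ _ → refl ; s-9 = λ _ → refl ; s-10 = λ _ → refl ; s-11 = λ _ → refl ; s-12 = λ _ → refl ; s-13 = λ _ → refl
 ; s-14 = λ _ → refl ; s-15 = λ _ → refl ; s-16 = λ _ → refl ; s-17 = λ _ → refl ; s-18 = λ _ → refl ; s-19 = λ _ → refl }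

same-refl : ∀ {σ} → SameArrays σ σ
same-refl = record
 { s-0 = λ _ → refl ; s-1 = λ _ → refl ; s-4 = λ _ → refl ; s-5 = λ _ → refl ; s-6 = λ _ → refl ; s-7 = λ _ → refl
 ; s-8 = λ _ → refl ; s-9 = λ _ → refl ; s-10 = λ _ → refl ; s-11 = λ _ → refl ; s-12 = λ _ → refl ; s-13 = λ _ → refl
 ; s-14 = λ _ → refl ; s-15 = λ _ → refl ; s-16 = λ _ → refl ; s-17 = λ _ → refl ; s-18 = λ _ → refl ; s-19 = λ _ → refl }

same-trans : ∀ {σ τ υ} → SameArrays σ τ → SameArrays τ υ → SameArrays σ υ
same-trans s r = record
 { s-0 = λ j → trans (b.s-0 j) (a.s-0 j) ; s-1 = λ j → trans (b.s-1 j) (a.s-1 j) ; s-4 = λ j → trans (b.s-4 j) (a.s-4 j)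
 ; s-5 = λ j → trans (b.s-5 j) (a.s-5 j) ; s-6 = λ j → trans (b.s-6 j) (a.s-6 j) ; s-7 = λ j → trans (b.s-7 j) (a.s-7 j)
 ; s-8 = λ j → trans (b.s-8 j) (a.s-8 j) ; s-9 = λ j → trans (b.s-9 j) (a.s-9 j) ; s-10 = λ j → trans (b.s-10 j) (a.s-10 j)
 ; s-11 = λ j → trans (b.s-11 j) (a.s-11 j) ; s-12 = λ j → trans (b.s-12 j) (a.s-12 j) ; s-13 = λ j → trans (b.s-13 j) (a.s-13 j)
 ; s-14 = λ j → trans (b.s-14 j) (a.s-14 j) ; s-15 = λ j → trans (b.s-15 j) (a.s-15 j) ; s-16 = λ j → trans (b.s-16 j) (a.s-16 j)
 ; s-17 = λ j → trans (b.s-17 j) (a.s-17 j) ; s-18 = λ j → trans (b.s-18 j) (a.s-18 j) ; s-19 = λ j → trans (b.s-19 j) (a.s-19 j) }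
 where module a = SameArrays s
       module b = SameArrays r

data Scalars : Program → Set where
 one  : ∀ {x e} → Scalars (x ≔ e)
 more : ∀ {x e P} → Scalars P → Scalars ((x ≔ e) ⨾ P)

scalars-same : ∀ P → Scalars P → ∀ σ → SameArrays σ (exec P σ)
scalars-same (3 [ lit x ]≔ e)       one      σ = scalar-write {σ} {x} {⟦ e ⟧ σ}
scalars-same ((3 [ lit x ]≔ e) ⨾ P) (more s) σ = same-trans (scalar-write {σ} {x} {⟦ e ⟧ σ}) (scalars-same P s (exec (x ≔ e) σ))

module _ {n : ℕ} {G : Fin n → Fin n → Set} {S₀ : Fin n → ℕ} where

 scan-bound : ∀ {σ} → Inv G S₀ σ → σ 3 5 < n
 scan-bound {σ} inv with good-fan (Inv.good-t inv)
 ... | y , u , v , rest , s , e with scan (edge (inl (inl (inl (here (here refl)))))) (edge (inl (inl (inl (here (there (here refl)))))))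
  (edge (inr (inl (inl (refl , refl)))))
  where
   open Inv inv
   edge : ∀ {p q} → Adj (node y (leafT u ∷ leafT v ∷ rest) ⋈ s) p q → K p q
   edge a = to fits-t (from (≃-adj e) a)
 ...   | z , _ , _ , le = ℕ.≤-<-trans le (toℕ<n z)

 inv-next : ∀ {σ} (inv : Inv G S₀ σ) → (∀ {u v w e} → Inv.K inv u v → Inv.K inv u w → Inv.K inv v w → e ∈ u ∷ v ∷ w ∷ [] → σ 12 (toℕ e) ≢ 0 → toℕ e ≢ σ 3 5) →
  Inv G S₀ (exec next-vertex σ)
 inv-next {σ} inv unseen = record
  { K = K ; K-sym = K-sym ; K-irr = K-irr ; t = t ; good-t = good-t ; fits-t = fits-t ; comp-t = comp-t
  ; rep = Rep-same same rep ; alive = alive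
  ; scan = λ p q r → let e , m , ne , le = scan p q r in e , m , ne ,
      subst (_≤ toℕ e) (ℕ.+-comm 1 (σ 3 5)) (ℕ.≤∧≢⇒< le (λ z → unseen p q r m ne (sym z)))
  ; chain = Chain-cong (λ _ → refl , refl , refl , refl , refl) chain
  ; steps = steps ; input = input ; sums = sums ; blank = blank
  }
  where
   open Inv inv
   same : SameArrays σ (exec next-vertex σ)
   same = scalar-write {i = 5} {σ 3 5 + 1}

-- τ differs from σ in scalars only, and p, q, r are loaded.
record Triple (σ τ : Store) (p q r : ℕ) : Set where
 field
  same : SameArrays σ τ
  e-5  : τ 3 5 ≡ σ 3 5
  e-6  : τ 3 6 ≡ σ 3 6
  e-7  : τ 3 7 ≡ σ 3 7
  e-8  : τ 3 8 ≡ p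
  e-9  : τ 3 9 ≡ q
  e-10 : τ 3 10 ≡ r

keep-triple : ∀ {σ} → Triple σ σ (σ 3 8) (σ 3 9) (σ 3 10)
keep-triple = record { same = same-refl
 ; e-5 = refl ; e-6 = refl ; e-7 = refl ; e-8 = refl ; e-9 = refl ; e-10 = refl }

rotated-triple : ∀ {σ} → Triple σ (exec rotate-triple σ) (σ 3 9) (σ 3 10) (σ 3 8)
rotated-triple = record { same = scalars-same rotate-triple (more (more (more one))) _
 ; e-5 = refl ; e-6 = refl ; e-7 = refl ; e-8 = refl ; e-9 = refl ; e-10 = refl }

loaded-triple : ∀ {σ} → Triple σ (exec load-triple σ) (σ 7 (σ 3 5)) (σ 8 (σ 3 5)) (σ 5 (σ 3 5) ∸ σ 7 (σ 3 5) ∸ σ 8 (σ 3 5))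
loaded-triple = record { same = scalars-same load-triple (more (more one)) _
 ; e-5 = refl ; e-6 = refl ; e-7 = refl ; e-8 = refl ; e-9 = refl ; e-10 = refl }

triple-trans : ∀ {σ τ υ p q r p′ q′ r′} → Triple σ τ p q r → Triple τ υ p′ q′ r′ → Triple σ υ p′ q′ r′
triple-trans a b = record { same = same-trans a.same b.same ; e-5 = trans b.e-5 a.e-5 ; e-6 = trans b.e-6 a.e-6 ; e-7 = trans b.e-7 a.e-7
 ; e-8 = b.e-8 ; e-9 = b.e-9 ; e-10 = b.e-10 }
 where module a = Triple a
       module b = Triple b

triple-cong : ∀ {σ τ p q r p′ q′ r′} → p ≡ p′ → q ≡ q′ → r ≡ r′ → Triple σ τ p q r → Triple σ τ p′ q′ r′
triple-cong refl refl refl t = t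

entry : Store → ℕ → ℕ → ℕ
entry σ p q = σ 9 (σ 10 p + q)

entry-same : ∀ {σ τ} → SameArrays σ τ → ∀ p q → entry τ p q ≡ entry σ p q
entry-same {σ} {τ} s p q = trans (s-9 _) (cong (λ r → σ 9 (r + q)) (s-10 p))
 where open SameArrays s

data Found (σ : Store) (p q r : ℕ) : ℕ → ℕ → ℕ → Set where
 now    : entry σ p q ≢ 0 → Found σ p q r p q r
 once   : entry σ q r ≢ 0 → Found σ p q r q r p
 twice  : entry σ r p ≢ 0 → Found σ p q r r p q

opaque
 unfolding find-edge

 find-edge-spec : ∀ σ {p q r} → σ 3 8 ≡ p → σ 3 9 ≡ q → σ 3 10 ≡ r →
  (∃ λ p′ → ∃₂ λ q′ r′ → Found σ p q r p′ q′ r′ × Triple σ (exec find-edge σ) p′ q′ r′) ⊎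
  (entry σ p q ≡ 0 × entry σ q r ≡ 0 × entry σ r p ≡ 0 × ∃ λ p′ → ∃₂ λ q′ r′ → Triple σ (exec find-edge σ) p′ q′ r′ × entry σ p′ q′ ≡ 0)
 find-edge-spec σ {p} {q} {r} refl refl refl = go (entry σ p q ≟ 0) (entry σ q r ≟ 0) (entry σ r p ≟ 0)
  where
   f : Store → Store
   f υ = exec (if≢0 mat (var #p) (var #q) then skip else rotate-triple) υ
   yes-f : ∀ υ → entry υ (υ 3 8) (υ 3 9) ≢ 0 → f υ ≡ υ
   yes-f υ ne = choose-suc ne
   no-f : ∀ υ → entry υ (υ 3 8) (υ 3 9) ≡ 0 → f υ ≡ exec rotate-triple υ
   no-f υ e = choose-zero e
   r₁ r₂ : Store
   r₁ = exec rotate-triple σ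
   r₂ = exec rotate-triple r₁
   Result : Set
   Result = (∃ λ p′ → ∃₂ λ q′ r′ → Found σ p q r p′ q′ r′ × Triple σ (exec find-edge σ) p′ q′ r′) ⊎
    (entry σ p q ≡ 0 × entry σ q r ≡ 0 × entry σ r p ≡ 0 × ∃ λ p′ → ∃₂ λ q′ r′ → Triple σ (exec find-edge σ) p′ q′ r′ × entry σ p′ q′ ≡ 0)
   T₁ : ∀ {υ} → f (f σ) ≡ υ → ∀ {a b c} → Triple σ υ a b c → Triple σ (f (f σ)) a b c
   T₁ refl t = t
   go : Dec (entry σ p q ≡ 0) → Dec (entry σ q r ≡ 0) → Dec (entry σ r p ≡ 0) → Result
   go (no ne) _ _ = inl (p , q , r , now ne , T₁ (trans (cong f (yes-f σ ne)) (yes-f σ ne)) keep-triple)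
   go (yes e) (no ne) _ = inl (q , r , p , once ne , T₁ (trans (cong f (no-f σ e)) (yes-f r₁ ne)) rotated-triple)
   go (yes e) (yes e′) (no ne) = inl (r , p , q , twice ne , T₁ (trans (cong f (no-f σ e)) (no-f r₁ e′)) (triple-trans rotated-triple (rotated-triple {r₁})))
   go (yes e) (yes e′) (yes e″) = inr (e , e′ , e″ , r , p , q , T₁ (trans (cong f (no-f σ e)) (no-f r₁ e′)) (triple-trans rotated-triple (rotated-triple {r₁})) , e″)

opaque
 unfolding merge-phase

 merge-phase-zero : ∀ σ → σ 4 (σ 3 9) ∸ 3 ≡ 0 → exec merge-phase σ ≡ exec merge-three σ
 merge-phase-zero σ e = choose-zero e

 merge-phase-suc : ∀ σ → σ 4 (σ 3 9) ∸ 3 ≢ 0 → exec merge-phase σ ≡ exec merge-two σ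
 merge-phase-suc σ ne = choose-suc ne

module _ {n : ℕ} {G : Fin n → Fin n → Set} {S₀ : Fin n → ℕ} where

 potential : Store → ℕ
 potential σ = (n ∸ σ 3 5) + σ 3 6

 Better : Store → Store → Set₁
 Better σ τ = Inv G S₀ τ × potential τ < potential σ

 entry-cell : ∀ {σ} {K : Fin n → Fin n → Set} → Rep σ K → ∀ u v → entry σ (toℕ u) (toℕ v) ≡ σ 9 (cell u v)
 entry-cell {σ} r u v = cong (λ m → σ 9 (m + toℕ v)) (Rep.rows r u)

 better-next : ∀ {σ} (inv : Inv G S₀ σ) → (∀ {u v w e} → Inv.K inv u v → Inv.K inv u w → Inv.K inv v w → e ∈ u ∷ v ∷ w ∷ [] → σ 12 (toℕ e) ≢ 0 → toℕ e ≢ σ 3 5) →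
  Better σ (exec next-vertex σ)
 better-next {σ} inv h = inv-next inv h , ℕ.+-monoˡ-< (σ 3 6) (ℕ.∸-monoʳ-< (ℕ.m<m+n (σ 3 5) (s≤s z≤n)) (subst (_≤ n) (ℕ.+-comm 1 (σ 3 5)) (scan-bound inv)))

 record AtActive {σ : Store} (inv : Inv G S₀ σ) : Set where
  constructor atActive
  field
   {a n₁ n₂ n₃} : Fin n
   is-a  : toℕ a ≡ σ 3 5
   na    : Nbrs (Inv.K inv) a (n₁ ∷ n₂ ∷ n₃ ∷ [])
   ready : Triple σ (exec load-triple σ) (toℕ n₁) (toℕ n₂) (toℕ n₃)

 at-active : ∀ {σ} (inv : Inv G S₀ σ) → σ 12 (σ 3 5) ≢ 0 → AtActive inv
 at-active {σ} inv ne = go (locals al)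
  where
   open Inv inv
   open Rep rep
   a : Fin n
   a = fromℕ< (scan-bound inv)
   a≡ : toℕ a ≡ σ 3 5
   a≡ = toℕ-fromℕ< (scan-bound inv)
   ne′ : σ 12 (toℕ a) ≢ 0
   ne′ z = ne (trans (cong (σ 12) (sym a≡)) z)
   al : Alive K a
   al = active ne′
   go : Local σ K a → AtActive inv
   go (local nb nn d tot tr) with tr ne′
   ... | n₁ , n₂ , n₃ , refl , e₁ , e₂ = atActive a≡ nn (triple-cong e₁′ e₂′
    (trans (cong₂ (λ x y → σ 5 (σ 3 5) ∸ x ∸ y) e₁′ e₂′) (trans (cong (λ i → σ 5 i ∸ toℕ n₁ ∸ toℕ n₂) (sym a≡)) (third-neighbour {p = n₁} {n₂} {n₃} ↭-refl tot)))
    (loaded-triple {σ}))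
    where
     e₁′ : σ 7 (σ 3 5) ≡ toℕ n₁
     e₁′ = trans (cong (σ 7) (sym a≡)) e₁
     e₂′ : σ 8 (σ 3 5) ≡ toℕ n₂
     e₂′ = trans (cong (σ 8) (sym a≡)) e₂

 Inv-triple : ∀ {σ τ p q r} → Triple σ τ p q r → Inv G S₀ σ → Inv G S₀ τ
 Inv-triple tr = Inv-same (Triple.same tr) (Triple.e-5 tr) (Triple.e-6 tr) (Triple.e-7 tr)

 progress-better : ∀ {σ τ} → Progress {G = G} {S₀} σ τ → Better σ τ
 progress-better {σ} {τ} (inv , e , lt) = inv , subst (λ i → (n ∸ i) + τ 3 6 < potential σ) (sym e) (ℕ.+-monoʳ-< (n ∸ σ 3 5) lt)

 better-merge : ∀ {σ} {inv : Inv G S₀ σ} {a b x α} → Triangle σ inv a b x α → Better σ (exec merge-phase σ)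
 better-merge {σ} {inv} {a} {b} {x} tri = go (σ 4 (σ 3 9) ∸ 3) refl
  where
   open Triangle tri
   open Inv inv
   open Rep rep
   ax : K a x
   ax = from (members na) (there (here refl))
   lx : Local σ K x
   lx = locals (a , K-sym ax)
   deg : σ 4 (σ 3 9) ≡ length (Local.nb lx)
   deg = trans (cong (σ 4) at-x) (Local.degree lx)
   ≥3 : 3 ≤ length (Local.nb lx)
   ≥3 = min-degree good-t fits-t (Local.isNbrs lx) (a , K-sym ax)
   go : ∀ d → σ 4 (σ 3 9) ∸ 3 ≡ d → Better σ (exec merge-phase σ)
   go zero e = subst (Better σ) (sym (merge-phase-zero σ e)) (progress-better {σ} (progress₃ tri merged₃
    (ℕ.≤-antisym (subst (_≤ 3) deg (ℕ.m∸n≡0⇒m≤n e)) ≥3)))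
   go (suc d) e = subst (Better σ) (sym (merge-phase-suc σ (λ z → case trans (sym e) z of λ ()))) (progress-better {σ} (progress₂ tri merged₂
    (ℕ.≰⇒> (λ le → case trans (sym e) (trans (cong (_∸ 3) deg) (ℕ.m≤n⇒m∸n≡0 le)) of λ ()))))

 module _ {σ : Store} (inv : Inv G S₀ σ) (5≤ : 5 ≤ length (verts (Inv.t inv))) {a p q r : Fin n}
  (na : Nbrs (Inv.K inv) a (p ∷ q ∷ r ∷ [])) (pq : Inv.K inv p q) (a-act : σ 12 (toℕ a) ≢ 0) (is-a : toℕ a ≡ σ 3 5)
  {τ : Store} (tr : Triple σ τ (toℕ p) (toℕ q) (toℕ r)) where
  open Inv inv
  open Rep rep
  open Triple tr
  open SameArrays same

  private
   invτ : Inv G S₀ τ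
   invτ = Inv-triple tr inv
   ap : K a p
   ap = from (members na) (here refl)
   aq : K a q
   aq = from (members na) (there (here refl))
   lp : Local σ K p
   lp = locals (a , K-sym ap)
   lq : Local σ K q
   lq = locals (a , K-sym aq)
   S Bst SwB : Program
   S = #t ≔ var #p ⨾ #p ≔ var #q ⨾ #q ≔ var #t
   Bst = #b ≔ 5 [ var #p ] ⊖ var #i ⊖ var #q
   SwB = #t ≔ var #p ⨾ #p ≔ var #q ⨾ #q ≔ var #t ⨾ #b ≔ 5 [ var #p ] ⊖ var #i ⊖ var #q
   e-a : τ 3 5 ≡ toℕ a
   e-a = trans e-5 (sym is-a)
   lift-better : ∀ {υ υ′} → υ 3 5 ≡ τ 3 5 → υ 3 6 ≡ τ 3 6 → Better υ υ′ → Better σ υ′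
   lift-better {υ} {υ′} e₅ e₆ (i , lt) = i , subst (potential υ′ <_) (cong₂ (λ i al → (n ∸ i) + al) (trans e₅ e-5) (trans e₆ e-6)) lt

  better-edge : Better σ (exec (prepare ⨾ merge-phase) τ)
  better-edge = go (τ 4 (τ 3 8) ∸ 3) refl
   where
    degp : τ 4 (τ 3 8) ≡ length (Local.nb lp)
    degp = trans (s-4 _) (trans (cong (σ 4) e-8) (Local.degree lp))
    go : ∀ d → τ 4 (τ 3 8) ∸ 3 ≡ d → Better σ (exec (prepare ⨾ merge-phase) τ)
    go zero e = subst (λ υ → Better σ (exec merge-phase (exec Bst υ))) (sym (choose-zero {p = exec S τ} e))
     (lift-better {exec Bst τ} refl refl (better-merge {inv = invυ} record
      { enough = 5≤ ; na = na ; bx = pq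
      ; b-deg = trans (s-4 _) (trans (Local.degree lp) (ℕ.≤-antisym (subst (_≤ 3) degp (ℕ.m∸n≡0⇒m≤n e)) (min-degree good-t fits-t (Local.isNbrs lp) (a , K-sym ap))))
      ; a-act = λ z → a-act (trans (sym (s-12 _)) z)
      ; at-a = e-a ; at-b = e-8 ; at-x = e-9 ; at-α = e-10
      ; at-β = cong₂ _∸_ (cong₂ _∸_ (cong (τ 5) e-8) e-a) e-9 }))
     where
      invυ : Inv G S₀ (exec Bst τ)
      invυ = Inv-same (scalars-same Bst one τ) refl refl refl invτ
    go (suc d) e = subst (λ υ → Better σ (exec merge-phase (exec Bst υ))) (sym (choose-suc {q = τ} (λ z → case trans (sym e) z of λ ())))
     (lift-better {exec SwB τ} refl refl (better-merge {inv = invυ} record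
      { enough = 5≤ ; na = Nbrs-↭ (Permₚ.swap p q ↭-refl) na ; bx = K-sym pq
      ; b-deg = trans (s-4 _) (trans (Local.degree lq) (some-degree-three good-t 5≤ fits-t ap aq pq (Local.isNbrs lp) (Local.isNbrs lq)
       (λ len → case trans (sym e) (trans (cong (_∸ 3) degp) (cong (_∸ 3) len)) of λ ())))
      ; a-act = λ z → a-act (trans (sym (s-12 _)) z)
      ; at-a = e-a ; at-b = e-9 ; at-x = e-8 ; at-α = e-10
      ; at-β = cong₂ _∸_ (cong₂ _∸_ (cong (τ 5) e-9) e-a) e-8 }))
     where
      invυ : Inv G S₀ (exec SwB τ)
      invυ = Inv-same (scalars-same SwB (more (more (more one))) τ) refl refl refl invτ

 better-step : ∀ {σ} → Inv G S₀ σ → σ 3 6 ∸ 4 ≢ 0 → Better σ (exec contract-step σ)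
 better-step {σ} inv big with σ 12 (σ 3 5) ≟ 0
 ... | yes z = subst (Better σ) (sym (choose-zero z)) (better-next inv (λ {u} {v} {w} {e} _ _ _ _ ne eq → ne (trans (cong (σ 12) eq) z)))
 ... | no nz = subst (Better σ) (sym (choose-suc nz)) (go (at-active inv nz))
  where
   open Inv inv
   open Rep rep
   5≤ : 5 ≤ length (verts t)
   5≤ = subst (5 ≤_) alive (ℕ.≰⇒> (λ le → big (ℕ.m≤n⇒m∸n≡0 le)))
   go : AtActive inv → Better σ (exec edge-phase (exec find-edge (exec load-triple σ)))
   go (atActive {a} {n₁} {n₂} {n₃} is-a na ld) = found-case (find-edge-spec σ₁ (Triple.e-8 ld) (Triple.e-9 ld) (Triple.e-10 ld))
    where
     σ₁ σ₂ : Store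
     σ₁ = exec load-triple σ
     σ₂ = exec find-edge σ₁
     same₁ : SameArrays σ σ₁
     same₁ = Triple.same ld
     alv : ∀ {w} → w ∈ n₁ ∷ n₂ ∷ n₃ ∷ [] → Alive K w
     alv m = a , K-sym (from (members na) m)
     act : σ 12 (toℕ a) ≢ 0
     act z = nz (trans (cong (σ 12) (sym is-a)) z)
     edge⁺ : ∀ {u v} → u ∈ n₁ ∷ n₂ ∷ n₃ ∷ [] → v ∈ n₁ ∷ n₂ ∷ n₃ ∷ [] → entry σ₁ (toℕ u) (toℕ v) ≢ 0 → K u v
     edge⁺ {u} {v} mu mv ne = from (matrix (alv mu) (alv mv)) (λ z → ne (trans (entry-same same₁ _ _) (trans (entry-cell rep u v) z)))
     edge⁻ : ∀ {u v} → u ∈ n₁ ∷ n₂ ∷ n₃ ∷ [] → v ∈ n₁ ∷ n₂ ∷ n₃ ∷ [] → entry σ₁ (toℕ u) (toℕ v) ≡ 0 → ¬ K u v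
     edge⁻ {u} {v} mu mv z k = to (matrix (alv mu) (alv mv)) k (trans (sym (entry-cell rep u v)) (trans (sym (entry-same same₁ _ _)) z))
     found-edge : ∀ {p q r : Fin n} → p ∷ q ∷ r ∷ [] ↭ n₁ ∷ n₂ ∷ n₃ ∷ [] → entry σ₁ (toℕ p) (toℕ q) ≢ 0 → Triple σ₁ σ₂ (toℕ p) (toℕ q) (toℕ r) →
      Better σ (exec edge-phase σ₂)
     found-edge {p} {q} {r} π ne tr = subst (Better σ) (sym (choose-suc c≢0))
      (better-edge inv 5≤ (Nbrs-↭ (↭-sym π) na) (edge⁺ (∈-resp-↭ π (here refl)) (∈-resp-↭ π (there (here refl))) ne) act is-a tr₂)
      where
       tr₂ : Triple σ σ₂ (toℕ p) (toℕ q) (toℕ r)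
       tr₂ = triple-trans ld tr
       c≢0 : entry σ₂ (σ₂ 3 8) (σ₂ 3 9) ≢ 0
       c≢0 z = ne (trans (sym (entry-same (Triple.same tr) _ _)) (trans (cong₂ (entry σ₂) (sym (Triple.e-8 tr)) (sym (Triple.e-9 tr))) z))
     found-case : _ → Better σ (exec edge-phase σ₂)
     found-case (inl (_ , _ , _ , now ne , tr)) = found-edge ↭-refl ne tr
     found-case (inl (_ , _ , _ , once ne , tr)) = found-edge (↭-trans (prep _ (Permₚ.swap _ _ ↭-refl)) (Permₚ.swap _ _ ↭-refl)) ne tr
     found-case (inl (_ , _ , _ , twice ne , tr)) = found-edge (↭-trans (Permₚ.swap _ _ ↭-refl) (prep _ (Permₚ.swap _ _ ↭-refl))) ne tr
     found-case (inr (z₁ , z₂ , z₃ , p , q , r , tr , z)) = subst (Better σ) (sym (choose-zero c≡0))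
      (fst nxt , subst (potential (exec next-vertex σ₂) <_) (cong₂ (λ i al → (n ∸ i) + al) (Triple.e-5 tr₂) (Triple.e-6 tr₂)) (snd nxt))
      where
       tr₂ : Triple σ σ₂ p q r
       tr₂ = triple-trans ld tr
       c≡0 : entry σ₂ (σ₂ 3 8) (σ₂ 3 9) ≡ 0
       c≡0 = trans (cong₂ (entry σ₂) (Triple.e-8 tr) (Triple.e-9 tr)) (trans (entry-same (Triple.same tr) _ _) z)
       M₁ : n₁ ∈ n₁ ∷ n₂ ∷ n₃ ∷ []
       M₁ = here refl
       M₂ : n₂ ∈ n₁ ∷ n₂ ∷ n₃ ∷ []
       M₂ = there (here refl)
       M₃ : n₃ ∈ n₁ ∷ n₂ ∷ n₃ ∷ []
       M₃ = there (there (here refl))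
       noEdge : ∀ {y w} → y ∈ n₁ ∷ n₂ ∷ n₃ ∷ [] → w ∈ n₁ ∷ n₂ ∷ n₃ ∷ [] → ¬ K y w
       noEdge (here refl) (here refl) = K-irr
       noEdge (here refl) (there (here refl)) = edge⁻ M₁ M₂ z₁
       noEdge (here refl) (there (there (here refl))) k = edge⁻ M₃ M₁ z₃ (K-sym k)
       noEdge (there (here refl)) (here refl) k = edge⁻ M₁ M₂ z₁ (K-sym k)
       noEdge (there (here refl)) (there (here refl)) = K-irr
       noEdge (there (here refl)) (there (there (here refl))) = edge⁻ M₂ M₃ z₂
       noEdge (there (there (here refl))) (here refl) = edge⁻ M₃ M₁ z₃
       noEdge (there (there (here refl))) (there (here refl)) k = edge⁻ M₂ M₃ z₂ (K-sym k)
       noEdge (there (there (here refl))) (there (there (here refl))) = K-irr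
       no-triangle : ∀ {y w} → K a y → K a w → ¬ K y w
       no-triangle ky kw = noEdge (to (members na) ky) (to (members na) kw)
       unseen : ∀ {u v w e} → K u v → K u w → K v w → e ∈ u ∷ v ∷ w ∷ [] → e ≢ a
       unseen uv uw vw (here refl) refl = no-triangle uv uw vw
       unseen uv uw vw (there (here refl)) refl = no-triangle (K-sym uv) vw uw
       unseen uv uw vw (there (there (here refl))) refl = no-triangle (K-sym uw) (K-sym vw) uv
       nxt : Better σ₂ (exec next-vertex σ₂)
       nxt = better-next (Inv-triple tr₂ inv) (λ uv uw vw m _ eq → unseen uv uw vw m (toℕ-injective (trans eq (trans (Triple.e-5 tr₂) (sym is-a)))))

 contract-time : ℕ
 contract-time = suc (cost (var #alive ⊖ lit 4) + maxTime contract-step)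

 run-contract : ∀ {σ} → Inv G S₀ σ →
  ∃ λ τ → Inv G S₀ τ × τ 3 6 ∸ 4 ≡ 0 × Runs contract-all σ (suc (cost (var #alive ⊖ lit 4)) + contract-time * potential σ) τ
 run-contract {σ} inv with run-while {e = var #alive ⊖ lit 4} {contract-step} contract-time (λ m υ → potential υ ≡ m × Inv G S₀ υ)
  (λ { _ υ (refl , i) ne → let i′ , lt = better-step i ne in
       potential (exec contract-step υ) , exec contract-step υ , (refl , i′) , maxTime contract-step , run-loop-free contract-step contract-step-loop-free υ , pay contract-time lt })
  (potential σ) σ (refl , inv)
 ... | _ , τ , (_ , inv′) , e , r = τ , inv′ , e , r

module _ {V : Set} where

 unique-⊆-length : {xs ys : List V} → Unique xs → (∀ {w} → w ∈ xs → w ∈ ys) → length xs ≤ length ys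
 unique-⊆-length {[]} _ _ = z≤n
 unique-⊆-length {x ∷ xs} {ys} (p ∷ u) f with ∈-∃++ (f (here refl))
 ... | as , bs , refl = subst (suc (length xs) ≤_) (sym (↭-length (shift x as bs))) (s≤s (unique-⊆-length u f′))
  where
   f′ : ∀ {w} → w ∈ xs → w ∈ as ++ bs
   f′ w∈ with ∈-resp-↭ (shift x as bs) (f (there w∈))
   ... | here refl = ⊥-elim (All.lookup p w∈ refl)
   ... | there q   = q

 neighbours-of : ∀ {t : CutTree V} {v} → Good t → v ∈ verts t → ∃ λ xs → Nbrs (Adj t) v xs × 3 ≤ length xs
 neighbours-of {t} {v} g m with leaf-or-int t m
 ... | inl l with cut-at-leaf g l
 ...   | s , e = _ , leaf-nbrs (good-≃ e g) (mk⇔ (from (≃-adj e)) (to (≃-adj e))) , s≤s (s≤s (s≤s z≤n))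
 neighbours-of {t} {v} g m | inr i with cut-at-int g i
 ... | c , c′ ∷ cs , s , e = _ , int-nbrs (good-≃ e g) (mk⇔ (from (≃-adj e)) (to (≃-adj e))) , s≤s (s≤s (s≤s z≤n))
 ... | c , [] , s , e with good-≃ e g
 ...   | good _ ((w , _) , _) _ = contradiction refl w

 four-vertices-complete : ∀ {t : CutTree V} {x y} → Good t → length (verts t) ≡ 4 → x ∈ verts t → y ∈ verts t → x ≢ y → Adj t x y
 four-vertices-complete {t} {x} {y} g len x∈ y∈ x≢y with neighbours-of g x∈
 ... | xs , nb , 3≤ with unique-⊆-↭ {xs = x ∷ xs} {verts t}
  (All.tabulate (λ m e → Adj-irrefl g (from (members nb) (subst (_∈ xs) (sym e) m))) ∷ distinct nb)
  (λ { (here refl) → x∈ ; (there m) → snd (Adj-∈ t (from (members nb) m)) })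
  (ℕ.≤-antisym (unique-⊆-length {xs = x ∷ xs} {verts t}
   (All.tabulate (λ m e → Adj-irrefl g (from (members nb) (subst (_∈ xs) (sym e) m))) ∷ distinct nb)
   (λ { (here refl) → x∈ ; (there m) → snd (Adj-∈ t (from (members nb) m)) }))
   (subst (_≤ suc (length xs)) (sym len) (s≤s 3≤)))
 ...   | π with ∈-resp-↭ (↭-sym π) y∈
 ...     | here e  = ⊥-elim (x≢y (sym e))
 ...     | there m = from (members nb) m

 star : V → V → V → V → CutTree V
 star z u v w = cherry z u v ⋈ leafT w

 star-good : ∀ {z u v w : V} → Unique (z ∷ u ∷ v ∷ w ∷ []) → Good (star z u v w)
 star-good u = good (mkU u) (((λ ()) , ((λ ()) , tt) , ((λ ()) , tt) , tt) , (λ ()) , tt) ℕ.≤-refl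

 star-par : ∀ {z u v w p y : V} → Unique (z ∷ u ∷ v ∷ w ∷ []) → Par (star z u v w) p y → p ∈ u ∷ v ∷ w ∷ [] × y ≡ z
 star-par {z} {u} {v} {w} {p} {y} un (m , e) with leaf-or-int (star z u v w) (snd (TE-∈ (star z u v w) e))
 ... | inl l = ⊥-elim (no-TE-between-leaves (star-good un) m l e)
 ... | inr (here q) = m , q

 four-vertices-centre : ∀ {t : CutTree V} {Ok IOk} → Good t → length (verts t) ≡ 4 → Compat Ok IOk t →
  ∃ λ y → y ∈ verts t × IOk y × (∀ {o} → o ∈ verts t → o ≢ y → Ok o y)
 four-vertices-centre {t} {Ok} g len co with good-fan g
 ... | y , u , v , c ∷ cs , s , e = contradiction (trans (sym (↭-length (verts↭ e))) len)
  (λ q → contradiction (subst (5 ≤_) q (s≤s (s≤s (s≤s (two-more c cs s))))) λ { (s≤s (s≤s (s≤s (s≤s ())))) })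
 ... | y , u , v , [] , node w (d ∷ ds) , e = contradiction (trans (sym (↭-length (verts↭ e))) len)
  (λ q → contradiction (subst (5 ≤_) q (s≤s (s≤s (s≤s (s≤s (ℕ.≤-trans (nonempty-preorder d) (subst (length (preorder d) ≤_) (sym (length-++ (preorder d))) (ℕ.m≤m+n _ _)))))))) λ { (s≤s (s≤s (s≤s (s≤s ())))) })
 ... | y , u , v , [] , node w [] , e = y , ∈-resp-↭ (↭-sym (verts↭ e)) (here refl) , intOk co′ (here refl) , ok
  where
   co′ : Compat _ _ (star y u v w)
   co′ = Compat-≃ e co
   te-y : ∀ {o} → o ∈ u ∷ v ∷ w ∷ [] → TE (star y u v w) o y
   te-y (here refl) = inr (inl (here (here refl)))
   te-y (there (here refl)) = inr (inl (here (there (here refl))))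
   te-y (there (there (here refl))) = inr (inr (inr (refl , refl)))
   ok : ∀ {o} → o ∈ verts t → o ≢ y → Ok o y
   ok m n with ∈-resp-↭ (verts↭ e) m
   ... | here q = ⊥-elim (n q)
   ... | there m′ = parOk co′ (m′ , te-y m′)

module _ {n : ℕ} where

 record Desc (σ : Store) (t : CutTree (Fin n)) : Set where
  field
   parents  : ∀ {p y} → Par t p y → σ 13 (toℕ p) ≡ toℕ y
   internal : ∀ {y} → y ∈ Ints t → σ 1 (toℕ y) ≡ 1
   others   : ∀ {y : Fin n} → y ∉ Ints t → σ 1 (toℕ y) ≡ 0
   c₀ c₁    : Fin n
   at-c₀    : σ 3 17 ≡ toℕ c₀
   at-c₁    : σ 3 18 ≡ toℕ c₁
   leaf-c₀  : c₀ ∈ Lvs t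
   leaf-c₁  : c₁ ∈ Lvs t
   edge     : Adj t c₀ c₁

 desc-lifted : ∀ {σ τ : Store} {K Ok IOk t} {u v z : Fin n} → Desc σ t → (l : Lifted K Ok IOk t u v z) →
  (∀ {j} → τ 13 j ≡ (if toℕ v ≡ᵇ j then toℕ z else (if toℕ u ≡ᵇ j then toℕ z else σ 13 j))) →
  (∀ {j} → τ 1 j ≡ (if toℕ z ≡ᵇ j then 1 else σ 1 j)) →
  τ 3 17 ≡ toℕ u → τ 3 18 ≡ toℕ v → Desc τ (Lifted.tree l)
 desc-lifted {σ} {τ} {t = t} {u} {v} {z} d l e₁₃ e₁ eu ev = record
  { parents = λ {p} {y} pr → go p y (Lifted.par l pr)
  ; internal = λ {y} m → int y (Lifted.int l m)
  ; others = λ {y} n → trans e₁ (trans (miss (λ e → n (Lifted.int⁻ l (inl e)))) (Desc.others d (λ m → n (Lifted.int⁻ l (inr m)))))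
  ; c₀ = u ; c₁ = v ; at-c₀ = eu ; at-c₁ = ev
  ; leaf-c₀ = fst (Lifted.leaves l) ; leaf-c₁ = fst (snd (Lifted.leaves l)) ; edge = snd (snd (Lifted.leaves l))
  }
  where
   uv : u ≢ v
   uv refl = Adj-irrefl (Lifted.isGood l) (snd (snd (Lifted.leaves l)))
   go : ∀ p y → (p ∈ u ∷ v ∷ [] × y ≡ z) ⊎ (p ∉ u ∷ v ∷ [] × Par t p y) → τ 13 (toℕ p) ≡ toℕ y
   go p y (inl (here refl , refl)) = trans e₁₃ (trans (miss uv) (hit {u = u}))
   go p y (inl (there (here refl) , refl)) = trans e₁₃ (hit {u = v})
   go p y (inr (p∉ , pr)) = trans e₁₃ (trans (miss {u = v} {p} (λ { refl → p∉ (there (here refl)) }))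
    (trans (miss {u = u} {p} (λ { refl → p∉ (here refl) })) (Desc.parents d pr)))
   int : ∀ y → y ≡ z ⊎ y ∈ Ints t → τ 1 (toℕ y) ≡ 1
   int y (inl refl) = trans e₁ (hit {u = y})
   int y (inr m) with y Fin.≟ z
   ... | yes refl = trans e₁ (hit {u = y})
   ... | no n = trans e₁ (trans (miss n) (Desc.internal d m))

 differ : ∀ {e f : ℕ} → e ≢ f → (e ∸ f) + (f ∸ e) ≢ 0
 differ {e} {f} n z = n (ℕ.≤-antisym (ℕ.m∸n≡0⇒m≤n (ℕ.m+n≡0⇒m≡0 (e ∸ f) z)) (ℕ.m∸n≡0⇒m≤n (ℕ.m+n≡0⇒n≡0 (e ∸ f) z)))

 agree : ∀ {e f : ℕ} → e ≡ f → (e ∸ f) + (f ∸ e) ≡ 0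
 agree {e} refl = cong₂ _+_ (ℕ.n∸n≡0 e) (ℕ.n∸n≡0 e)

 undo-load undo-choose undo-write : Program
 undo-load = #k ≔ var #k ⊖ lit 1 ⨾ #i ≔ 14 [ var #k ] ⨾ #p ≔ 15 [ var #k ] ⨾ #q ≔ 16 [ var #k ]
 undo-choose = if≢0 13 [ var #i ] ≠ 17 [ var #k ]
  then (if≢0 13 [ var #i ] ≠ 18 [ var #k ] then skip else (#t ≔ var #p ⨾ #p ≔ var #q ⨾ #q ≔ var #t))
  else (#t ≔ var #i ⨾ #i ≔ var #p ⨾ #p ≔ var #q ⨾ #q ≔ var #t)
 undo-write = 1 [ var #q ]≔ lit 1 ⨾ 13 [ var #i ]≔ var #q ⨾ 13 [ var #p ]≔ var #q ⨾ #c₀ ≔ var #i ⨾ #c₁ ≔ var #p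

 record History (σ τ : Store) : Set where
  field
   h-0  : ∀ j → τ 0 j ≡ σ 0 j
   h-6  : ∀ j → τ 6 j ≡ σ 6 j
   h-14 : ∀ j → τ 14 j ≡ σ 14 j
   h-15 : ∀ j → τ 15 j ≡ σ 15 j
   h-16 : ∀ j → τ 16 j ≡ σ 16 j
   h-17 : ∀ j → τ 17 j ≡ σ 17 j
   h-18 : ∀ j → τ 18 j ≡ σ 18 j

 history-refl : ∀ {σ} → History σ σ
 history-refl = record { h-0 = λ _ → refl ; h-6 = λ _ → refl ; h-14 = λ _ → refl ; h-15 = λ _ → refl ; h-16 = λ _ → refl ; h-17 = λ _ → refl ; h-18 = λ _ → refl }

 history-trans : ∀ {σ τ υ} → History σ τ → History τ υ → History σ υ
 history-trans a b = record
  { h-0 = λ j → trans (B.h-0 j) (A.h-0 j) ; h-6 = λ j → trans (B.h-6 j) (A.h-6 j) ; h-14 = λ j → trans (B.h-14 j) (A.h-14 j) ; h-15 = λ j → trans (B.h-15 j) (A.h-15 j)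
  ; h-16 = λ j → trans (B.h-16 j) (A.h-16 j) ; h-17 = λ j → trans (B.h-17 j) (A.h-17 j) ; h-18 = λ j → trans (B.h-18 j) (A.h-18 j) }
  where module A = History a
        module B = History b

 module _ {G : Fin n → Fin n → Set} where

  undo-cost : ℕ
  undo-cost = suc (cost (var #k) + maxTime undo-step)

  Undone : Store → ℕ → Set
  Undone σ k = ∃ λ τ → Runs undo-all σ (suc (cost (var #k)) + undo-cost * k) τ × History σ τ × ∃ λ t → Good t × Fits t G × Desc τ t

  undone-step : ∀ {σ τ k} → σ 3 7 ≡ suc k → exec undo-step σ ≡ τ → History σ τ → Undone τ k → Undone σ (suc k)
  undone-step {σ} {k = k} e refl h (τ′ , (t′ , r′ , t′≤) , h′ , rest) with run-loop-free undo-step _ σ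
  ... | t , r , t≤ = τ′ , (_ , loop (λ z → case trans (sym e) z of λ ()) r r′ , bound) , history-trans h h′ , rest
   where
    bound : suc (cost (var #k) + (t + t′)) ≤ suc (cost (var #k)) + undo-cost * suc k
    bound = ℕ.≤-trans (s≤s (ℕ.+-monoʳ-≤ (cost (var #k)) (ℕ.+-mono-≤ t≤ t′≤)))
     (ℕ.≤-reflexive (trans (lem (cost (var #k)) (maxTime undo-step) (undo-cost * k)) (cong (suc (cost (var #k)) +_) (sym (ℕ.*-suc undo-cost k)))))
     where
      lem : ∀ c b x → suc (c + (b + (suc c + x))) ≡ suc c + (suc (c + b) + x)
      lem = solve-∀

  undo-chain : ∀ {σ υ k K Ok IOk} → Chain σ G k K Ok IOk → υ 3 7 ≡ k → History σ υ →
   ∀ {t} → Good t → Fits t K → Compat Ok IOk t → Desc υ t → Undone υ k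
  undo-chain {υ = υ} start e h g f c d = υ , (_ , stop e , ℕ.m≤m+n _ _) , history-refl , _ , g , f , d
  undo-chain {σ} {υ} (step {k} {K} {Ok} {IOk} {a = a} {b} {x} {α} {β} ch h₁₄ h₁₅ h₁₆ h₁₇ h₁₈ lift) e h {t} g f c d
   with lift g f c
  ... | y , pr , lα , lβ , lξ = result
   where
    open History h
    υ₁ : Store
    υ₁ = exec undo-load υ
    k≡ : υ 3 7 ∸ 1 ≡ k
    k≡ = cong (_∸ 1) e
    i≡ : υ₁ 3 5 ≡ toℕ a
    i≡ = trans (cong (υ 14) k≡) (trans (h-14 k) h₁₄)
    p≡ : υ₁ 3 8 ≡ toℕ b
    p≡ = trans (cong (υ 15) k≡) (trans (h-15 k) h₁₅)
    q≡ : υ₁ 3 9 ≡ toℕ x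
    q≡ = trans (cong (υ 16) k≡) (trans (h-16 k) h₁₆)
    y≡ : υ 13 (υ₁ 3 5) ≡ toℕ y
    y≡ = trans (cong (υ 13) i≡) (Desc.parents d pr)
    α≡ : υ 17 (υ 3 7 ∸ 1) ≡ toℕ α
    α≡ = trans (cong (υ 17) k≡) (trans (h-17 k) h₁₇)
    β≡ : υ 18 (υ 3 7 ∸ 1) ≡ toℕ β
    β≡ = trans (cong (υ 18) k≡) (trans (h-18 k) h₁₈)
    finish : ∀ {u v z} υ₂ → exec undo-choose υ₁ ≡ υ₂ → (∀ {j} → υ₂ 1 j ≡ υ 1 j) → (∀ {j} → υ₂ 13 j ≡ υ 13 j) → History υ υ₂ →
     υ₂ 3 7 ≡ υ 3 7 ∸ 1 → υ₂ 3 5 ≡ toℕ u → υ₂ 3 8 ≡ toℕ v → υ₂ 3 9 ≡ toℕ z → Lifted K Ok IOk t u v z → Undone υ (suc k)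
    finish {u} {v} {z} υ₂ eq e₁ e₁₃ h₂ e₇ eu ev ez l = undone-step e (cong (exec undo-write) eq) (history-trans h₂ h₃)
     (undo-chain ch (trans e₇ k≡) (history-trans h (history-trans h₂ h₃)) (Lifted.isGood l) (Lifted.fits l) (Lifted.comp l)
      (desc-lifted d l (trans (arr₁₃ eu ev ez) (cong (λ m → if toℕ v ≡ᵇ _ then toℕ z else (if toℕ u ≡ᵇ _ then toℕ z else m)) e₁₃))
       (trans (arr₁ ez) (cong (λ m → if toℕ z ≡ᵇ _ then 1 else m) e₁)) eu ev))
     where
      h₃ : History υ₂ (exec undo-write υ₂)
      h₃ = record { h-0 = λ _ → refl ; h-6 = λ _ → refl ; h-14 = λ _ → refl ; h-15 = λ _ → refl ; h-16 = λ _ → refl ; h-17 = λ _ → refl ; h-18 = λ _ → refl }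
      arr₁₃ : ∀ {A B C j} → υ₂ 3 5 ≡ A → υ₂ 3 8 ≡ B → υ₂ 3 9 ≡ C → exec undo-write υ₂ 13 j ≡ (if B ≡ᵇ j then C else (if A ≡ᵇ j then C else υ₂ 13 j))
      arr₁₃ refl refl refl = refl
      arr₁ : ∀ {C j} → υ₂ 3 9 ≡ C → exec undo-write υ₂ 1 j ≡ (if C ≡ᵇ j then 1 else υ₂ 1 j)
      arr₁ refl = refl
    S R : Program
    S = #t ≔ var #p ⨾ #p ≔ var #q ⨾ #q ≔ var #t
    R = #t ≔ var #i ⨾ #i ≔ var #p ⨾ #p ≔ var #q ⨾ #q ≔ var #t
    plain : ∀ {υ′} → υ′ ≡ υ₁ → History υ υ₁
    plain _ = record { h-0 = λ _ → refl ; h-6 = λ _ → refl ; h-14 = λ _ → refl ; h-15 = λ _ → refl ; h-16 = λ _ → refl ; h-17 = λ _ → refl ; h-18 = λ _ → refl }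
    result : Undone υ (suc k)
    result with y Fin.≟ α | y Fin.≟ β
    ... | yes q | _ = finish (exec R υ₁) (choose-zero (agree (trans y≡ (trans (cong toℕ q) (sym α≡))))) refl refl
     (record { h-0 = λ _ → refl ; h-6 = λ _ → refl ; h-14 = λ _ → refl ; h-15 = λ _ → refl ; h-16 = λ _ → refl ; h-17 = λ _ → refl ; h-18 = λ _ → refl })
     refl p≡ q≡ i≡ (lα q)
    ... | no p | yes q = finish (exec S υ₁)
     (trans (choose-suc (differ (λ z → p (toℕ-injective (trans (sym y≡) (trans z α≡))))))
      (choose-zero (agree (trans y≡ (trans (cong toℕ q) (sym β≡)))))) refl refl
     (record { h-0 = λ _ → refl ; h-6 = λ _ → refl ; h-14 = λ _ → refl ; h-15 = λ _ → refl ; h-16 = λ _ → refl ; h-17 = λ _ → refl ; h-18 = λ _ → refl })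
     refl i≡ q≡ p≡ (lβ p q)
    ... | no p | no q = finish υ₁
     (trans (choose-suc (differ (λ z → p (toℕ-injective (trans (sym y≡) (trans z α≡))))))
      (choose-suc (differ (λ z → q (toℕ-injective (trans (sym y≡) (trans z β≡))))))) refl refl
     (plain refl) refl i≡ p≡ q≡ (lξ p q)

sum-is-three⁻ : ∀ j p q r → 1 ≤ p → 1 ≤ q → 1 ≤ r → j + p + q + r ∸ 3 ≡ 0 → j ≡ 0 × p ≡ 1 × q ≡ 1 × r ≡ 1
sum-is-three⁻ j (suc p) (suc q) (suc r) _ _ _ e = ℕ.m+n≡0⇒m≡0 j (ℕ.m+n≡0⇒m≡0 (j + p) (ℕ.m+n≡0⇒m≡0 (j + p + q) z))
 , cong suc (ℕ.m+n≡0⇒n≡0 j (ℕ.m+n≡0⇒m≡0 (j + p) (ℕ.m+n≡0⇒m≡0 (j + p + q) z)))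
 , cong suc (ℕ.m+n≡0⇒n≡0 (j + p) (ℕ.m+n≡0⇒m≡0 (j + p + q) z)) , cong suc (ℕ.m+n≡0⇒n≡0 (j + p + q) z)
 where
  lem : ∀ j p q r → j + suc p + suc q + suc r ≡ 3 + (j + p + q + r)
  lem = solve-∀
  z : j + p + q + r ≡ 0
  z = trans (sym (trans (cong (_∸ 3) (lem j p q r)) (ℕ.m+n∸m≡n 3 _))) e

opaque
 unfolding finish-star

 finish-star-1 : ∀ τ {A j} → τ 3 5 ≡ A → exec finish-star τ 1 j ≡ (if A ≡ᵇ j then 1 else τ 1 j)
 finish-star-1 τ refl = refl

 finish-star-13 : ∀ τ {A P Q R j} → τ 3 5 ≡ A → τ 3 8 ≡ P → τ 3 9 ≡ Q → τ 3 10 ≡ R → exec finish-star τ 13 j ≡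
  (if R ≡ᵇ j then A else (if Q ≡ᵇ j then A else (if P ≡ᵇ j then A else τ 13 j)))
 finish-star-13 τ refl refl refl refl = refl

 finish-star-ends : ∀ τ → exec finish-star τ 3 17 ≡ τ 3 8 × exec finish-star τ 3 18 ≡ τ 3 9 × exec finish-star τ 3 7 ≡ τ 3 7
 finish-star-ends τ = refl , refl , refl

 finish-star-history : ∀ {n} τ → History {n} τ (exec finish-star τ)
 finish-star-history τ = record { h-0 = λ _ → refl ; h-6 = λ _ → refl ; h-14 = λ _ → refl ; h-15 = λ _ → refl ; h-16 = λ _ → refl ; h-17 = λ _ → refl ; h-18 = λ _ → refl }

module _ {n : ℕ} {G : Fin n → Fin n → Set} {S₀ : Fin n → ℕ} where

 find-cost : ℕ
 find-cost = suc (cost (lit 1 ⊖ 12 [ var #i ]) + maxTime next-vertex)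

 run-find-active : ∀ {σ} → Inv G S₀ σ →
  ∃ λ τ → Inv G S₀ τ × τ 3 6 ≡ σ 3 6 × τ 12 (τ 3 5) ≢ 0 × Runs find-active σ (suc (cost (lit 1 ⊖ 12 [ var #i ])) + find-cost * n) τ
 run-find-active {σ} inv with run-while {e = lit 1 ⊖ 12 [ var #i ]} {next-vertex} find-cost (λ m υ → n ∸ υ 3 5 ≡ m × Inv G S₀ υ × υ 3 6 ≡ σ 3 6) advance (n ∸ σ 3 5) σ (refl , inv , refl)
  where
   advance : ∀ m υ → n ∸ υ 3 5 ≡ m × Inv G S₀ υ × υ 3 6 ≡ σ 3 6 → 1 ∸ υ 12 (υ 3 5) ≢ 0 →
    ∃₂ λ m′ υ′ → (n ∸ υ′ 3 5 ≡ m′ × Inv G S₀ υ′ × υ′ 3 6 ≡ σ 3 6) × ∃ λ b → Runs next-vertex υ b υ′ × suc (cost (lit 1 ⊖ 12 [ var #i ]) + b) + find-cost * m′ ≤ find-cost * m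
   advance _ υ (refl , i , e) ne = _ , exec next-vertex υ , (refl , inv-next i (λ _ _ _ _ act eq → act (trans (cong (υ 12) eq) z)) , e)
    , maxTime next-vertex , run-loop-free next-vertex _ υ
    , pay find-cost (ℕ.∸-monoʳ-< (ℕ.m<m+n (υ 3 5) (s≤s z≤n)) (subst (_≤ n) (ℕ.+-comm 1 (υ 3 5)) (scan-bound i)))
    where
     zero-of : ∀ x → 1 ∸ x ≢ 0 → x ≡ 0
     zero-of zero    _ = refl
     zero-of (suc x) h = ⊥-elim (h (ℕ.0∸n≡0 x))
     z : υ 12 (υ 3 5) ≡ 0
     z = zero-of _ ne
 ... | _ , τ , (_ , i , e) , z , (t , r , t≤) = τ , i , e , (λ z′ → case trans (sym (cong (1 ∸_) z′)) z of λ ()) ,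
  (t , r , ℕ.≤-trans t≤ (ℕ.+-monoʳ-≤ (suc (cost (lit 1 ⊖ 12 [ var #i ]))) (ℕ.*-monoʳ-≤ find-cost (ℕ.m∸n≤m n (σ 3 5)))))

 record Quad (σ τ : Store) (w₁ w₂ w₃ w₄ : Fin n) : Set where
  field
   same : SameArrays σ τ
   e-7  : τ 3 7 ≡ σ 3 7
   e-5  : τ 3 5 ≡ toℕ w₁
   e-8  : τ 3 8 ≡ toℕ w₂
   e-9  : τ 3 9 ≡ toℕ w₃
   e-10 : τ 3 10 ≡ toℕ w₄

 badness : Store → Fin n → Fin n → Fin n → Fin n → ℕ
 badness σ w₁ w₂ w₃ w₄ = σ 11 (toℕ w₁) + σ 9 (cell w₂ w₁) + σ 9 (cell w₃ w₁) + σ 9 (cell w₄ w₁) ∸ 3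

 badness-read : ∀ {σ τ w₁ w₂ w₃ w₄} {K : Fin n → Fin n → Set} → Rep σ K → Quad σ τ w₁ w₂ w₃ w₄ → ⟦ bad-centre ⟧ τ ≡ badness σ w₁ w₂ w₃ w₄
 badness-read {σ} {τ} {w₁} {w₂} {w₃} {w₄} rep q =
  cong (_∸ 3) (cong₂ _+_ (cong₂ _+_ (cong₂ _+_ (trans (cong (τ 11) e-5) (s-11 _)) (rd w₂ e-8)) (rd w₃ e-9)) (rd w₄ e-10))
  where
   open Quad q
   open SameArrays same
   rd : ∀ {p} w → p ≡ toℕ w → entry τ p (τ 3 5) ≡ σ 9 (cell w w₁)
   rd w refl = trans (cong (entry τ (toℕ w)) e-5) (trans (entry-same same _ _) (entry-cell {G = G} {S₀} rep w w₁))

 rotate-quad : Program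
 rotate-quad = #t ≔ var #i ⨾ #i ≔ var #p ⨾ #p ≔ var #q ⨾ #q ≔ var #r ⨾ #r ≔ var #t

 opaque
  unfolding change-centre

  change-spec : ∀ {σ τ w₁ w₂ w₃ w₄} {K : Fin n → Fin n → Set} → Rep σ K → Quad σ τ w₁ w₂ w₃ w₄ →
   (badness σ w₁ w₂ w₃ w₄ ≡ 0 × Quad σ (exec change-centre τ) w₁ w₂ w₃ w₄) ⊎
   (badness σ w₁ w₂ w₃ w₄ ≢ 0 × Quad σ (exec change-centre τ) w₂ w₃ w₄ w₁)
  change-spec {σ} {τ} {w₁} {w₂} {w₃} {w₄} rep q with badness σ w₁ w₂ w₃ w₄ ≟ 0
  ... | yes z = inl (z , subst (λ υ → Quad σ υ w₁ w₂ w₃ w₄) (sym (choose-zero (trans (badness-read rep q) z))) q)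
  ... | no ne = inr (ne , subst (λ υ → Quad σ υ w₂ w₃ w₄ w₁) (sym (choose-suc (λ z → ne (trans (sym (badness-read rep q)) z)))) record
   { same = same-trans same (scalars-same rotate-quad (more (more (more (more one)))) τ)
   ; e-7 = e-7 ; e-5 = e-8 ; e-8 = e-9 ; e-9 = e-10 ; e-10 = e-5 })
   where open Quad q

 module _ {σ : Store} (inv : Inv G S₀ σ) (four : length (verts (Inv.t inv)) ≡ 4) (act : σ 12 (σ 3 5) ≢ 0) where
  open Inv inv
  open Rep rep

  private
   vs : List (Fin n)
   vs = verts t
   Centre : Fin n → Set
   Centre w = σ 11 (toℕ w) ≡ 0 × (∀ {o} → o ∈ vs → o ≢ w → σ 9 (cell o w) ≡ 1)
   the-centre : ∃ λ y → y ∈ vs × Centre y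
   the-centre = four-vertices-centre good-t four comp-t
   y : Fin n
   y = fst the-centre
   alv : ∀ {w} → w ∈ vs → Alive K w
   alv m = let z , e = has-neighbour good-t m in z , to fits-t e

  module _ {w₁ w₂ w₃ w₄ : Fin n} (π : w₁ ∷ w₂ ∷ w₃ ∷ w₄ ∷ [] ↭ vs) where

   private
    un : Unique (w₁ ∷ w₂ ∷ w₃ ∷ w₄ ∷ [])
    un = unique-resp-↭ (↭-sym π) (unV (uniq good-t))
    ≢₁ : ∀ {o} → o ∈ w₂ ∷ w₃ ∷ w₄ ∷ [] → o ≢ w₁
    ≢₁ m refl = Uniq.Unique[x∷xs]⇒x∉xs un m
    ≥1 : ∀ {o} → o ∈ w₂ ∷ w₃ ∷ w₄ ∷ [] → 1 ≤ σ 9 (cell o w₁)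
    ≥1 m = ℕ.n≢0⇒n>0 (to (matrix (alv (∈-resp-↭ π (there m))) (alv (∈-resp-↭ π (here refl))))
     (to fits-t (four-vertices-complete good-t four (∈-resp-↭ π (there m)) (∈-resp-↭ π (here refl)) (≢₁ m))))

   good-centre : badness σ w₁ w₂ w₃ w₄ ≡ 0 → Centre w₁
   good-centre z with sum-is-three⁻ (σ 11 (toℕ w₁)) _ _ _ (≥1 (here refl)) (≥1 (there (here refl))) (≥1 (there (there (here refl)))) z
   ... | j , p , q , r = j , λ m ne → go (∈-resp-↭ (↭-sym π) m) ne
    where
     go : ∀ {o} → o ∈ w₁ ∷ w₂ ∷ w₃ ∷ w₄ ∷ [] → o ≢ w₁ → σ 9 (cell o w₁) ≡ 1
     go (here e) ne = ⊥-elim (ne e)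
     go (there (here refl)) _ = p
     go (there (there (here refl))) _ = q
     go (there (there (there (here refl)))) _ = r

   centre-good : Centre w₁ → badness σ w₁ w₂ w₃ w₄ ≡ 0
   centre-good (j , h) = cong (_∸ 3) (cong₂ _+_ (cong₂ _+_ (cong₂ _+_ j (ok (here refl))) (ok (there (here refl)))) (ok (there (there (here refl)))))
    where
     ok : ∀ {o} → o ∈ w₂ ∷ w₃ ∷ w₄ ∷ [] → σ 9 (cell o w₁) ≡ 1
     ok m = h (∈-resp-↭ π (there m)) (≢₁ m)

  Search : ℕ → Store → Set
  Search k τ = ∃₂ λ w₁ w₂ → ∃₂ λ w₃ w₄ → w₁ ∷ w₂ ∷ w₃ ∷ w₄ ∷ [] ↭ vs × Quad σ τ w₁ w₂ w₃ w₄ × (Centre w₁ ⊎ y ∈ take k (w₁ ∷ w₂ ∷ w₃ ∷ w₄ ∷ []))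

  search-step : ∀ k {τ} → k ≤ 3 → Search (suc k) τ → Search k (exec change-centre τ)
  search-step k {τ} k≤3 (w₁ , w₂ , w₃ , w₄ , π , q , c) with change-spec rep q
  ... | inl (z , q′) = w₁ , w₂ , w₃ , w₄ , π , q′ , inl (good-centre π z)
  ... | inr (ne , q′) = w₂ , w₃ , w₄ , w₁ , ↭-trans rot π , q′ , inr (go c)
   where
    rot : w₂ ∷ w₃ ∷ w₄ ∷ w₁ ∷ [] ↭ w₁ ∷ w₂ ∷ w₃ ∷ w₄ ∷ []
    rot = ↭-sym (Perm.∷↭∷ʳ w₁ (w₂ ∷ w₃ ∷ w₄ ∷ []))
    prefix : ∀ k → k ≤ 3 → y ∈ take k (w₂ ∷ w₃ ∷ w₄ ∷ []) → y ∈ take k (w₂ ∷ w₃ ∷ w₄ ∷ w₁ ∷ [])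
    prefix 0 _ ()
    prefix 1 _ m = m
    prefix 2 _ m = m
    prefix 3 _ m = m
    prefix (suc (suc (suc (suc k)))) (s≤s (s≤s (s≤s ()))) _
    go : Centre w₁ ⊎ y ∈ w₁ ∷ take k (w₂ ∷ w₃ ∷ w₄ ∷ []) → y ∈ take k (w₂ ∷ w₃ ∷ w₄ ∷ w₁ ∷ [])
    go (inl ce) = ⊥-elim (ne (centre-good π ce))
    go (inr (here refl)) = ⊥-elim (ne (centre-good π (snd (snd the-centre))))
    go (inr (there m)) = prefix k k≤3 m

  star-made : Undone {G = G} (exec make-star σ) (σ 3 7) × History {n} σ (exec make-star σ)
  star-made with at-active inv act
  ... | atActive {a} {n₁} {n₂} {n₃} is-a na ld = go (search-step 1 (s≤s z≤n) (search-step 2 (s≤s (s≤s z≤n)) (search-step 3 (s≤s (s≤s (s≤s z≤n))) start′)))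
   where
    in-vs : ∀ {w} → w ∈ a ∷ n₁ ∷ n₂ ∷ n₃ ∷ [] → w ∈ vs
    in-vs (here refl) = fst (Adj-∈ t (from fits-t (from (members na) (here refl))))
    in-vs (there m) = snd (Adj-∈ t (from fits-t (from (members na) m)))
    π₀ : a ∷ n₁ ∷ n₂ ∷ n₃ ∷ [] ↭ vs
    π₀ = unique-⊆-↭ (All.tabulate (λ m e → K-irr (subst (K a) (sym e) (from (members na) m))) ∷ distinct na) in-vs (sym four)
    start′ : Search 4 (exec load-triple σ)
    start′ = a , n₁ , n₂ , n₃ , π₀ , record { same = Triple.same ld ; e-7 = Triple.e-7 ld ; e-5 = trans (Triple.e-5 ld) (sym is-a)
     ; e-8 = Triple.e-8 ld ; e-9 = Triple.e-9 ld ; e-10 = Triple.e-10 ld }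
     , inr (∈-resp-↭ (↭-sym π₀) (fst (snd the-centre)))
    go : ∀ {τ} → Search 1 τ → Undone {G = G} (exec finish-star τ) (σ 3 7) × History {n} σ (exec finish-star τ)
    go {τ} (z , u , v , w , π , q , c) = undo-chain chain (trans (snd (snd (finish-star-ends τ))) e-7) hist g f co desc , hist
     where
      open Quad q
      open SameArrays same
      un : Unique (z ∷ u ∷ v ∷ w ∷ [])
      un = unique-resp-↭ (↭-sym π) (unV (uniq good-t))
      cz : Centre z
      cz = [ id , (λ { (here e) → subst Centre e (snd (snd the-centre)) }) ]′ c
      g : Good (star z u v w)
      g = star-good un
      f : Fits (star z u v w) K
      f {x} {x′} = mk⇔ (λ e → to fits-t (four-vertices-complete good-t four (∈-resp-↭ π (fst (Adj-∈ (star z u v w) e))) (∈-resp-↭ π (snd (Adj-∈ (star z u v w) e)))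
       (λ { refl → Adj-irrefl g e })))
       (λ k → four-vertices-complete g refl (∈-resp-↭ (↭-sym π) (fst (Adj-∈ t (from fits-t k)))) (∈-resp-↭ (↭-sym π) (snd (Adj-∈ t (from fits-t k))))
        (λ { refl → K-irr k }))
      ≢z : ∀ {p} → p ∈ u ∷ v ∷ w ∷ [] → p ≢ z
      ≢z m refl = Uniq.Unique[x∷xs]⇒x∉xs un m
      co : Compat (OkIn σ) (IntOkIn σ) (star z u v w)
      co = compat (λ { {p} pr → let m , e = star-par un pr in subst (OkIn σ p) (sym e) (snd cz (∈-resp-↭ π (there m)) (≢z m)) })
                  (λ { (here refl) → fst cz })
      hist : History {n} σ (exec finish-star τ)
      hist = history-trans {n = n} (record { h-0 = s-0 ; h-6 = s-6 ; h-14 = s-14 ; h-15 = s-15 ; h-16 = s-16 ; h-17 = s-17 ; h-18 = s-18 }) (finish-star-history τ)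
      par : ∀ {p} → p ∈ u ∷ v ∷ w ∷ [] → exec finish-star τ 13 (toℕ p) ≡ toℕ z
      par (here refl) = trans (finish-star-13 τ e-5 e-8 e-9 e-10) (trans (miss (fst (snd (distinct₃ (unique-tail un))))) (trans (miss (fst (distinct₃ (unique-tail un)))) (hit {u = u})))
      par (there (here refl)) = trans (finish-star-13 τ e-5 e-8 e-9 e-10) (trans (miss (snd (snd (distinct₃ (unique-tail un))))) (hit {u = v}))
      par (there (there (here refl))) = trans (finish-star-13 τ e-5 e-8 e-9 e-10) (hit {u = w})
      desc : Desc (exec finish-star τ) (star z u v w)
      desc = record
       { parents = λ pr → let m , e = star-par un pr in trans (par m) (cong toℕ (sym e))
       ; internal = λ { (here refl) → trans (finish-star-1 τ e-5) (hit {u = z}) }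
       ; others = λ {y} n → trans (finish-star-1 τ e-5) (trans (miss (λ e → n (here e))) (trans (s-1 _) (blank _)))
       ; c₀ = u ; c₁ = v ; at-c₀ = trans (fst (finish-star-ends τ)) e-8 ; at-c₁ = trans (fst (snd (finish-star-ends τ))) e-9
       ; leaf-c₀ = here refl ; leaf-c₁ = there (here refl)
       ; edge = inr (inl (inl (refl , refl))) }

At : (ℕ → ℕ) → ℕ → List ℕ → Set
At f p []       = ⊤
At f p (x ∷ xs) = f p ≡ x × At f (suc p) xs

At-cong : ∀ {f g} p xs → (∀ j → g j ≡ f j) → At f p xs → At g p xs
At-cong p []       e _       = tt
At-cong p (x ∷ xs) e (q , a) = trans (e p) q , At-cong (suc p) xs e a

At-suc : ∀ {f} p xs → At (f ∘ suc) p xs → At f (suc p) xs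
At-suc p []       _       = tt
At-suc p (x ∷ xs) (q , a) = q , At-suc (suc p) xs a

At-load : ∀ xs → At (load xs 0) 0 xs
At-load []       = tt
At-load (x ∷ xs) = refl , At-suc 0 xs (At-load xs)

At-++ : ∀ {f} p xs {ys} → At f p (xs ++ ys) → At f p xs × At f (p + length xs) ys
At-++ p []       a rewrite ℕ.+-identityʳ p = tt , a
At-++ {f} p (x ∷ xs) {ys} (q , a) = let b , c = At-++ (suc p) xs a in (q , b) , subst (λ m → At f m ys) (sym (ℕ.+-suc p (length xs))) c

last-two : List ℕ → ℕ × ℕ → ℕ × ℕ
last-two []       ab      = ab
last-two (u ∷ us) (a , b) = last-two us (u , a)

record RowRead (σ τ : Store) (v r : ℕ) (us : List ℕ) : Set where
 field
  f-0   : ∀ j → τ 0 j ≡ σ 0 j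
  f-1   : ∀ j → τ 1 j ≡ σ 1 j
  f-4   : ∀ j → τ 4 j ≡ σ 4 j
  f-6   : ∀ j → τ 6 j ≡ σ 6 j
  f-10  : ∀ j → τ 10 j ≡ σ 10 j
  f-11  : ∀ j → τ 11 j ≡ σ 11 j
  f-12  : ∀ j → τ 12 j ≡ σ 12 j
  f-19  : ∀ j → τ 19 j ≡ σ 19 j
  v≡    : τ 3 0 ≡ σ 3 0
  pos≡  : τ 3 1 ≡ σ 3 1 + length us
  row≡  : τ 3 2 ≡ σ 3 2
  cnt≡  : τ 3 3 ≡ σ 3 3
  i≡    : τ 3 5 ≡ σ 3 5
  al≡   : τ 3 6 ≡ σ 3 6
  k≡    : τ 3 7 ≡ σ 3 7
  total : τ 5 v ≡ σ 5 v + sum us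
  lasts : (τ 7 v , τ 8 v) ≡ last-two us (σ 7 v , σ 8 v)
  o-5   : ∀ {j} → v ≢ j → τ 5 j ≡ σ 5 j
  o-7   : ∀ {j} → v ≢ j → τ 7 j ≡ σ 7 j
  o-8   : ∀ {j} → v ≢ j → τ 8 j ≡ σ 8 j
  m-in  : ∀ {u} → u ∈ us → τ 9 (r + u) ≡ 1
  m-out : ∀ {j} → (∀ {u} → u ∈ us → r + u ≢ j) → τ 9 j ≡ σ 9 j

row-time : ℕ
row-time = suc (cost (var #deg) + maxTime read-neighbour)

row-read-one : ∀ σ {v r u} → σ 3 0 ≡ v → σ 10 v ≡ r → σ 0 (σ 3 1) ≡ u → RowRead σ (exec read-neighbour σ) v r (u ∷ [])
row-read-one σ {v} {r} {u} refl refl refl = record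
 { f-0 = λ _ → refl ; f-1 = λ _ → refl ; f-4 = λ _ → refl ; f-6 = λ _ → refl ; f-10 = λ _ → refl ; f-11 = λ _ → refl ; f-12 = λ _ → refl ; f-19 = λ _ → refl
 ; v≡ = refl ; pos≡ = refl ; row≡ = refl ; cnt≡ = refl ; i≡ = refl ; al≡ = refl ; k≡ = refl
 ; total = trans (upd-hit {v} refl) (cong (σ 5 v +_) (sym (ℕ.+-identityʳ u)))
 ; lasts = cong₂ _,_ (upd-hit {v} refl) (upd-hit {v} refl)
 ; o-5 = upd-miss ; o-7 = upd-miss ; o-8 = upd-miss
 ; m-in = λ { (here refl) → upd-hit {r + u} refl }
 ; m-out = λ h → upd-miss (h (here refl)) }

row-read-++ : ∀ {σ τ υ v r u us} → RowRead σ τ v r (u ∷ []) → RowRead τ υ v r us → RowRead σ υ v r (u ∷ us)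
row-read-++ {σ} {τ} {υ} {v} {r} {u} {us} a b = record
 { f-0 = λ j → trans (B.f-0 j) (A.f-0 j) ; f-1 = λ j → trans (B.f-1 j) (A.f-1 j) ; f-4 = λ j → trans (B.f-4 j) (A.f-4 j)
 ; f-6 = λ j → trans (B.f-6 j) (A.f-6 j) ; f-10 = λ j → trans (B.f-10 j) (A.f-10 j) ; f-11 = λ j → trans (B.f-11 j) (A.f-11 j)
 ; f-12 = λ j → trans (B.f-12 j) (A.f-12 j) ; f-19 = λ j → trans (B.f-19 j) (A.f-19 j)
 ; v≡ = trans B.v≡ A.v≡ ; pos≡ = trans B.pos≡ (trans (cong (_+ length us) A.pos≡) (ℕ.+-assoc (σ 3 1) 1 _)) ; row≡ = trans B.row≡ A.row≡
 ; cnt≡ = trans B.cnt≡ A.cnt≡ ; i≡ = trans B.i≡ A.i≡ ; al≡ = trans B.al≡ A.al≡ ; k≡ = trans B.k≡ A.k≡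
 ; total = trans B.total (trans (cong (_+ sum us) A.total) (trans (ℕ.+-assoc (σ 5 v) _ _) (cong (λ x → σ 5 v + (x + sum us)) (ℕ.+-identityʳ u))))
 ; lasts = trans B.lasts (cong (last-two us) A.lasts)
 ; o-5 = λ n → trans (B.o-5 n) (A.o-5 n) ; o-7 = λ n → trans (B.o-7 n) (A.o-7 n) ; o-8 = λ n → trans (B.o-8 n) (A.o-8 n)
 ; m-in = m-in
 ; m-out = λ h → trans (B.m-out (h ∘ there)) (A.m-out (λ { (here refl) → h (here refl) })) }
 where
  module A = RowRead a
  module B = RowRead b
  m-in : ∀ {w} → w ∈ u ∷ us → υ 9 (r + w) ≡ 1
  m-in {w} m with DecMem._∈?_ _≟_ w us
  ... | yes m′ = B.m-in m′
  m-in {w} (here refl) | no n = trans (B.m-out (λ {w′} m′ e → n (subst (_∈ us) (ℕ.+-cancelˡ-≡ r w′ w e) m′))) (A.m-in (here refl))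
  m-in (there m) | no n = ⊥-elim (n m)

run-row : ∀ us σ {v r} → σ 3 0 ≡ v → σ 10 v ≡ r → At (σ 0) (σ 3 1) us → σ 3 4 ≡ length us →
 ∃ λ τ → RowRead σ τ v r us × Runs (while≢0 var #deg repeat read-neighbour) σ (suc (cost (var #deg)) + row-time * length us) τ
run-row [] σ ev er _ ed = σ , record
 { f-0 = λ _ → refl ; f-1 = λ _ → refl ; f-4 = λ _ → refl ; f-6 = λ _ → refl ; f-10 = λ _ → refl ; f-11 = λ _ → refl ; f-12 = λ _ → refl ; f-19 = λ _ → refl
 ; v≡ = refl ; pos≡ = sym (ℕ.+-identityʳ _) ; row≡ = refl ; cnt≡ = refl ; i≡ = refl ; al≡ = refl ; k≡ = refl
 ; total = sym (ℕ.+-identityʳ _) ; lasts = refl ; o-5 = λ _ → refl ; o-7 = λ _ → refl ; o-8 = λ _ → refl ; m-in = λ () ; m-out = λ _ → refl }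
 , _ , stop ed , ℕ.m≤m+n _ _
run-row (u ∷ us) σ {v} {r} ev er (eu , at) ed
 with row-read-one σ ev er eu | run-loop-free read-neighbour _ σ
... | first-read | t , run , t≤ with run-row us (exec read-neighbour σ) (trans (RowRead.v≡ first-read) ev) (trans (RowRead.f-10 first-read v) er)
 (subst (λ p → At (exec read-neighbour σ 0) p us) (ℕ.+-comm 1 (σ 3 1)) at) (cong (_∸ 1) ed)
...   | τ , rest , t′ , run′ , t′≤ = τ , row-read-++ first-read rest , _ , loop (λ z → case trans (sym ed) z of λ ()) run run′ , bound
 where
  c : ℕ
  c = cost (var #deg)
  bound : suc (c + (t + t′)) ≤ suc c + row-time * suc (length us)
  bound = ℕ.≤-trans (s≤s (ℕ.+-monoʳ-≤ c (ℕ.+-mono-≤ t≤ t′≤)))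
   (ℕ.≤-reflexive (trans (lem c (maxTime read-neighbour) (row-time * length us)) (cong (suc c +_) (sym (ℕ.*-suc row-time (length us))))))
   where
    lem : ∀ c b x → suc (c + (b + (suc c + x))) ≡ suc c + (suc (c + b) + x)
    lem = solve-∀

module _ {n : ℕ} (nbs : Fin n → List (Fin n)) where

 record-of : Fin n → List ℕ
 record-of v = length (nbs v) ∷ map toℕ (nbs v)

 record Done (σ : Store) (w : Fin n) : Set where
  field
   d-4   : σ 4 (toℕ w) ≡ length (nbs w)
   d-5   : σ 5 (toℕ w) ≡ sum (map toℕ (nbs w))
   d-6   : σ 6 (toℕ w) ≡ sum (map toℕ (nbs w))
   d-10  : σ 10 (toℕ w) ≡ toℕ w * n
   d-12  : σ 12 (toℕ w) ≡ 1 ∸ ((length (nbs w) ∸ 3) + (3 ∸ length (nbs w)))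
   d-19  : σ 19 (toℕ w) ≡ toℕ w
   d-78  : ∃ λ ab → (σ 7 (toℕ w) , σ 8 (toℕ w)) ≡ last-two (map toℕ (nbs w)) ab
   d-in  : ∀ {u} → u ∈ nbs w → σ 9 (cell w u) ≡ 1
   d-out : ∀ {u} → u ∉ nbs w → σ 9 (cell w u) ≡ 0

 record Reading (k : ℕ) (vs : List (Fin n)) (σ : Store) : Set where
  field
   r-v    : σ 3 0 ≡ k
   r-row  : σ 3 2 ≡ k * n
   r-cnt  : σ 3 3 ≡ length vs
   r-at   : At (σ 0) (σ 3 1) (concatMap record-of vs)
   done   : ∀ w → toℕ w < k → Done σ w
   fresh₅ : ∀ w → k ≤ w → σ 5 w ≡ 0
   fresh₉ : ∀ (w u : Fin n) → k ≤ toℕ w → σ 9 (cell w u) ≡ 0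
   r-0    : σ 0 0 ≡ n
   r-1    : ∀ j → σ 1 j ≡ 0
   r-11   : ∀ j → σ 11 j ≡ 0
   r-i    : σ 3 5 ≡ 0
   r-al   : σ 3 6 ≡ n
   r-k    : σ 3 7 ≡ 0

 vertex-body : Program
 vertex-body = start-vertex ⨾ while≢0 var #deg repeat read-neighbour ⨾ end-vertex

 record Started (σ τ : Store) (v p : ℕ) : Set where
  field
   a-0  : ∀ j → τ 0 j ≡ σ 0 j
   a-1  : ∀ j → τ 1 j ≡ σ 1 j
   a-5  : ∀ j → τ 5 j ≡ σ 5 j
   a-6  : ∀ j → τ 6 j ≡ σ 6 j
   a-7  : ∀ j → τ 7 j ≡ σ 7 j
   a-8  : ∀ j → τ 8 j ≡ σ 8 j
   a-9  : ∀ j → τ 9 j ≡ σ 9 j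
   a-11 : ∀ j → τ 11 j ≡ σ 11 j
   a-4  : ∀ j → τ 4 j ≡ (if v ≡ᵇ j then σ 0 p else σ 4 j)
   a-10 : ∀ j → τ 10 j ≡ (if v ≡ᵇ j then σ 3 2 else σ 10 j)
   a-12 : ∀ j → τ 12 j ≡ (if v ≡ᵇ j then 1 ∸ ((σ 0 p ∸ 3) + (3 ∸ σ 0 p)) else σ 12 j)
   a-19 : ∀ j → τ 19 j ≡ (if v ≡ᵇ j then v else σ 19 j)
   s-v  : τ 3 0 ≡ v
   s-p  : τ 3 1 ≡ suc p
   s-r  : τ 3 2 ≡ σ 3 2 + σ 0 0
   s-c  : τ 3 3 ≡ σ 3 3
   s-d  : τ 3 4 ≡ σ 0 p
   s-i  : τ 3 5 ≡ σ 3 5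
   s-al : τ 3 6 ≡ σ 3 6
   s-k  : τ 3 7 ≡ σ 3 7

 started : ∀ σ {v p} → σ 3 0 ≡ v → σ 3 1 ≡ p → Started σ (exec start-vertex σ) v p
 started σ refl refl = record
  { a-0 = λ _ → refl ; a-1 = λ _ → refl ; a-5 = λ _ → refl ; a-6 = λ _ → refl ; a-7 = λ _ → refl ; a-8 = λ _ → refl ; a-9 = λ _ → refl ; a-11 = λ _ → refl
  ; a-4 = λ _ → refl ; a-10 = λ _ → refl ; a-12 = λ _ → refl ; a-19 = λ _ → refl
  ; s-v = refl ; s-p = ℕ.+-comm (σ 3 1) 1 ; s-r = refl ; s-c = refl ; s-d = refl ; s-i = refl ; s-al = refl ; s-k = refl }

 vertex-time : ℕ
 vertex-time = suc (cost (var #cnt) + (maxTime start-vertex + (suc (cost (var #deg)) + row-time + maxTime end-vertex)))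

 read-vertex : ∀ {k v vs σ} → toℕ v ≡ k → Reading k (v ∷ vs) σ →
  ∃ λ τ → Reading (suc k) vs τ × ∃ λ b → Runs vertex-body σ b τ × suc (cost (var #cnt) + b) ≤ vertex-time * length (record-of v)
 read-vertex {k} {v} {vs} {σ} refl rd with started σ {toℕ v} {σ 3 1} (Reading.r-v rd) refl
 ... | st with At-++ {σ 0} (σ 3 1) (record-of v) (Reading.r-at rd)
 ...   | (ed , at₁) , at₂ with run-row (map toℕ (nbs v)) (exec start-vertex σ) {toℕ v} {toℕ v * n} (Started.s-v st)
  (trans (Started.a-10 st (toℕ v)) (trans (hit {u = v}) (Reading.r-row rd)))
  (subst (λ p → At (exec start-vertex σ 0) p (map toℕ (nbs v))) (sym (Started.s-p st)) (At-cong _ _ (Started.a-0 st) at₁))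
  (trans (Started.s-d st) (trans ed (sym (length-map toℕ (nbs v)))))
 ...     | υ , row , run-r with run-loop-free start-vertex _ σ | run-loop-free end-vertex _ υ
 ...       | run-s | run-e = exec end-vertex υ , next-reading , _ , run-seq run-s (run-seq run-r run-e) , time
  where
   module S = Started st
   module W = RowRead row
   open Reading rd
   τ : Store
   τ = exec end-vertex υ
   V≡ : υ 3 0 ≡ toℕ v
   V≡ = trans W.v≡ S.s-v
   six : ∀ {x j} → υ 3 0 ≡ x → τ 6 j ≡ (if x ≡ᵇ j then υ 5 x else υ 6 j)
   six refl = refl
   total : υ 5 (toℕ v) ≡ sum (map toℕ (nbs v))
   total = trans W.total (cong (_+ sum (map toℕ (nbs v))) (trans (S.a-5 _) (fresh₅ _ ℕ.≤-refl)))
   out-other : ∀ {w u : Fin n} → w ≢ v → υ 9 (cell w u) ≡ σ 9 (cell w u)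
   out-other {w} {u} ne = trans (W.m-out (λ {x} m e → case ∈-map⁻ toℕ m of λ { (y , _ , refl) → ne (sym (fst (cell-injective {u = v} {y} {w} {u} e))) })) (S.a-9 _)
   not : ∀ {w : Fin n} → w ≢ v → toℕ v ≢ toℕ w
   not ne e = ne (sym (toℕ-injective e))
   old-done : ∀ w → w ≢ v → Done σ w → Done τ w
   old-done w ne d = record
    { d-4 = trans (W.f-4 _) (trans (S.a-4 _) (trans (miss ne) d-4))
    ; d-5 = trans (W.o-5 (not ne)) (trans (S.a-5 _) d-5)
    ; d-6 = trans (six V≡) (trans (miss ne) (trans (W.f-6 _) (trans (S.a-6 _) d-6)))
    ; d-10 = trans (W.f-10 _) (trans (S.a-10 _) (trans (miss ne) d-10))
    ; d-12 = trans (W.f-12 _) (trans (S.a-12 _) (trans (miss ne) d-12))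
    ; d-19 = trans (W.f-19 _) (trans (S.a-19 _) (trans (miss ne) d-19))
    ; d-78 = fst d-78 , trans (cong₂ _,_ (trans (W.o-7 (not ne)) (S.a-7 _)) (trans (W.o-8 (not ne)) (S.a-8 _))) (snd d-78)
    ; d-in = λ {u} m → trans (out-other {w} {u} ne) (d-in m)
    ; d-out = λ {u} m → trans (out-other {w} {u} ne) (d-out m) }
    where open Done d
   new-done : Done τ v
   new-done = record
    { d-4 = trans (W.f-4 _) (trans (S.a-4 _) (trans (hit {u = v}) ed))
    ; d-5 = total
    ; d-6 = trans (six V≡) (trans (hit {u = v}) total)
    ; d-10 = trans (W.f-10 _) (trans (S.a-10 _) (trans (hit {u = v}) r-row))
    ; d-12 = trans (W.f-12 _) (trans (S.a-12 _) (trans (hit {u = v}) (cong (λ d → 1 ∸ ((d ∸ 3) + (3 ∸ d))) ed)))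
    ; d-19 = trans (W.f-19 _) (trans (S.a-19 _) (hit {u = v}))
    ; d-78 = _ , W.lasts
    ; d-in = λ {u} m → W.m-in (∈-map⁺ toℕ m)
    ; d-out = λ {u} m → trans (W.m-out (λ m′ e → case ∈-map⁻ toℕ m′ of λ { (y , y∈ , refl) → m (subst (_∈ nbs v) (snd (cell-injective {u = v} {y} {v} {u} e)) y∈) }))
     (trans (S.a-9 _) (fresh₉ v u ℕ.≤-refl)) }
   next-reading : Reading (suc (toℕ v)) vs τ
   next-reading = record
    { r-v = trans (cong (_+ 1) V≡) (ℕ.+-comm (toℕ v) 1)
    ; r-row = trans W.row≡ (trans S.s-r (trans (cong₂ _+_ r-row r-0) (ℕ.+-comm _ n)))
    ; r-cnt = cong (_∸ 1) (trans W.cnt≡ (trans S.s-c r-cnt))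
    ; r-at = subst (λ p → At (υ 0) p (concatMap record-of vs))
     (sym (trans W.pos≡ (trans (cong (_+ length (map toℕ (nbs v))) S.s-p) (sym (ℕ.+-suc (σ 3 1) _)))))
     (At-cong _ _ (λ j → trans (W.f-0 j) (S.a-0 j)) at₂)
    ; done = λ w lt → case w Fin.≟ v of λ
     { (yes refl) → new-done
     ; (no ne) → old-done w ne (done w (ℕ.≤∧≢⇒< (ℕ.≤-pred lt) (λ e → ne (toℕ-injective e)))) }
    ; fresh₅ = λ w le → trans (W.o-5 (ℕ.<⇒≢ le)) (trans (S.a-5 _) (fresh₅ w (ℕ.<⇒≤ le)))
    ; fresh₉ = λ w u le → trans (out-other {w} {u} (λ e → ℕ.<⇒≢ le (cong toℕ (sym e)))) (fresh₉ w u (ℕ.<⇒≤ le))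
    ; r-0 = trans (W.f-0 _) (trans (S.a-0 _) r-0) ; r-1 = λ j → trans (W.f-1 j) (trans (S.a-1 j) (r-1 j))
    ; r-11 = λ j → trans (W.f-11 j) (trans (S.a-11 j) (r-11 j))
    ; r-i = trans W.i≡ (trans S.s-i r-i) ; r-al = trans W.al≡ (trans S.s-al r-al) ; r-k = trans W.k≡ (trans S.s-k r-k) }
   time : suc (cost (var #cnt) + (maxTime start-vertex + (suc (cost (var #deg)) + row-time * length (map toℕ (nbs v)) + maxTime end-vertex))) ≤ vertex-time * length (record-of v)
   time = ℕ.≤-trans (ℕ.≤-trans (ℕ.m≤m+n _ (row-time + rest * l)) (ℕ.≤-reflexive (lem (cost (var #cnt)) (maxTime start-vertex) (cost (var #deg)) row-time (maxTime end-vertex) l)))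
    (ℕ.≤-reflexive refl)
    where
     l : ℕ
     l = length (map toℕ (nbs v))
     rest : ℕ
     rest = suc (cost (var #cnt) + (maxTime start-vertex + (suc (cost (var #deg)) + maxTime end-vertex)))
     lem : ∀ c s d r e l → suc (c + (s + (suc d + r * l + e))) + (r + suc (c + (s + (suc d + e))) * l) ≡ suc (c + (s + (suc d + r + e))) * suc l
     lem = solve-∀

module _ {n : ℕ} where

 Consecutive : ℕ → List (Fin n) → Set
 Consecutive k []       = k ≡ n
 Consecutive k (v ∷ vs) = toℕ v ≡ k × Consecutive (suc k) vs

 consecutive-tabulate : ∀ {m} (f : Fin m → Fin n) k → (∀ i → toℕ (f i) ≡ k + toℕ i) → k + m ≡ n → Consecutive k (Data.List.tabulate f)
 consecutive-tabulate {zero}  f k _ e = trans (sym (ℕ.+-identityʳ k)) e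
 consecutive-tabulate {suc m} f k h e = trans (h Fin.zero) (ℕ.+-identityʳ k) ,
  consecutive-tabulate (f ∘ Fin.suc) (suc k) (λ i → trans (h (Fin.suc i)) (ℕ.+-suc k (toℕ i))) (trans (sym (ℕ.+-suc k m)) e)

 allFin-consecutive : Consecutive 0 (allFin n)
 allFin-consecutive = consecutive-tabulate id 0 (λ _ → refl) refl

 module _ (nbs : Fin n → List (Fin n)) where

  run-vertices : ∀ vs k σ → Consecutive k vs → Reading nbs k vs σ →
   ∃ λ τ → Reading nbs n [] τ × Runs (while≢0 var #cnt repeat vertex-body nbs) σ
    (suc (cost (var #cnt)) + vertex-time nbs * length (concatMap (record-of nbs) vs)) τ
  run-vertices [] k σ refl rd = σ , rd , _ , stop (Reading.r-cnt rd) , ℕ.m≤m+n _ _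
  run-vertices (v ∷ vs) k σ (e , cs) rd with read-vertex nbs e rd
  ... | τ , rd′ , b , (t , r , t≤) , b≤ with run-vertices vs (suc k) τ cs rd′
  ...   | υ , rd″ , t′ , r′ , t′≤ = υ , rd″ , _ , loop (λ z → case trans (sym (Reading.r-cnt rd)) z of λ ()) r r′ , bound
   where
    c V l m : ℕ
    c = cost (var #cnt)
    V = vertex-time nbs
    l = length (record-of nbs v)
    m = length (concatMap (record-of nbs) vs)
    open ℕ.≤-Reasoning
    shuffle : ∀ x y z → x + (y + z) ≡ y + (x + z)
    shuffle = solve-∀
    bound : suc (c + (t + t′)) ≤ suc c + V * length (concatMap (record-of nbs) (v ∷ vs))
    bound = begin
     suc (c + (t + t′))             ≤⟨ s≤s (ℕ.+-monoʳ-≤ c (ℕ.+-mono-≤ t≤ t′≤)) ⟩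
     suc (c + (b + (suc c + V * m))) ≡⟨ cong suc (sym (ℕ.+-assoc c b _)) ⟩
     suc (c + b) + (suc c + V * m)  ≤⟨ ℕ.+-monoˡ-≤ (suc c + V * m) b≤ ⟩
     V * l + (suc c + V * m)        ≡⟨ shuffle (V * l) (suc c) (V * m) ⟩
     suc c + (V * l + V * m)        ≡⟨ cong (suc c +_) (sym (ℕ.*-distribˡ-+ V l m)) ⟩
     suc c + V * (l + m)            ≡⟨ cong (λ x → suc c + V * x) (sym (length-++ (record-of nbs v))) ⟩
     suc c + V * length (concatMap (record-of nbs) (v ∷ vs)) ∎

  input-word : List ℕ
  input-word = n ∷ concatMap (record-of nbs) (allFin n)

  length-allFin : ∀ m → length (allFin m) ≡ m
  length-allFin m = Data.List.Properties.length-tabulate id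

  read-all : ∃ λ τ → Reading nbs n [] τ × Runs read-input (load input-word)
   (maxTime (#pos ≔ lit 1 ⨾ #cnt ≔ size-of-input ⨾ #alive ≔ size-of-input) + (suc (cost (var #cnt)) + vertex-time nbs * length (concatMap (record-of nbs) (allFin n)))) τ
  read-all with run-vertices (allFin n) 0 (exec (#pos ≔ lit 1 ⨾ #cnt ≔ size-of-input ⨾ #alive ≔ size-of-input) (load input-word)) allFin-consecutive record
   { r-v = refl ; r-row = refl ; r-cnt = sym (length-allFin n) ; r-at = snd (At-load input-word)
   ; done = λ _ () ; fresh₅ = λ _ _ → refl ; fresh₉ = λ _ _ _ → refl ; r-0 = refl ; r-1 = λ _ → refl ; r-11 = λ _ → refl ; r-i = refl ; r-al = refl ; r-k = refl }
  ... | τ , rd , run = τ , rd , run-seq (run-loop-free (#pos ≔ lit 1 ⨾ #cnt ≔ size-of-input ⨾ #alive ≔ size-of-input) _ (load input-word)) run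

  neighbour-sum : Fin n → ℕ
  neighbour-sum v = sum (map toℕ (nbs v))

  initial-inv : ∀ {G : Fin n → Fin n → Set} {τ} → Symmetric G → (∀ v → Nbrs G v (nbs v)) → ∀ {t} → Good t → Fits t G → length (verts t) ≡ n →
   Reading nbs n [] τ → Inv G neighbour-sum τ
  initial-inv {G} {τ} G-sym nb {t} g f len rd = record
   { K = G ; K-sym = G-sym ; K-irr = λ k → Adj-irrefl g (from f k)
   ; t = t ; good-t = g ; fits-t = f
   ; comp-t = compat (λ {p} {y} pr → Done.d-in (done′ p) (to (members (nb p)) (to f (inl (snd pr))))) (λ _ → r-11 _)
   ; rep = record
    { rows = λ u → Done.d-10 (done′ u)
    ; locals = λ {v} _ → loc v
    ; active = λ {v} ne → alive-of v (active-degree v ne)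
    ; matrix = λ {u} {v} _ _ → mk⇔ (λ k z → case trans (sym (Done.d-in (done′ u) (to (members (nb u)) k))) z of λ ())
     (λ ne → edge-of u v ne)
    ; names = λ {v} _ → Done.d-19 (done′ v) }
   ; alive = trans r-al (sym len)
   ; scan = scan
   ; chain = subst (λ k → Chain τ G k G (OkIn τ) (IntOkIn τ)) (sym r-k) start
   ; steps = ℕ.≤-reflexive (cong₂ _+_ r-k r-al)
   ; input = r-0 ; sums = λ v → Done.d-6 (done′ v) ; blank = r-1 }
   where
    open Reading rd
    done′ : ∀ w → Done nbs τ w
    done′ w = done w (toℕ<n w)
    active-degree : ∀ v → τ 12 (toℕ v) ≢ 0 → length (nbs v) ≡ 3
    active-degree v ne with length (nbs v) ≟ 3
    ... | yes e = e
    ... | no h = ⊥-elim (ne (trans (Done.d-12 (done′ v)) (zero-of _ (differ {n = n} h))))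
     where
      zero-of : ∀ x → x ≢ 0 → 1 ∸ x ≡ 0
      zero-of zero    h = contradiction refl h
      zero-of (suc x) _ = ℕ.0∸n≡0 x
    alive-of : ∀ v → length (nbs v) ≡ 3 → Alive G v
    alive-of v e with nbs v | nb v | e
    ... | w ∷ _ | m | _ = w , from (members m) (here refl)
    edge-of : ∀ u v → τ 9 (cell u v) ≢ 0 → G u v
    edge-of u v ne with DecMem._∈?_ Fin._≟_ v (nbs u)
    ... | yes m = from (members (nb u)) m
    ... | no m = ⊥-elim (ne (Done.d-out (done′ u) m))
    loc : ∀ v → Local τ G v
    loc v = local (reverse (nbs v)) (Nbrs-↭ (↭-sym (Perm.↭-reverse (nbs v))) (nb v))
     (trans (Done.d-4 (done′ v)) (sym (↭-length (Perm.↭-reverse (nbs v)))))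
     (trans (Done.d-5 (done′ v)) (sym (sum-↭ (Perm.map⁺ toℕ (Perm.↭-reverse (nbs v))))))
     (λ ne → tr (nbs v) (active-degree v ne) (snd (Done.d-78 (done′ v))))
     where
      tr : ∀ us → length us ≡ 3 → ∀ {ab} → (τ 7 (toℕ v) , τ 8 (toℕ v)) ≡ last-two (map toℕ us) ab →
       ∃₂ λ n₁ n₂ → ∃ λ n₃ → reverse us ≡ n₁ ∷ n₂ ∷ n₃ ∷ [] × τ 7 (toℕ v) ≡ toℕ n₁ × τ 8 (toℕ v) ≡ toℕ n₂
      tr (u₁ ∷ u₂ ∷ u₃ ∷ []) _ e = u₃ , u₂ , u₁ , refl , cong fst e , cong snd e
    leaf-active : ∀ {v} → v ∈ Lvs t → τ 12 (toℕ v) ≢ 0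
    leaf-active {v} l z = case trans (sym (trans (Done.d-12 (done′ v)) (cong (λ d → 1 ∸ ((d ∸ 3) + (3 ∸ d))) (leaf-degree g f l (nb v))))) z of λ ()
    scan : ∀ {u v w} → G u v → G u w → G v w → ∃ λ e → e ∈ u ∷ v ∷ w ∷ [] × τ 12 (toℕ e) ≢ 0 × τ 3 5 ≤ toℕ e
    scan {u} {v} {w} uv uw vw with leaf-or-int t (fst (Adj-∈ t (from f uv))) | leaf-or-int t (snd (Adj-∈ t (from f uv)))
    ... | inl l | _ = u , here refl , leaf-active l , subst (_≤ toℕ u) (sym r-i) z≤n
    ... | inr _ | inl l = v , there (here refl) , leaf-active l , subst (_≤ toℕ v) (sym r-i) z≤n
    ... | inr i | inr j = ⊥-elim (int-edge-no-triangle g i j (from f uv) (from f uw) (from f vw))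

 record Copied (k : ℕ) (σ τ : Store) : Set where
  field
   c-0  : τ 0 0 ≡ σ 0 0
   c-1  : ∀ j → τ 1 j ≡ σ 1 j
   c-6  : ∀ j → τ 6 j ≡ σ 6 j
   c-13 : ∀ j → τ 13 j ≡ σ 13 j
   c-17 : τ 3 17 ≡ σ 3 17
   c-18 : τ 3 18 ≡ σ 3 18
   c-v  : τ 3 0 ≡ k
   c-2  : ∀ (w : Fin n) → toℕ w < k → τ 2 (toℕ w) ≡ σ 1 (toℕ w)

 leaf-weight : Store → Fin n → ℕ
 leaf-weight σ v = 1 ∸ σ 1 (toℕ v)

 copy-time : ℕ
 copy-time = suc (cost (var #cnt) + maxTime copy-vertex)

 run-copy : ∀ σ vs k τ → Consecutive k vs → Copied k σ τ → τ 3 3 ≡ length vs →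
  ∃ λ υ → Copied n σ υ × υ 3 4 ≡ τ 3 4 + sum (map (leaf-weight σ) vs) ×
   Runs (while≢0 var #cnt repeat copy-vertex) τ (suc (cost (var #cnt)) + copy-time * length vs) υ
 run-copy σ [] k τ refl c e = τ , c , sym (ℕ.+-identityʳ _) , _ , stop e , ℕ.m≤m+n _ _
 run-copy σ (v ∷ vs) k τ (refl , cs) c e with run-loop-free copy-vertex _ τ
 ... | t , r , t≤ with run-copy σ vs (suc (toℕ v)) (exec copy-vertex τ) cs copied (cong (_∸ 1) e)
  where
   open Copied c
   two : ∀ {x j} → τ 3 0 ≡ x → exec copy-vertex τ 2 j ≡ (if x ≡ᵇ j then τ 1 x else τ 2 j)
   two refl = refl
   copied : Copied (suc (toℕ v)) σ (exec copy-vertex τ)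
   copied = record { c-0 = c-0 ; c-1 = c-1 ; c-6 = c-6 ; c-13 = c-13 ; c-17 = c-17 ; c-18 = c-18 ; c-v = trans (cong (_+ 1) c-v) (ℕ.+-comm _ 1)
    ; c-2 = λ w lt → case w Fin.≟ v of λ
     { (yes refl) → trans (two c-v) (trans (hit {u = v}) (c-1 _))
     ; (no ne) → trans (two c-v) (trans (miss ne) (c-2 w (ℕ.≤∧≢⇒< (ℕ.≤-pred lt) (λ e → ne (toℕ-injective e))))) } }
 ...   | υ , c′ , e′ , t′ , r′ , t′≤ = υ , c′ , trans e′ (trans (cong (_+ rest) deg) (ℕ.+-assoc (τ 3 4) _ rest)) ,
  _ , loop (λ z → case trans (sym e) z of λ ()) r r′ , bound
  where
   open Copied c
   rest : ℕ
   rest = sum (map (leaf-weight σ) vs)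
   deg : τ 3 4 + (1 ∸ τ 1 (τ 3 0)) ≡ τ 3 4 + leaf-weight σ v
   deg = cong (λ x → τ 3 4 + (1 ∸ x)) (trans (cong (τ 1) c-v) (c-1 _))
   cc : ℕ
   cc = cost (var #cnt)
   bound : suc (cc + (t + t′)) ≤ suc cc + copy-time * suc (length vs)
   bound = ℕ.≤-trans (s≤s (ℕ.+-monoʳ-≤ cc (ℕ.+-mono-≤ t≤ t′≤)))
    (ℕ.≤-reflexive (trans (lem cc (maxTime copy-vertex) (copy-time * length vs)) (cong (suc cc +_) (sym (ℕ.*-suc copy-time (length vs))))))
    where
     lem : ∀ c b x → suc (c + (b + (suc c + x))) ≡ suc c + (suc (c + b) + x)
     lem = solve-∀

 -- Along the list, the leaves get the marks b, 1 - b, b, … in f, and their successors in g.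
 Marks : (f g : ℕ → ℕ) → ℕ → List (Fin n) → Fin n → Set
 Marks f g b []       z = ⊤
 Marks f g b (x ∷ xs) z = f (toℕ x) ≡ b × g (toℕ (hd xs z)) ≡ b × Marks f g (1 ∸ b) xs z

 walk-time : ℕ
 walk-time = suc (cost (var #deg) + maxTime walk-step)

 targets : List (Fin n) → Fin n → List (Fin n)
 targets []       z = []
 targets (x ∷ xs) z = hd xs z ∷ targets xs z

 targets-∈ : ∀ xs {z w} → w ∈ targets xs z → w ∈ xs ⊎ w ≡ z
 targets-∈ (x ∷ [])     (here e) = inr e
 targets-∈ (x ∷ y ∷ ys) (here e) = inl (there (here e))
 targets-∈ (x ∷ y ∷ ys) (there m) = map-⊎ there id (targets-∈ (y ∷ ys) m)

 module _ (Step : Fin n → Fin n → Fin n → Set) {σ₀ : Store}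
  (sum-rule : ∀ {a b c} → Step a b c → σ₀ 6 (toℕ b) ∸ σ₀ 13 (toℕ b) ∸ toℕ a ≡ toℕ c) where

  Steps : List (Fin n) → Fin n → Set
  Steps []           z = ⊤
  Steps (x ∷ [])     z = ⊤
  Steps (x ∷ y ∷ xs) z = Step x y (hd xs z) × Steps (y ∷ xs) z

  run-walk : ∀ x xs z b τ → Steps (x ∷ xs) z → Unique (x ∷ xs) → Unique (targets (x ∷ xs) z) →
   (∀ j → τ 6 j ≡ σ₀ 6 j) → (∀ j → τ 13 j ≡ σ₀ 13 j) →
   τ 3 17 ≡ toℕ x → τ 3 18 ≡ toℕ (hd xs z) → τ 3 19 ≡ b → τ 3 4 ≡ length (x ∷ xs) →
   ∃ λ υ → Marks (υ 1) (υ 2) b (x ∷ xs) z × (∀ w → w ∉ x ∷ xs → υ 1 (toℕ w) ≡ τ 1 (toℕ w)) × (∀ w → w ∉ targets (x ∷ xs) z → υ 2 (toℕ w) ≡ τ 2 (toℕ w)) ×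
    Runs (while≢0 var #deg repeat walk-step) τ (suc (cost (var #deg)) + walk-time * length (x ∷ xs)) υ
  run-walk x xs z b τ st (px ∷ ux) (pt ∷ ut) e₆ e₁₃ ex ey eb ed = finish xs ux ut px pt st ey ed
   where
    τ′ : Store
    τ′ = exec walk-step τ
    one′ : ∀ {A B j} → τ 3 17 ≡ A → τ 3 19 ≡ B → τ′ 1 j ≡ (if A ≡ᵇ j then B else τ 1 j)
    one′ refl refl = refl
    two′ : ∀ {A B j} → τ 3 18 ≡ A → τ 3 19 ≡ B → τ′ 2 j ≡ (if A ≡ᵇ j then B else τ 2 j)
    two′ refl refl = refl
    c : ℕ
    c = cost (var #deg)
    bound : ∀ {t t′} m → t ≤ maxTime walk-step → t′ ≤ suc c + walk-time * m → suc (c + (t + t′)) ≤ suc c + walk-time * suc m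
    bound m t≤ t′≤ = ℕ.≤-trans (s≤s (ℕ.+-monoʳ-≤ c (ℕ.+-mono-≤ t≤ t′≤)))
     (ℕ.≤-reflexive (trans (lem c (maxTime walk-step) (walk-time * m)) (cong (suc c +_) (sym (ℕ.*-suc walk-time m)))))
     where
      lem : ∀ c b x → suc (c + (b + (suc c + x))) ≡ suc c + (suc (c + b) + x)
      lem = solve-∀
    finish : ∀ xs → Unique xs → Unique (targets xs z) → All (x ≢_) xs → All (hd xs z ≢_) (targets xs z) → Steps (x ∷ xs) z →
     τ 3 18 ≡ toℕ (hd xs z) → τ 3 4 ≡ length (x ∷ xs) →
     ∃ λ υ → Marks (υ 1) (υ 2) b (x ∷ xs) z × (∀ w → w ∉ x ∷ xs → υ 1 (toℕ w) ≡ τ 1 (toℕ w)) × (∀ w → w ∉ targets (x ∷ xs) z → υ 2 (toℕ w) ≡ τ 2 (toℕ w)) ×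
      Runs (while≢0 var #deg repeat walk-step) τ (suc c + walk-time * length (x ∷ xs)) υ
    finish [] _ _ _ _ _ ey ed with run-loop-free walk-step _ τ
    ... | t , r , t≤ = τ′ , (trans (one′ ex eb) (hit {u = x}) , trans (two′ ey eb) (hit {u = z}) , tt)
     , (λ w n → trans (one′ ex eb) (miss (λ e → n (here e)))) , (λ w n → trans (two′ ey eb) (miss (λ e → n (here e))))
     , _ , loop (λ q → case trans (sym ed) q of λ ()) r (stop (cong (_∸ 1) ed)) , bound 0 t≤ (ℕ.m≤m+n _ _)
    finish (y ∷ ys) uys ut px pt (s , st) ey ed with run-loop-free walk-step _ τ
    ... | t , r , t≤ with run-walk y ys z (1 ∸ b) τ′ st uys ut e₆ e₁₃ ey third (cong (1 ∸_) eb) (cong (_∸ 1) ed)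
     where
      third : τ 6 (τ 3 18) ∸ τ 13 (τ 3 18) ∸ τ 3 17 ≡ toℕ (hd ys z)
      third = trans (cong₂ _∸_ (cong₂ _∸_ (trans (cong (τ 6) ey) (e₆ _)) (trans (cong (τ 13) ey) (e₁₃ _))) ex) (sum-rule s)
    ...   | υ , mk , o₁ , o₂ , t′ , r′ , t′≤ = υ
     , (trans (o₁ x (λ m → All.lookup px m refl)) (trans (one′ ex eb) (hit {u = x}))
      , trans (o₂ y (λ m → All.lookup pt m refl)) (trans (two′ ey eb) (hit {u = y})) , mk)
     , (λ w n → trans (o₁ w (n ∘ there)) (trans (one′ ex eb) (miss (λ e → n (here e)))))
     , (λ w n → trans (o₂ w (n ∘ there)) (trans (two′ ey eb) (miss (λ e → n (here e)))))
     , _ , loop (λ q → case trans (sym ed) q of λ ()) r r′ , bound (length (y ∷ ys)) t≤ t′≤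

module _ {V : Set} where

 Inner-split : ∀ L {u w : V} → Inner L u w → ∃₂ λ as bs → L ≡ as ++ u ∷ w ∷ bs
 Inner-split (x ∷ y ∷ ys) (inl (refl , refl)) = [] , ys , refl
 Inner-split (x ∷ y ∷ ys) (inr i) with Inner-split (y ∷ ys) i
 ... | as , bs , e = x ∷ as , bs , cong (x ∷_) e

 Inner-join : ∀ as {bs} {u w : V} → Inner (as ++ u ∷ w ∷ bs) u w
 Inner-join []           = inl (refl , refl)
 Inner-join (x ∷ [])     = inr (inl (refl , refl))
 Inner-join (x ∷ y ∷ as) = inr (Inner-join (y ∷ as))

 Inner-reverse : ∀ L {u w : V} → Inner L u w → Inner (reverse L) w u
 Inner-reverse L {u} {w} i with Inner-split L i
 ... | as , bs , refl = subst (λ l → Inner l w u) (sym eq) (Inner-join (reverse bs))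
  where
   eq : reverse (as ++ u ∷ w ∷ bs) ≡ reverse bs ++ w ∷ u ∷ reverse as
   eq = trans (reverse-++ as (u ∷ w ∷ bs)) (trans (cong (_++ reverse as) (trans (unfold-reverse u (w ∷ bs)) (cong (_∷ʳ u) (unfold-reverse w bs))))
    (trans (++-assoc (reverse bs ∷ʳ w) (u ∷ []) (reverse as)) (++-assoc (reverse bs) (w ∷ []) (u ∷ reverse as))))

 hd-reverse : ∀ L {z : V} → hd (reverse L) z ≡ lst L z
 hd-reverse []       = refl
 hd-reverse (x ∷ xs) {z} = trans (cong (λ l → hd l z) (unfold-reverse x xs)) (trans (hd-++ (reverse xs)) (hd-reverse xs))

 mirror  : PlaneTree V → PlaneTree V
 mirrors : List (PlaneTree V) → List (PlaneTree V)
 mirror (node v ts) = node v (mirrors ts)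
 mirrors []       = []
 mirrors (t ∷ ts) = mirrors ts ∷ʳ mirror t

 root-mirror : ∀ (t : PlaneTree V) → root (mirror t) ≡ root t
 root-mirror (node v ts) = refl

 private
  mirrors≢[] : ∀ t ts → mirrors (t ∷ ts) ≢ []
  mirrors≢[] t ts e with mirrors ts
  mirrors≢[] t ts () | []
  mirrors≢[] t ts () | _ ∷ _

  lvs-node : ∀ {v : V} {ts} → ts ≢ [] → lvs (node v ts) ≡ lvss ts
  lvs-node {ts = []}    n = contradiction refl n
  lvs-node {ts = _ ∷ _} n = refl

  ints-node : ∀ {v : V} {ts} → ts ≢ [] → ints (node v ts) ≡ v ∷ intss ts
  ints-node {ts = []}    n = contradiction refl n
  ints-node {ts = _ ∷ _} n = refl

 lvs-mirror  : ∀ (t : PlaneTree V) → lvs (mirror t) ≡ reverse (lvs t)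
 lvss-mirror : ∀ (ts : List (PlaneTree V)) → lvss (mirrors ts) ≡ reverse (lvss ts)
 lvs-mirror (node v [])       = refl
 lvs-mirror (node v (t ∷ ts)) = trans (lvs-node (mirrors≢[] t ts)) (lvss-mirror (t ∷ ts))
 lvss-mirror []       = refl
 lvss-mirror (t ∷ ts) = trans (lvss-++ (mirrors ts)) (trans (cong₂ _++_ (lvss-mirror ts) (trans (++-identityʳ _) (lvs-mirror t))) (sym (reverse-++ (lvs t) (lvss ts))))

 preorder-mirror  : ∀ (t : PlaneTree V) → preorder (mirror t) ↭ preorder t
 preorders-mirror : ∀ (ts : List (PlaneTree V)) → preorders (mirrors ts) ↭ preorders ts
 preorder-mirror (node v ts) = prep v (preorders-mirror ts)
 preorders-mirror []       = ↭-refl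
 preorders-mirror (t ∷ ts) = ↭-trans (↭-reflexive (preorders-++ (mirrors ts))) (↭-trans (++-comm (preorders (mirrors ts)) _)
  (Perm.++⁺ (↭-trans (↭-reflexive (++-identityʳ _)) (preorder-mirror t)) (preorders-mirror ts)))

 ints-mirror  : ∀ (t : PlaneTree V) → ints (mirror t) ↭ ints t
 intss-mirror : ∀ (ts : List (PlaneTree V)) → intss (mirrors ts) ↭ intss ts
 ints-mirror (node v [])       = ↭-refl
 ints-mirror (node v (t ∷ ts)) = ↭-trans (↭-reflexive (ints-node (mirrors≢[] t ts))) (prep v (intss-mirror (t ∷ ts)))
 intss-mirror []       = ↭-refl
 intss-mirror (t ∷ ts) = ↭-trans (↭-reflexive (intss-++ (mirrors ts))) (↭-trans (++-comm (intss (mirrors ts)) _)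
  (Perm.++⁺ (↭-trans (↭-reflexive (++-identityʳ _)) (ints-mirror t)) (intss-mirror ts)))

 length-mirrors : ∀ (ts : List (PlaneTree V)) → length (mirrors ts) ≡ length ts
 length-mirrors []       = refl
 length-mirrors (t ∷ ts) = trans (length-∷ʳ {V} (mirrors ts)) (cong suc (length-mirrors ts))

 wf-mirror  : ∀ (t : PlaneTree V) → Wf t → Wf (mirror t)
 wfs-mirror : ∀ (ts : List (PlaneTree V)) → Wfs ts → Wfs (mirrors ts)
 wf-mirror (node v ts) (l , ws) = (λ e → l (trans (sym (length-mirrors ts)) e)) , wfs-mirror ts ws
 wfs-mirror []       _        = tt
 wfs-mirror (t ∷ ts) (w , ws) = Wfs-++ (mirrors ts) (wfs-mirror ts ws) (wf-mirror t w , tt)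

 child-mirror  : ∀ (t : PlaneTree V) {u w} → Child t u w → Child (mirror t) u w
 child-mirrors : ∀ {v : V} ts {u w} → Child (node v ts) u w → Child (node v (mirrors ts)) u w
 child-mirror (node v ts) c = child-mirrors ts c
 child-mirrors (t ∷ ts) c with Child-∷⁻ c
 ... | inl (refl , refl) = Child-++⁺ʳ (mirrors ts) (subst (Child _ _) (root-mirror t) (here (here refl)))
 ... | inr (inl d) = Child-++⁺ʳ (mirrors ts) (below (here refl) (child-mirror t d))
 ... | inr (inr d) = Child-++⁺ˡ (child-mirrors ts d)
 child-mirrors [] (here ())
 child-mirrors [] (below () _)

 child-mirror⁻  : ∀ (t : PlaneTree V) {u w} → Child (mirror t) u w → Child t u w
 child-mirrors⁻ : ∀ {v : V} ts {u w} → Child (node v (mirrors ts)) u w → Child (node v ts) u w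
 child-mirror⁻ (node v ts) c = child-mirrors⁻ ts c
 child-mirrors⁻ [] c = c
 child-mirrors⁻ {v} (t ∷ ts) c with Child-++⁻ (mirrors ts) {mirror t ∷ []} c
 ... | inl d = Child-there (child-mirrors⁻ ts d)
 ... | inr d with Child-one d
 ...   | inl (refl , refl) = subst (Child (node v (t ∷ ts)) v) (sym (root-mirror t)) (here (here refl))
 ...   | inr d′ = below (here refl) (child-mirror⁻ t d′)

 module _ {a : V} {s : PlaneTree V} (g : Good (leafT a ⋈ s)) where

  private
   t t′ : CutTree V
   t  = leafT a ⋈ s
   t′ = leafT a ⋈ mirror s
   te⁺ : ∀ {u w} → TE t u w → TE t′ u w
   te⁺ = map-⊎ f f
    where
     f : ∀ {u w} → Arc t u w → Arc t′ u w
     f (inl c) = inl c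
     f (inr (inl c)) = inr (inl (child-mirror s c))
     f (inr (inr (e , e′))) = inr (inr (e , trans e′ (sym (root-mirror s))))
   te⁻ : ∀ {u w} → TE t′ u w → TE t u w
   te⁻ = map-⊎ f f
    where
     f : ∀ {u w} → Arc t′ u w → Arc t u w
     f (inl c) = inl c
     f (inr (inl c)) = inr (inl (child-mirror⁻ s c))
     f (inr (inr (e , e′))) = inr (inr (e , trans e′ (root-mirror s)))
   cyc-rev : ∀ L {u w} → Cyc (a ∷ L) u w → Cyc (a ∷ reverse L) w u
   cyc-rev L {u} {w} c with cyc₁⁻ L c
   ... | inl i = cyc₁⁺ (reverse L) (inl (Inner-reverse L i))
   ... | inr (inl (e , e′)) = cyc₁⁺ (reverse L) (inr (inr (trans e′ (trans (cong (λ l → hd l a) (sym (reverse-involutive L))) (hd-reverse (reverse L))) , e)))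
   ... | inr (inr (e , e′)) = cyc₁⁺ (reverse L) (inr (inl (e′ , trans e (sym (hd-reverse L)))))
   ce⁺ : ∀ {u w} → CE t u w → CE t′ w u
   ce⁺ {u} {w} c = subst (λ l → Cyc (a ∷ l) w u) (sym (lvs-mirror s)) (cyc-rev (lvs s) c)
   ce⁻ : ∀ {u w} → CE t′ u w → CE t w u
   ce⁻ {u} {w} c = subst (λ l → Cyc (a ∷ l) w u) (reverse-involutive (lvs s)) (cyc-rev (reverse (lvs s)) (subst (λ l → Cyc (a ∷ l) u w) (lvs-mirror s) c))

  mirror-te : ∀ {u w} → TE t u w ⇔ TE t′ u w
  mirror-te = mk⇔ te⁺ te⁻

  mirror-adj : ∀ {u w} → Adj t u w ⇔ Adj t′ u w
  mirror-adj = mk⇔ (λ { (inl e) → inl (te⁺ e) ; (inr (inl c)) → inr (inr (ce⁺ c)) ; (inr (inr c)) → inr (inl (ce⁺ c)) })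
   (λ { (inl e) → inl (te⁻ e) ; (inr (inl c)) → inr (inr (ce⁻ c)) ; (inr (inr c)) → inr (inl (ce⁻ c)) })

  mirror-lvs : Lvs t′ ↭ Lvs t
  mirror-lvs = prep a (↭-trans (↭-reflexive (lvs-mirror s)) (Perm.↭-reverse (lvs s)))

  mirror-ints : Ints t′ ↭ Ints t
  mirror-ints = ints-mirror s

  mirror-good : Good t′
  mirror-good = good (mkU (unique-resp-↭ (↭-sym π) (unV (uniq g)))) (fst (isWF g) , wf-mirror s (snd (isWF g))) (subst (4 ≤_) (sym (↭-length π)) (size g))
   where
    π : verts t′ ↭ verts t
    π = prep a (preorder-mirror s)

  mirror-first : first (mirror s) ≡ final s
  mirror-first = trans (cong (λ l → hd l (root (mirror s))) (lvs-mirror s)) (trans (hd-reverse (lvs s)) (lst-lvs s))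

 at : List V → ℕ → V → V
 at []       _       z = z
 at (x ∷ _)  zero    z = x
 at (x ∷ xs) (suc k) z = at xs k z

 lookup-at : ∀ L (i : Fin (length L)) z → lookup L i ≡ at L (toℕ i) z
 lookup-at (x ∷ xs) zero    z = refl
 lookup-at (x ∷ xs) (suc i) z = lookup-at xs i z

 at-end : ∀ L z → at L (length L) z ≡ z
 at-end []       z = refl
 at-end (x ∷ xs) z = at-end xs z

 hd-at : ∀ L z → hd L z ≡ at L 0 z
 hd-at []      z = refl
 hd-at (_ ∷ _) z = refl

 Succ-index⁻ : ∀ L {z u w} → Succ L z u w → ∃ λ (i : Fin (length L)) → u ≡ lookup L i × w ≡ at L (suc (toℕ i)) z
 Succ-index⁻ (x ∷ xs) (inl (e , e′)) = zero , e , trans e′ (hd-at xs _)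
 Succ-index⁻ (x ∷ xs) (inr s) with Succ-index⁻ xs s
 ... | i , e , e′ = suc i , e , e′

 Succ-index⁺ : ∀ L {z} (i : Fin (length L)) → Succ L z (lookup L i) (at L (suc (toℕ i)) z)
 Succ-index⁺ (x ∷ xs) zero    = inl (refl , sym (hd-at xs _))
 Succ-index⁺ (x ∷ xs) (suc i) = inr (Succ-index⁺ xs i)

toℕ-next : ∀ {l} (i : Fin l) → (suc (toℕ i) < l × toℕ (next i) ≡ suc (toℕ i)) ⊎ (suc (toℕ i) ≡ l × toℕ (next i) ≡ 0)
toℕ-next {l} i with ℕ.m≤n⇒m<n∨m≡n (toℕ<n i)
... | inl lt = inl (lt , trans (toℕ-fromℕ< _) (m<n⇒m%n≡m {{nonZeroIndex i}} lt))
... | inr e  = inr (e , trans (toℕ-fromℕ< _) (trans (cong (λ m → _%_ m l {{nonZeroIndex i}}) e) (n%n≡0 l {{nonZeroIndex i}})))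

module _ {V : Set} where

 lookup-next : ∀ (L : List V) (i : Fin (length L)) z → lookup L (next i) ≡ at L (suc (toℕ i)) (hd L z)
 lookup-next L i z with toℕ-next i
 ... | inl (_ , e) = trans (lookup-at L (next i) (hd L z)) (cong (λ m → at L m (hd L z)) e)
 ... | inr (e , e′) = trans (lookup-at L (next i) z) (trans (cong (λ m → at L m z) e′)
  (trans (sym (hd-at L z)) (trans (sym (at-end L (hd L z))) (cong (λ m → at L m (hd L z)) (sym e)))))

 Cyc-index : ∀ (L : List V) {u w} → Cyc L u w ⇔ (∃ λ (i : Fin (length L)) → u ≡ lookup L i × w ≡ lookup L (next i))
 Cyc-index L {u} {w} = mk⇔
  (λ s → let i , e , e′ = Succ-index⁻ L s in i , e , trans e′ (sym (lookup-next L i u)))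
  (λ { (i , refl , refl) → subst (Succ L (hd L (lookup L i)) (lookup L i)) (sym (lookup-next L i (lookup L i))) (Succ-index⁺ L i) })

module _ {n : ℕ} where

 vertices-↭ : ∀ {xs : List (Fin n)} → Unique xs → (∀ v → v ∈ xs) → xs ↭ allFin n
 vertices-↭ u all = unique-↭ u (Uniq.allFin⁺ n) (λ _ → ∈-allFin _) (λ _ → all _)

 module _ (T : Graph n) (t : CutTree (Fin n)) (U : UniqueV t) (edges : ∀ {u w} → Graph._~_ T u w ⇔ TE t u w) where
  open Graph T

  degree-cut : ∀ {u cs s} → t ≃ node u cs ⋈ s → degree u ≡ suc (length cs)
  degree-cut {u} {cs} {s} e = trans (↭-length (unique-↭ (Uniq.filter⁺ (u ~?_) (Uniq.allFin⁺ n)) (te-nbrs-unique U′)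
   (λ m → te-nbr⁻ U′ (to (te e) (to edges (snd (∈-filter⁻ (u ~?_) {xs = allFin n} m)))))
   (λ m → ∈-filter⁺ (u ~?_) (∈-allFin _) (from edges (from (te e) (te-nbr⁺ U′ m))))))
   (cong suc (length-map root cs))
   where
    U′ : UniqueV (node u cs ⋈ s)
    U′ = mkU (unique-resp-↭ (verts↭ e) (unV U))

 filter-leaves  : ∀ {P : Fin n → Set} (P? : ∀ v → Dec (P v)) p → (∀ {u cs} → Sub (node u cs) p → P u ⇔ cs ≡ []) → filter P? (preorder p) ≡ lvs p
 filter-leavess : ∀ {P : Fin n → Set} (P? : ∀ v → Dec (P v)) ps → (∀ {u cs p} → p ∈ ps → Sub (node u cs) p → P u ⇔ cs ≡ []) → filter P? (preorders ps) ≡ lvss ps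
 filter-leaves P? (node v []) h = filter-accept P? (from (h whole) refl)
 filter-leaves P? (node v (c ∷ cs)) h = trans (filter-reject P? (λ p → case to (h whole) p of λ ())) (filter-leavess P? (c ∷ cs) (λ m i → h (inner m i)))
 filter-leavess P? []       h = refl
 filter-leavess P? (p ∷ ps) h = trans (filter-++ P? (preorder p) _) (cong₂ _++_ (filter-leaves P? p (h (here refl))) (filter-leavess P? ps (λ m → h (there m))))

 wf-from-subs  : ∀ (p : PlaneTree (Fin n)) → (∀ {u cs} → Sub (node u cs) p → length cs ≢ 1) → Wf p
 wfs-from-subs : ∀ (ps : List (PlaneTree (Fin n))) → (∀ {u cs p} → p ∈ ps → Sub (node u cs) p → length cs ≢ 1) → Wfs ps
 wf-from-subs (node v ts) h = h whole , wfs-from-subs ts (λ m i → h (inner m i))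
 wfs-from-subs []       h = tt
 wfs-from-subs (p ∷ ps) h = wf-from-subs p (h (here refl)) , wfs-from-subs ps (λ m i → h (there m) i)

 sub-wf  : ∀ {u cs} (p : PlaneTree (Fin n)) → Wf p → Sub (node u cs) p → length cs ≢ 1
 subs-wf : ∀ {u cs} (ps : List (PlaneTree (Fin n))) → Wfs ps → ∀ {p} → p ∈ ps → Sub (node u cs) p → length cs ≢ 1
 sub-wf p (w , _) whole = w
 sub-wf (node v ts) (_ , ws) (inner m i) = subs-wf ts ws m i
 subs-wf (p ∷ ps) (w , _) (here refl) i = sub-wf p w i
 subs-wf (p ∷ ps) (_ , ws) (there m) i = subs-wf ps ws m i

 module _ {T : Graph n} {p q : PlaneTree (Fin n)} (U : UniqueV (p ⋈ q)) (edges : ∀ {u w} → Graph._~_ T u w ⇔ TE (p ⋈ q) u w) where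
  open Graph T

  sub-degreeˡ : ∀ {u cs} → Sub (node u cs) p → degree u ≡ suc (length cs)
  sub-degreeˡ i = let s , e = cut-at-sub i q in degree-cut T (p ⋈ q) U edges e

  sub-degreeʳ : ∀ {u cs} → Sub (node u cs) q → degree u ≡ suc (length cs)
  sub-degreeʳ i = let s , e = cut-at-sub i p in degree-cut T (p ⋈ q) U edges (≃-trans (swap p q) e)

  leaf-iff : ∀ {u} {cs : List (PlaneTree (Fin n))} → degree u ≡ suc (length cs) → IsLeaf u ⇔ cs ≡ []
  leaf-iff {u} {[]} e = mk⇔ (λ _ → refl) (λ _ → e)
  leaf-iff {u} {_ ∷ _} e = mk⇔ (λ l → case trans (sym l) e of λ ()) λ ()

  filter-Lvs : filter isLeaf? (preorder p ++ preorder q) ≡ Lvs (p ⋈ q)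
  filter-Lvs = trans (filter-++ isLeaf? (preorder p) (preorder q))
   (cong₂ _++_ (filter-leaves isLeaf? p (λ i → leaf-iff (sub-degreeˡ i))) (filter-leaves isLeaf? q (λ i → leaf-iff (sub-degreeʳ i))))

 rooted : CutTree (Fin n) → PlaneTree (Fin n)
 rooted (node v ts ⋈ q) = node v (ts ∷ʳ q)

 preorder-rooted : ∀ t → preorder (rooted t) ≡ verts t
 preorder-rooted (node v ts ⋈ q) = cong (v ∷_) (trans (preorders-++ ts) (cong (preorders ts ++_) (++-identityʳ _)))

 rooted-arc⁻ : ∀ t {u w} → Child (rooted t) u w → Arc t u w
 rooted-arc⁻ (node v ts ⋈ q) c with Child-++⁻ ts {q ∷ []} c
 ... | inl d = inl d
 ... | inr d with Child-one d
 ...   | inl e = inr (inr e)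
 ...   | inr e = inr (inl e)

 rooted-arc⁺ : ∀ t {u w} → Arc t u w → Child (rooted t) u w
 rooted-arc⁺ (node v ts ⋈ q) (inl c) = Child-++⁺ˡ c
 rooted-arc⁺ (node v ts ⋈ q) (inr (inl c)) = Child-++⁺ʳ ts (below (here refl) c)
 rooted-arc⁺ (node v ts ⋈ q) (inr (inr (refl , refl))) = Child-++⁺ʳ ts (here (here refl))

 record HalinTree (G : Graph n) (H : Halin G) : Set where
  field
   tree     : CutTree (Fin n)
   isGood   : Good tree
   fits     : Fits tree (Graph._~_ G)
   order    : length (verts tree) ≡ n
   all      : ∀ v → v ∈ verts tree
   tree-leaves : Halin.leaves H ≡ Lvs tree
   internal : ∀ v → Graph.IsLeaf (Halin.T H) v ⇔ v ∈ Lvs tree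

 halin-tree : ∀ {G} (H : Halin G) → HalinTree G H
 halin-tree {G} H = go (PlaneEmbedding.tree E) refl
  where
   open Halin H using (T; l≥3; noDegreeTwo)
   E : PlaneEmbedding T
   E = Halin.embedding H
   open Graph T
   go : ∀ tr → PlaneEmbedding.tree E ≡ tr → HalinTree G H
   go (node v []) e = contradiction (ℕ.≤-trans l≥3 (length-filter isLeaf? (preorder (PlaneEmbedding.tree E))))
    (λ le → contradiction (subst (λ tr → 3 ≤ length (preorder tr)) e le) λ { (s≤s ()) })
   go (node v (c ∷ cs)) e with snoc c cs
   ... | ts , s , eq = record
    { tree = t ; isGood = good U (wf-from-subs _ (λ i w → noDegreeTwo _ (trans (sub-degreeˡ {T = T} U ed i) (cong suc w))) ,
     wf-from-subs _ (λ i w → noDegreeTwo _ (trans (sub-degreeʳ {T = T} U ed i) (cong suc w)))) four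
    ; fits = mk⇔ (λ a → from (Halin.edges H _ _) (map-⊎ (from ed) (map-⊎ (to cyc) (to cyc)) a))
     (λ k → map-⊎ (to ed) (map-⊎ (from cyc) (from cyc)) (to (Halin.edges H _ _) k))
    ; order = trans (↭-length (vertices-↭ (unV U) all-in)) (length-tabulate id)
    ; all = all-in
    ; tree-leaves = leaves≡
    ; internal = λ u → mk⇔ (λ l → subst (u ∈_) leaves≡ (∈-filter⁺ isLeaf? (PlaneEmbedding.spanning E u) l))
     (λ m → snd (∈-filter⁻ isLeaf? {xs = preorder (PlaneEmbedding.tree E)} (subst (u ∈_) (sym leaves≡) m))) }
    where
     t : CutTree (Fin n)
     t = node v ts ⋈ s
     tree≡ : PlaneEmbedding.tree E ≡ rooted t
     tree≡ = trans e (cong (node v) eq)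
     pre≡ : preorder (PlaneEmbedding.tree E) ≡ verts t
     pre≡ = trans (cong preorder tree≡) (preorder-rooted t)
     U : UniqueV t
     U = mkU (subst Unique pre≡ (PlaneEmbedding.distinct E))
     all-in : ∀ u → u ∈ verts t
     all-in u = subst (u ∈_) pre≡ (PlaneEmbedding.spanning E u)
     ed : ∀ {u w} → u ~ w ⇔ TE t u w
     ed {u} {w} = mk⇔ (λ k → map-⊎ f f (to (PlaneEmbedding.edges E u w) k)) (λ k → from (PlaneEmbedding.edges E u w) (map-⊎ b b k))
      where
       f : ∀ {u w} → Child (PlaneEmbedding.tree E) u w → Arc t u w
       f {u} {w} c = rooted-arc⁻ t (subst (λ tr → Child tr u w) tree≡ c)
       b : ∀ {u w} → Arc t u w → Child (PlaneEmbedding.tree E) u w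
       b {u} {w} c = subst (λ tr → Child tr u w) (sym tree≡) (rooted-arc⁺ t c)
     leaves≡ : Halin.leaves H ≡ Lvs t
     leaves≡ = trans (cong (filter isLeaf?) pre≡) (filter-Lvs {T = T} U ed)
     cyc : ∀ {u w} → CE t u w ⇔ Halin.OnCycle H u w
     cyc {u} {w} = subst (λ L → Cyc L u w ⇔ Halin.OnCycle H u w) leaves≡ (Cyc-index (Halin.leaves H))
     four : 4 ≤ length (verts t)
     four = subst (4 ≤_) (sym (length-verts t)) (sz (node v ts) s (subst (λ L → 3 ≤ length L) leaves≡ l≥3))
      where
       sz : ∀ p q → 3 ≤ length (Lvs (p ⋈ q)) → 4 ≤ length (Lvs (p ⋈ q)) + length (Ints (p ⋈ q))
       sz (node _ []) (node _ []) (s≤s (s≤s ()))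
       sz (node a (d ∷ ds)) q h = ℕ.≤-trans (ℕ.+-mono-≤ h (s≤s z≤n)) ℕ.≤-refl
       sz (node _ []) (node b (d ∷ ds)) h = ℕ.≤-trans (ℕ.+-mono-≤ h (s≤s z≤n)) ℕ.≤-refl

 module _ {G : Graph n} {t : CutTree (Fin n)} (g : Good t) (f : Fits t (Graph._~_ G)) (len : length (verts t) ≡ n) where

  private
   _∈?_ = DecMem._∈?_ (Fin._≟_ {n})
   all-in : ∀ v → v ∈ verts t
   all-in v = ∈-resp-↭ (↭-sym (unique-⊆-↭ (unV (uniq g)) (λ _ → ∈-allFin _) (trans len (sym (length-tabulate id))))) (∈-allFin v)
   te? : ∀ u w → Dec (TE t u w)
   te? u w with Graph._~?_ G u w | u ∈? Lvs t | w ∈? Lvs t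
   ... | no nk | _ | _ = no (λ e → nk (to f (inl e)))
   ... | yes _ | yes lu | yes lw = no (no-TE-between-leaves g lu lw)
   ... | yes k | no nu | _ with from f k
   ...   | inl e = yes e
   ...   | inr (inl c) = ⊥-elim (nu (fst (Cyc-∈ (Lvs t) c)))
   ...   | inr (inr c) = ⊥-elim (nu (snd (Cyc-∈ (Lvs t) c)))
   te? u w | yes k | yes _ | no nw with from f k
   ...   | inl e = yes e
   ...   | inr (inl c) = ⊥-elim (nw (snd (Cyc-∈ (Lvs t) c)))
   ...   | inr (inr c) = ⊥-elim (nw (fst (Cyc-∈ (Lvs t) c)))

  tree-graph : Graph n
  tree-graph = record { _~_ = TE t ; _~?_ = te? ; ~-sym = TE-sym t ; ~-irr = TE-irrefl g }

  tree-embedding : PlaneEmbedding tree-graph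
  tree-embedding = record
   { tree = rooted t ; distinct = subst Unique (sym (preorder-rooted t)) (unV (uniq g))
   ; spanning = λ v → subst (v ∈_) (sym (preorder-rooted t)) (all-in v)
   ; edges = λ u w → mk⇔ (map-⊎ (rooted-arc⁺ t) (rooted-arc⁺ t)) (map-⊎ (rooted-arc⁻ t) (rooted-arc⁻ t)) }

 module _ {G : Graph n} {t : CutTree (Fin n)} (g : Good t) (f : Fits t (Graph._~_ G)) (len : length (verts t) ≡ n) where

  embedding-leaves : PlaneEmbedding.leaves (tree-embedding {G} g f len) ≡ Lvs t
  embedding-leaves = trans (cong (filter (Graph.isLeaf? (tree-graph {G} g f len))) (preorder-rooted t)) (lem t refl)
   where
    lem : ∀ t′ → t ≡ t′ → filter (Graph.isLeaf? (tree-graph {G} g f len)) (verts t′) ≡ Lvs t′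
    lem (p ⋈ q) refl = filter-Lvs {T = tree-graph {G} g f len} (uniq g) (mk⇔ id id)

  tree-halin : Halin G
  tree-halin = record
   { T = tree-graph {G} g f len ; embedding = tree-embedding {G} g f len
   ; noDegreeTwo = no-two
   ; l≥3 = subst (λ L → 3 ≤ length L) (sym embedding-leaves) (three (length (Lvs t)) (many-leaves t (isWF g)))
   ; edges = λ u w → mk⇔ (λ k → map-⊎ id (map-⊎ (to cyc) (to cyc)) (from f k)) (λ k → to f (map-⊎ id (map-⊎ (from cyc) (from cyc)) k)) }
   where
    three : ∀ l → 2 + length (verts t) ≤ 2 * l → 3 ≤ l
    three 0 ()
    three 1 h = contradiction (ℕ.≤-trans (ℕ.+-monoʳ-≤ 2 (size g)) h) λ { (s≤s (s≤s ())) }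
    three 2 h = contradiction (ℕ.≤-trans (ℕ.+-monoʳ-≤ 2 (size g)) h) λ { (s≤s (s≤s (s≤s (s≤s ())))) }
    three (suc (suc (suc l))) _ = s≤s (s≤s (s≤s z≤n))
    ls : List (Fin n)
    ls = PlaneEmbedding.leaves (tree-embedding {G} g f len)
    OnCyc : Fin n → Fin n → Set
    OnCyc u w = ∃ λ (i : Fin (length ls)) → u ≡ lookup ls i × w ≡ lookup ls (next i)
    cyc : ∀ {u w} → CE t u w ⇔ OnCyc u w
    cyc {u} {w} = subst (λ L → Cyc L u w ⇔ OnCyc u w) embedding-leaves (Cyc-index ls)
    no-two : ∀ v → Graph.degree (tree-graph {G} g f len) v ≢ 2
    no-two v d with cut-at-vertex t (subst (v ∈_) refl (∈-resp-↭ (↭-sym (unique-⊆-↭ (unV (uniq g)) (λ _ → ∈-allFin _) (trans len (sym (length-tabulate id))))) (∈-allFin v)))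
    ... | cs , s , e with good-≃ e g | trans (sym (degree-cut (tree-graph {G} g f len) t (uniq g) (mk⇔ id id) e)) d
    ...   | good _ ((w , _) , _) _ | e2 = w (ℕ.suc-injective e2)

-- The eternal vertex cover class

parity-step : ∀ k → ((2 ∣ k) × (¬ (2 ∣ suc k))) ⊎ ((¬ (2 ∣ k)) × (2 ∣ suc k))
parity-step zero = inl (2 ∣0 , λ d → case ∣1⇒≡1 d of λ ())
parity-step (suc k) with parity-step k
... | inl (e , o) = inr (o , ∣m∣n⇒∣m+n ∣-refl e)
... | inr (o , e) = inl (e , λ d → o (∣m+n∣m⇒∣n {2} {2} {k} d ∣-refl))

even-suc : ∀ {k} → (2 ∣ k) → ¬ (2 ∣ suc k)
even-suc {k} e with parity-step k
... | inl (_ , o) = o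
... | inr (o , _) = ⊥-elim (o e)

odd-suc : ∀ {k} → ¬ (2 ∣ k) → (2 ∣ suc k)
odd-suc {k} o with parity-step k
... | inl (e , _) = ⊥-elim (o e)
... | inr (_ , e) = e

lookup-injective : ∀ {A : Set} {xs : List A} → Unique xs → ∀ i j → lookup xs i ≡ lookup xs j → i ≡ j
lookup-injective (_ ∷ _) zero zero _ = refl
lookup-injective {xs = x ∷ xs} (p ∷ _) zero (suc j) e = ⊥-elim (All.lookup p (∈-lookup j) e)
lookup-injective {xs = x ∷ xs} (p ∷ _) (suc i) zero e = ⊥-elim (All.lookup p (∈-lookup i) (sym e))
lookup-injective (_ ∷ u) (suc i) (suc j) e = cong suc (lookup-injective u i j e)

next-injective : ∀ {l} (i j : Fin l) → next i ≡ next j → i ≡ j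
next-injective i j e with toℕ-next i | toℕ-next j
... | inl (_ , p) | inl (_ , q) = toℕ-injective (ℕ.suc-injective (trans (sym p) (trans (cong toℕ e) q)))
... | inr (p , _) | inr (q , _) = toℕ-injective (ℕ.suc-injective (trans p (sym q)))
... | inl (_ , p) | inr (_ , q) = case trans (sym p) (trans (cong toℕ e) q) of λ ()
... | inr (_ , p) | inl (_ , q) = case trans (sym q) (trans (cong toℕ (sym e)) p) of λ ()

before : ∀ {l} (j : Fin l) {k} → toℕ j ≡ suc k → ∃ λ i → toℕ i ≡ k × next i ≡ j
before {l} j {k} e = fromℕ< k<l , toℕ-fromℕ< k<l , toℕ-injective (go (toℕ-next (fromℕ< k<l)))
 where
  k<l : k < l
  k<l = ℕ.<-trans (ℕ.≤-reflexive (sym e)) (toℕ<n j)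
  go : _ → toℕ (next (fromℕ< k<l)) ≡ toℕ j
  go (inl (_ , p)) = trans p (trans (cong suc (toℕ-fromℕ< k<l)) (sym e))
  go (inr (p , _)) = ⊥-elim (ℕ.<⇒≢ (toℕ<n j) (trans e (trans (cong suc (sym (toℕ-fromℕ< k<l))) p)))

odd-is-next : ∀ {l} (j : Fin l) → ¬ (2 ∣ toℕ j) → ∃ λ i → (2 ∣ toℕ i) × (next i ≡ j)
odd-is-next j o with toℕ j in e
... | zero  = ⊥-elim (o (2 ∣0))
... | suc k with parity-step k
...   | inl (ev , _) = let i , p , q = before j e in i , subst (2 ∣_) (sym p) ev , q
...   | inr (_ , ev) = ⊥-elim (o ev)

next-even : ∀ {l} (i : Fin l) → ¬ (2 ∣ toℕ i) → (2 ∣ toℕ (next i))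
next-even i o with toℕ-next i
... | inl (_ , p) = subst (2 ∣_) (sym p) (odd-suc o)
... | inr (_ , p) = subst (2 ∣_) (sym p) (2 ∣0)

module _ {V : Set} where

 Inner-functional : ∀ {xs} {u w w′ : V} → Unique xs → Inner xs u w → Inner xs u w′ → w ≡ w′
 Inner-functional {x ∷ y ∷ ys} _ (inl (_ , e)) (inl (_ , e′)) = trans e (sym e′)
 Inner-functional {x ∷ y ∷ ys} (p ∷ _) (inl (e , _)) (inr i) = ⊥-elim (All.lookup p (fst (Inner-∈ (y ∷ ys) i)) (sym e))
 Inner-functional {x ∷ y ∷ ys} (p ∷ _) (inr i) (inl (e , _)) = ⊥-elim (All.lookup p (fst (Inner-∈ (y ∷ ys) i)) (sym e))
 Inner-functional {x ∷ y ∷ ys} (_ ∷ u) (inr i) (inr j) = Inner-functional u i j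

 Inner-injective : ∀ {xs} {u u′ w : V} → Unique xs → Inner xs u w → Inner xs u′ w → u ≡ u′
 Inner-injective {x ∷ y ∷ ys} _ (inl (e , _)) (inl (e′ , _)) = trans e (sym e′)
 Inner-injective {x ∷ y ∷ ys} (_ ∷ u) (inl (_ , e)) (inr i) = ⊥-elim (Inner-head u i e)
 Inner-injective {x ∷ y ∷ ys} (_ ∷ u) (inr i) (inl (_ , e)) = ⊥-elim (Inner-head u i e)
 Inner-injective {x ∷ y ∷ ys} (_ ∷ u) (inr i) (inr j) = Inner-injective u i j

 has-predecessor : ∀ {x : V} xs {w} → w ∈ xs → ∃ λ u → Inner (x ∷ xs) u w
 has-predecessor (y ∷ ys) (here e) = _ , inl (refl , e)
 has-predecessor (y ∷ ys) (there m) = let u , i = has-predecessor ys m in u , inr i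

 spine : PlaneTree V → List V
 spine (node v [])      = v ∷ []
 spine (node v (t ∷ _)) = v ∷ spine t

 spine-head : ∀ t → ∃ λ xs → spine t ≡ root t ∷ xs
 spine-head (node v [])      = [] , refl
 spine-head (node v (t ∷ _)) = spine t , refl

 spine⊆ : ∀ t {x} → x ∈ spine t → x ∈ preorder t
 spine⊆ (node v [])      m = m
 spine⊆ (node v (t ∷ _)) (here e) = here e
 spine⊆ (node v (t ∷ ts)) (there m) = there (∈-++⁺ˡ (spine⊆ t m))

 spine-unique : ∀ t → Unique (preorder t) → Unique (spine t)
 spine-unique (node v [])       u = u
 spine-unique (node v (t ∷ ts)) (p ∷ u) = All.tabulate (λ m → All.lookup p (∈-++⁺ˡ (spine⊆ t m))) ∷ spine-unique t (fst (unique-++⁻ (preorder t) u))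

 spine-first : ∀ v (t : PlaneTree V) ts → first (node v (t ∷ ts)) ≡ first t
 spine-first v t ts = hd-lvs t {lvss ts} {v}

 spine-kind : ∀ t {x} → x ∈ spine t → x ∈ ints t ⊎ x ≡ first t
 spine-kind (node v [])       (here e) = inr e
 spine-kind (node v (t ∷ ts)) (here e) = inl (here e)
 spine-kind (node v (t ∷ ts)) (there m) with spine-kind t m
 ... | inl i = inl (there (∈-++⁺ˡ i))
 ... | inr e = inr (trans e (sym (spine-first v t ts)))

 spine-next : ∀ t {x} → x ∈ spine t → x ≡ first t ⊎ ∃ λ y → Inner (spine t) x y
 spine-next (node v [])       (here e) = inl e
 spine-next (node v (t ∷ ts)) (here refl) with spine t | spine-head t
 ... | _ | xs , refl = inr (root t , inl (refl , refl))
 spine-next (node v (t ∷ ts)) (there m) with spine-next t m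
 ... | inl e = inl (trans e (sym (spine-first v t ts)))
 ... | inr (y , i) with spine t | spine-head t
 ...   | _ | xs , refl = inr (y , inr i)

 spine-child : ∀ t {x y} → Inner (spine t) x y → Child t x y
 spine-child (node v []) ()
 spine-child (node v (t ∷ ts)) i with spine t | spine-head t | spine-child t
 ... | _ | xs , refl | ch with i
 ...   | inl (refl , refl) = here (here refl)
 ...   | inr j = below (here refl) (ch j)

 child-source : ∀ (t : PlaneTree V) {x y : V} → Child t x y → x ∈ ints t
 child-source (node v (t ∷ ts)) (here _) = here refl
 child-source (node v (t ∷ ts)) (below {t = s} m c) = there (deep (t ∷ ts) m (child-source s c))
  where
   deep : ∀ ts {t x} → t ∈ ts → x ∈ ints t → x ∈ intss ts
   deep (t ∷ ts) (here refl) i = ∈-++⁺ˡ i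
   deep (t ∷ ts) (there m)   i = ∈-++⁺ʳ (ints t) (deep ts m i)
 child-source (node v []) (here ())
 child-source (node v []) (below () _)

 first∈spine : ∀ t → first t ∈ spine t
 first∈spine (node v [])       = here refl
 first∈spine (node v (t ∷ ts)) = there (subst (_∈ spine t) (sym (spine-first v t ts)) (first∈spine t))

module _ {n : ℕ} (G : Graph n) where
 open Graph G

 -- Guards move from C to C′ along R.
 record Matching (C C′ : Subset n) (R : Fin n → Fin n → Set) : Set where
  field
   total    : ∀ {v} → v ∈ₛ C → ∃ λ w → w ∈ₛ C′ × R v w
   cototal  : ∀ {w} → w ∈ₛ C′ → ∃ λ v → v ∈ₛ C × R v w
   function : ∀ {v w w′} → R v w → R v w′ → w ≡ w′
   injective : ∀ {v v′ w} → R v w → R v′ w → v ≡ v′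
   stays-or-moves : ∀ {v w} → R v w → w ≡ v ⊎ v ~ w

 flip-matching : ∀ {C C′ R} → Matching C C′ R → Matching C′ C (λ v w → R w v)
 flip-matching m = record
  { total = cototal ; cototal = total ; function = injective ; injective = function
  ; stays-or-moves = λ r → map-⊎ sym ~-sym (stays-or-moves r) }
  where open Matching m

 answers : ∀ {C C′ R u v} → Matching C C′ R → (u ∈ₛ C × R u v) ⊎ (v ∈ₛ C × R v u) → Answers G C C′ u v
 answers {C} {C′} {R} {u} {v} m x = record
  { φ = mk⤖ {to = f} ((λ {p} {q} → inj p q) , surj)
  ; moves = λ { (w , w∈) → stays-or-moves (snd (snd (total w∈))) }
  ; crosses = map-⊎ (λ { (u∈ , r) → u∈ , function (snd (snd (total u∈))) r }) (λ { (v∈ , r) → v∈ , function (snd (snd (total v∈))) r }) x }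
  where
   open Matching m
   f : ∃ (_∈ₛ C) → ∃ (_∈ₛ C′)
   f (w , w∈) = fst (total w∈) , fst (snd (total w∈))
   same : ∀ {S : Subset n} {p q : ∃ (_∈ₛ S)} → fst p ≡ fst q → p ≡ q
   same {p = w , a} {_ , b} refl = cong (w ,_) ([]=-irrelevant a b)
   inj : ∀ p q → f p ≡ f q → p ≡ q
   inj (p , p∈) (q , q∈) e = same (injective (snd (snd (total p∈))) (subst (R q) (sym (cong fst e)) (snd (snd (total q∈)))))
   surj : ∀ y → ∃ λ p → ∀ {z} → z ≡ p → f z ≡ y
   surj (w , w∈) = let p , p∈ , r = cototal w∈ in (p , p∈) , λ { refl → same (function (snd (snd (total p∈))) r) }

 swap-matching : ∀ {C u v} → u ∈ₛ C → v ∈ₛ C → u ~ v →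
  Matching C C (λ a b → (a ≡ u × b ≡ v) ⊎ (a ≡ v × b ≡ u) ⊎ (a ≢ u × a ≢ v × b ≡ a))
 swap-matching {C} {u} {v} u∈ v∈ uv = record
  { total = tot ; cototal = cotot ; function = fun ; injective = inj
  ; stays-or-moves = λ { (inl (refl , refl)) → inr uv ; (inr (inl (refl , refl))) → inr (~-sym uv) ; (inr (inr (_ , _ , e))) → inl e } }
  where
   R : Fin n → Fin n → Set
   R a b = (a ≡ u × b ≡ v) ⊎ (a ≡ v × b ≡ u) ⊎ (a ≢ u × a ≢ v × b ≡ a)
   u≢v : u ≢ v
   u≢v refl = ~-irr uv
   tot : ∀ {a} → a ∈ₛ C → ∃ λ b → b ∈ₛ C × R a b
   tot {a} a∈ with a Fin.≟ u | a Fin.≟ v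
   ... | yes p | _     = v , v∈ , inl (p , refl)
   ... | no _  | yes q = u , u∈ , inr (inl (q , refl))
   ... | no p  | no q  = a , a∈ , inr (inr (p , q , refl))
   cotot : ∀ {b} → b ∈ₛ C → ∃ λ a → a ∈ₛ C × R a b
   cotot {b} b∈ with b Fin.≟ u | b Fin.≟ v
   ... | yes p | _     = v , v∈ , inr (inl (refl , p))
   ... | no _  | yes q = u , u∈ , inl (refl , q)
   ... | no p  | no q  = b , b∈ , inr (inr (p , q , refl))
   fun : ∀ {a b b′} → R a b → R a b′ → b ≡ b′
   fun (inl (_ , e)) (inl (_ , e′)) = trans e (sym e′)
   fun (inl (e , _)) (inr (inl (e′ , _))) = ⊥-elim (u≢v (trans (sym e) e′))
   fun (inl (e , _)) (inr (inr (n , _))) = ⊥-elim (n e)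
   fun (inr (inl (e , _))) (inl (e′ , _)) = ⊥-elim (u≢v (trans (sym e′) e))
   fun (inr (inl (_ , e))) (inr (inl (_ , e′))) = trans e (sym e′)
   fun (inr (inl (e , _))) (inr (inr (_ , n , _))) = ⊥-elim (n e)
   fun (inr (inr (n , _))) (inl (e , _)) = ⊥-elim (n e)
   fun (inr (inr (_ , n , _))) (inr (inl (e , _))) = ⊥-elim (n e)
   fun (inr (inr (_ , _ , e))) (inr (inr (_ , _ , e′))) = trans e (sym e′)
   inj : ∀ {a a′ b} → R a b → R a′ b → a ≡ a′
   inj (inl (e , _)) (inl (e′ , _)) = trans e (sym e′)
   inj (inl (_ , e)) (inr (inl (_ , e′))) = ⊥-elim (u≢v (trans (sym e′) e))
   inj (inl (_ , e)) (inr (inr (_ , n , e′))) = ⊥-elim (n (trans (sym e′) e))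
   inj (inr (inl (_ , e))) (inl (_ , e′)) = ⊥-elim (u≢v (trans (sym e) e′))
   inj (inr (inl (e , _))) (inr (inl (e′ , _))) = trans e (sym e′)
   inj (inr (inl (_ , e))) (inr (inr (n , _ , e′))) = ⊥-elim (n (trans (sym e′) e))
   inj (inr (inr (_ , n , e))) (inl (_ , e′)) = ⊥-elim (n (trans (sym e) e′))
   inj (inr (inr (n , _ , e))) (inr (inl (_ , e′))) = ⊥-elim (n (trans (sym e) e′))
   inj (inr (inr (_ , _ , e))) (inr (inr (_ , _ , e′))) = trans (sym e) e′

elements : ∀ {n} → Subset n → List (Fin n)
elements Vec.[]            = []
elements (true  Vec.∷ S) = zero ∷ map suc (elements S)
elements (false Vec.∷ S) = map suc (elements S)

length-elements : ∀ {n} (S : Subset n) → length (elements S) ≡ ∣ S ∣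
length-elements Vec.[]            = refl
length-elements (true  Vec.∷ S) = cong suc (trans (length-map suc (elements S)) (length-elements S))
length-elements (false Vec.∷ S) = trans (length-map suc (elements S)) (length-elements S)

elements⁺ : ∀ {n} {S : Subset n} {v} → v ∈ₛ S → v ∈ elements S
elements⁺ {S = true  Vec.∷ S} Vec.here      = here refl
elements⁺ {S = true  Vec.∷ S} (Vec.there m) = there (∈-map⁺ suc (elements⁺ m))
elements⁺ {S = false Vec.∷ S} (Vec.there m) = ∈-map⁺ suc (elements⁺ m)

elements⁻ : ∀ {n} {S : Subset n} {v} → v ∈ elements S → v ∈ₛ S
elements⁻ {S = true Vec.∷ S} (here refl) = Vec.here
elements⁻ {S = true Vec.∷ S} (there m) with ∈-map⁻ suc m
... | _ , m′ , refl = Vec.there (elements⁻ m′)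
elements⁻ {S = false Vec.∷ S} m with ∈-map⁻ suc m
... | _ , m′ , refl = Vec.there (elements⁻ m′)

elements-unique : ∀ {n} (S : Subset n) → Unique (elements S)
elements-unique Vec.[]            = []
elements-unique (true  Vec.∷ S) = All.tabulate (λ m e → case subst (_∈ map suc (elements S)) (sym e) m of λ m′ → case ∈-map⁻ suc m′ of λ ())
 ∷ Uniq.map⁺ suc-injective (elements-unique S)
elements-unique (false Vec.∷ S) = Uniq.map⁺ suc-injective (elements-unique S)

size-by-listing : ∀ {n} {S : Subset n} {xs} → Unique xs → (∀ {v} → v ∈ₛ S ⇔ v ∈ xs) → ∣ S ∣ ≡ length xs
size-by-listing {S = S} u h = trans (sym (length-elements S))
 (↭-length (unique-↭ (elements-unique S) u (to h ∘ elements⁻) (elements⁺ ∘ from h)))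

∈-⋃-map : ∀ {n} {A : Set} (f : A → Fin n) xs {v} → v ∈ₛ ⋃ (map (λ i → ⁅ f i ⁆) xs) ⇔ (∃ λ i → i ∈ xs × v ≡ f i)
∈-⋃-map f []       = mk⇔ (λ m → ⊥-elim (∉⊥ m)) λ ()
∈-⋃-map f (x ∷ xs) = mk⇔
 (λ m → case x∈p∪q⁻ ⁅ f x ⁆ _ m of λ
  { (inl p) → x , here refl , x∈⁅y⁆⇒x≡y (f x) p
  ; (inr p) → let i , i∈ , e = to (∈-⋃-map f xs) p in i , there i∈ , e })
 (λ { (i , here refl , refl) → x∈p∪q⁺ (inl (x∈⁅x⁆ (f x)))
  ; (i , there m , e) → x∈p∪q⁺ {p = ⁅ f x ⁆} (inr (from (∈-⋃-map f xs) (i , m , e))) })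

next-surjective : ∀ {l} (j : Fin l) → ∃ λ i → next i ≡ j
next-surjective {suc l} j with toℕ j in e
... | suc k = let i , _ , p = before j e in i , p
... | zero with toℕ-next {suc l} (fromℕ< {l} ℕ.≤-refl)
...   | inl (lt , _) = contradiction (trans (cong suc (sym (toℕ-fromℕ< {l} ℕ.≤-refl))) refl) (≢-sym (ℕ.<⇒≢ lt))
...   | inr (_ , p) = _ , toℕ-injective (trans p (sym e))

module _ {V : Set} where

 leaf-neighbour-unique : ∀ {t : CutTree V} {v u u′} → Good t → v ∈ Lvs t → TE t v u → TE t v u′ → u ≡ u′
 leaf-neighbour-unique g m a b with cut-at-leaf g m
 ... | s , e with te-nbr⁻ (uniq (good-≃ e g)) (to (te e) a) | te-nbr⁻ (uniq (good-≃ e g)) (to (te e) b)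
 ...   | here p | here q = trans p (sym q)

 path-edge : ∀ a s {x y : V} → Inner (a ∷ spine s) x y → TE (leafT a ⋈ s) x y
 path-edge a s i with spine s | spine-head s | spine-child s
 ... | _ | xs , refl | ch with i
 ...   | inl (refl , refl) = inl (inr (inr (refl , refl)))
 ...   | inr j = inl (inr (inl (ch j)))

module Guards {n : ℕ} (G : Graph n) {t : CutTree (Fin n)} (isGood : Good t) (all : ∀ v → v ∈ verts t) (fits : Fits t (Graph._~_ G))
 {l : ℕ} (c : Fin l → Fin n) (c-injective : ∀ {i j} → c i ≡ c j → i ≡ j) (c∈Lvs : ∀ i → c i ∈ Lvs t) (Lvs-index : ∀ {v} → v ∈ Lvs t → ∃ λ i → v ≡ c i)
 (cycle : ∀ {u w} → CE t u w ⇔ (∃ λ i → u ≡ c i × w ≡ c (next i)))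
 {C₁ C₂ : Subset n} (∈C₁ : ∀ {v} → v ∈ₛ C₁ ⇔ (v ∈ Ints t ⊎ (∃ λ i → (2 ∣ toℕ i) × v ≡ c i)))
 (∈C₂ : ∀ {v} → v ∈ₛ C₂ ⇔ (v ∈ Ints t ⊎ (∃ λ i → (2 ∣ toℕ i) × v ≡ c (next i)))) where
 open Graph G

 Even : Fin l → Set
 Even i = 2 ∣ toℕ i

 evens : List (Fin l)
 evens = filter (λ i → 2 ∣? toℕ i) (allFin l)

 not-int : ∀ {v i} → v ∈ Ints t → v ≢ c i
 not-int m refl = lvs-ints-disjoint (uniq isGood) (c∈Lvs _) m

 cover-edge : ∀ {u w} → u ~ w → TE t u w ⊎ ((∃ λ i → u ≡ c i × w ≡ c (next i)) ⊎ (∃ λ i → w ≡ c i × u ≡ c (next i)))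
 cover-edge k = map-⊎ id (map-⊎ (to cycle) (to cycle)) (from fits k)

 along : ∀ i → c i ~ c (next i)
 along i = to fits (inr (inl (from cycle (i , refl , refl))))

 odd∈C₂ : ∀ {j} → ¬ Even j → c j ∈ₛ C₂
 odd∈C₂ {j} o = let i , e , p = odd-is-next j o in from ∈C₂ (inr (i , e , cong c (sym p)))

 even∈C₁ : ∀ {j} → Even j → c j ∈ₛ C₁
 even∈C₁ e = from ∈C₁ (inr (_ , e , refl))

 evens-unique : Unique evens
 evens-unique = Uniq.filter⁺ (λ i → 2 ∣? toℕ i) (Uniq.allFin⁺ l)

 few-evens : 2 * length evens ≤ suc l
 few-evens = ℕ.≤-trans (ℕ.≤-reflexive (trans (cong (length evens +_) (ℕ.+-identityʳ _)) (sym
  (trans (length-++ (map toℕ evens)) (cong₂ _+_ (length-map toℕ evens) (length-map (suc ∘ toℕ) evens))))))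
  (ℕ.≤-trans (unique-⊆-length (Uniq.++⁺ (Uniq.map⁺ toℕ-injective evens-unique)
   (Uniq.map⁺ (toℕ-injective ∘ ℕ.suc-injective) evens-unique) disj) (λ m → ∈-upTo⁺ (bound m))) (ℕ.≤-reflexive (length-upTo (suc l))))
  where
   ev : ∀ {i} → i ∈ evens → Even i
   ev m = snd (∈-filter⁻ (λ i → 2 ∣? toℕ i) {xs = allFin l} m)
   disj : ∀ {k} → ¬ (k ∈ map toℕ evens × k ∈ map (suc ∘ toℕ) evens)
   disj (a , b) with ∈-map⁻ toℕ a | ∈-map⁻ (suc ∘ toℕ) b
   ... | i , i∈ , refl | j , j∈ , e = even-suc (ev j∈) (subst (2 ∣_) e (ev i∈))
   bound : ∀ {k} → k ∈ map toℕ evens ++ map (suc ∘ toℕ) evens → k < suc l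
   bound m with ∈-++⁻ (map toℕ evens) m
   ... | inl a with ∈-map⁻ toℕ a
   ...   | i , _ , refl = ℕ.m≤n⇒m≤1+n (toℕ<n i)
   bound m | inr b with ∈-map⁻ (suc ∘ toℕ) b
   ...   | i , _ , refl = s≤s (toℕ<n i)

 private
  size-of : ∀ {S} (f : Fin l → Fin n) → (∀ {i j} → f i ≡ f j → i ≡ j) → (∀ i → f i ∈ Lvs t) →
   (∀ {v} → v ∈ₛ S ⇔ (v ∈ Ints t ⊎ (∃ λ i → Even i × v ≡ f i))) → ∣ S ∣ ≡ length (Ints t) + length evens
  size-of f inj f∈ h = trans (size-by-listing {xs = Ints t ++ map f evens}
   (Uniq.++⁺ ints-unique (Uniq.map⁺ inj evens-unique) (λ { (a , b) → case ∈-map⁻ f b of λ { (i , _ , refl) → lvs-ints-disjoint (uniq isGood) (f∈ i) a } }))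
   (mk⇔ (λ m → [ ∈-++⁺ˡ , (λ { (i , e , refl) → ∈-++⁺ʳ (Ints t) (∈-map⁺ f (∈-filter⁺ (λ i → 2 ∣? toℕ i) (∈-allFin i) e)) }) ]′ (to h m))
    (λ m → from h (map-⊎ id (λ b → let i , i∈ , e = ∈-map⁻ f b in i , snd (∈-filter⁻ (λ i → 2 ∣? toℕ i) {xs = allFin l} i∈) , e) (∈-++⁻ (Ints t) m)))))
   (trans (length-++ (Ints t)) (cong (length (Ints t) +_) (length-map f evens)))
   where
    ints-unique : Unique (Ints t)
    ints-unique = fst (snd (unique-++⁻ (Lvs t) (unique-resp-↭ (verts-split t) (unV (uniq isGood)))))

 size-C₁ : ∣ C₁ ∣ ≡ length (Ints t) + length evens
 size-C₁ = size-of c c-injective c∈Lvs ∈C₁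

 size-C₂ : ∣ C₂ ∣ ≡ length (Ints t) + length evens
 size-C₂ = size-of (c ∘ next) (next-injective _ _ ∘ c-injective) (c∈Lvs ∘ next) ∈C₂

 cover₁ : IsVertexCover G C₁
 cover₁ {u} {v} k with cover-edge k
 ... | inr (inl (i , refl , refl)) = [ (λ (e , _) → inl (even∈C₁ e)) , (λ (o , _) → inr (even∈C₁ (next-even i o))) ]′ (parity-step (toℕ i))
 ... | inr (inr (i , refl , refl)) = [ (λ (e , _) → inr (even∈C₁ e)) , (λ (o , _) → inl (even∈C₁ (next-even i o))) ]′ (parity-step (toℕ i))
 ... | inl e with leaf-or-int t (all u) | leaf-or-int t (all v)
 ...   | inr a | _      = inl (from ∈C₁ (inl a))
 ...   | _      | inr b = inr (from ∈C₁ (inl b))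
 ...   | inl a | inl b = ⊥-elim (no-TE-between-leaves isGood a b e)

 cover₂ : IsVertexCover G C₂
 cover₂ {u} {v} k with cover-edge k
 ... | inr (inl (i , refl , refl)) = [ (λ (e , _) → inr (from ∈C₂ (inr (i , e , refl)))) , (λ (o , _) → inl (odd∈C₂ o)) ]′ (parity-step (toℕ i))
 ... | inr (inr (i , refl , refl)) = [ (λ (e , _) → inl (from ∈C₂ (inr (i , e , refl)))) , (λ (o , _) → inr (odd∈C₂ o)) ]′ (parity-step (toℕ i))
 ... | inl e with leaf-or-int t (all u) | leaf-or-int t (all v)
 ...   | inr a | _      = inl (from ∈C₂ (inl a))
 ...   | _      | inr b = inr (from ∈C₂ (inl b))
 ...   | inl a | inl b = ⊥-elim (no-TE-between-leaves isGood a b e)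

 Forward : Fin n → Fin n → Set
 Forward v w = (v ∈ Ints t × w ≡ v) ⊎ (∃ λ i → Even i × v ≡ c i × w ≡ c (next i))

 forward : Matching G C₁ C₂ Forward
 forward = record
  { total = λ m → case to ∈C₁ m of λ
   { (inl a) → _ , from ∈C₂ (inl a) , inl (a , refl)
   ; (inr (i , e , p)) → _ , from ∈C₂ (inr (i , e , refl)) , inr (i , e , p , refl) }
  ; cototal = λ m → case to ∈C₂ m of λ
   { (inl a) → _ , from ∈C₁ (inl a) , inl (a , refl)
   ; (inr (i , e , p)) → _ , even∈C₁ e , inr (i , e , refl , p) }
  ; function = λ
   { (inl (_ , e)) (inl (_ , e′)) → trans e (sym e′)
   ; (inl (a , _)) (inr (_ , _ , e , _)) → ⊥-elim (not-int a e)
   ; (inr (_ , _ , e , _)) (inl (a , _)) → ⊥-elim (not-int a e)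
   ; (inr (i , _ , refl , p)) (inr (j , _ , e , q)) → trans p (trans (cong (c ∘ next) (c-injective e)) (sym q)) }
  ; injective = λ
   { (inl (_ , e)) (inl (_ , e′)) → trans (sym e) e′
   ; (inl (a , refl)) (inr (_ , _ , _ , e)) → ⊥-elim (not-int a e)
   ; (inr (_ , _ , _ , e)) (inl (a , refl)) → ⊥-elim (not-int a e)
   ; (inr (i , _ , p , refl)) (inr (j , _ , q , e)) → trans p (trans (cong c (next-injective i j (c-injective e))) (sym q)) }
  ; stays-or-moves = λ { (inl (_ , e)) → inl e ; (inr (i , _ , refl , refl)) → inr (along i) } }

 -- The guard on c 0 stays put when l is odd: then c 0 lies in both covers.
 Backward : Fin n → Fin n → Set
 Backward v w = (v ∈ Ints t × w ≡ v) ⊎ (∃ λ i → ¬ Even i × v ≡ c (next i) × w ≡ c i)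
  ⊎ (∃ λ i → (Even i × Even (next i)) × v ≡ c (next i) × w ≡ v)

 backward : Matching G C₁ C₂ Backward
 backward = record
  { total = λ m → case to ∈C₁ m of λ
   { (inl a) → _ , from ∈C₂ (inl a) , inl (a , refl)
   ; (inr (j , e , refl)) → tot j e }
  ; cototal = λ m → case to ∈C₂ m of λ
   { (inl a) → _ , from ∈C₁ (inl a) , inl (a , refl)
   ; (inr (i , e , refl)) → cotot i e }
  ; function = λ
   { (inl (_ , e)) (inl (_ , e′)) → trans e (sym e′)
   ; (inl (a , _)) (inr (inl (_ , _ , e , _))) → ⊥-elim (not-int a e)
   ; (inl (a , _)) (inr (inr (_ , _ , e , _))) → ⊥-elim (not-int a e)
   ; (inr (inl (_ , _ , e , _))) (inl (a , _)) → ⊥-elim (not-int a e)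
   ; (inr (inr (_ , _ , e , _))) (inl (a , _)) → ⊥-elim (not-int a e)
   ; (inr (inl (i , _ , refl , p))) (inr (inl (j , _ , e , q))) → trans p (trans (cong c (next-injective i j (c-injective e))) (sym q))
   ; (inr (inl (i , o , refl , _))) (inr (inr (j , (ev , _) , e , _))) → ⊥-elim (o (subst Even (sym (next-injective i j (c-injective e))) ev))
   ; (inr (inr (j , (ev , _) , refl , _))) (inr (inl (i , o , e , _))) → ⊥-elim (o (subst Even (next-injective j i (c-injective e)) ev))
   ; (inr (inr (_ , _ , _ , p))) (inr (inr (_ , _ , _ , q))) → trans p (sym q) }
  ; injective = λ
   { (inl (_ , e)) (inl (_ , e′)) → trans (sym e) e′
   ; (inl (a , refl)) (inr (inl (_ , _ , _ , e))) → ⊥-elim (not-int a e)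
   ; (inl (a , refl)) (inr (inr (_ , _ , e , refl))) → ⊥-elim (not-int a e)
   ; (inr (inl (_ , _ , _ , e))) (inl (a , refl)) → ⊥-elim (not-int a e)
   ; (inr (inr (_ , _ , e , refl))) (inl (a , refl)) → ⊥-elim (not-int a e)
   ; (inr (inl (i , _ , p , refl))) (inr (inl (j , _ , q , e))) → trans p (trans (cong (c ∘ next) (c-injective e)) (sym q))
   ; (inr (inl (i , o , _ , refl))) (inr (inr (j , (_ , ev) , e , refl))) → ⊥-elim (o (subst Even (sym (c-injective e)) ev))
   ; (inr (inr (j , (_ , ev) , refl , refl))) (inr (inl (i , o , _ , e))) → ⊥-elim (o (subst Even (c-injective e) ev))
   ; (inr (inr (_ , _ , _ , p))) (inr (inr (_ , _ , _ , q))) → trans (sym p) q }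
  ; stays-or-moves = λ { (inl (_ , e)) → inl e ; (inr (inl (i , _ , refl , refl))) → inr (~-sym (along i)) ; (inr (inr (_ , _ , _ , e))) → inl e } }
  where
   tot : ∀ j → Even j → ∃ λ w → w ∈ₛ C₂ × Backward (c j) w
   tot j e with next-surjective j
   ... | i , refl with parity-step (toℕ i)
   ...   | inl (ev , _) = _ , from ∈C₂ (inr (i , ev , refl)) , inr (inr (i , (ev , e) , refl , refl))
   ...   | inr (o , _)  = _ , odd∈C₂ o , inr (inl (i , o , refl , refl))
   cotot : ∀ i → Even i → ∃ λ v → v ∈ₛ C₁ × Backward v (c (next i))
   cotot i e with parity-step (toℕ (next i))
   ... | inl (ev , _) = _ , even∈C₁ ev , inr (inr (i , (e , ev) , refl , refl))
   ... | inr (o , _)  = _ , even∈C₁ (next-even (next i) o) , inr (inl (next i , o , refl , refl))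

 -- The guards between c i and c (next i) shift along the tree path joining these two leaves.
 module Detour (i : Fin l) (ev : Even i) where

  private
   s : PlaneTree (Fin n)
   s = fst (cut-at-leaf isGood (c∈Lvs i))
   e : t ≃ leafT (c i) ⋈ s
   e = snd (cut-at-leaf isGood (c∈Lvs i))
   g : Good (leafT (c i) ⋈ s)
   g = good-≃ e isGood
   path : List (Fin n)
   path = c i ∷ spine s
   path-unique : Unique path
   path-unique = (All.tabulate λ m p → root-fresh (uniq g) (spine⊆ s m) p) ∷ spine-unique s (fst (snd (unique-++⁻ (c i ∷ []) (unV (uniq g)))))
   _∈?_ = DecMem._∈?_ (Fin._≟_ {n})
   first≡ : first s ≡ c (next i)
   first≡ = sym (ce-leaf-next (uniq g) (to (ce e) (from cycle (i , refl , refl))))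
   in-ints : ∀ {v} → v ∈ ints s → v ∈ Ints t
   in-ints m = ∈-resp-↭ (↭-sym (ints↭ e)) m
   kind : ∀ {v} → v ∈ spine s → v ∈ Ints t ⊎ v ≡ c (next i)
   kind m = map-⊎ in-ints (λ p → trans p first≡) (spine-kind s m)
   next≢ : c (next i) ≢ c i
   next≢ p = root-fresh (uniq g) (spine⊆ s (first∈spine s)) (sym (trans first≡ p))

  edge : ∀ {v w} → Inner path v w → TE t v w
  edge p = from (te e) (path-edge (c i) s p)

  Shift : Fin n → Fin n → Set
  Shift v w = Inner path v w ⊎ ((v ∈ Ints t × v ∉ path) × w ≡ v) ⊎ (∃ λ j → (Even j × j ≢ i) × v ≡ c j × w ≡ c (next j))

  private
   source : ∀ {v w} → Inner path v w → v ∈ₛ C₁ × (v ∈ Ints t ⊎ v ≡ c i)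
   source p with spine s | spine-head s | (λ {x y} → spine-child s {x} {y})
   ... | _ | xs , refl | ch with p
   ...   | inl (refl , refl) = even∈C₁ ev , inr refl
   ...   | inr q = let m = in-ints (child-source s (ch q)) in from ∈C₁ (inl m) , inl m
   target : ∀ {v w} → Inner path v w → w ∈ spine s
   target p with spine s | spine-head s
   ... | _ | xs , refl with p
   ...   | inl (_ , q) = here q
   ...   | inr q = snd (Inner-∈ (root s ∷ xs) q)
   from-path : ∀ {v} → v ∈ₛ C₁ → v ∈ path → v ≡ c (next i) ⊎ ∃ λ w → Inner path v w
   from-path m (here refl) with spine s | spine-head s
   ... | _ | xs , refl = inr (root s , inl (refl , refl))
   from-path m (there k) with spine-next s k
   ... | inl p = inl (trans p first≡)
   ... | inr (y , q) with spine s | spine-head s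
   ...   | _ | xs , refl = inr (y , inr q)
   target∈ : ∀ {v w} → Inner path v w → w ∈ₛ C₂
   target∈ p with kind (target p)
   ... | inl a = from ∈C₂ (inl a)
   ... | inr q = from ∈C₂ (inr (i , ev , q))
   tot : ∀ {v} → v ∈ₛ C₁ → ∃ λ w → w ∈ₛ C₂ × Shift v w
   tot {v} m with to ∈C₁ m
   ... | inl a with v ∈? path
   ...   | no nk = v , from ∈C₂ (inl a) , inr (inl ((a , nk) , refl))
   ...   | yes k with from-path m k
   ...     | inl p = ⊥-elim (not-int a p)
   ...     | inr (w , p) = w , target∈ p , inl p
   tot m | inr (j , ej , refl) with j Fin.≟ i
   ...   | no ne = _ , from ∈C₂ (inr (j , ej , refl)) , inr (inr (j , (ej , ne) , refl , refl))
   ...   | yes refl with from-path m (here refl)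
   ...     | inl p = ⊥-elim (next≢ (sym p))
   ...     | inr (w , p) = w , target∈ p , inl p
   cotot : ∀ {w} → w ∈ₛ C₂ → ∃ λ v → v ∈ₛ C₁ × Shift v w
   cotot {w} m with w ∈? spine s
   ... | yes k = let v , p = has-predecessor (spine s) k in v , fst (source p) , inl p
   ... | no nk with to ∈C₂ m
   ...   | inl a = w , from ∈C₁ (inl a) , inr (inl ((a , λ { (here p) → not-int a p ; (there k) → nk k }) , refl))
   ...   | inr (j , ej , refl) = c j , even∈C₁ ej , inr (inr (j , (ej , λ { refl → nk (subst (_∈ spine s) first≡ (first∈spine s)) }) , refl , refl))

  shift-matching : Matching G C₁ C₂ Shift
  shift-matching = record
   { total = tot ; cototal = cotot
   ; function = λ
    { (inl p) (inl q) → Inner-functional path-unique p q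
    ; (inl p) (inr (inl ((_ , nk) , _))) → ⊥-elim (nk (fst (Inner-∈ path p)))
    ; (inl p) (inr (inr (j , (_ , ne) , refl , _))) → ⊥-elim ([ (λ a → not-int a refl) , (λ q → ne (c-injective q)) ]′ (snd (source p)))
    ; (inr (inl ((_ , nk) , _))) (inl p) → ⊥-elim (nk (fst (Inner-∈ path p)))
    ; (inr (inr (j , (_ , ne) , refl , _))) (inl p) → ⊥-elim ([ (λ a → not-int a refl) , (λ q → ne (c-injective q)) ]′ (snd (source p)))
    ; (inr (inl (_ , p))) (inr (inl (_ , q))) → trans p (sym q)
    ; (inr (inl ((a , _) , _))) (inr (inr (_ , _ , q , _))) → ⊥-elim (not-int a q)
    ; (inr (inr (_ , _ , q , _))) (inr (inl ((a , _) , _))) → ⊥-elim (not-int a q)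
    ; (inr (inr (_ , _ , refl , p))) (inr (inr (_ , _ , q , r))) → trans p (trans (cong (c ∘ next) (c-injective q)) (sym r)) }
   ; injective = λ
    { (inl p) (inl q) → Inner-injective path-unique p q
    ; (inl p) (inr (inl ((_ , nk) , refl))) → ⊥-elim (nk (there (target p)))
    ; (inl p) (inr (inr (j , (_ , ne) , _ , refl))) → ⊥-elim (arrived p ne)
    ; (inr (inl ((_ , nk) , refl))) (inl p) → ⊥-elim (nk (there (target p)))
    ; (inr (inr (j , (_ , ne) , _ , refl))) (inl p) → ⊥-elim (arrived p ne)
    ; (inr (inl (_ , p))) (inr (inl (_ , q))) → trans (sym p) q
    ; (inr (inl ((a , _) , refl))) (inr (inr (_ , _ , _ , q))) → ⊥-elim (not-int a q)
    ; (inr (inr (_ , _ , _ , q))) (inr (inl ((a , _) , refl))) → ⊥-elim (not-int a q)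
    ; (inr (inr (j , _ , p , refl))) (inr (inr (k , _ , q , r))) → trans p (trans (cong c (next-injective j k (c-injective r))) (sym q)) }
   ; stays-or-moves = λ { (inl p) → inr (to fits (inl (edge p))) ; (inr (inl (_ , p))) → inl p ; (inr (inr (j , _ , refl , refl))) → inr (along j) } }
   where
    arrived : ∀ {v j} → Inner path v (c (next j)) → j ≢ i → ⊥
    arrived p ne = [ (λ a → not-int a refl) , (λ q → ne (next-injective _ _ (c-injective q))) ]′ (kind (target p))

  shift-from : ∃ λ w → Inner path (c i) w
  shift-from with spine s | spine-head s
  ... | _ | xs , refl = root s , inl (refl , refl)

  shift-to : ∃ λ v → Inner path v (c (next i))
  shift-to = has-predecessor (spine s) (subst (_∈ spine s) first≡ (first∈spine s))

 private
  outside₁ : ∀ {v} → v ∉ₛ C₁ → ∃ λ j → ¬ Even j × v ≡ c j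
  outside₁ {v} nv with leaf-or-int t (all v)
  ... | inr a = ⊥-elim (nv (from ∈C₁ (inl a)))
  ... | inl a with Lvs-index a
  ...   | j , refl = j , (λ e → nv (even∈C₁ e)) , refl

  outside₂ : ∀ {v} → v ∉ₛ C₂ → ∃ λ j → Even j × v ≡ c j
  outside₂ {v} nv with leaf-or-int t (all v)
  ... | inr a = ⊥-elim (nv (from ∈C₂ (inl a)))
  ... | inl a with Lvs-index a
  ...   | j , refl with parity-step (toℕ j)
  ...     | inl (e , _) = j , e , refl
  ...     | inr (o , _) = ⊥-elim (nv (odd∈C₂ o))

 Reply : Subset n → Subset n → Fin n → Fin n → Set₁
 Reply C C′ u v = ∃ λ R → Matching G C C′ R × R u v

 reply₁ : ∀ {u v} → v ∉ₛ C₁ → u ~ v → Reply C₁ C₂ u v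
 reply₁ {u} {v} nv k with cover-edge k
 reply₁ nv k | inr (inl (i , refl , refl)) with parity-step (toℕ i)
 ... | inl (e , _) = _ , forward , inr (i , e , refl , refl)
 ... | inr (o , _) = ⊥-elim (nv (even∈C₁ (next-even i o)))
 reply₁ nv k | inr (inr (i , refl , refl)) = _ , backward , inr (inl (i , (λ e → nv (even∈C₁ e)) , refl , refl))
 reply₁ nv k | inl a with outside₁ nv
 ... | j , o , refl with odd-is-next j o
 ...   | i , e , refl = _ , Detour.shift-matching i e , inl (subst (λ x → Inner _ x (c (next i)))
  (leaf-neighbour-unique isGood (c∈Lvs (next i)) (TE-sym t (Detour.edge i e (snd (Detour.shift-to i e)))) (TE-sym t a)) (snd (Detour.shift-to i e)))

 reply₂ : ∀ {u v} → v ∉ₛ C₂ → u ~ v → Reply C₂ C₁ u v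
 reply₂ {u} {v} nv k with cover-edge k
 reply₂ nv k | inr (inr (i , refl , refl)) with parity-step (toℕ i)
 ... | inl (e , _) = _ , flip-matching G forward , inr (i , e , refl , refl)
 ... | inr (o , _) = ⊥-elim (nv (odd∈C₂ o))
 reply₂ nv k | inr (inl (i , refl , refl)) = _ , flip-matching G backward , inr (inl (i , (λ e → nv (from ∈C₂ (inr (i , e , refl)))) , refl , refl))
 reply₂ nv k | inl a with outside₂ nv
 ... | i , e , refl = _ , flip-matching G (Detour.shift-matching i e) , inl (subst (Inner _ (c i))
  (leaf-neighbour-unique isGood (c∈Lvs i) (Detour.edge i e (snd (Detour.shift-from i e))) (TE-sym t a)) (snd (Detour.shift-from i e)))

 private
  defend : ∀ {C C′ u v} → IsVertexCover G C → (∀ {u v} → v ∉ₛ C → u ~ v → Reply C C′ u v) → u ~ v →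
   ∃ λ C″ → (C″ ≡ C ⊎ C″ ≡ C′) × Answers G C C″ u v
  defend {C} {C′} {u} {v} cov r k with u ∈ₛ? C | v ∈ₛ? C
  ... | yes a | yes b = C , inl refl , answers G (swap-matching G a b k) (inl (a , inl (refl , refl)))
  ... | no a  | no b  = ⊥-elim ([ a , b ]′ (cov k))
  ... | yes a | no b  = let _ , m , x = r b k in C′ , inr refl , answers G m (inl (a , x))
  ... | no a  | yes b = let _ , m , x = r a (~-sym k) in C′ , inr refl , answers G m (inr (b , x))

 evc-class : IsEVCClass G ｛ C₁ , C₂ ｝ (length (Ints t) + length evens)
 evc-class = record
  { nonempty = C₁ , inl refl
  ; covers   = λ { (inl refl) → cover₁ ; (inr refl) → cover₂ }
  ; size     = λ { (inl refl) → size-C₁ ; (inr refl) → size-C₂ }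
  ; defends  = λ { (inl refl) k → defend cover₁ reply₁ k
   ; (inr refl) k → let C″ , x , y = defend cover₂ reply₂ k in C″ , [ inr , inl ]′ x , y } }

module _ {n : ℕ} {G : Graph n} {H : Halin G} (T : HalinTree G H) where
 open Halin H using (c; int; evens; OnCycle; leaves; C₁; C₂)
 open HalinTree T

 private
  leaf? : ∀ v → Dec (Graph.IsLeaf (Halin.T H) v)
  leaf? = Graph.isLeaf? (Halin.T H)

  index-of : ∀ {v} {xs : List (Fin n)} → v ∈ xs → ∃ λ i → v ≡ lookup xs i
  index-of (here e)  = zero , e
  index-of (there m) = let i , e = index-of m in suc i , e

 ∈int : ∀ {v} → v ∈ₛ int ⇔ v ∈ Ints tree
 ∈int {v} = mk⇔ (λ m → i⁻ (trans (sym (lookup∘tabulate (λ v → does (¬? (leaf? v))) v)) ([]=⇒lookup m)))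
  (λ m → lookup⇒[]= v int (trans (lookup∘tabulate (λ v → does (¬? (leaf? v))) v)
   (dec-true (¬? (leaf? v)) (λ il → lvs-ints-disjoint (uniq isGood) (to (internal v) il) m))))
  where
   i⁻ : does (¬? (leaf? v)) ≡ true → v ∈ Ints tree
   i⁻ e with leaf-or-int tree (all v)
   ... | inl m = case trans (sym e) (dec-false (¬? (leaf? v)) (λ k → k (from (internal v) m))) of λ ()
   ... | inr m = m

 ∈cover : ∀ (f : Fin (Halin.l H) → Fin n) {v} → v ∈ₛ int ∪ ⋃ (map (λ i → ⁅ f i ⁆) evens) ⇔ (v ∈ Ints tree ⊎ (∃ λ i → (2 ∣ toℕ i) × v ≡ f i))
 ∈cover f = mk⇔
  (λ m → map-⊎ (to ∈int) (λ m → let i , i∈ , e = to (∈-⋃-map f evens) m in i , snd (∈-filter⁻ (λ i → 2 ∣? toℕ i) {xs = allFin _} i∈) , e) (x∈p∪q⁻ int _ m))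
  (λ m → x∈p∪q⁺ {p = int} (map-⊎ (from ∈int) (λ { (i , e , p) → from (∈-⋃-map f evens) (i , ∈-filter⁺ (λ i → 2 ∣? toℕ i) (∈-allFin i) e , p) }) m))

 private
  c-injective : ∀ {i j} → c i ≡ c j → i ≡ j
  c-injective = lookup-injective (subst Unique (sym tree-leaves) (Lvs-unique (uniq isGood))) _ _
  c∈Lvs : ∀ i → c i ∈ Lvs tree
  c∈Lvs i = subst (c i ∈_) tree-leaves (∈-lookup i)
  Lvs-index : ∀ {v} → v ∈ Lvs tree → ∃ λ i → v ≡ c i
  Lvs-index {v} m = index-of (subst (v ∈_) (sym tree-leaves) m)
  cycle : ∀ {u w} → CE tree u w ⇔ OnCycle u w
  cycle {u} {w} = subst (λ L → Cyc L u w ⇔ OnCycle u w) tree-leaves (Cyc-index leaves)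

 open Guards G isGood all fits c c-injective c∈Lvs Lvs-index cycle (∈cover c) (∈cover (c ∘ next)) public using (evc-class; few-evens)

-- Vertex covers and degrees

module _ {V : Set} where

 Inner-∷ : ∀ x xs {u w : V} → Inner xs u w → Inner (x ∷ xs) u w
 Inner-∷ x (y ∷ ys) i = inr i

 Inner-++ʳ : ∀ xs {ys} {u w : V} → Inner ys u w → Inner (xs ++ ys) u w
 Inner-++ʳ []       i = i
 Inner-++ʳ (x ∷ xs) i = Inner-∷ x (xs ++ _) (Inner-++ʳ xs i)

 Inner-++ˡ : ∀ xs {ys} {u w : V} → Inner xs u w → Inner (xs ++ ys) u w
 Inner-++ˡ (x ∷ y ∷ xs) (inl e) = inl e
 Inner-++ˡ (x ∷ y ∷ xs) (inr i) = inr (Inner-++ˡ (y ∷ xs) i)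

 Inner-junction : ∀ (x : V) xs y ys → Inner ((x ∷ xs) ++ y ∷ ys) (lst (x ∷ xs) x) y
 Inner-junction x []       y ys = inl (refl , refl)
 Inner-junction x (z ∷ xs) y ys = inr (Inner-junction z xs y ys)

 total : (V → ℕ) → PlaneTree V → ℕ
 total f t = sum (map f (preorder t))

 totals : (V → ℕ) → List (PlaneTree V) → ℕ
 totals f ts = sum (map f (preorders ts))

 sum-map-++ : ∀ (f : V → ℕ) xs ys → sum (map f (xs ++ ys)) ≡ sum (map f xs) + sum (map f ys)
 sum-map-++ f xs ys = trans (cong sum (map-++ f xs ys)) (sum-++ (map f xs) (map f ys))

 -- inn and out are the characteristic functions of a vertex cover and its complement. The bound for the
 -- whole tree follows by induction if the two extreme leaves and the root are taken into account.
 module Cover (inn out : V → ℕ) (one : ∀ v → inn v + out v ≡ 1) where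

  private
   O I : PlaneTree V → ℕ
   O = total out
   I = total inn
   Os Is : List (PlaneTree V) → ℕ
   Os = totals out
   Is = totals inn

  Covered : PlaneTree V → Set
  Covered t = (∀ {u w} → Child t u w → out u + out w ≤ 1) × (∀ {u w} → Inner (lvs t) u w → out u + out w ≤ 1)

  Covereds : V → List (PlaneTree V) → Set
  Covereds v ts = (∀ {u w} → Child (node v ts) u w → out u + out w ≤ 1) × (∀ {u w} → Inner (lvss ts) u w → out u + out w ≤ 1)

  last-of : PlaneTree V → List (PlaneTree V) → V
  last-of t ts = lst (lvss ts) (final t)

  out≤1 : ∀ v → out v ≤ 1
  out≤1 v = subst (out v ≤_) (one v) (ℕ.m≤n+m _ _)

  private
   covered-head : ∀ {v t ts} → Covereds v (t ∷ ts) → Covered t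
   covered-head {t = t} (c , i) = (λ d → c (below (here refl) d)) , (λ j → i (Inner-++ˡ (lvs t) j))
   covered-tail : ∀ {v t ts} → Covereds v (t ∷ ts) → Covereds v ts
   covered-tail {t = t} (c , i) = (λ d → c (Child-there d)) , (λ j → i (Inner-++ʳ (lvs t) j))
   junction : ∀ {v t t′ ts} → Covereds v (t ∷ t′ ∷ ts) → out (final t) + out (first t′) ≤ 1
   junction {t = t} {t′} {ts} (c , i) = i (j (lvs t) (lvs t′) {root t} {root t′} (lvs-nonempty t) (lvs-nonempty t′))
    where
     j : ∀ (L L′ : List V) {a b} → (∃₂ λ x xs → L ≡ x ∷ xs) → (∃₂ λ x xs → L′ ≡ x ∷ xs) → Inner (L ++ L′ ++ lvss ts) (lst L a) (hd L′ b)
     j _ _ (x , xs , refl) (y , ys , refl) = Inner-junction x xs y (ys ++ lvss ts)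

   split : ∀ f t ts → totals f (t ∷ ts) ≡ total f t + totals f ts
   split f t ts = sum-map-++ f (preorder t) (preorders ts)

   cancel : ∀ k {x y x′ y′} → x′ ≤ y′ → x′ ≡ k + x → y′ ≡ k + y → x ≤ y
   cancel k le refl refl = ℕ.+-cancelˡ-≤ k _ _ le

   join : ∀ {o i o′ i′ a d c e} → suc o ≤ i + (a + d) → suc o′ ≤ i′ + (c + e) → d + c ≤ 1 → suc (o + o′) ≤ (i + i′) + (a + e)
   join {o} {i} {o′} {i′} {a} {d} {c} {e} p q r = cancel (1 + (d + c)) (ℕ.+-mono-≤ (ℕ.+-mono-≤ p q) r) (eq₁ o o′ d c) (eq₂ i i′ a d c e)
    where
     eq₁ : ∀ o o′ d c → suc o + suc o′ + (d + c) ≡ 1 + (d + c) + suc (o + o′)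
     eq₁ = solve-∀
     eq₂ : ∀ i i′ a d c e → i + (a + d) + (i′ + (c + e)) + 1 ≡ 1 + (d + c) + (i + i′ + (a + e))
     eq₂ = solve-∀
   join₂ : ∀ {o i o′ i′ d c} → suc o ≤ i + d → suc o′ ≤ i′ + c → d + c ≤ 1 → suc (o + o′) ≤ i + i′
   join₂ {o} {i} {o′} {i′} {d} {c} p q r = subst (suc (o + o′) ≤_) (ℕ.+-identityʳ _)
    (join {o} {i} {o′} {i′} {0} {d} {c} {0} p (subst (λ x → suc o′ ≤ i′ + x) (sym (ℕ.+-identityʳ c)) q) r)
   apart : ∀ {o i o′ i′ a b} → suc o ≤ i + a → suc o′ ≤ i′ + b → 2 + (o + o′) ≤ (i + i′) + (a + b)
   apart {o} {i} {o′} {i′} {a} {b} p q = subst₂ _≤_ (cong suc (ℕ.+-suc o o′)) (eq i i′ a b) (ℕ.+-mono-≤ p q)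
    where
     eq : ∀ i i′ a b → i + a + (i′ + b) ≡ i + i′ + (a + b)
     eq = solve-∀
   drop-≤ : ∀ {o i c} → suc o ≤ i + c → c ≤ 1 → o ≤ i
   drop-≤ {o} {i} p q = ℕ.≤-pred (ℕ.≤-trans p (ℕ.≤-trans (ℕ.+-monoʳ-≤ i q) (ℕ.≤-reflexive (ℕ.+-comm i 1))))

  Slack : PlaneTree V → Set
  Slack t = suc (O t) ≤ I t + (out (first t) + out (final t))
   × (out (root t) ≡ 0 → suc (O t) ≤ I t + out (first t) × suc (O t) ≤ I t + out (final t))

  slack  : ∀ t → Wf t → Covered t → Slack t
  slack-in  : ∀ v t ts → Wfs (t ∷ ts) → Covereds v (t ∷ ts) → suc (Os (t ∷ ts)) ≤ Is (t ∷ ts) + (out (first t) + out (last-of t ts))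
  slack-all : ∀ v t ts → Wfs (t ∷ ts) → Covereds v (t ∷ ts) → out v ≡ 1 → suc (Os (t ∷ ts)) ≤ Is (t ∷ ts) + out (last-of t ts) × Os (t ∷ ts) ≤ Is (t ∷ ts)
  slack-out : ∀ v t t′ ts → Wfs (t ∷ t′ ∷ ts) → Covereds v (t ∷ t′ ∷ ts) → out v ≡ 1 →
   suc (Os (t ∷ t′ ∷ ts)) ≤ Is (t ∷ t′ ∷ ts) × 2 + Os (t ∷ t′ ∷ ts) ≤ Is (t ∷ t′ ∷ ts) + (out (first t) + out (last-of t (t′ ∷ ts)))

  private
   last-tail : ∀ t t′ ts → last-of t (t′ ∷ ts) ≡ last-of t′ ts
   last-tail t t′ ts = trans (lst-++ (lvs t′)) (cong (lst (lvss ts)) (lst-lvs t′))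
   out-or-in : ∀ v → (out v ≡ 0 × inn v ≡ 1) ⊎ (out v ≡ 1 × inn v ≡ 0)
   out-or-in v with out v | one v
   ... | zero        | e = inl (refl , trans (sym (ℕ.+-identityʳ _)) e)
   ... | suc zero    | e = inr (refl , ℕ.suc-injective (trans (ℕ.+-comm 1 _) e))
   ... | suc (suc _) | e = case trans (ℕ.+-comm (suc (suc _)) (inn v)) e of λ ()
   final-last : ∀ v t ts → final (node v (t ∷ ts)) ≡ last-of t ts
   final-last v t ts = trans (lst-++ (lvs t)) (cong (lst (lvss ts)) (lst-lvs t))
   root-in : ∀ {v t ts} → Covereds v (t ∷ ts) → out v ≡ 1 → out (root t) ≡ 0
   root-in {t = t} (c , _) e = ℕ.n≤0⇒n≡0 (ℕ.≤-pred (subst (λ x → x + out (root t) ≤ 1) e (c (here (here refl)))))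

  slack (node v []) _ _ with out-or-in v
  ... | inl (a , b) rewrite a | b = s≤s z≤n , λ _ → s≤s z≤n , s≤s z≤n
  ... | inr (a , b) rewrite a | b = s≤s (s≤s z≤n) , λ ()
  slack (node v (t ∷ ts)) w c with out-or-in v
  ... | inl (a , b) rewrite a | b | spine-first v t ts | final-last v t ts = ℕ.m≤n⇒m≤1+n s
   , λ _ → s≤s (drop-≤ (subst (suc (Os (t ∷ ts)) ≤_) (sym (ℕ.+-assoc (Is (t ∷ ts)) _ _)) s) (out≤1 (last-of t ts)))
    , s≤s (drop-≤ {i = Is (t ∷ ts) + out (last-of t ts)} (subst (suc (Os (t ∷ ts)) ≤_) (shuffle (Is (t ∷ ts)) _ _) s) (out≤1 (first t)))
   where
    s = slack-in v t ts (snd w) c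
    shuffle : ∀ x y z → x + (y + z) ≡ x + z + y
    shuffle = solve-∀
  slack (node v (t ∷ [])) w c | inr _ = contradiction refl (fst w)
  slack (node v (t ∷ t′ ∷ ts)) w c | inr (a , b) rewrite a | b | spine-first v t (t′ ∷ ts) | final-last v t (t′ ∷ ts) =
   snd (slack-out v t t′ ts (snd w) c a) , λ ()
  slack-in v t [] w c rewrite ++-identityʳ (preorder t) = fst (slack t (fst w) (covered-head {v} c))
  slack-in v t (t′ ∷ ts) w c rewrite split out t (t′ ∷ ts) | split inn t (t′ ∷ ts) | last-tail t t′ ts =
   join {O t} {I t} {a = out (first t)} {out (final t)} {out (first t′)} (fst (slack t (fst w) (covered-head {v} c))) (slack-in v t′ ts (snd w) (covered-tail {v} {t} c)) (junction c)
  slack-all v t [] w c e rewrite ++-identityʳ (preorder t) = s , drop-≤ s (out≤1 _)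
   where s = snd (snd (slack t (fst w) (covered-head {v} c)) (root-in c e))
  slack-all v t (t′ ∷ ts) w c e rewrite split out t (t′ ∷ ts) | split inn t (t′ ∷ ts) | last-tail t t′ ts = s , drop-≤ s (out≤1 _)
   where
    here≤ : O t ≤ I t
    here≤ = drop-≤ (fst (snd (slack t (fst w) (covered-head {v} c)) (root-in c e))) (out≤1 _)
    s : suc (O t + Os (t′ ∷ ts)) ≤ I t + Is (t′ ∷ ts) + out (last-of t′ ts)
    s = subst₂ _≤_ (ℕ.+-suc (O t) _) (sym (ℕ.+-assoc (I t) _ _)) (ℕ.+-mono-≤ here≤ (fst (slack-all v t′ ts (snd w) (covered-tail {v} {t} c) e)))
  slack-out v t t′ ts w c e rewrite split out t (t′ ∷ ts) | split inn t (t′ ∷ ts) | last-tail t t′ ts = near ts (snd (snd w)) c′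
   , apart {O t} {I t} {a = out (first t)} (fst h) (fst (slack-all v t′ ts (snd w) c′ e))
   where
    c′ = covered-tail {v} {t} c
    h = snd (slack t (fst w) (covered-head {v} c)) (root-in c e)
    h′ = snd (slack t′ (fst (snd w)) (covered-head {v} c′)) (root-in c′ e)
    near : ∀ ts → Wfs ts → Covereds v (t′ ∷ ts) → suc (O t + Os (t′ ∷ ts)) ≤ I t + Is (t′ ∷ ts)
    near [] _ _ rewrite ++-identityʳ (preorder t′) = join₂ {O t} {I t} {d = out (final t)} (snd h) (fst h′) (junction c)
    near (r ∷ rs) ws d rewrite split out t′ (r ∷ rs) | split inn t′ (r ∷ rs) =
     subst₂ _≤_ (cong suc (ℕ.+-assoc (O t) _ _)) (ℕ.+-assoc (I t) _ _)
      (ℕ.+-mono-≤ (join₂ {O t} {I t} {d = out (final t)} (snd h) (fst h′) (junction c)) (snd (slack-all v r rs ws (covered-tail {v} {t′} d) e)))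

  cover-majority : ∀ {t} → Good t → (∀ {u w} → Adj t u w → out u + out w ≤ 1) → suc (sum (map out (verts t))) ≤ sum (map inn (verts t))
  cover-majority {p ⋈ q} g cov with cut-at-leaf {a = first p} g (∈-++⁺ˡ (first∈ p))
  ... | s , e = subst₂ (λ x y → suc x ≤ y) (sum-↭ (Perm.map⁺ out (↭-sym (verts↭ e)))) (sum-↭ (Perm.map⁺ inn (↭-sym (verts↭ e))))
   (at-leaf (good-≃ e g) (cov ∘ from (≃-adj e)))
   where
    at-leaf : ∀ {a s} → Good (leafT a ⋈ s) → (∀ {u w} → Adj (leafT a ⋈ s) u w → out u + out w ≤ 1) → suc (out a + O s) ≤ inn a + I s
    at-leaf {a} {s} g cov with good-leaf g
    ... | branching {y} {t} {t′} {ts} = go (out-or-in a) (out-or-in y)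
     where
      c : Covered s
      c = (λ d → cov (inl (inl (inr (inl d))))) , (λ i → cov (inr (inl (inr (Inner⇒Succ (lvs s) i)))))
      s-in = slack-in y t (t′ ∷ ts) (snd (snd (isWF g))) c
      s-out = slack-out y t t′ ts (snd (snd (isWF g))) c
      ends : out a ≡ 1 → ∀ {w} → Adj (leafT a ⋈ s) a w → out w ≡ 0
      ends e {w} k = ℕ.n≤0⇒n≡0 (ℕ.≤-pred (subst (λ x → x + out w ≤ 1) e (cov k)))
      two : ∀ {f l} → f ≤ 1 → l ≤ 1 → f + l ≤ 2
      two = ℕ.+-mono-≤
      go : _ → _ → suc (out a + O s) ≤ inn a + I s
      go (inl (a₀ , a₁)) (inl (y₀ , y₁)) rewrite a₀ | a₁ | y₀ | y₁ =
       s≤s (ℕ.≤-pred (ℕ.≤-trans s-in (ℕ.≤-trans (ℕ.+-monoʳ-≤ (Is (t ∷ t′ ∷ ts)) (two (out≤1 (first t)) (out≤1 _))) (ℕ.≤-reflexive (ℕ.+-comm (Is (t ∷ t′ ∷ ts)) 2)))))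
      go (inl (a₀ , a₁)) (inr (y₁ , y₀)) rewrite a₀ | a₁ | y₀ = s≤s (subst (λ x → x + Os (t ∷ t′ ∷ ts) ≤ Is (t ∷ t′ ∷ ts)) (sym y₁) (fst (s-out y₁)))
      go (inr (a₁ , a₀)) (inr (y₁ , _)) = case trans (sym y₁) (ends a₁ (inl (inl (inr (inr (refl , refl)))))) of λ ()
      go (inr (a₁ , a₀)) (inl (y₀ , y₁)) rewrite a₁ | a₀ | y₀ | y₁ =
       s≤s (subst (suc (Os (t ∷ t′ ∷ ts)) ≤_) (trans (cong₂ (λ f l → Is (t ∷ t′ ∷ ts) + (f + l)) f≡ l≡) (ℕ.+-identityʳ _)) s-in)
       where
        f≡ : out (first t) ≡ 0
        f≡ = trans (cong out (sym (spine-first y t (t′ ∷ ts)))) (ends a₁ (inr (inl (ce-next-leaf (uniq g)))))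
        l≡ : out (last-of t (t′ ∷ ts)) ≡ 0
        l≡ = trans (cong out (sym (final-last y t (t′ ∷ ts)))) (ends a₁ (inr (inr (ce-prev-leaf (uniq g)))))

module _ {V : Set} (deg : V → ℕ) where

 total-degree  : ∀ (p : PlaneTree V) → (∀ {x} → x ∈ lvs p → deg x ≡ 3) → (∀ {u c cs} → Sub (node u (c ∷ cs)) p → deg u ≡ suc (length (c ∷ cs))) →
  suc (total deg p) ≡ 2 * (length (preorder p) + length (lvs p))
 totals-degree : ∀ (ps : List (PlaneTree V)) → (∀ {x} → x ∈ lvss ps → deg x ≡ 3) → (∀ {u c cs p} → p ∈ ps → Sub (node u (c ∷ cs)) p → deg u ≡ suc (length (c ∷ cs))) →
  length ps + totals deg ps ≡ 2 * (length (preorders ps) + length (lvss ps))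
 total-degree (node v []) lf _ = cong suc (trans (ℕ.+-identityʳ _) (lf (here refl)))
 total-degree (node v (p ∷ ps)) lf int = trans (cong (λ d → suc (d + totals deg (p ∷ ps))) (int whole))
  (trans (cong (2 +_) (totals-degree (p ∷ ps) lf (λ m i → int (inner m i)))) (eq (length (preorders (p ∷ ps))) (length (lvss (p ∷ ps)))))
  where
   eq : ∀ x y → 2 + 2 * (x + y) ≡ 2 * (suc x + y)
   eq = solve-∀
 totals-degree []       _  _   = refl
 totals-degree (p ∷ ps) lf int rewrite sum-map-++ deg (preorder p) (preorders ps) | length-++ (preorder p) {preorders ps} | length-++ (lvs p) {lvss ps} =
  trans (eq₁ (length ps) (total deg p) (totals deg ps))
   (trans (cong₂ _+_ (total-degree p (lf ∘ ∈-++⁺ˡ) (int (here refl))) (totals-degree ps (lf ∘ ∈-++⁺ʳ (lvs p)) (λ m → int (there m))))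
    (eq₂ (length (preorder p)) (length (lvs p)) (length (preorders ps)) (length (lvss ps))))
  where
   eq₁ : ∀ l x y → suc l + (x + y) ≡ suc x + (l + y)
   eq₁ = solve-∀
   eq₂ : ∀ a b c d → 2 * (a + b) + 2 * (c + d) ≡ 2 * (a + c + (b + d))
   eq₂ = solve-∀

 degree-sum : ∀ {K : V → V → Set} {t : CutTree V} {nbs : V → List V} → Good t → Fits t K → (∀ v → Nbrs K v (nbs v)) → (∀ v → deg v ≡ length (nbs v)) →
  2 + sum (map deg (verts t)) ≡ 2 * (length (verts t) + length (Lvs t))
 degree-sum {K} {t = p ⋈ q} {nbs} g f nb d≡ rewrite sum-map-++ deg (preorder p) (preorder q) | length-++ (preorder p) {preorder q} | length-++ (lvs p) {lvs q} =
  trans (eq₁ (total deg p) (total deg q)) (trans (cong₂ _+_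
   (total-degree p (λ m → lf (∈-++⁺ˡ m)) (λ i → let s , e = cut-at-sub i q in int e))
   (total-degree q (λ m → lf (∈-++⁺ʳ (lvs p) m)) (λ i → let s , e = cut-at-sub i p in int (≃-trans (swap p q) e))))
   (eq₂ (length (preorder p)) (length (lvs p)) (length (preorder q)) (length (lvs q))))
  where
   lf : ∀ {x} → x ∈ Lvs (p ⋈ q) → deg x ≡ 3
   lf {x} m = trans (d≡ x) (leaf-degree g f m (nb x))
   int : ∀ {u c cs s} → p ⋈ q ≃ node u (c ∷ cs) ⋈ s → deg u ≡ suc (length (c ∷ cs))
   int {u} {c} {cs} e = trans (d≡ u) (trans (Nbrs-length (nb u) (int-nbrs (good-≃ e g) (Fits-≃ e f))) (cong suc (length-map root (c ∷ cs))))
   eq₁ : ∀ x y → 2 + (x + y) ≡ suc x + suc y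
   eq₁ = solve-∀
   eq₂ : ∀ a b c d → 2 * (a + b) + 2 * (c + d) ≡ 2 * (a + c + (b + d))
   eq₂ = solve-∀

indicator : Bool → ℕ
indicator b = if b then 1 else 0

sum-indicator : ∀ {n} (S : Subset n) → sum (map (indicator ∘ Vec.lookup S) (allFin n)) ≡ ∣ S ∣
sum-indicator S = trans (cong sum (map-tabulate id (indicator ∘ Vec.lookup S))) (go S)
 where
  go : ∀ {n} (S : Subset n) → sum (Data.List.tabulate (indicator ∘ Vec.lookup S)) ≡ ∣ S ∣
  go Vec.[]            = refl
  go (true  Vec.∷ S) = cong suc (go S)
  go (false Vec.∷ S) = go S

module _ {n : ℕ} {G : Graph n} where
 open Graph G

 module _ {H : Halin G} (T : HalinTree G H) where
  open HalinTree T

  vertices : verts tree ↭ allFin n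
  vertices = vertices-↭ (unV (uniq isGood)) all

  Halin-degree-sum : ∀ {nbs} → (∀ v → Nbrs _~_ v (nbs v)) → 2 + sum (map (length ∘ nbs) (allFin n)) ≡ 2 * (n + Halin.l H)
  Halin-degree-sum {nbs} nb = trans (cong (2 +_) (sum-↭ (Perm.map⁺ (length ∘ nbs) (↭-sym vertices))))
   (trans (degree-sum (length ∘ nbs) isGood fits nb (λ _ → refl)) (cong₂ (λ a b → 2 * (a + b)) order (cong length (sym tree-leaves))))

  cover-size : ∀ {S} → IsVertexCover G S → suc n ≤ 2 * ∣ S ∣
  cover-size {S} cov = ℕ.≤-trans (ℕ.≤-reflexive (trans (cong suc (sym total-n)) (sym (ℕ.+-suc (sum (map inn (allFin n))) _))))
   (subst (sum (map inn (allFin n)) + suc (sum (map out (allFin n))) ≤_) (eq ∣ S ∣)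
    (ℕ.+-mono-≤ (ℕ.≤-reflexive (sum-indicator S)) (subst₂ (λ x y → suc x ≤ y) (sum-↭ (Perm.map⁺ out vertices)) (trans (sum-↭ (Perm.map⁺ inn vertices)) (sum-indicator S)) majority)))
   where
    inn out : Fin n → ℕ
    inn = indicator ∘ Vec.lookup S
    out v = 1 ∸ inn v
    unit : ∀ v → inn v + out v ≡ 1
    unit v with Vec.lookup S v
    ... | true  = refl
    ... | false = refl
    in-S : ∀ {v} → v ∈ₛ S → out v ≡ 0
    in-S m = cong (λ b → 1 ∸ indicator b) ([]=⇒lookup m)
    majority = Cover.cover-majority inn out unit isGood (λ {u} {w} k → [ (λ m → subst (λ x → x + out w ≤ 1) (sym (in-S m)) (Cover.out≤1 inn out unit w))
     , (λ m → subst (λ x → out u + x ≤ 1) (sym (in-S m)) (ℕ.≤-trans (ℕ.≤-reflexive (ℕ.+-identityʳ _)) (Cover.out≤1 inn out unit u))) ]′ (cov (to fits k)))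
    total-n : sum (map inn (allFin n)) + sum (map out (allFin n)) ≡ n
    total-n = trans (go (allFin n)) (Data.List.Properties.length-tabulate id)
     where
      shuffle : ∀ a b c d → a + b + (c + d) ≡ (a + c) + (b + d)
      shuffle = solve-∀
      go : ∀ vs → sum (map inn vs) + sum (map out vs) ≡ length vs
      go []       = refl
      go (v ∷ vs) = trans (shuffle (inn v) _ (out v) _) (cong₂ _+_ (unit v) (go vs))
    eq : ∀ s → s + s ≡ 2 * s
    eq = solve-∀

 leaf-count-unique : ∀ (H H′ : Halin G) → Halin.l H ≡ Halin.l H′
 leaf-count-unique H H′ = ℕ.+-cancelˡ-≡ n _ _ (ℕ.*-cancelˡ-≡ _ _ 2 (trans (sym (Halin-degree-sum (halin-tree H) nb)) (Halin-degree-sum (halin-tree H′) nb)))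
  where
   nb : ∀ v → Nbrs _~_ v (filter (v ~?_) (allFin n))
   nb v = nbrs (Uniq.filter⁺ (v ~?_) (Uniq.allFin⁺ n)) (mk⇔ (λ k → ∈-filter⁺ (v ~?_) (∈-allFin _) k) (λ m → snd (∈-filter⁻ (v ~?_) {xs = allFin n} m)))

 class-bound : ∀ {i e l m} → n ≡ l + i → 2 * e ≤ suc l → 2 + n ≤ 2 * l → suc n ≤ 2 * m → (9 * n ≤ 16 * m) ⊎ (2 * n ≤ 3 * l) → 3 * (i + e) ≤ 4 * m
 class-bound {i} {e} {l} {m} refl ev fl mv (inl h) = ℕ.*-cancelˡ-≤ 4 (cancel (12 + 3 * (2 + (l + i))) (ℕ.+-mono-≤ (ℕ.+-mono-≤ (ℕ.*-monoʳ-≤ 6 ev) (ℕ.*-monoʳ-≤ 3 fl)) h) (eq₁ i e l) (eq₂ l i m))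
  where
   cancel : ∀ k {x y x′ y′} → x′ ≤ y′ → x′ + 12 * i + 12 ≡ k + x + 9 * (l + i) → y′ + 12 * i + 12 ≡ k + y + 9 * (l + i) → x ≤ y
   cancel k {x} {y} le p q = ℕ.+-cancelˡ-≤ k x y (ℕ.+-cancelʳ-≤ (9 * (l + i)) (k + x) (k + y) (subst₂ _≤_ p q (ℕ.+-monoˡ-≤ 12 (ℕ.+-monoˡ-≤ (12 * i) le))))
   eq₁ : ∀ i e l → 6 * (2 * e) + 3 * (2 + (l + i)) + 9 * (l + i) + 12 * i + 12 ≡ 12 + 3 * (2 + (l + i)) + 4 * (3 * (i + e)) + 9 * (l + i)
   eq₁ = solve-∀
   eq₂ : ∀ l i m → 6 * suc l + 3 * (2 * l) + 16 * m + 12 * i + 12 ≡ 12 + 3 * (2 + (l + i)) + 4 * (4 * m) + 9 * (l + i)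
   eq₂ = solve-∀
 class-bound {i} {e} {l} {m} refl ev fl mv (inr h) = ℕ.*-cancelˡ-≤ {3 * (i + e)} {4 * m} 2 (cancel {y = 2 * (4 * m)} (ℕ.+-mono-≤ (ℕ.+-mono-≤ (ℕ.*-monoʳ-≤ 3 ev) h) (ℕ.*-monoʳ-≤ 4 mv)) (eq₁ i e l) (ℕ.≤-trans (ℕ.≤-reflexive (eq₂ l i m)) (ℕ.+-monoʳ-≤ (6 * i + 6 * l) (ℕ.+-monoˡ-≤ (2 * (4 * m)) (ℕ.n≤1+n 3)))))
  where
   cancel : ∀ {x y x′ y′} → x′ ≤ y′ → x′ + 6 * i ≡ (6 * i + 6 * l) + (4 + x) → y′ + 6 * i ≤ (6 * i + 6 * l) + (4 + y) → x ≤ y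
   cancel {x} {y} le p q = ℕ.+-cancelˡ-≤ 4 x y (ℕ.+-cancelˡ-≤ (6 * i + 6 * l) _ _ (ℕ.≤-trans (ℕ.≤-reflexive (sym p)) (ℕ.≤-trans (ℕ.+-monoˡ-≤ (6 * i) le) q)))
   eq₁ : ∀ i e l → 3 * (2 * e) + 2 * (l + i) + 4 * suc (l + i) + 6 * i ≡ 6 * i + 6 * l + (4 + 2 * (3 * (i + e)))
   eq₁ = solve-∀
   eq₂ : ∀ l i m → 3 * suc l + 3 * l + 4 * (2 * m) + 6 * i ≡ 6 * i + 6 * l + (3 + 2 * (4 * m))
   eq₂ = solve-∀

 Halin-class : ∀ {m} (H H′ : Halin G) → IsMvc G m → (9 * n ≤ 16 * m) ⊎ (2 * n ≤ 3 * Halin.l H) →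
  ∃ λ s → IsEVCClass G ｛ Halin.C₁ H′ , Halin.C₂ H′ ｝ s × 3 * s ≤ 4 * m
 Halin-class H H′ ((S , cov , refl) , _) h = _ , evc-class T ,
  class-bound {m = ∣ S ∣} (trans (sym order) (trans (length-verts tree) (cong (_+ length (Ints tree)) l≡))) (few-evens T)
   (subst₂ (λ a b → 2 + a ≤ 2 * b) order l≡ (many-leaves tree (isWF isGood))) (cover-size T {S} cov)
   (map-⊎ id (subst (λ l → 2 * n ≤ 3 * l) (leaf-count-unique H H′)) h)
  where
   T = halin-tree H′
   open HalinTree T
   l≡ : length (Lvs tree) ≡ Halin.l H′
   l≡ = cong length (sym tree-leaves)

-- The run of the algorithm

alternate : ℕ → ℕ → ℕ
alternate b zero    = b
alternate b (suc k) = alternate (1 ∸ b) k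

alternate-parity : ∀ k → ((2 ∣ k) → alternate 1 k ≡ 1 × alternate 0 k ≡ 0) × (¬ (2 ∣ k) → alternate 1 k ≡ 0 × alternate 0 k ≡ 1)
alternate-parity zero = (λ _ → refl , refl) , λ o → ⊥-elim (o (2 ∣0))
alternate-parity (suc k) with parity-step k | alternate-parity k
... | inl (e , o) | h , _ = (λ e′ → ⊥-elim (o e′)) , λ _ → let x , y = h e in y , x
... | inr (o , e) | _ , h = (λ _ → let x , y = h o in y , x) , λ o′ → ⊥-elim (o′ e)

sum-constant : ∀ {A : Set} {f : A → ℕ} k xs → (∀ {x} → x ∈ xs → f x ≡ k) → sum (map f xs) ≡ length xs * k
sum-constant k []       h = refl
sum-constant k (x ∷ xs) h = cong₂ _+_ (h (here refl)) (sum-constant k xs (h ∘ there))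

module _ {n : ℕ} where

 Marks-at : ∀ {f g b} xs {z : Fin n} → Marks f g b xs z → ∀ (i : Fin (length xs)) →
  f (toℕ (lookup xs i)) ≡ alternate b (toℕ i) × g (toℕ (at xs (suc (toℕ i)) z)) ≡ alternate b (toℕ i)
 Marks-at {g = g} {b} (x ∷ xs) {z} (p , q , _) zero = p , trans (cong (g ∘ toℕ) (sym (hd-at xs z))) q
 Marks-at (x ∷ xs) (_ , _ , m) (suc i) = Marks-at xs m i

 targets-∷ʳ : ∀ x xs {z : Fin n} → targets (x ∷ xs) z ≡ xs ∷ʳ z
 targets-∷ʳ x []       = refl
 targets-∷ʳ x (y ∷ ys) = cong (y ∷_) (targets-∷ʳ y ys)

 listed : List (Fin n) → CutTree (Fin n) → (∀ {l} → Fin l → Fin l) → Subset n → Set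
 listed L t r S = ∀ {v} → v ∈ₛ S ⇔ (v ∈ Ints t ⊎ (∃ λ (i : Fin (length L)) → (2 ∣ toℕ i) × v ≡ lookup L (r i)))

 module _ {K : Fin n → Fin n → Set} {nbs : Fin n → List (Fin n)} (nb : ∀ v → Nbrs K v (nbs v)) {a : Fin n} {s : PlaneTree (Fin n)}
  (g : Good (leafT a ⋈ s)) (f : Fits (leafT a ⋈ s) K) (all : ∀ v → v ∈ verts (leafT a ⋈ s)) {C₁ C₂ : Subset n}
  (∈C₁ : listed (a ∷ lvs s) (leafT a ⋈ s) id C₁) (∈C₂ : listed (a ∷ lvs s) (leafT a ⋈ s) next C₂) where

  private
   t : CutTree (Fin n)
   t = leafT a ⋈ s
   L : List (Fin n)
   L = a ∷ lvs s
   c : Fin (length L) → Fin n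
   c = lookup L
   L-unique : Unique L
   L-unique = Lvs-unique (uniq g)

  private
   marked : ∀ {S} (x : Fin n → ℕ) (p : Fin (length L) → Fin n) → (∀ {v} → v ∈ₛ S ⇔ (v ∈ Ints t ⊎ (∃ λ i → (2 ∣ toℕ i) × v ≡ p i))) →
    (∀ {i j} → p i ≡ p j → i ≡ j) → (∀ {v} → v ∈ Lvs t → ∃ λ i → v ≡ p i) →
    (∀ {v} → v ∈ Ints t → x v ≡ 1) → (∀ i → x (p i) ≡ alternate 1 (toℕ i)) → ∀ v → x v ≡ indicator (Vec.lookup S v)
   marked {S} x p mem inj onto h₁ h₂ v = by-membership _ refl
    where
     inside : v ∈ₛ S → x v ≡ 1
     inside m with to mem m
     ... | inl i = h₁ i
     ... | inr (i , e , refl) = trans (h₂ i) (fst (fst (alternate-parity (toℕ i)) e))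
     outside : v ∉ₛ S → x v ≡ 0
     outside nm with leaf-or-int t (all v)
     ... | inr i = ⊥-elim (nm (from mem (inl i)))
     ... | inl l with onto l
     ...   | i , e = trans (cong x e) (trans (h₂ i) (fst (snd (alternate-parity (toℕ i)) (λ ev → nm (from mem (inr (i , ev , e)))))))
     by-membership : ∀ b → Vec.lookup S v ≡ b → x v ≡ indicator b
     by-membership true  e = inside (lookup⇒[]= v S e)
     by-membership false e = outside (λ m → case trans (sym e) ([]=⇒lookup m) of λ ())

  module _ {σ τ : Store} (parents : ∀ {p y} → Par (leafT a ⋈ s) p y → σ 13 (toℕ p) ≡ toℕ y) (sums : ∀ v → σ 6 (toℕ v) ≡ neighbour-sum nbs v)
   (internal : ∀ {y} → y ∈ ints s → σ 1 (toℕ y) ≡ 1) (others : ∀ {y} → y ∉ ints s → σ 1 (toℕ y) ≡ 0)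
   (copied : Copied {n} n σ τ) (count : τ 3 4 ≡ sum (map (leaf-weight σ) (allFin n)))
   (at₀ : σ 3 17 ≡ toℕ a) (at₁ : σ 3 18 ≡ toℕ (first s)) where

   private
    Step : Fin n → Fin n → Fin n → Set
    Step x y w = CE t x y × CE t y w
    sum-rule : ∀ {x y w} → Step x y w → σ 6 (toℕ y) ∸ σ 13 (toℕ y) ∸ toℕ x ≡ toℕ w
    sum-rule {x} {y} {w} (xy , yw) =
     trans (cong₂ (λ p q → σ 6 (toℕ y) ∸ p ∸ toℕ q) (parents (y∈ , from (te e) (te-nbr⁺ (uniq g′) (here refl)))) (ce-leaf-prev (uniq g′) (to (ce e) xy)))
      (trans (third-neighbour (unique-↭ (distinct (nb y)) (distinct m) (to (members m) ∘ from (members (nb y))) (to (members (nb y)) ∘ from (members m))) (sums y))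
       (cong toℕ (sym (ce-leaf-next (uniq g′) (to (ce e) yw)))))
     where
      y∈ = fst (Cyc-∈ (Lvs t) yw)
      e = snd (cut-at-leaf g y∈)
      g′ = good-≃ e g
      m = leaf-nbrs g′ (Fits-≃ e f)
    steps : ∀ xs → (∀ {u w} → Succ xs a u w → CE t u w) → Steps Step {σ} sum-rule xs a
    steps []           h = tt
    steps (x ∷ [])     h = tt
    steps (x ∷ y ∷ xs) h = (h (inl (refl , refl)) , h (inr (inl (refl , refl)))) , steps (y ∷ xs) (h ∘ inr)
    target⇒leaf : ∀ {w} → w ∈ targets L a → w ∈ L
    target⇒leaf m = [ id , (λ { refl → here refl }) ]′ (targets-∈ L m)
    leaf-number : sum (map (leaf-weight σ) (allFin n)) ≡ length L
    leaf-number = trans (sum-↭ (Perm.map⁺ (leaf-weight σ) (↭-trans (↭-sym (vertices-↭ (unV (uniq g)) all)) (verts-split t))))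
     (trans (sum-map-++ (leaf-weight σ) L (ints s)) (trans (cong₂ _+_
      (sum-constant 1 L (λ m → cong (1 ∸_) (others (lvs-ints-disjoint (uniq g) m)))) (sum-constant 0 (ints s) (λ m → cong (1 ∸_) (internal m))))
      (trans (cong₂ _+_ (ℕ.*-identityʳ (length L)) (ℕ.*-zeroʳ (length (ints s)))) (ℕ.+-identityʳ _))))

   walk-bound : ℕ
   walk-bound = maxTime (#bit ≔ lit 1) + (suc (cost (var #deg)) + walk-time {n} * length L)

   run-output : ∃ λ υ → Runs walk-cycle τ walk-bound υ × Holds υ 1 C₁ × Holds υ 2 C₂
   run-output with run-walk Step {σ} sum-rule a (lvs s) a 1 (exec (#bit ≔ lit 1) τ) (steps L id) L-unique
    (subst Unique (sym (targets-∷ʳ a (lvs s))) (unique-resp-↭ (++-comm (a ∷ []) (lvs s)) L-unique))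
    (Copied.c-6 copied) (Copied.c-13 copied) (trans (Copied.c-17 copied) at₀)
    (trans (Copied.c-18 copied) (trans at₁ (cong toℕ (trans (sym (hd-lvs s {[]} {a})) (cong (λ l → hd l a) (++-identityʳ (lvs s)))))))
    refl (trans count leaf-number)
   ... | υ , mk , o₁ , o₂ , run = υ , run-seq (run-loop-free (#bit ≔ lit 1) _ τ) run
    , marked (υ 1 ∘ toℕ) c ∈C₁ (lookup-injective L-unique _ _) index-of
     (λ {v} m → trans (o₁ v (λ l → lvs-ints-disjoint (uniq g) l m)) (trans (Copied.c-1 copied (toℕ v)) (internal m))) (fst ∘ marks)
    , marked (υ 2 ∘ toℕ) (c ∘ next) ∈C₂ (next-injective _ _ ∘ lookup-injective L-unique _ _)
     (λ m → let i , e = index-of m ; j , e′ = next-surjective i in j , trans e (cong c (sym e′)))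
     (λ {v} m → trans (o₂ v (λ l → lvs-ints-disjoint (uniq g) (target⇒leaf l) m)) (trans (Copied.c-2 copied v (toℕ<n v)) (internal m))) (snd ∘ marks)
    where
     index-of : ∀ {v} → v ∈ Lvs t → ∃ λ i → v ≡ c i
     index-of m = Any.index m , AnyP.lookup-index m
     marks : ∀ i → υ 1 (toℕ (c i)) ≡ alternate 1 (toℕ i) × υ 2 (toℕ (c (next i))) ≡ alternate 1 (toℕ i)
     marks i = let x , y = Marks-at L mk i in x , trans (cong (υ 2 ∘ toℕ) (lookup-next L i a)) y

module _ {n : ℕ} {K : Fin n → Fin n → Set} where

 record Oriented (σ : Store) : Set where
  field
   {a}      : Fin n
   {s}      : PlaneTree (Fin n)
   isGood   : Good (leafT a ⋈ s)
   isFit    : Fits (leafT a ⋈ s) K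
   parents  : ∀ {p y} → Par (leafT a ⋈ s) p y → σ 13 (toℕ p) ≡ toℕ y
   internal : ∀ {y} → y ∈ Ints (leafT a ⋈ s) → σ 1 (toℕ y) ≡ 1
   others   : ∀ {y} → y ∉ Ints (leafT a ⋈ s) → σ 1 (toℕ y) ≡ 0
   at-a     : σ 3 17 ≡ toℕ a
   at-next  : σ 3 18 ≡ toℕ (first s)

 -- The starting edge may run clockwise; then the mirror image of the tree is used.
 orient : ∀ {σ t} → Good t → Fits t K → Desc σ t → Oriented σ
 orient {σ} {t} g f d = by-edge (to (≃-adj e) edge)
  where
   open Desc d
   s = fst (cut-at-leaf g leaf-c₀)
   e : t ≃ leafT c₀ ⋈ s
   e = snd (cut-at-leaf g leaf-c₀)
   g′ = good-≃ e g
   m = mirror-good g′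
   by-edge : Adj (leafT c₀ ⋈ s) c₀ c₁ → Oriented σ
   by-edge (inl k) = ⊥-elim (no-TE-between-leaves g′ (here refl) (∈-resp-↭ (lvs↭ e) leaf-c₁) k)
   by-edge (inr (inl k)) = record
    { isGood = g′ ; isFit = Fits-≃ e f
    ; parents = λ { (l , k) → parents (∈-resp-↭ (↭-sym (lvs↭ e)) l , from (te e) k) }
    ; internal = λ i → internal (∈-resp-↭ (↭-sym (ints↭ e)) i) ; others = λ ni → others (ni ∘ ∈-resp-↭ (ints↭ e))
    ; at-a = at-c₀ ; at-next = trans at-c₁ (cong toℕ (ce-leaf-next (uniq g′) k)) }
   by-edge (inr (inr k)) = record
    { isGood = m ; isFit = mk⇔ (to (Fits-≃ e f) ∘ from (mirror-adj g′)) (to (mirror-adj g′) ∘ from (Fits-≃ e f))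
    ; parents = λ { (l , k) → parents (∈-resp-↭ (↭-trans (mirror-lvs g′) (↭-sym (lvs↭ e))) l , from (te e) (from (mirror-te g′) k)) }
    ; internal = λ i → internal (∈-resp-↭ (↭-trans (mirror-ints g′) (↭-sym (ints↭ e))) i)
    ; others = λ ni → others (ni ∘ ∈-resp-↭ (↭-trans (ints↭ e) (↭-sym (mirror-ints g′))))
    ; at-a = at-c₀ ; at-next = trans at-c₁ (cong toℕ (trans (ce-leaf-prev (uniq g′) k) (sym (mirror-first g′)))) }

module _ {n : ℕ} {G : Graph n} {t : CutTree (Fin n)} (g : Good t) (f : Fits t (Graph._~_ G)) (len : length (verts t) ≡ n) where

 private
  E : PlaneEmbedding (tree-graph {G = G} g f len)
  E = tree-embedding {G = G} g f len
  leaves≡ : PlaneEmbedding.leaves E ≡ Lvs t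
  leaves≡ = embedding-leaves {G = G} g f len
  isLeaf : ∀ v → Dec (Graph.IsLeaf (tree-graph {G = G} g f len) v)
  isLeaf = Graph.isLeaf? (tree-graph {G = G} g f len)

 tree-halin-tree : HalinTree G (tree-halin {G = G} g f len)
 tree-halin-tree = record
  { tree = t ; isGood = g ; fits = f ; order = len ; tree-leaves = leaves≡
  ; all = λ v → subst (v ∈_) (preorder-rooted t) (PlaneEmbedding.spanning E v)
  ; internal = λ v → mk⇔ (λ l → subst (v ∈_) leaves≡ (∈-filter⁺ isLeaf (PlaneEmbedding.spanning E v) l))
   (λ m → snd (∈-filter⁻ isLeaf {xs = preorder (PlaneEmbedding.tree E)} (subst (v ∈_) (sym leaves≡) m))) }

module _ {n : ℕ} {G : Graph n} {H : Halin G} (T : HalinTree G H) where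
 open Halin H using (C₁; C₂; c)
 open HalinTree T

 listed₁ : listed (Lvs tree) tree id C₁
 listed₁ {v} = subst (λ M → v ∈ₛ C₁ ⇔ (v ∈ Ints tree ⊎ (∃ λ (i : Fin (length M)) → (2 ∣ toℕ i) × v ≡ lookup M i))) tree-leaves (∈cover T c)

 listed₂ : listed (Lvs tree) tree next C₂
 listed₂ {v} = subst (λ M → v ∈ₛ C₂ ⇔ (v ∈ Ints tree ⊎ (∃ λ (i : Fin (length M)) → (2 ∣ toℕ i) × v ≡ lookup M (next i)))) tree-leaves (∈cover T (c ∘ next))

module _ {n : ℕ} (1≤n : 1 ≤ n) where

 record Linear (P : Program) (σ : Store) (k : ℕ) (τ : Store) : Set where
  constructor within
  field runs : Runs P σ (k * n) τ
 open Linear public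

 linear : ∀ {P σ τ} x a b m → Runs P σ (a + b * x) τ → x ≤ m * n → Linear P σ (a + b * m) τ
 linear x a b m (t , r , le) h = within (t , r , ℕ.≤-trans le (ℕ.≤-trans (ℕ.+-mono-≤ (pay-constant a) (ℕ.≤-trans (ℕ.*-monoʳ-≤ b h) (ℕ.≤-reflexive (sym (ℕ.*-assoc b m n)))))
  (ℕ.≤-reflexive (sym (ℕ.*-distribʳ-+ n a (b * m))))))
  where
   pay-constant : ∀ a → a ≤ a * n
   pay-constant a = ℕ.≤-trans (ℕ.≤-reflexive (sym (ℕ.*-identityʳ a))) (ℕ.*-monoʳ-≤ a 1≤n)

 linear-after : ∀ {P σ τ} x c a b m → Runs P σ (c + (a + b * x)) τ → x ≤ m * n → Linear P σ (c + a + b * m) τ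
 linear-after {P} {σ} {τ} x c a b m r = linear x (c + a) b m (subst (λ k → Runs P σ k τ) (sym (ℕ.+-assoc c a (b * x))) r)

 linear-seq : ∀ {P Q σ τ υ k l} → Linear P σ k τ → Linear Q τ l υ → Linear (P ⨾ Q) σ (k + l) υ
 linear-seq {P} {Q} {σ} {υ = υ} {k} {l} (within r) (within r′) = within (subst (λ b → Runs (P ⨾ Q) σ b υ) (sym (ℕ.*-distribʳ-+ n k l)) (run-seq r r′))

start-reading start-copy : Program
start-reading = #pos ≔ lit 1 ⨾ #cnt ≔ size-of-input ⨾ #alive ≔ size-of-input
start-copy = #v ≔ lit 0 ⨾ #cnt ≔ size-of-input ⨾ #deg ≔ lit 0

read-factor contract-factor find-factor star-factor undo-factor copy-factor time-factor : ℕ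
read-factor     = maxTime start-reading + suc (cost (var #cnt)) + vertex-time {0} (λ ()) * 5
contract-factor = suc (cost (var #alive ⊖ lit 4)) + contract-time {0} {λ _ _ → ⊥} {λ _ → 0} * 2
find-factor     = suc (cost (lit 1 ⊖ 12 [ var #i ])) + find-cost {0} {λ _ _ → ⊥} {λ _ → 0} * 1
star-factor     = maxTime make-star + 0 * 0
undo-factor     = suc (cost (var #k)) + undo-cost {0} {λ _ _ → ⊥} * 1
copy-factor     = maxTime start-copy + suc (cost (var #cnt)) + copy-time {0} * 1
 + (maxTime (#bit ≔ lit 1) + suc (cost (var #deg)) + walk-time {0} * 1)
time-factor     = read-factor + (contract-factor + (find-factor + (star-factor + (undo-factor + copy-factor))))

module _ {n : ℕ} {G : Graph n} {H : Halin G} (halin : HalinTree G H) (L : AdjacencyLists G) where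
 open Graph G
 open AdjacencyLists L renaming (neighbours to nbs)

 private
  module T = HalinTree halin

  nb : ∀ v → Nbrs _~_ v (nbs v)
  nb v = nbrs (unique v) (complete v _)

  1≤n : 1 ≤ n
  1≤n = ℕ.≤-trans (s≤s z≤n) (subst (4 ≤_) T.order (size T.isGood))

  word-length : length (concatMap (record-of nbs) (allFin n)) ≤ 5 * n
  word-length = ℕ.≤-trans (ℕ.≤-reflexive (trans (go (allFin n)) (cong (_+ total-degree′) (Data.List.Properties.length-tabulate id))))
   (ℕ.+-monoʳ-≤ n (ℕ.≤-trans (ℕ.m≤n+m total-degree′ 2) (ℕ.≤-trans (ℕ.≤-reflexive (Halin-degree-sum halin nb))
    (ℕ.≤-trans (ℕ.*-monoʳ-≤ 2 (ℕ.+-monoʳ-≤ n few)) (ℕ.≤-reflexive (eq n))))))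
   where
    total-degree′ : ℕ
    total-degree′ = sum (map (length ∘ nbs) (allFin n))
    shuffle : ∀ a b c → suc a + (b + c) ≡ suc (b + (a + c))
    shuffle = solve-∀
    go : ∀ vs → length (concatMap (record-of nbs) vs) ≡ length vs + sum (map (length ∘ nbs) vs)
    go []       = refl
    go (v ∷ vs) = trans (length-++ (record-of nbs v)) (trans (cong₂ (λ a b → suc a + b) (length-map toℕ (nbs v)) (go vs)) (shuffle (length (nbs v)) (length vs) _))
    few : Halin.l H ≤ n
    few = subst₂ _≤_ (cong length (sym T.tree-leaves)) (trans (sym (length-verts T.tree)) T.order) (ℕ.m≤m+n _ _)
    eq : ∀ n → 2 * (n + n) ≡ 4 * n
    eq = solve-∀

  ≤1* : ∀ {x} → x ≤ n → x ≤ 1 * n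
  ≤1* h = ℕ.≤-trans h (ℕ.≤-reflexive (sym (ℕ.*-identityˡ n)))

  Result : Program → Store → ℕ → Set₁
  Result P σ k = ∃₂ λ C₁ C₂ → AlgorithmOutput G C₁ C₂ × ∃ λ τ → Linear 1≤n P σ k τ × Holds τ 1 C₁ × Holds τ 2 C₂

  prepend : ∀ {k l P Q σ τ} → Linear 1≤n P σ k τ → Result Q τ l → Result (P ⨾ Q) σ (k + l)
  prepend r (C₁ , C₂ , out , υ , r′ , h) = C₁ , C₂ , out , υ , linear-seq 1≤n r r′ , h

  copy-and-walk : ∀ {σ} → Oriented {K = _~_} σ → (∀ v → σ 6 (toℕ v) ≡ neighbour-sum nbs v) → σ 0 0 ≡ n →
   Result (copy-internal ⨾ walk-cycle) σ copy-factor
  copy-and-walk {σ} o sums in₀ with run-copy σ (allFin n) 0 (exec start-copy σ) allFin-consecutive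
   (record { c-0 = refl ; c-1 = λ _ → refl ; c-6 = λ _ → refl ; c-13 = λ _ → refl ; c-17 = refl ; c-18 = refl ; c-v = refl ; c-2 = λ _ () })
   (trans in₀ (sym (Data.List.Properties.length-tabulate id)))
  ... | τ , copied , count , run = _ , _ , (H′ , refl , refl) , υ
   , linear-seq 1≤n (linear-after 1≤n (length (allFin n)) (maxTime start-copy) (suc (cost (var #cnt))) (copy-time {n}) 1 (run-seq (run-loop-free start-copy _ σ) run)
    (≤1* (ℕ.≤-reflexive (Data.List.Properties.length-tabulate id))))
    (linear-after 1≤n (length (Lvs (leafT a ⋈ s))) (maxTime (#bit ≔ lit 1)) (suc (cost (var #deg))) (walk-time {n}) 1 (fst (snd output))
     (≤1* (ℕ.≤-trans (ℕ.m≤m+n _ _) (ℕ.≤-reflexive (trans (sym (length-verts (leafT a ⋈ s))) len)))))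
   , snd (snd output)
   where
    open Oriented o
    all : ∀ v → v ∈ verts (leafT a ⋈ s)
    all v = fst (Adj-∈ (leafT a ⋈ s) (from isFit (to T.fits (snd (has-neighbour T.isGood (T.all v))))))
    len : length (verts (leafT a ⋈ s)) ≡ n
    len = trans (↭-length (vertices-↭ (unV (uniq isGood)) all)) (Data.List.Properties.length-tabulate id)
    H′ = tree-halin {G = G} isGood isFit len
    T′ = tree-halin-tree {G = G} isGood isFit len
    output = run-output nb isGood isFit all (listed₁ T′) (listed₂ T′) parents sums internal others copied count at-a at-next
    υ = fst output

  undo-and-walk : ∀ {σ k} → k ≤ n → (∀ v → σ 6 (toℕ v) ≡ neighbour-sum nbs v) → σ 0 0 ≡ n → Undone {G = _~_} σ k →
   Result (undo-all ⨾ copy-internal ⨾ walk-cycle) σ (undo-factor + copy-factor)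
  undo-and-walk k≤n sums in₀ (τ , run , h , t , g , f , desc) = prepend {undo-factor} {copy-factor}
   (linear 1≤n _ (suc (cost (var #k))) (undo-cost {n} {_~_}) 1 run (≤1* k≤n))
   (copy-and-walk (orient g f desc) (λ v → trans (History.h-6 h _) (sums v)) (trans (History.h-0 h 0) in₀))

  star-and-undo : ∀ {σ} (inv : Inv _~_ (neighbour-sum nbs) σ) → σ 3 6 ≡ 4 → σ 12 (σ 3 5) ≢ 0 →
   Result (make-star ⨾ undo-all ⨾ copy-internal ⨾ walk-cycle) σ (star-factor + (undo-factor + copy-factor))
  star-and-undo {σ} inv four act = prepend {star-factor} {undo-factor + copy-factor}
   (linear 1≤n 0 (maxTime make-star) 0 0 (let t , r , le = run-loop-free make-star make-star-loop-free σ in t , r , ℕ.≤-trans le (ℕ.m≤m+n _ _)) z≤n)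
   (undo-and-walk {exec make-star σ} {σ 3 7} (ℕ.≤-trans (ℕ.m≤m+n (σ 3 7) (σ 3 6)) (Inv.steps inv)) (λ v → trans (History.h-6 (snd made) _) (Inv.sums inv v))
    (trans (History.h-0 (snd made) 0) (Inv.input inv)) (fst made))
   where
    made : Undone {G = _~_} (exec make-star σ) (σ 3 7) × History {n} σ (exec make-star σ)
    made = star-made inv (trans (sym (Inv.alive inv)) four) act

  find-and-undo : ∀ {σ} → Inv _~_ (neighbour-sum nbs) σ → σ 3 6 ∸ 4 ≡ 0 →
   Result (find-active ⨾ make-star ⨾ undo-all ⨾ copy-internal ⨾ walk-cycle) σ (find-factor + (star-factor + (undo-factor + copy-factor)))
  find-and-undo inv stopped = let τ , inv′ , e , act , run = run-find-active inv in prepend {find-factor} {star-factor + (undo-factor + copy-factor)}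
    (linear 1≤n n (suc (cost (lit 1 ⊖ 12 [ var #i ]))) (find-cost {n} {_~_} {neighbour-sum nbs}) 1 run (≤1* ℕ.≤-refl))
    (star-and-undo inv′ (trans e (ℕ.≤-antisym (ℕ.m∸n≡0⇒m≤n stopped) (subst (4 ≤_) (sym (Inv.alive inv)) (size (Inv.good-t inv))))) act)

 algorithm-result : Result algorithm (load encode) time-factor
 algorithm-result = let τ , rd , run = read-all nbs ; τ′ , inv , stopped , run′ = run-contract (initial-inv nbs ~-sym nb T.isGood T.fits T.order rd) in
   prepend {read-factor} {contract-factor + (find-factor + (star-factor + (undo-factor + copy-factor)))}
     (linear-after 1≤n _ (maxTime start-reading) (suc (cost (var #cnt))) (vertex-time nbs) 5 run word-length)
     (prepend {contract-factor} {find-factor + (star-factor + (undo-factor + copy-factor))}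
       (linear 1≤n _ (suc (cost (var #alive ⊖ lit 4))) (contract-time {n} {_~_} {neighbour-sum nbs}) 2 run′
         (ℕ.≤-reflexive (trans (cong₂ (λ i k → (n ∸ i) + k) (Reading.r-i rd) (Reading.r-al rd)) (cong (n +_) (sym (ℕ.+-identityʳ n))))))
       (find-and-undo inv stopped))

theorem14 :
  ∃₂ λ (P : Program) (k : ℕ) →
    ∀ {n} (G : Graph n) (H : Halin G) (m : ℕ) → IsMvc G m →
    (9 * n ≤ 16 * m) ⊎ (2 * n ≤ 3 * Halin.l H) →
      (∀ e → IsEvc G e → 3 * e ≤ 4 * m)
    × (∀ C₁ C₂ → AlgorithmOutput G C₁ C₂ →
         ∃[ s ] (IsEVCClass G ｛ C₁ , C₂ ｝ s × 3 * s ≤ 4 * m))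
    × (∀ (L : AdjacencyLists G) →
         ∃₂ λ C₁ C₂ → AlgorithmOutput G C₁ C₂
           × P computes⟨ C₁ , C₂ ⟩from AdjacencyLists.encode L within (k * n))
theorem14 = algorithm , time-factor , λ G H m mvc large →
    (λ e evc → let s , class , s≤ = Halin-class H H mvc large in ℕ.≤-trans (ℕ.*-monoʳ-≤ 3 (snd evc s (_ , class))) s≤)
  , (λ { C₁ C₂ (H′ , refl , refl) → Halin-class H H′ mvc large })
  , λ L → let C₁ , C₂ , out , τ , within (t , run , t≤) , h₁ , h₂ = algorithm-result (halin-tree H) L in C₁ , C₂ , out , t , τ , run , t≤ , h₁ , h₂
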